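{- Let $n\ge 2$ and let $BH_n$ be the $n$-dimensional balanced hypercube. Let $F\subseteq E(BH_n)$ be a set of edges with $|F|\le 4n-5$ such that the minimum degree of $BH_n-F$ satisfies $\delta(BH_n-F)\ge 2$ (i.e. every vertex is incident with at least two edges not in $F$). Then every edge of $BH_n-F$ lies on a Hamiltonian cycle of $BH_n-F$.
   Context: The $n$-dimensional balanced hypercube $BH_n$ ($n\ge 1$) has vertex set $\{0,1,2,3\}^n$, vertices written $(a_0,a_1,\dots,a_{n-1})$. All arithmetic on coordinates is modulo $4$. A vertex $(a_0,a_1,\dots,a_{n-1})$ is adjacent exactly to the $2n$ vertices $(a_0\pm 1,a_1,\dots,a_{n-1})$ and, for each $1\le i\le n-1$, $(a_0\pm1,a_1,\dots,a_{i-1},a_i+(-1)^{a_0},a_{i+1},\dots,a_{n-1})$. $BH_1$ is a $4$-cycle. A Hamiltonian cycle of a graph is a cycle containing all its vertices. -}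

module Defs where

open import Data.Nat using (ℕ; zero; suc; _+_; _*_; _∸_; _≤_)
open import Data.Fin using (Fin; zero; suc)
open import Data.Vec using (Vec; []; _∷_; _[_]%=_)
open import Data.List using (List; []; _∷_; _++_; zip; length; [_])
open import Data.List.Membership.Propositional using (_∈_)
open import Data.List.Relation.Unary.Unique.Propositional using (Unique)
open import Data.List.Relation.Unary.All using (All)
open import Data.Product using (_×_; _,_; ∃-syntax; uncurry)
open import Data.Sum using (_⊎_)
open import Data.Empty using (⊥)
open import Relation.Binary.PropositionalEquality using (_≡_)
open import Relation.Nullary using (¬_)

inc4 : Fin 4 → Fin 4
inc4 zero = suc zero
inc4 (suc zero) = suc (suc zero)
inc4 (suc (suc zero)) = suc (suc (suc zero))
inc4 (suc (suc (suc zero))) = zero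

dec4 : Fin 4 → Fin 4
dec4 zero = suc (suc (suc zero))
dec4 (suc zero) = zero
dec4 (suc (suc zero)) = suc zero
dec4 (suc (suc (suc zero))) = suc (suc zero)

-- x ↦ x + (-1)^a  (mod 4)
shift : Fin 4 → Fin 4 → Fin 4
shift zero = inc4
shift (suc zero) = dec4
shift (suc (suc zero)) = inc4
shift (suc (suc (suc zero))) = dec4

Vertex : ℕ → Set
Vertex n = Vec (Fin 4) n

Adj : ∀ {n} → Vertex n → Vertex n → Set
Adj [] [] = ⊥
Adj (a ∷ as) (b ∷ bs) =
  (b ≡ inc4 a ⊎ b ≡ dec4 a) × (bs ≡ as ⊎ ∃[ i ] bs ≡ (as [ i ]%= shift a))

InF : ∀ {n} → List (Vertex n × Vertex n) → Vertex n → Vertex n → Set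
InF F u v = (u , v) ∈ F ⊎ (v , u) ∈ F

AdjF : ∀ {n} → List (Vertex n × Vertex n) → Vertex n → Vertex n → Set
AdjF F u v = Adj u v × ¬ InF F u v

MinDeg≥2 : ∀ {n} → List (Vertex n × Vertex n) → Set
MinDeg≥2 {n} F = (w : Vertex n) →
  ∃[ x ] ∃[ y ] (¬ x ≡ y × AdjF F w x × AdjF F w y)

cycleEdges : {A : Set} → List A → List (A × A)
cycleEdges [] = []
cycleEdges (x ∷ xs) = zip (x ∷ xs) (xs ++ [ x ])

IsHamCycle : {V : Set} → (V → V → Set) → List V → Set
IsHamCycle {V} E c =
  Unique c × ((w : V) → w ∈ c) × 3 ≤ length c × All (uncurry E) (cycleEdges c)

EdgeOnCycle : {V : Set} → V → V → List V → Set
EdgeOnCycle u v c = (u , v) ∈ cycleEdges c ⊎ (v , u) ∈ cycleEdges c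

{-# OPTIONS --safe #-}
module Submission where

open import Defs
open import Data.Bool using (Bool; true; false; if_then_else_; not; _∧_; _∨_; T)
open import Data.Bool.Properties using (not-involutive) renaming (_≟_ to _≟ᵇ_)
open import Data.Nat using (ℕ; zero; suc; _+_; _*_; _∸_; _^_; _≤_; _<_; _≤?_; _<?_; nonZero; z≤n; s≤s; _≡ᵇ_; _≤ᵇ_; _/_; _%_)
open import Data.Nat.Properties using (≤-refl; ≤-trans; ≤-reflexive; +-mono-≤; +-monoʳ-≤; +-monoˡ-≤; *-monoʳ-≤; +-assoc; +-comm; +-identityʳ; *-comm; m≤m+n; m≤n+m; 1+n≰n; ≰⇒>; ≮⇒≥; +-cancelˡ-≤; +-cancelʳ-≤; n≤1+n; ≤-antisym; suc-injective; +-suc; ≤-pred; *-distribˡ-+; *-monoʳ-<; m≤n⇒m<n∨m≡n; ≡ᵇ⇒≡; ≤ᵇ⇒≤) renaming (_≟_ to _≟ⁿ_)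
open import Data.Fin using (Fin; zero; suc; toℕ)
open import Data.Fin.Properties using () renaming (_≟_ to _≟ᶠ_; any? to anyᶠ?; all? to allᶠ?)
open import Data.Vec using (Vec; []; _∷_; _[_]%=_; lookup; insertAt)
open import Data.Vec.Properties using () renaming (≡-dec to ≡-decⱽ)
open import Data.List using (List; []; _∷_; _++_; length; map; reverse; zip; [_])
open import Data.List.Properties using (length-++; unfold-reverse; length-map; ++-assoc)
open import Data.List.Membership.Propositional using (_∈_)
open import Data.List.Membership.Propositional.Properties using (∈-∃++; ∈-++⁺ˡ; ∈-++⁺ʳ; ∈-++⁻; ∈-map⁻; ∈-map⁺)
open import Data.List.Relation.Unary.Any using (Any; here; there; any?)
open import Data.List.Relation.Unary.All as All using (All; []; _∷_)
open import Data.List.Relation.Unary.Unique.Propositional using (Unique; []; _∷_)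
open import Data.Product using (∃-syntax; _×_; _,_; proj₁; proj₂; uncurry)
open import Data.Product.Properties using () renaming (≡-dec to ≡-dec×)
open import Data.Sum using (_⊎_; inj₁; inj₂)
open import Data.Empty using (⊥; ⊥-elim)
open import Data.Unit using (tt)
open import Function using (_∘_; id)
open import Relation.Nullary using (¬_; Dec; yes; no; does)
open import Relation.Nullary.Decidable using (¬?; _×-dec_; _⊎-dec_; decidable-stable; toWitness; _→-dec_)
open import Relation.Binary.PropositionalEquality using (_≡_; refl; sym; trans; cong; cong₂; subst; subst₂; module ≡-Reasoning)
open import Data.Nat.Tactic.RingSolver using (solve-∀)
open import Data.Maybe using (Maybe; just; nothing)

-- Along each of its n dimensions BH_n splits into a ring of four copies of BH_(n-1), consecutive copies being joined by 4-cycles.  By induction on n one proves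
-- that BH_n with at most 2n-2 faults has a Hamiltonian path from every even to every odd vertex, and that with at most 4n-5 faults and minimum degree two it has one
-- between any two adjacent vertices.  In the second case at most one copy carries too many faults for the first statement; a path of that copy (or one with a
-- single fault, which is then cut out) is extended through the other three copies.  The dimension is chosen either as that of the given edge, so that the ends lie
-- in consecutive copies, or as another one, so that they lie in the same copy; if all choices fail, counting forces the faults into a few configurations, which
-- do not exist for n ≥ 4 and which for n = 3 are resolved, like the base case n = 2, by a finite search in BH_2 that reveals the faults one at a time.

b2n : Bool → ℕ
b2n true = 1
b2n false = 0

sumW : {A : Set} → (A → ℕ) → List A → ℕ
sumW f [] = 0
sumW f (x ∷ l) = f x + sumW f l

cnt : {A : Set} → (A → Bool) → List A → ℕ
cnt p = sumW (b2n ∘ p)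

interchange : ∀ a b c d → (a + b) + (c + d) ≡ (a + c) + (b + d)
interchange a b c d = trans (+-assoc a b (c + d)) (trans (cong (a +_) (trans (sym (+-assoc b c d)) (trans (cong (_+ d) (+-comm b c)) (+-assoc c b d)))) (sym (+-assoc a c (b + d))))

∉-All : {A : Set} {x : A} {l : List A} → All (λ y → ¬ x ≡ y) l → ¬ x ∈ l
∉-All (p ∷ ps) (here e) = p e
∉-All (p ∷ ps) (there i) = ∉-All ps i

All-∉ : {A : Set} {x : A} (l : List A) → ¬ x ∈ l → All (λ y → ¬ x ≡ y) l
All-∉ [] h = []
All-∉ (y ∷ l) h = (h ∘ here) ∷ All-∉ l (h ∘ there)

module _ {A : Set} where

  sumW-mono : {f g : A → ℕ} (l : List A) → (∀ {x} → x ∈ l → f x ≤ g x) → sumW f l ≤ sumW g l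
  sumW-mono [] h = z≤n
  sumW-mono (x ∷ l) h = +-mono-≤ (h (here refl)) (sumW-mono l (h ∘ there))

  sumW-+ : (f g : A → ℕ) (l : List A) → sumW (λ x → f x + g x) l ≡ sumW f l + sumW g l
  sumW-+ f g [] = refl
  sumW-+ f g (x ∷ l) = trans (cong (f x + g x +_) (sumW-+ f g l)) (interchange (f x) (g x) _ _)

  sumW-++ : (f : A → ℕ) (l l' : List A) → sumW f (l ++ l') ≡ sumW f l + sumW f l'
  sumW-++ f [] l' = refl
  sumW-++ f (x ∷ l) l' = trans (cong (f x +_) (sumW-++ f l l')) (sym (+-assoc (f x) _ _))

  sumW-1 : (l : List A) → sumW (λ _ → 1) l ≡ length l
  sumW-1 [] = refl
  sumW-1 (x ∷ l) = cong suc (sumW-1 l)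

  cnt≤length : (p : A → Bool) (l : List A) → cnt p l ≤ length l
  cnt≤length p l = ≤-trans (sumW-mono l (λ {x} _ → b2n≤1 (p x))) (≤-reflexive (sumW-1 l))
    where
    b2n≤1 : ∀ b → b2n b ≤ 1
    b2n≤1 true = ≤-refl
    b2n≤1 false = z≤n

  ∈-remove : ∀ {x y : A} (as : List A) {bs} → ¬ y ≡ x → y ∈ as ++ x ∷ bs → y ∈ as ++ bs
  ∈-remove [] ne (here e) = ⊥-elim (ne e)
  ∈-remove [] ne (there i) = i
  ∈-remove (a ∷ as) ne (here e) = here e
  ∈-remove (a ∷ as) ne (there i) = there (∈-remove as ne i)

  sumW-middle : (f : A → ℕ) (x : A) (as : List A) {bs : List A} → sumW f (as ++ x ∷ bs) ≡ f x + sumW f (as ++ bs)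
  sumW-middle f x as {bs} = trans (sumW-++ f as (x ∷ bs)) (trans (sym (+-assoc (sumW f as) (f x) (sumW f bs))) (trans (cong (_+ sumW f bs) (+-comm (sumW f as) (f x))) (trans (+-assoc (f x) _ _) (cong (f x +_) (sym (sumW-++ f as bs))))))

  -- Every lower bound on the number of faults below applies this to a list of pairwise distinct
  -- faults.
  sumW-⊆ : (f : A → ℕ) {xs F : List A} → Unique xs → (∀ {x} → x ∈ xs → x ∈ F) → sumW f xs ≤ sumW f F
  sumW-⊆ f [] h = z≤n
  sumW-⊆ f {x ∷ xs} {F} (nx ∷ u) h with ∈-∃++ (h (here refl))
  ... | as , bs , refl = subst (f x + sumW f xs ≤_) (sym (sumW-middle f x as))
        (+-monoʳ-≤ (f x) (sumW-⊆ f u (λ {y} i → ∈-remove as (λ e → ∉-All nx (subst (_∈ xs) e i)) (h (there i)))))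

  ⊆-length : {xs F : List A} → Unique xs → (∀ {x} → x ∈ xs → x ∈ F) → length xs ≤ length F
  ⊆-length {xs} {F} u h = subst₂ _≤_ (sumW-1 xs) (sumW-1 F) (sumW-⊆ (λ _ → 1) u h)

  cnt-all : (p : A → Bool) (xs : List A) → (∀ {x} → x ∈ xs → p x ≡ true) → cnt p xs ≡ length xs
  cnt-all p [] h = refl
  cnt-all p (x ∷ xs) h rewrite h (here refl) = cong suc (cnt-all p xs (h ∘ there))

  ⊆-cnt : (p : A → Bool) {xs F : List A} → Unique xs → (∀ {x} → x ∈ xs → x ∈ F × p x ≡ true) → length xs ≤ cnt p F
  ⊆-cnt p {xs} {F} u h = subst (_≤ cnt p F) (cnt-all p xs (proj₂ ∘ h)) (sumW-⊆ (b2n ∘ p) u (proj₁ ∘ h))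

  Unique-map : {B : Set} (f : A → B) {xs : List A} → (∀ {x y} → x ∈ xs → y ∈ xs → f x ≡ f y → x ≡ y) → Unique xs → Unique (map f xs)
  Unique-map f inj [] = []
  Unique-map f {x ∷ xs} inj (nx ∷ u) = All-∉ _ no-x ∷ Unique-map f (λ i j → inj (there i) (there j)) u
    where
    no-x : ¬ f x ∈ map f xs
    no-x i with ∈-map⁻ f i
    ... | y , j , e = ∉-All nx (subst (_∈ xs) (sym (inj (here refl) (there j) e)) j)

  Unique-++ : {xs ys : List A} → Unique xs → Unique ys → (∀ {x} → x ∈ xs → x ∈ ys → ⊥) → Unique (xs ++ ys)
  Unique-++ [] v h = v
  Unique-++ {x ∷ xs} {ys} (nx ∷ u) v h = All-∉ _ no-x ∷ Unique-++ u v (λ i → h (there i))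
    where
    no-x : ¬ x ∈ xs ++ ys
    no-x i with ∈-++⁻ xs i
    ... | inj₁ j = ∉-All nx j
    ... | inj₂ j = h (here refl) j

-- Occurrence counts: a list with all counts equal to 1 enumerates the type, and the condition is additive under concatenation.
module Occ {A : Set} (_≟_ : (x y : A) → Dec (x ≡ y)) where

  same : A → A → ℕ
  same x y = b2n (does (x ≟ y))

  occ : A → List A → ℕ
  occ w = sumW (same w)

  same-refl : ∀ x → same x x ≡ 1
  same-refl x with x ≟ x
  ... | yes _ = refl
  ... | no h = ⊥-elim (h refl)

  same-≢ : ∀ {x y} → ¬ x ≡ y → same x y ≡ 0
  same-≢ {x} {y} h with x ≟ y
  ... | yes e = ⊥-elim (h e)
  ... | no _ = refl

  occ-∈ : ∀ w l → 1 ≤ occ w l → w ∈ l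
  occ-∈ w [] ()
  occ-∈ w (x ∷ l) h with w ≟ x
  ... | yes e = here e
  ... | no _ = there (occ-∈ w l h)

  ∈-occ : ∀ {w l} → w ∈ l → 1 ≤ occ w l
  ∈-occ {w} (here refl) = ≤-trans (≤-reflexive (sym (same-refl w))) (m≤m+n _ _)
  ∈-occ {w} {x ∷ l} (there i) = ≤-trans (∈-occ i) (m≤n+m _ (same w x))

  occ⇒Unique : ∀ l → (∀ w → occ w l ≤ 1) → Unique l
  occ⇒Unique [] h = []
  occ⇒Unique (x ∷ l) h = All-∉ l no-x ∷ occ⇒Unique l (λ w → ≤-trans (m≤n+m _ (same w x)) (h w))
    where
    no-x : ¬ x ∈ l
    no-x i = 1+n≰n (≤-trans (+-mono-≤ (≤-reflexive (sym (same-refl x))) (∈-occ i)) (h x))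

  occ-reverse : ∀ w l → occ w (reverse l) ≡ occ w l
  occ-reverse w [] = refl
  occ-reverse w (x ∷ l) rewrite unfold-reverse x l | sumW-++ (same w) (reverse l) (x ∷ []) | occ-reverse w l =
    trans (cong (occ w l +_) (+-identityʳ _)) (+-comm (occ w l) (same w x))

  Full : List A → Set
  Full l = ∀ w → occ w l ≡ 1

  Full-∈ : ∀ l → Full l → ∀ w → w ∈ l
  Full-∈ l f w = occ-∈ w _ (≤-reflexive (sym (f w)))

  Full-Unique : ∀ l → Full l → Unique l
  Full-Unique l f = occ⇒Unique l (λ w → ≤-reflexive (f w))

-- Paths, cuts and filters.

-- The vertex list is an index, so that being Hamiltonian becomes a statement about occurrences in
-- that list.
data Path {A : Set} (E : A → A → Set) : A → A → List A → Set where
  stop : ∀ x → Path E x x (x ∷ [])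
  _▸_  : ∀ {x y z l} → E x y → Path E y z l → Path E x z (x ∷ l)

infixr 5 _▸_

module _ {A : Set} {E : A → A → Set} where

  join : ∀ {x y z w l l'} → Path E x y l → E y z → Path E z w l' → Path E x w (l ++ l')
  join (stop x) e q = e ▸ q
  join (f ▸ p) e q = f ▸ join p e q

  rev : (∀ {x y} → E x y → E y x) → ∀ {x y l} → Path E x y l → Path E y x (reverse l)
  rev s (stop x) = (stop x)
  rev s {x} (_▸_ {l = l} e p) = subst (Path E _ _) (sym (unfold-reverse x l)) (join (rev s p) (s e) (stop x))

  first-∈ : ∀ {x y l} → Path E x y l → x ∈ l
  first-∈ (stop x) = here refl
  first-∈ (e ▸ p) = here refl

  last-∈ : ∀ {x y l} → Path E x y l → y ∈ l
  last-∈ (stop x) = here refl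
  last-∈ (e ▸ p) = there (last-∈ p)

  record Cut (u v : A) (l : List A) (r t : A) : Set where
    constructor cut
    field
      l₁ l₂ : List A
      eq : l ≡ l₁ ++ l₂
      left : Path E u r l₁
      edge : E r t
      right : Path E t v l₂

  consCut : ∀ {x y v l r t} → E x y → Cut y v l r t → Cut x v (x ∷ l) r t
  consCut {x} e (cut l₁ l₂ eq a b c) = cut (x ∷ l₁) l₂ (cong (x ∷_) eq) (e ▸ a) b c

  cutBefore : ∀ {u v l t} → Path E u v l → t ∈ l → ¬ t ≡ u → ∃[ r ] Cut u v l r t
  cutBefore (stop x) (here refl) ne = ⊥-elim (ne refl)
  cutBefore (e ▸ p) (here refl) ne = ⊥-elim (ne refl)
  cutBefore {t = t} (_▸_ {x} {y} {z} {l} e p) (there i) ne = helper p i e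
    where
      helper : ∀ {x y l} → Path E y z l → t ∈ l → E x y → ∃[ r ] Cut x z (x ∷ l) r t
      helper {x} (stop _) (here refl) e = x , cut (x ∷ []) _ refl (stop x) e (stop _)
      helper {x} (f ▸ q) (here refl) e = x , cut (x ∷ []) _ refl (stop x) e (f ▸ q)
      helper {x} (f ▸ q) (there i) e with helper q i f
      ... | r , c = r , consCut e c

  cutAfter : ∀ {u v l t} → Path E u v l → t ∈ l → ¬ t ≡ v → ∃[ r ] Cut u v l t r
  cutAfter (stop x) (here refl) ne = ⊥-elim (ne refl)
  cutAfter (_▸_ {x} {y} e p) (here refl) ne = y , cut (x ∷ []) _ refl (stop x) e p
  cutAfter (e ▸ p) (there i) ne with cutAfter p i ne
  ... | r , c = r , consCut e c

mapPath : {A B : Set} {E : A → A → Set} {E' : B → B → Set} (f : A → B) → (∀ {x y} → E x y → E' (f x) (f y)) →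
  ∀ {x y l} → Path E x y l → Path E' (f x) (f y) (map f l)
mapPath f h (stop x) = stop (f x)
mapPath f h (e ▸ p) = h e ▸ mapPath f h p

pathMono : {A : Set} {E E' : A → A → Set} → (∀ {x y} → E x y → E' x y) → ∀ {x y l} → Path E x y l → Path E' x y l
pathMono h (stop x) = stop x
pathMono h (e ▸ p) = h e ▸ pathMono h p

head-eq : {A : Set} {E : A → A → Set} {x y u v : A} {l l' : List A} → Path E x u l → Path E y v l' → l ≡ l' → x ≡ y
head-eq (stop x) (stop _) refl = refl
head-eq (stop x) (e ▸ p) refl = refl
head-eq (e ▸ p) (stop _) refl = refl
head-eq (e ▸ p) (e' ▸ p') refl = refl

∷-inj₂ : {A : Set} {x y : A} {l l' : List A} → x ∷ l ≡ y ∷ l' → l ≡ l'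
∷-inj₂ refl = refl

∷-inj₁ : {A : Set} {x y : A} {l l' : List A} → x ∷ l ≡ y ∷ l' → x ≡ y
∷-inj₁ refl = refl

module _ {A : Set} {E : A → A → Set} where

  cutUnique : ∀ {x y r l₁ l₁' l₂ l₂'} → Path E x r l₁ → Path E y r l₁' → l₁ ++ l₂ ≡ l₁' ++ l₂' → Unique (l₁ ++ l₂) → l₂ ≡ l₂'
  cutUnique (stop _) (stop _) e u = ∷-inj₂ e
  cutUnique {l₂ = l₂} (stop r) (f ▸ p) e (n ∷ _) = ⊥-elim (∉-All n (subst (r ∈_) (sym (∷-inj₂ e)) (∈-++⁺ˡ (last-∈ p))))
  cutUnique (f ▸ p) (stop r) e (n ∷ _) = ⊥-elim (∉-All n (subst (_∈ _) (sym (∷-inj₁ e)) (∈-++⁺ˡ (last-∈ p))))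
  cutUnique (f ▸ p) (g ▸ q) e (_ ∷ u) = cutUnique p q (∷-inj₂ e) u

  -- A path without repetitions passes `r` only once. Used to see that a vertex and its twin have
  -- different predecessors.
  succ-unique : ∀ {x v l r t t'} → Unique l → Cut {E = E} x v l r t → Cut {E = E} x v l r t' → t ≡ t'
  succ-unique u (cut l₁ l₂ refl a _ b) (cut l₁' l₂' e a' _ b') = head-eq b b' (cutUnique a a' e u)

keep : {P A : Set} → Dec P → A → List A → List A
keep (yes _) x l = x ∷ l
keep (no _) x l = l

module _ {A : Set} {P : A → Set} (P? : ∀ x → Dec (P x)) where

  sel : List A → List A
  sel [] = []
  sel (x ∷ l) = keep (P? x) x (sel l)

  ∈-sel⁻ : ∀ {x l} → x ∈ sel l → x ∈ l × P x
  ∈-sel⁻ {l = y ∷ l} i with P? y | i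
  ... | yes p | here refl = here refl , p
  ... | yes p | there j = there (proj₁ (∈-sel⁻ j)) , proj₂ (∈-sel⁻ {l = l} j)
  ... | no _ | j = there (proj₁ (∈-sel⁻ j)) , proj₂ (∈-sel⁻ {l = l} j)

  ∈-sel⁺ : ∀ {x l} → x ∈ l → P x → x ∈ sel l
  ∈-sel⁺ {l = y ∷ l} i p with P? y | i
  ... | yes _ | here refl = here refl
  ... | yes _ | there j = there (∈-sel⁺ j p)
  ... | no h | here refl = ⊥-elim (h p)
  ... | no _ | there j = ∈-sel⁺ j p

  sel-Unique : ∀ {l} → Unique l → Unique (sel l)
  sel-Unique [] = []
  sel-Unique {x ∷ l} (n ∷ u) with P? x
  ... | yes _ = All-∉ _ (λ i → ∉-All n (proj₁ (∈-sel⁻ i))) ∷ sel-Unique u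
  ... | no _ = sel-Unique u

search : {A : Set} {P : A → Set} → (∀ x → Dec (P x)) → (l : List A) → (∃[ x ] (x ∈ l × P x)) ⊎ (∀ {x} → x ∈ l → ¬ P x)
search P? [] = inj₂ (λ ())
search P? (x ∷ l) with P? x
... | yes p = inj₁ (x , here refl , p)
... | no h with search P? l
... | inj₁ (y , i , p) = inj₁ (y , there i , p)
... | inj₂ g = inj₂ (λ { (here refl) → h ; (there i) → g i })

++-disjoint : {A : Set} (l : List A) {l' : List A} {x : A} → Unique (l ++ l') → x ∈ l → x ∈ l' → ⊥
++-disjoint (y ∷ l) (n ∷ u) (here refl) j = ∉-All n (∈-++⁺ʳ l j)
++-disjoint (y ∷ l) (n ∷ u) (there i) j = ++-disjoint l u i j

-- Gives two ways to open a path next to an inner vertex; if the neighbour on one side is blocked,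
-- the other one may still serve.
cutBoth : {A : Set} {E : A → A → Set} → ∀ {u v l t} → Unique l → Path E u v l → t ∈ l → ¬ t ≡ u → ¬ t ≡ v →
  ∃[ r ] ∃[ r' ] (Cut {E = E} u v l r t × Cut {E = E} u v l t r' × ¬ r ≡ r')
cutBoth un p i tu tv with cutBefore p i tu
... | r , cut l₁ _ refl a e (stop _) = ⊥-elim (tv refl)
... | r , cut l₁ (t ∷ l₂) refl a e (e' ▸ b) = r , _ , cut l₁ (t ∷ l₂) refl a e (e' ▸ b) ,
      cut (l₁ ++ t ∷ []) l₂ (sym (++-assoc l₁ (t ∷ []) l₂)) (join a e (stop t)) e' b ,
      λ { refl → ++-disjoint l₁ un (last-∈ a) (there (first-∈ b)) }

-- Arithmetic modulo 4 and updates of coordinates.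

pattern #0 = zero
pattern #1 = suc zero
pattern #2 = suc (suc zero)
pattern #3 = suc (suc (suc zero))

step : Bool → Fin 4 → Fin 4
step true = inc4
step false = dec4

pe : Fin 4 → Bool
pe #0 = true
pe #1 = false
pe #2 = true
pe #3 = false

tw4 : Fin 4 → Fin 4
tw4 a = inc4 (inc4 a)

inc-dec : ∀ a → inc4 (dec4 a) ≡ a
inc-dec #0 = refl
inc-dec #1 = refl
inc-dec #2 = refl
inc-dec #3 = refl

dec-inc : ∀ a → dec4 (inc4 a) ≡ a
dec-inc #0 = refl
dec-inc #1 = refl
dec-inc #2 = refl
dec-inc #3 = refl

step-step : ∀ b a → step (not b) (step b a) ≡ a
step-step true a = dec-inc a
step-step false a = inc-dec a

step-tw : ∀ b a → step (not b) (tw4 a) ≡ step b a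
step-tw true a = dec-inc (inc4 a)
step-tw false #0 = refl
step-tw false #1 = refl
step-tw false #2 = refl
step-tw false #3 = refl

step-inj : ∀ b c a → step b a ≡ step c a → b ≡ c
step-inj true true a e = refl
step-inj false false a e = refl
step-inj true false #0 ()
step-inj true false #1 ()
step-inj true false #2 ()
step-inj true false #3 ()
step-inj false true #0 ()
step-inj false true #1 ()
step-inj false true #2 ()
step-inj false true #3 ()

pe-step : ∀ b a → pe (step b a) ≡ not (pe a)
pe-step true #0 = refl
pe-step true #1 = refl
pe-step true #2 = refl
pe-step true #3 = refl
pe-step false #0 = refl
pe-step false #1 = refl
pe-step false #2 = refl
pe-step false #3 = refl

pe-tw : ∀ a → pe (tw4 a) ≡ pe a
pe-tw #0 = refl
pe-tw #1 = refl
pe-tw #2 = refl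
pe-tw #3 = refl

-- Rotation of the four copies; true is the direction in which even vertices leave their copy.
up : Bool → Fin 4 → Fin 4
up true = inc4
up false = dec4

shift-up : ∀ a k → shift a k ≡ up (pe a) k
shift-up #0 k = refl
shift-up #1 k = refl
shift-up #2 k = refl
shift-up #3 k = refl

shift-tw : ∀ a k → shift (tw4 a) k ≡ shift a k
shift-tw #0 k = refl
shift-tw #1 k = refl
shift-tw #2 k = refl
shift-tw #3 k = refl

shift-shift : ∀ b a k → shift (step b a) (shift a k) ≡ k
shift-shift true #0 k = dec-inc k
shift-shift true #1 k = inc-dec k
shift-shift true #2 k = dec-inc k
shift-shift true #3 k = inc-dec k
shift-shift false #0 k = dec-inc k
shift-shift false #1 k = inc-dec k
shift-shift false #2 k = dec-inc k
shift-shift false #3 k = inc-dec k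

inc-≢ : ∀ k → ¬ inc4 k ≡ k
inc-≢ #0 ()
inc-≢ #1 ()
inc-≢ #2 ()
inc-≢ #3 ()

shift-≢ : ∀ a k → ¬ shift a k ≡ k
shift-≢ #0 k e = inc-≢ k e
shift-≢ #1 k e = inc-≢ k (trans (cong inc4 (sym e)) (inc-dec k))
shift-≢ #2 k e = inc-≢ k e
shift-≢ #3 k e = inc-≢ k (trans (cong inc4 (sym e)) (inc-dec k))

module _ {A : Set} where
  upd-involutive : ∀ {n} (f g : A → A) → (∀ x → g (f x) ≡ x) → (τ : Vec A n) (i : Fin n) → (τ [ i ]%= f) [ i ]%= g ≡ τ
  upd-involutive f g h (x ∷ τ) zero = cong (_∷ τ) (h x)
  upd-involutive f g h (x ∷ τ) (suc i) = cong (x ∷_) (upd-involutive f g h τ i)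

  upd-cong : ∀ {n} {f g : A → A} → (∀ x → f x ≡ g x) → (τ : Vec A n) (i : Fin n) → τ [ i ]%= f ≡ τ [ i ]%= g
  upd-cong h (x ∷ τ) zero = cong (_∷ τ) (h x)
  upd-cong h (x ∷ τ) (suc i) = cong (x ∷_) (upd-cong h τ i)

  upd-lookup : ∀ {n} (f : A → A) (τ : Vec A n) i → lookup (τ [ i ]%= f) i ≡ f (lookup τ i)
  upd-lookup f (x ∷ τ) zero = refl
  upd-lookup f (x ∷ τ) (suc i) = upd-lookup f τ i

  upd-lookup-≢ : ∀ {n} (f : A → A) (τ : Vec A n) i j → ¬ i ≡ j → lookup (τ [ i ]%= f) j ≡ lookup τ j
  upd-lookup-≢ f (x ∷ τ) zero zero h = ⊥-elim (h refl)
  upd-lookup-≢ f (x ∷ τ) zero (suc j) h = refl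
  upd-lookup-≢ f (x ∷ τ) (suc i) zero h = refl
  upd-lookup-≢ f (x ∷ τ) (suc i) (suc j) h = upd-lookup-≢ f τ i j (h ∘ cong suc)

  remove : ∀ {n} → Vec A (suc n) → Fin (suc n) → Vec A n
  remove (x ∷ τ) zero = τ
  remove {suc n} (x ∷ τ) (suc i) = x ∷ remove τ i

  remove-insert : ∀ {n} (τ : Vec A n) i k → remove (insertAt τ i k) i ≡ τ
  remove-insert τ zero k = refl
  remove-insert (x ∷ τ) (suc i) k = cong (x ∷_) (remove-insert τ i k)

  lookup-insert : ∀ {n} (τ : Vec A n) i k → lookup (insertAt τ i k) i ≡ k
  lookup-insert τ zero k = refl
  lookup-insert (x ∷ τ) (suc i) k = lookup-insert τ i k

  insert-remove : ∀ {n} (τ : Vec A (suc n)) i → insertAt (remove τ i) i (lookup τ i) ≡ τ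
  insert-remove (x ∷ τ) zero = refl
  insert-remove (x ∷ y ∷ τ) (suc i) = cong (x ∷_) (insert-remove (y ∷ τ) i)

  remove-upd : ∀ {n} (f : A → A) (τ : Vec A (suc n)) i → remove (τ [ i ]%= f) i ≡ remove τ i
  remove-upd f (x ∷ τ) zero = refl
  remove-upd f (x ∷ y ∷ τ) (suc i) = cong (x ∷_) (remove-upd f (y ∷ τ) i)

  remove-upd-≢ : ∀ {n} (f : A → A) (τ : Vec A (suc n)) i j → ¬ i ≡ j →
    ∃[ i' ] remove (τ [ i ]%= f) j ≡ (remove τ j) [ i' ]%= f
  remove-upd-≢ f (x ∷ τ) zero zero h = ⊥-elim (h refl)
  remove-upd-≢ f (x ∷ y ∷ τ) zero (suc j) h = zero , refl
  remove-upd-≢ f (x ∷ y ∷ τ) (suc i) zero h = i , refl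
  remove-upd-≢ f (x ∷ y ∷ τ) (suc i) (suc j) h with remove-upd-≢ f (y ∷ τ) i j (h ∘ cong suc)
  ... | i' , e = suc i' , cong (x ∷_) e

  insert-upd-≢ : ∀ {n} (f : A → A) (τ : Vec A n) i j k → ∃[ i' ] insertAt (τ [ i ]%= f) j k ≡ (insertAt τ j k) [ i' ]%= f
  insert-upd-≢ f τ i zero k = suc i , refl
  insert-upd-≢ f (x ∷ τ) zero (suc j) k = zero , refl
  insert-upd-≢ f (x ∷ τ) (suc i) (suc j) k with insert-upd-≢ f τ i j k
  ... | i' , e = suc i' , cong (x ∷_) e

-- Neighbours, parity and twins.

nb : ∀ {n} → Fin n → Bool → Vertex n → Vertex n
nb zero b (a ∷ τ) = step b a ∷ τ
nb (suc i) b (a ∷ τ) = step b a ∷ (τ [ i ]%= shift a)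

par : ∀ {n} → Vertex (suc n) → Bool
par (a ∷ τ) = pe a

-- The twin has the same neighbours, see `nb-tw`. Along each dimension a vertex, its twin and their
-- two common neighbours form a 4-cycle, called a line below.
tw : ∀ {n} → Vertex (suc n) → Vertex (suc n)
tw (a ∷ τ) = tw4 a ∷ τ

nb-nb : ∀ {n} (i : Fin n) b x → nb i (not b) (nb i b x) ≡ x
nb-nb zero b (a ∷ τ) = cong (_∷ τ) (step-step b a)
nb-nb (suc i) b (a ∷ τ) = cong₂ _∷_ (step-step b a) (upd-involutive (shift a) (shift (step b a)) (shift-shift b a) τ i)

nb-tw : ∀ {n} (i : Fin (suc n)) b x → nb i (not b) (tw x) ≡ nb i b x
nb-tw zero b (a ∷ τ) = cong (_∷ τ) (step-tw b a)
nb-tw (suc i) b (a ∷ τ) = cong₂ _∷_ (step-tw b a) (upd-cong (shift-tw a) τ i)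

par-nb : ∀ {n} (i : Fin (suc n)) b x → par (nb i b x) ≡ not (par x)
par-nb zero b (a ∷ τ) = pe-step b a
par-nb (suc i) b (a ∷ τ) = pe-step b a

par-tw : ∀ {n} (x : Vertex (suc n)) → par (tw x) ≡ par x
par-tw (a ∷ τ) = pe-tw a

tw-≢ : ∀ {n} (x : Vertex (suc n)) → ¬ tw x ≡ x
tw-≢ (#0 ∷ τ) ()
tw-≢ (#1 ∷ τ) ()
tw-≢ (#2 ∷ τ) ()
tw-≢ (#3 ∷ τ) ()

adj-nb : ∀ {n} (i : Fin n) b (x : Vertex n) → Adj x (nb i b x)
adj-nb zero true (a ∷ τ) = inj₁ refl , inj₁ refl
adj-nb zero false (a ∷ τ) = inj₂ refl , inj₁ refl
adj-nb (suc i) true (a ∷ τ) = inj₁ refl , inj₂ (i , refl)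
adj-nb (suc i) false (a ∷ τ) = inj₂ refl , inj₂ (i , refl)

nb-adj : ∀ {n} {x y : Vertex n} → Adj x y → ∃[ i ] ∃[ b ] y ≡ nb i b x
nb-adj {x = []} {[]} ()
nb-adj {x = a ∷ τ} {c ∷ σ} (inj₁ refl , inj₁ refl) = zero , true , refl
nb-adj {x = a ∷ τ} {c ∷ σ} (inj₂ refl , inj₁ refl) = zero , false , refl
nb-adj {x = a ∷ τ} {c ∷ σ} (inj₁ refl , inj₂ (i , refl)) = suc i , true , refl
nb-adj {x = a ∷ τ} {c ∷ σ} (inj₂ refl , inj₂ (i , refl)) = suc i , false , refl

adj-sym : ∀ {n} {x y : Vertex n} → Adj x y → Adj y x
adj-sym {x = x} h with nb-adj h
... | i , b , refl = subst (Adj (nb i b x)) (nb-nb i b x) (adj-nb i (not b) (nb i b x))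

adj-par : ∀ {n} {x y : Vertex (suc n)} → Adj x y → par y ≡ not (par x)
adj-par {x = x} h with nb-adj h
... | i , b , refl = par-nb i b x

_≟ⱽ_ : ∀ {n} (x y : Vertex n) → Dec (x ≡ y)
_≟ⱽ_ = ≡-decⱽ _≟ᶠ_

-- The dimension is read off from the tail coordinate that moves (none for dimension 0), the bit
-- from the head.
nb-inj : ∀ {n} (i j : Fin n) b c (x : Vertex n) → nb i b x ≡ nb j c x → i ≡ j × b ≡ c
nb-inj zero zero b c (a ∷ τ) e = refl , step-inj b c a (cong (λ v → lookup v zero) e)
nb-inj zero (suc j) b c (a ∷ τ) e = ⊥-elim (shift-≢ a (lookup τ j) (trans (sym (upd-lookup (shift a) τ j)) (sym (cong (λ v → lookup v (suc j)) e))))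
nb-inj (suc i) zero b c (a ∷ τ) e = ⊥-elim (shift-≢ a (lookup τ i) (trans (sym (upd-lookup (shift a) τ i)) (cong (λ v → lookup v (suc i)) e)))
nb-inj (suc i) (suc j) b c (a ∷ τ) e with i ≟ᶠ j
... | yes refl = refl , step-inj b c a (cong (λ v → lookup v zero) e)
... | no h = ⊥-elim (shift-≢ a (lookup τ i) (trans (sym (upd-lookup (shift a) τ i)) (trans (cong (λ v → lookup v (suc i)) e) (upd-lookup-≢ (shift a) τ j i (h ∘ sym)))))

fins : ∀ n → List (Fin n)
fins zero = []
fins (suc n) = zero ∷ map suc (fins n)

fins-∈ : ∀ {n} (i : Fin n) → i ∈ fins n
fins-∈ zero = here refl
fins-∈ (suc i) = there (∈-map⁺ suc (fins-∈ i))

fins-Unique : ∀ n → Unique (fins n)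
fins-Unique zero = []
fins-Unique (suc n) = All-∉ _ (λ i → h (∈-map⁻ suc i)) ∷ Unique-map suc (λ _ _ → λ { refl → refl }) (fins-Unique n)
  where
  h : ∃[ y ] (y ∈ fins n × zero ≡ suc y) → ⊥
  h (y , _ , ())

fins-length : ∀ n → length (fins n) ≡ n
fins-length zero = refl
fins-length (suc n) = cong suc (trans (length-map suc (fins n)) (fins-length n))

both : {A B : Set} → (A → Bool → B) → List A → List B
both f [] = []
both f (x ∷ l) = f x true ∷ f x false ∷ both f l

module _ {A B : Set} (f : A → Bool → B) where
  both-∈ : ∀ {x l} b → x ∈ l → f x b ∈ both f l
  both-∈ true (here refl) = here refl
  both-∈ false (here refl) = there (here refl)
  both-∈ b (there i) = there (there (both-∈ b i))

  ∈-both : ∀ {y} l → y ∈ both f l → ∃[ x ] ∃[ b ] (x ∈ l × y ≡ f x b)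
  ∈-both (x ∷ l) (here e) = x , true , here refl , e
  ∈-both (x ∷ l) (there (here e)) = x , false , here refl , e
  ∈-both (x ∷ l) (there (there i)) with ∈-both l i
  ... | z , b , j , e = z , b , there j , e

  both-Unique : ∀ {l} → (∀ {x y b c} → x ∈ l → y ∈ l → f x b ≡ f y c → x ≡ y × b ≡ c) → Unique l → Unique (both f l)
  both-Unique inj [] = []
  both-Unique {x ∷ l} inj (nx ∷ u) = All-∉ _ h₁ ∷ (All-∉ _ (h₂ false) ∷ both-Unique (λ i j → inj (there i) (there j)) u)
    where
    h₂ : ∀ b → ¬ f x b ∈ both f l
    h₂ b i with ∈-both l i
    ... | z , c , j , e = ∉-All nx (subst (_∈ l) (sym (proj₁ (inj (here refl) (there j) e))) j)
    h₁ : ¬ f x true ∈ f x false ∷ both f l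
    h₁ (here e) with proj₂ (inj (here refl) (here refl) e)
    ... | ()
    h₁ (there i) = h₂ true i

  both-length : ∀ l → length (both f l) ≡ length l + length l
  both-length [] = refl
  both-length (x ∷ l) = cong suc (trans (cong suc (both-length l)) (sym (+-suc (length l) (length l))))

abstract
  nbrs : ∀ {n} → Vertex n → List (Vertex n)
  nbrs {n} x = both (λ i b → nb i b x) (fins n)

  nbrs-Unique : ∀ {n} (x : Vertex n) → Unique (nbrs x)
  nbrs-Unique {n} x = both-Unique _ (λ {i} {j} {b} {c} _ _ e → nb-inj i j b c x e) (fins-Unique n)

  nbrs-length : ∀ {n} (x : Vertex n) → length (nbrs x) ≡ n + n
  nbrs-length {n} x = trans (both-length _ (fins n)) (cong₂ _+_ (fins-length n) (fins-length n))

  adj-nbrs : ∀ {n} {x y : Vertex n} → Adj x y → y ∈ nbrs x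
  adj-nbrs h with nb-adj h
  ... | i , b , refl = both-∈ _ b (fins-∈ i)

  nbrs-adj : ∀ {n} {x y : Vertex n} → y ∈ nbrs x → Adj x y
  nbrs-adj {n} {x} h with ∈-both _ (fins n) h
  ... | i , b , _ , refl = adj-nb i b x

cons-inj : ∀ {n} a {τ σ : Vertex n} {b c} → step b a ∷ τ ≡ step c a ∷ σ → τ ≡ σ × b ≡ c
cons-inj a {b = b} {c} e = cong Data.Vec.tail e , step-inj b c a (cong Data.Vec.head e)
  where import Data.Vec

abstract
  allV : ∀ n → List (Vertex n)
  allV zero = [] ∷ []
  allV (suc n) = both (λ τ b → step b #0 ∷ τ) (allV n) ++ both (λ τ b → step b #1 ∷ τ) (allV n)

  allV-Unique : ∀ n → Unique (allV n)
  allV-Unique zero = [] ∷ []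
  allV-Unique (suc n) = Unique-++ (both-Unique _ (λ _ _ → cons-inj #0) (allV-Unique n)) (both-Unique _ (λ _ _ → cons-inj #1) (allV-Unique n)) disj
    where
    pr : ∀ {a} {y : Vertex (suc n)} → y ∈ both (λ τ b → step b a ∷ τ) (allV n) → par y ≡ not (pe a)
    pr {a} i with ∈-both _ (allV n) i
    ... | τ , b , _ , refl = pe-step b a
    disj : ∀ {y} → y ∈ both (λ τ b → step b #0 ∷ τ) (allV n) → y ∈ both (λ τ b → step b #1 ∷ τ) (allV n) → ⊥
    disj i j with trans (sym (pr i)) (pr j)
    ... | ()

  allV-length : ∀ n → length (allV n) ≡ 4 ^ n
  allV-length zero = refl
  allV-length (suc n) = trans (length-++ (both _ (allV n))) (trans (cong₂ _+_ (trans (both-length _ (allV n)) (cong₂ _+_ ih ih)) (trans (both-length _ (allV n)) (cong₂ _+_ ih ih))) (lem (4 ^ n)))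
    where
    ih : length (allV n) ≡ 4 ^ n
    ih = allV-length n
    lem : ∀ k → (k + k) + (k + k) ≡ 4 * k
    lem k = trans (+-assoc k k (k + k)) (cong (λ z → k + (k + (k + z))) (sym (+-identityʳ k)))

  allV-∈ : ∀ {n} (x : Vertex n) → x ∈ allV n
  allV-∈ [] = here refl
  allV-∈ {suc n} (#0 ∷ τ) = ∈-++⁺ʳ (both (λ τ b → step b #0 ∷ τ) (allV n)) (both-∈ (λ τ b → step b #1 ∷ τ) false (allV-∈ τ))
  allV-∈ {suc n} (#1 ∷ τ) = ∈-++⁺ˡ (both-∈ (λ τ b → step b #0 ∷ τ) true (allV-∈ τ))
  allV-∈ {suc n} (#2 ∷ τ) = ∈-++⁺ʳ (both (λ τ b → step b #0 ∷ τ) (allV n)) (both-∈ (λ τ b → step b #1 ∷ τ) true (allV-∈ τ))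
  allV-∈ {suc n} (#3 ∷ τ) = ∈-++⁺ˡ (both-∈ (λ τ b → step b #0 ∷ τ) false (allV-∈ τ))

-- Faults are lists of unordered pairs; the same notion serves BH_n and the ring of four copies.
InL : {V : Set} → List (V × V) → V → V → Set
InL F u v = (u , v) ∈ F ⊎ (v , u) ∈ F

GF : {V : Set} → (V → V → Set) → List (V × V) → V → V → Set
GF A F u v = A u v × ¬ InL F u v

InL-sym : {V : Set} {F : List (V × V)} {x y : V} → InL F x y → InL F y x
InL-sym (inj₁ i) = inj₂ i
InL-sym (inj₂ i) = inj₁ i

GF-sym : {V : Set} {A : V → V → Set} {F : List (V × V)} → (∀ {x y} → A x y → A y x) → ∀ {x y} → GF A F x y → GF A F y x
GF-sym s (a , h) = s a , h ∘ InL-sym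

module OV {n} = Occ (_≟ⱽ_ {n})

HP : ∀ {n} → List (Vertex n × Vertex n) → Vertex n → Vertex n → Set
HP F u v = ∃[ l ] (Path (AdjF F) u v l × OV.Full l)

-- The ring of four copies and the splitting along each dimension.

R : ℕ → Set
R m = Fin 4 × Vertex (suc m)

parR : ∀ {m} → R m → Bool
parR (k , x) = par x

-- Once the split coordinate is removed, all that remains of a crossing edge is the step of the
-- head, which is the dimension 0 step of the smaller cube.
RAdj : ∀ {m} → R m → R m → Set
RAdj (k , x) (l , y) = (l ≡ k × Adj x y) ⊎ ∃[ b ] (l ≡ up (par x) k × y ≡ nb zero b x)

cr : ∀ {m} → Bool → R m → R m
cr b (k , x) = up (par x) k , nb zero b x

adj-cr : ∀ {m} b (p : R m) → RAdj p (cr b p)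
adj-cr b p = inj₂ (b , refl , refl)

up-up : ∀ d k → up (not d) (up d k) ≡ k
up-up true k = dec-inc k
up-up false k = inc-dec k

up-≢ : ∀ d k → ¬ up d k ≡ k
up-≢ true k = inc-≢ k
up-≢ false k e = inc-≢ k (trans (cong inc4 (sym e)) (inc-dec k))

cr-cr : ∀ {m} b (p : R m) → cr (not b) (cr b p) ≡ p
cr-cr b (k , x) = cong₂ _,_ (trans (cong (λ d → up d (up (par x) k)) (par-nb zero b x)) (up-up (par x) k)) (nb-nb zero b x)

parR-cr : ∀ {m} b (p : R m) → parR (cr b p) ≡ not (parR p)
parR-cr b (k , x) = par-nb zero b x

radj-sym : ∀ {m} {p q : R m} → RAdj p q → RAdj q p
radj-sym (inj₁ (refl , a)) = inj₁ (refl , adj-sym a)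
radj-sym {p = p} (inj₂ (b , refl , refl)) = subst (RAdj (cr b p)) (cr-cr b p) (adj-cr (not b) (cr b p))

_⊖_ : Fin 4 → Fin 4 → Fin 4
y ⊖ #0 = y
y ⊖ #1 = dec4 y
y ⊖ #2 = dec4 (dec4 y)
y ⊖ #3 = inc4 y

⊖-inv : ∀ y x → y ⊖ (y ⊖ x) ≡ x
⊖-inv #0 #0 = refl
⊖-inv #0 #1 = refl
⊖-inv #0 #2 = refl
⊖-inv #0 #3 = refl
⊖-inv #1 #0 = refl
⊖-inv #1 #1 = refl
⊖-inv #1 #2 = refl
⊖-inv #1 #3 = refl
⊖-inv #2 #0 = refl
⊖-inv #2 #1 = refl
⊖-inv #2 #2 = refl
⊖-inv #2 #3 = refl
⊖-inv #3 #0 = refl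
⊖-inv #3 #1 = refl
⊖-inv #3 #2 = refl
⊖-inv #3 #3 = refl

inc-⊖ : ∀ y x → inc4 y ⊖ x ≡ inc4 (y ⊖ x)
inc-⊖ y #0 = refl
inc-⊖ y #1 = trans (dec-inc y) (sym (inc-dec y))
inc-⊖ y #2 = trans (cong dec4 (dec-inc y)) (sym (inc-dec (dec4 y)))
inc-⊖ y #3 = refl

dec-⊖ : ∀ y x → dec4 y ⊖ x ≡ dec4 (y ⊖ x)
dec-⊖ y x = trans (sym (dec-inc (dec4 y ⊖ x))) (cong dec4 (trans (sym (inc-⊖ (dec4 y) x)) (cong (_⊖ x) (inc-dec y))))

⊖-inc : ∀ y x → y ⊖ inc4 x ≡ dec4 (y ⊖ x)
⊖-inc y #0 = refl
⊖-inc y #1 = refl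
⊖-inc y #2 = sym (lem y)
  where
  lem : ∀ y → dec4 (dec4 (dec4 y)) ≡ inc4 y
  lem #0 = refl
  lem #1 = refl
  lem #2 = refl
  lem #3 = refl
⊖-inc y #3 = sym (dec-inc y)

⊖-dec : ∀ y x → y ⊖ dec4 x ≡ inc4 (y ⊖ x)
⊖-dec y x = trans (sym (inc-dec (y ⊖ dec4 x))) (cong inc4 (trans (sym (⊖-inc y (dec4 x))) (cong (y ⊖_) (inc-dec x))))

up-⊖ : ∀ d y x → up d y ⊖ x ≡ up d (y ⊖ x)
up-⊖ true = inc-⊖
up-⊖ false = dec-⊖

⊖-up : ∀ d y x → y ⊖ up d x ≡ up (not d) (y ⊖ x)
⊖-up true = ⊖-inc
⊖-up false = ⊖-dec

-- The coordinate of dimension 0: parity minus the sum of the other coordinates.  It changes exactly along the edges that fix all other coordinates.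
hgt : ∀ {n} → Bool → Vec (Fin 4) n → Fin 4
hgt d [] = if d then #0 else #1
hgt d (x ∷ τ) = hgt d τ ⊖ x

hgt-not : ∀ {n} d (τ : Vec (Fin 4) n) → hgt (not d) τ ≡ up d (hgt d τ)
hgt-not true [] = refl
hgt-not false [] = refl
hgt-not d (x ∷ τ) = trans (cong (_⊖ x) (hgt-not d τ)) (up-⊖ d (hgt d τ) x)

hgt-upd : ∀ {n} d d' (τ : Vec (Fin 4) n) i → hgt d (τ [ i ]%= up d') ≡ up (not d') (hgt d τ)
hgt-upd d d' (x ∷ τ) zero = ⊖-up d' (hgt d τ) x
hgt-upd d d' (x ∷ τ) (suc i) = trans (cong (_⊖ x) (hgt-upd d d' τ i)) (up-⊖ (not d') (hgt d τ) x)

hgt-edge : ∀ {n} d (τ : Vec (Fin 4) n) i → hgt (not d) (τ [ i ]%= up d) ≡ hgt d τ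
hgt-edge d τ i = trans (hgt-upd (not d) d τ i) (trans (cong (up (not d)) (hgt-not d τ)) (up-up d (hgt d τ)))

-- For dimension 0 the copy number is the height, and the first tail coordinate is dropped because
-- the height determines it. The edges that move this coordinate become the dimension 0 edges of the
-- copy, so that dimension 0 behaves like all the others.
φ : ∀ {m} → Fin (suc (suc m)) → Vertex (suc (suc m)) → R m
φ zero (a ∷ x ∷ τ) = hgt (pe a) (x ∷ τ) , a ∷ τ
φ (suc i) (a ∷ τ) = lookup τ i , a ∷ remove τ i

ψ : ∀ {m} → Fin (suc (suc m)) → R m → Vertex (suc (suc m))
ψ zero (k , a ∷ τ) = a ∷ hgt (pe a) (k ∷ τ) ∷ τ
ψ (suc i) (k , a ∷ τ) = a ∷ insertAt τ i k

ψφ : ∀ {m} i (x : Vertex (suc (suc m))) → ψ i (φ i x) ≡ x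
ψφ zero (a ∷ x ∷ τ) = cong (λ z → a ∷ z ∷ τ) (⊖-inv (hgt (pe a) τ) x)
ψφ (suc i) (a ∷ τ) = cong (a ∷_) (insert-remove τ i)

φψ : ∀ {m} i (p : R m) → φ i (ψ i p) ≡ p
φψ zero (k , a ∷ τ) = cong (_, a ∷ τ) (⊖-inv (hgt (pe a) τ) k)
φψ (suc i) (k , a ∷ τ) = cong₂ _,_ (lookup-insert τ i k) (cong (a ∷_) (remove-insert τ i k))

κ : ∀ {n} → Fin (suc (suc n)) → Vertex (suc (suc n)) → Fin 4
κ i x = proj₁ (φ i x)

par-φ : ∀ {m} i (x : Vertex (suc (suc m))) → parR (φ i x) ≡ par x
par-φ zero (a ∷ x ∷ τ) = refl
par-φ (suc i) (a ∷ τ) = refl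

par-ψ : ∀ {m} i (p : R m) → par (ψ i p) ≡ parR p
par-ψ i p = trans (sym (par-φ i (ψ i p))) (cong parR (φψ i p))

shift≡up : ∀ {n} a (τ : Vec (Fin 4) n) i → τ [ i ]%= shift a ≡ τ [ i ]%= up (pe a)
shift≡up a τ i = upd-cong (shift-up a) τ i

φ-nb-same : ∀ {m} i b (x : Vertex (suc (suc m))) → φ i (nb i b x) ≡ cr b (φ i x)
φ-nb-same zero b (a ∷ x ∷ τ) = cong (_, step b a ∷ τ) (trans (cong (λ d → hgt d (x ∷ τ)) (pe-step b a)) (hgt-not (pe a) (x ∷ τ)))
φ-nb-same (suc i) b (a ∷ τ) = cong₂ _,_ (trans (upd-lookup (shift a) τ i) (shift-up a (lookup τ i))) (cong (step b a ∷_) (remove-upd (shift a) τ i))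

φ-nb-other : ∀ {m} i j b (x : Vertex (suc (suc m))) → ¬ i ≡ j → ∃[ i' ] φ j (nb i b x) ≡ (κ j x , nb i' b (proj₂ (φ j x)))
φ-nb-other zero zero b x h = ⊥-elim (h refl)
φ-nb-other zero (suc j) b (a ∷ τ) h = zero , refl
φ-nb-other (suc zero) zero b (a ∷ x ∷ τ) h = zero , cong (_, step b a ∷ τ)
  (trans (cong₂ hgt (pe-step b a) (shift≡up a (x ∷ τ) zero)) (hgt-edge (pe a) (x ∷ τ) zero))
φ-nb-other (suc (suc i)) zero b (a ∷ x ∷ τ) h = suc i , cong (_, step b a ∷ (τ [ i ]%= shift a))
  (trans (cong₂ hgt (pe-step b a) (shift≡up a (x ∷ τ) (suc i))) (hgt-edge (pe a) (x ∷ τ) (suc i)))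
φ-nb-other (suc i) (suc j) b (a ∷ τ) h with remove-upd-≢ (shift a) τ i j (h ∘ cong suc)
... | i' , e = suc i' , cong₂ _,_ (upd-lookup-≢ (shift a) τ i j (h ∘ cong suc)) (cong (step b a ∷_) e)

φ-adj : ∀ {m} i {x y : Vertex (suc (suc m))} → Adj x y → RAdj (φ i x) (φ i y)
φ-adj i {x} h with nb-adj h
... | j , b , refl with j ≟ᶠ i
... | yes refl = subst (RAdj (φ i x)) (sym (φ-nb-same i b x)) (adj-cr b (φ i x))
... | no ne with φ-nb-other j i b x ne
... | i' , e = subst (RAdj (φ i x)) (sym e) (inj₁ (refl , adj-nb i' b _))

-- Every edge of the ring comes from an edge of BH_n: the 2n neighbours of ψ p have 2n distinct images, all among the neighbours of p.
ψ-nb : ∀ {m} i (p : R m) j b → Adj (ψ i p) (ψ i (proj₁ p , nb j b (proj₂ p)))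
ψ-nb zero (k , a ∷ τ) zero b = subst (Adj _) (cong (λ z → step b a ∷ z ∷ τ)
  (sym (trans (cong (λ d → hgt d (k ∷ τ)) (pe-step b a)) (trans (hgt-not (pe a) (k ∷ τ)) (sym (shift-up a _)))))) (adj-nb (suc zero) b _)
ψ-nb zero (k , a ∷ τ) (suc j) b = subst (Adj _) (cong (λ z → step b a ∷ z ∷ (τ [ j ]%= shift a))
  (sym (trans (cong₂ (λ d σ → hgt d (k ∷ σ)) (pe-step b a) (shift≡up a τ j)) (hgt-edge (pe a) (k ∷ τ) (suc j))))) (adj-nb (suc (suc j)) b _)
ψ-nb (suc i) (k , a ∷ τ) zero b = adj-nb zero b _
ψ-nb (suc i) (k , a ∷ τ) (suc j) b with insert-upd-≢ (shift a) τ j i k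
... | i' , e = subst (Adj _) (cong (step b a ∷_) (sym e)) (adj-nb (suc i') b _)

ψ-cr : ∀ {m} i (p : R m) b → ψ i (cr b p) ≡ nb i b (ψ i p)
ψ-cr i p b = trans (cong (ψ i ∘ cr b) (sym (φψ i p))) (trans (cong (ψ i) (sym (φ-nb-same i b (ψ i p)))) (ψφ i _))

ψ-adj : ∀ {m} i {p q : R m} → RAdj p q → Adj (ψ i p) (ψ i q)
ψ-adj i {p} (inj₁ (refl , a)) with nb-adj a
... | j , b , refl = ψ-nb i p j b
ψ-adj i {p} (inj₂ (b , refl , refl)) = subst (Adj (ψ i p)) (sym (ψ-cr i p b)) (adj-nb i b (ψ i p))

_≟ᴿ_ : ∀ {m} (p q : R m) → Dec (p ≡ q)
_≟ᴿ_ = ≡-dec× _≟ᶠ_ _≟ⱽ_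

module OR {m} = Occ (_≟ᴿ_ {m})

HPR : ∀ {m} → List (R m × R m) → R m → R m → Set
HPR F u v = ∃[ l ] (Path (GF RAdj F) u v l × OR.Full l)

pmap : {A B : Set} → (A → B) → A × A → B × B
pmap f (x , y) = f x , f y

module _ {A B : Set} (_≟A_ : (x y : A) → Dec (x ≡ y)) (_≟B_ : (x y : B) → Dec (x ≡ y))
         (f : A → B) (g : B → A) (gf : ∀ x → g (f x) ≡ x) (fg : ∀ y → f (g y) ≡ y) where
  private
    module OA = Occ _≟A_
    module OB = Occ _≟B_

  occ-map : ∀ w l → OB.occ w (map f l) ≡ OA.occ (g w) l
  occ-map w [] = refl
  occ-map w (x ∷ l) = cong₂ _+_ same≡ (occ-map w l)
    where
    same≡ : OB.same w (f x) ≡ OA.same (g w) x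
    same≡ with w ≟B f x | g w ≟A x
    ... | yes _ | yes _ = refl
    ... | no _ | no _ = refl
    ... | yes e | no h = ⊥-elim (h (trans (cong g e) (gf x)))
    ... | no h | yes e = ⊥-elim (h (trans (sym (fg w)) (cong f e)))

  transport : {E : A → A → Set} {E' : B → B → Set} → (∀ {x y} → E x y → E' (f x) (f y)) →
    ∀ {u v} → ∃[ l ] (Path E u v l × OA.Full l) → ∃[ l ] (Path E' (f u) (f v) l × OB.Full l)
  transport h (l , p , full) = map f l , mapPath f h p , λ w → trans (occ-map w l) (full (g w))

  InL-map : {F : List (A × A)} {x y : A} → InL F x y → InL (map (pmap f) F) (f x) (f y)
  InL-map (inj₁ i) = inj₁ (∈-map⁺ (pmap f) i)
  InL-map (inj₂ i) = inj₂ (∈-map⁺ (pmap f) i)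

  map-InL : {F : List (A × A)} {x y : A} → InL (map (pmap f) F) (f x) (f y) → InL F x y
  map-InL {F} {x} {y} (inj₁ i) with ∈-map⁻ (pmap f) i
  ... | (x' , y') , j , e = inj₁ (subst₂ (λ s t → (s , t) ∈ F) (trans (sym (gf x')) (trans (cong (g ∘ proj₁) (sym e)) (gf x))) (trans (sym (gf y')) (trans (cong (g ∘ proj₂) (sym e)) (gf y))) j)
  map-InL {F} {x} {y} (inj₂ i) with ∈-map⁻ (pmap f) i
  ... | (x' , y') , j , e = inj₂ (subst₂ (λ s t → (s , t) ∈ F) (trans (sym (gf x')) (trans (cong (g ∘ proj₁) (sym e)) (gf y))) (trans (sym (gf y')) (trans (cong (g ∘ proj₂) (sym e)) (gf x))) j)

FR : ∀ {m} → Fin (suc (suc m)) → List (Vertex (suc (suc m)) × Vertex (suc (suc m))) → List (R m × R m)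
FR i F = map (pmap (φ i)) F

fromRing : ∀ {m} i (F : List (Vertex (suc (suc m)) × Vertex (suc (suc m)))) u v → HPR (FR i F) (φ i u) (φ i v) → HP F u v
fromRing i F u v h = subst₂ (HP F) (ψφ i u) (ψφ i v) (transport _≟ᴿ_ _≟ⱽ_ (ψ i) (φ i) (φψ i) (ψφ i)
  (λ { {p} {q} (a , nf) → ψ-adj i a , λ f → nf (subst₂ (InL (FR i F)) (φψ i p) (φψ i q) (InL-map _≟ⱽ_ _≟ᴿ_ (φ i) (ψ i) (ψφ i) (φψ i) f)) }) h)

inn : ∀ {m} → Fin 4 → R m × R m → Bool
inn k ((a , x) , (b , y)) = does (a ≟ᶠ k) ∧ does (b ≟ᶠ k)

inner : ∀ {m} → Fin 4 → List (R m × R m) → List (Vertex (suc m) × Vertex (suc m))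
inner k [] = []
inner k (r ∷ F) = if inn k r then pmap proj₂ r ∷ inner k F else inner k F

isX : ∀ {m} → R m × R m → Bool
isX ((a , x) , (b , y)) = not (does (a ≟ᶠ b))

inner-length : ∀ {m} k (F : List (R m × R m)) → length (inner k F) ≡ cnt (inn k) F
inner-length k [] = refl
inner-length k (r ∷ F) with inn k r
... | true = cong suc (inner-length k F)
... | false = inner-length k F

∈-inner⁺ : ∀ {m} {k} {F : List (R m × R m)} {x y} → ((k , x) , (k , y)) ∈ F → (x , y) ∈ inner k F
∈-inner⁺ {k = k} {r ∷ F} (here refl) with k ≟ᶠ k
... | yes _ = here refl
... | no h = ⊥-elim (h refl)
∈-inner⁺ {k = k} {r ∷ F} (there i) with inn k r
... | true = there (∈-inner⁺ i)
... | false = ∈-inner⁺ i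

∈-inner⁻ : ∀ {m} {k} {F : List (R m × R m)} {x y} → (x , y) ∈ inner k F → ((k , x) , (k , y)) ∈ F
∈-inner⁻ {k = k} {((a , x) , (b , y)) ∷ F} i with a ≟ᶠ k | b ≟ᶠ k | i
... | yes refl | yes refl | here refl = here refl
... | yes refl | yes refl | there j = there (∈-inner⁻ j)
... | yes _ | no _ | j = there (∈-inner⁻ j)
... | no _ | yes _ | j = there (∈-inner⁻ j)
... | no _ | no _ | j = there (∈-inner⁻ j)

inner-Unique : ∀ {m} k {F : List (R m × R m)} → Unique F → Unique (inner k F)
inner-Unique k [] = []
inner-Unique k {((a , x) , (b , y)) ∷ F} (n ∷ u) with a ≟ᶠ k | b ≟ᶠ k
... | yes refl | yes refl = All-∉ _ (λ i → ∉-All n (∈-inner⁻ i)) ∷ inner-Unique k u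
... | yes _ | no _ = inner-Unique k u
... | no _ | yes _ = inner-Unique k u
... | no _ | no _ = inner-Unique k u

liftG : ∀ {m} k {F : List (R m × R m)} {x y} → AdjF (inner k F) x y → GF RAdj F (k , x) (k , y)
liftG k (a , nf) = inj₁ (refl , a) , λ { (inj₁ i) → nf (inj₁ (∈-inner⁺ i)) ; (inj₂ i) → nf (inj₂ (∈-inner⁺ i)) }

-- With every fault written from its even end, an unordered pair is one list entry, so that distinct
-- faulty edges can be counted by membership.
Canon : ∀ {n} → List (Vertex (suc n) × Vertex (suc n)) → Set
Canon F = ∀ {x y} → (x , y) ∈ F → par x ≡ true × Adj x y

CanonR : ∀ {m} → List (R m × R m) → Set
CanonR F = ∀ {p q} → (p , q) ∈ F → parR p ≡ true × RAdj p q

canon-φ : ∀ {m} i {F : List (Vertex (suc (suc m)) × Vertex (suc (suc m)))} → Canon F → CanonR (FR i F)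
canon-φ i c h with ∈-map⁻ (pmap (φ i)) h
... | (x , y) , j , refl = trans (par-φ i x) (proj₁ (c j)) , φ-adj i (proj₂ (c j))

canon-inner : ∀ {m} k {F : List (R m × R m)} → CanonR F → Canon (inner k F)
canon-inner k c {x} h with c (∈-inner⁻ h)
... | p , inj₁ (_ , a) = p , a
... | p , inj₂ (b , e , _) = ⊥-elim (up-≢ (par x) k (sym e))

module O4 = Occ (_≟ᶠ_ {4})

≢-not : ∀ {a b} → ¬ a ≡ b → a ≡ not b
≢-not {true} {true} h = ⊥-elim (h refl)
≢-not {true} {false} h = refl
≢-not {false} {true} h = refl
≢-not {false} {false} h = ⊥-elim (h refl)

up₂ up₃ : Bool → Fin 4 → Fin 4
up₂ d a = up d (up d a)
up₃ d a = up d (up d (up d a))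

down-up₃ : ∀ d a → up (not d) a ≡ up₃ d a
down-up₃ true #0 = refl
down-up₃ true #1 = refl
down-up₃ true #2 = refl
down-up₃ true #3 = refl
down-up₃ false #0 = refl
down-up₃ false #1 = refl
down-up₃ false #2 = refl
down-up₃ false #3 = refl

others : Bool → Fin 4 → List (Fin 4)
others d a = up d a ∷ up₂ d a ∷ up₃ d a ∷ []

others-cover : ∀ d a k → O4.occ k (a ∷ others d a) ≡ 1
others-cover true #0 #0 = refl
others-cover true #0 #1 = refl
others-cover true #0 #2 = refl
others-cover true #0 #3 = refl
others-cover true #1 #0 = refl
others-cover true #1 #1 = refl
others-cover true #1 #2 = refl
others-cover true #1 #3 = refl
others-cover true #2 #0 = refl
others-cover true #2 #1 = refl
others-cover true #2 #2 = refl
others-cover true #2 #3 = refl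
others-cover true #3 #0 = refl
others-cover true #3 #1 = refl
others-cover true #3 #2 = refl
others-cover true #3 #3 = refl
others-cover false #0 #0 = refl
others-cover false #0 #1 = refl
others-cover false #0 #2 = refl
others-cover false #0 #3 = refl
others-cover false #1 #0 = refl
others-cover false #1 #1 = refl
others-cover false #1 #2 = refl
others-cover false #1 #3 = refl
others-cover false #2 #0 = refl
others-cover false #2 #1 = refl
others-cover false #2 #2 = refl
others-cover false #2 #3 = refl
others-cover false #3 #0 = refl
others-cover false #3 #1 = refl
others-cover false #3 #2 = refl
others-cover false #3 #3 = refl

four-copies : ∀ d a k → k ≡ a ⊎ k ≡ up d a ⊎ k ≡ up₂ d a ⊎ k ≡ up₃ d a
four-copies d a k with O4.occ-∈ k (a ∷ others d a) (≤-reflexive (sym (others-cover d a k)))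
... | here e = inj₁ e
... | there (here e) = inj₂ (inj₁ e)
... | there (there (here e)) = inj₂ (inj₂ (inj₁ e))
... | there (there (there (here e))) = inj₂ (inj₂ (inj₂ e))

edge : ∀ {n} → Vertex (suc n) → Vertex (suc n) → Vertex (suc n) × Vertex (suc n)
edge x y = if par x then (x , y) else (y , x)

edgeR : ∀ {m} → R m → R m → R m × R m
edgeR x y = if parR x then (x , y) else (y , x)

edge-∈ : ∀ {n} {F : List (Vertex (suc n) × Vertex (suc n))} {x y} → Canon F → par y ≡ not (par x) → InL F x y → edge x y ∈ F
edge-∈ {x = x} {y} c e i with par x in ex | i
... | true | inj₁ j = j
... | true | inj₂ j with trans (sym (proj₁ (c j))) e
... | ()
edge-∈ {x = x} {y} c e i | false | inj₁ j with trans (sym (proj₁ (c j))) ex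
... | ()
edge-∈ {x = x} {y} c e i | false | inj₂ j = j

edgeR-∈ : ∀ {m} {F : List (R m × R m)} {x y} → CanonR F → parR y ≡ not (parR x) → InL F x y → edgeR x y ∈ F
edgeR-∈ {x = x} {y} c e i with parR x in ex | i
... | true | inj₁ j = j
... | true | inj₂ j with trans (sym (proj₁ (c j))) e
... | ()
edgeR-∈ {x = x} {y} c e i | false | inj₁ j with trans (sym (proj₁ (c j))) ex
... | ()
edgeR-∈ {x = x} {y} c e i | false | inj₂ j = j

∈-edge : ∀ {n} {F : List (Vertex (suc n) × Vertex (suc n))} {x y} → edge x y ∈ F → InL F x y
∈-edge {x = x} i with par x
... | true = inj₁ i
... | false = inj₂ i

_≟ᴱ_ : ∀ {n} (p q : Vertex n × Vertex n) → Dec (p ≡ q)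
_≟ᴱ_ = ≡-dec× _≟ⱽ_ _≟ⱽ_

abstract
 InL? : ∀ {n} (F : List (Vertex n × Vertex n)) x y → Dec (InL F x y)
 InL? F x y = any? ((x , y) ≟ᴱ_) F ⊎-dec any? ((y , x) ≟ᴱ_) F

abstract
 InLR? : ∀ {m} (F : List (R m × R m)) x y → Dec (InL F x y)
 InLR? F x y = any? (≡-dec× _≟ᴿ_ _≟ᴿ_ (x , y)) F ⊎-dec any? (≡-dec× _≟ᴿ_ _≟ᴿ_ (y , x)) F

adjF-sym : ∀ {n} {F : List (Vertex n × Vertex n)} {x y} → AdjF F x y → AdjF F y x
adjF-sym (a , h) = adj-sym a , h ∘ InL-sym

HP-sym : ∀ {n} {F : List (Vertex n × Vertex n)} {u v} → HP F u v → HP F v u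
HP-sym (l , p , f) = reverse l , rev adjF-sym p , λ w → trans (OV.occ-reverse w l) (f w)

-- Segments through whole copies, and blocked vertices.

module RingBase {m : ℕ} (F : List (R m × R m)) where

  G : R m → R m → Set
  G = GF RAdj F

  G-sym : ∀ {x y} → G x y → G y x
  G-sym = GF-sym {F = F} radj-sym

  -- The only obstruction to joining paths of neighbouring copies: at every other vertex a path can
  -- leave or enter its copy.
  Blocked : R m → Set
  Blocked z = InL F z (cr true z) × InL F z (cr false z)

  Blocked? : ∀ z → Dec (Blocked z)
  Blocked? z = InLR? F z (cr true z) ×-dec InLR? F z (cr false z)

  exitN : ∀ d k x → par x ≡ d → ¬ Blocked (k , x) → ∃[ b ] G (k , x) (up d k , nb zero b x)
  exitN d k x refl nb-bl with InLR? F (k , x) (cr true (k , x)) | InLR? F (k , x) (cr false (k , x))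
  ... | no h | _ = true , adj-cr true (k , x) , h
  ... | yes _ | no h = false , adj-cr false (k , x) , h
  ... | yes h | yes h' = ⊥-elim (nb-bl (h , h'))

  exit : ∀ d k x → par x ≡ d → ¬ Blocked (k , x) → ∃[ y ] (G (k , x) (up d k , y) × par y ≡ not d)
  exit d k x e h with exitN d k x e h
  ... | b , g = nb zero b x , g , trans (par-nb zero b x) (cong not e)

  -- Three steps forward are one step back; all copies are named by steps in one direction, as in
  -- `others`.
  exit₃ : ∀ d k x → par x ≡ not d → ¬ Blocked (k , x) → ∃[ y ] (G (k , x) (up₃ d k , y) × par y ≡ d)
  exit₃ d k x e h with exit (not d) k x e h
  ... | y , g , e' = y , subst (λ z → G (k , x) (z , y)) (down-up₃ d k) g , trans e' (not-involutive d)

  -- `ks` lists the copies that the path exhausts. Stated with counts, coverage simply adds up under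
  -- concatenation, and a list that contains every copy once makes the path Hamiltonian.
  record Seg (u v : R m) (ks : List (Fin 4)) : Set where
    constructor seg
    field
      verts : List (R m)
      path : Path G u v verts
      cov : ∀ w → OR.occ w verts ≡ O4.occ (proj₁ w) ks

  joinSeg : ∀ {u v w x ks ks'} → Seg u v ks → G v w → Seg w x ks' → Seg u x (ks ++ ks')
  joinSeg {ks = ks} {ks'} (seg l p c) g (seg l' p' c') = seg (l ++ l') (join p g p')
    λ w → trans (sumW-++ (OR.same w) l l') (trans (cong₂ _+_ (c w) (c' w)) (sym (sumW-++ (O4.same (proj₁ w)) ks ks')))

  revSeg : ∀ {u v ks} → Seg u v ks → Seg v u ks
  revSeg (seg l p c) = seg (reverse l) (rev G-sym p) λ w → trans (OR.occ-reverse w l) (c w)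

  fullSeg : ∀ {u v ks} → Seg u v ks → (∀ k → O4.occ k ks ≡ 1) → HPR F u v
  fullSeg (seg l p c) h = l , p , λ w → trans (c w) (h (proj₁ w))

  occ-lift : ∀ k w (l : List (Vertex (suc m))) → OR.occ w (map (k ,_) l) ≡ O4.same (proj₁ w) k * OV.occ (proj₂ w) l
  occ-lift k w [] = sym (*-comm (O4.same (proj₁ w) k) 0)
  occ-lift k w@(j , x) (y ∷ l) = trans (cong₂ _+_ one (occ-lift k w l)) (sym (lem (O4.same j k) (OV.same x y) (OV.occ x l)))
    where
    lem : ∀ a b c → a * (b + c) ≡ a * b + a * c
    lem a b c = *-distribˡ-+ a b c
      where open import Data.Nat.Properties using (*-distribˡ-+)
    one : OR.same (j , x) (k , y) ≡ O4.same j k * OV.same x y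
    one = go (j ≟ᶠ k) (x ≟ⱽ y)
      where
      go : Dec (j ≡ k) → Dec (x ≡ y) → OR.same (j , x) (k , y) ≡ O4.same j k * OV.same x y
      go (yes refl) (yes refl) = trans (OR.same-refl (j , x)) (sym (cong₂ _*_ (O4.same-refl j) (OV.same-refl x)))
      go (yes refl) (no h) = trans (OR.same-≢ {x = j , x} {y = k , y} (λ e → h (cong proj₂ e))) (sym (trans (cong (O4.same j j *_) (OV.same-≢ h)) (*-comm (O4.same j j) 0)))
      go (no h) _ = trans (OR.same-≢ {x = j , x} {y = k , y} (λ e → h (cong proj₁ e))) (sym (cong (_* OV.same x y) (O4.same-≢ h)))

  liftHP : ∀ k {x y} → HP (inner k F) x y → Seg (k , x) (k , y) (k ∷ [])
  liftHP k (l , p , f) = seg (map (k ,_) l) (mapPath (k ,_) (liftG k) p)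
    λ w → trans (occ-lift k w l) (trans (cong (O4.same (proj₁ w) k *_) (f (proj₂ w))) (trans (*-comm _ 1) refl))

  -- A Hamiltonian path of a copy with the edge between `r` and `t` removed. Only adjacency of `r`
  -- and `t` is kept, since the removed edge may itself be a fault.
  record Broken (k : Fin 4) (u r t v : Vertex (suc m)) : Set where
    constructor broken
    field
      l₁ l₂ : List (Vertex (suc m))
      p₁ : Path (AdjF (inner k F)) u r l₁
      p₂ : Path (AdjF (inner k F)) t v l₂
      full : OV.Full (l₁ ++ l₂)
      adj : Adj r t

    odd : par t ≡ not (par r)
    odd = adj-par adj

  cutBroken : ∀ {k u v l r t} → Cut {E = AdjF (inner k F)} u v l r t → OV.Full l → Broken k u r t v
  cutBroken (cut l₁ l₂ refl a b c) f = broken l₁ l₂ a c f (proj₁ b)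

  insert : ∀ {a u r t v p q ks} → Broken a u r t v → G (a , r) p → Seg p q ks → G q (a , t) → (∀ k → O4.occ k (a ∷ ks) ≡ 1) → HPR F (a , u) (a , v)
  insert {a} {ks = ks} (broken l₁ l₂ p₁ p₂ full _) g (seg l p c) g' h =
    map (a ,_) l₁ ++ (l ++ map (a ,_) l₂) , join (mapPath (a ,_) (liftG a) p₁) g (join p g' (mapPath (a ,_) (liftG a) p₂)) , cov
    where
    open import Data.Nat.Properties using (*-distribˡ-+; *-identityʳ)
    cov : ∀ w → OR.occ w (map (a ,_) l₁ ++ (l ++ map (a ,_) l₂)) ≡ 1
    cov w@(j , x) = begin
      OR.occ w (map (a ,_) l₁ ++ (l ++ map (a ,_) l₂)) ≡⟨ sumW-++ (OR.same w) (map (a ,_) l₁) _ ⟩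
      OR.occ w (map (a ,_) l₁) + OR.occ w (l ++ map (a ,_) l₂) ≡⟨ cong (OR.occ w (map (a ,_) l₁) +_) (trans (sumW-++ (OR.same w) l _) (+-comm (OR.occ w l) _)) ⟩
      OR.occ w (map (a ,_) l₁) + (OR.occ w (map (a ,_) l₂) + OR.occ w l) ≡⟨ sym (+-assoc (OR.occ w (map (a ,_) l₁)) _ _) ⟩
      (OR.occ w (map (a ,_) l₁) + OR.occ w (map (a ,_) l₂)) + OR.occ w l ≡⟨ cong₂ _+_ (cong₂ _+_ (occ-lift a w l₁) (occ-lift a w l₂)) (c w) ⟩
      (O4.same j a * OV.occ x l₁ + O4.same j a * OV.occ x l₂) + O4.occ j ks ≡⟨ cong (_+ O4.occ j ks) (trans (sym (*-distribˡ-+ (O4.same j a) (OV.occ x l₁) (OV.occ x l₂))) (trans (cong (O4.same j a *_) (trans (sym (sumW-++ (OV.same x) l₁ l₂)) (full x))) (*-identityʳ (O4.same j a)))) ⟩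
      O4.same j a + O4.occ j ks ≡⟨ h j ⟩
      1 ∎
      where open ≡-Reasoning

  crossEntry : Fin 4 → Vertex (suc m) → Bool → R m × R m
  crossEntry k z b = edgeR (k , z) (cr b (k , z))

  isX-edgeR : ∀ {k l} {x y : Vertex (suc m)} → ¬ k ≡ l → isX (edgeR (k , x) (l , y)) ≡ true
  isX-edgeR {k} {l} {x} h with par x
  ... | true with k ≟ᶠ l
  ... | yes e = ⊥-elim (h e)
  ... | no _ = refl
  isX-edgeR {k} {l} {x} h | false with l ≟ᶠ k
  ... | yes e = ⊥-elim (h (sym e))
  ... | no _ = refl

  crossList-Unique : ∀ k {zs : List (Vertex (suc m))} → Unique zs → Unique (both (crossEntry k) zs)
  crossList-Unique k u = both-Unique (crossEntry k) (λ _ _ → inj) u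
    where
    lem : ∀ {x y : Vertex (suc m)} {b c} → x ≡ y → nb zero b x ≡ nb zero c y → x ≡ y × b ≡ c
    lem {x} {_} {b} {c} refl e' = refl , proj₂ (nb-inj zero zero b c x e')
    inj : ∀ {x y b c} → crossEntry k x b ≡ crossEntry k y c → x ≡ y × b ≡ c
    inj {x} {y} {b} {c} e with par x | par y
    ... | true | true = lem (cong (proj₂ ∘ proj₁) e) (cong (proj₂ ∘ proj₂) e)
    ... | false | false = lem (cong (proj₂ ∘ proj₂) e) (cong (proj₂ ∘ proj₁) e)
    -- The entry of an even vertex begins in copy `k`, that of an odd vertex in a neighbouring copy.
    ... | true | false = ⊥-elim (up-≢ false k (sym (cong (proj₁ ∘ proj₁) e)))
    ... | false | true = ⊥-elim (up-≢ false k (cong (proj₁ ∘ proj₁) e))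

  crossList-∈ : CanonR F → ∀ k (zs : List (Vertex (suc m))) → (∀ {z} → z ∈ zs → Blocked (k , z)) → ∀ {r} → r ∈ both (crossEntry k) zs → r ∈ F × isX r ≡ true
  crossList-∈ can k zs bl i with ∈-both (crossEntry k) zs i
  ... | z , true , j , refl = edgeR-∈ can (parR-cr true (k , z)) (proj₁ (bl j)) , isX-edgeR {x = z} {y = nb zero true z} (λ e → up-≢ (par z) k (sym e))
  ... | z , false , j , refl = edgeR-∈ can (parR-cr false (k , z)) (proj₂ (bl j)) , isX-edgeR {x = z} {y = nb zero false z} (λ e → up-≢ (par z) k (sym e))

  -- Each blocked vertex of a copy consumes two crossing faults of its own.
  crossCount : CanonR F → ∀ k (zs : List (Vertex (suc m))) → Unique zs → (∀ {z} → z ∈ zs → Blocked (k , z)) → length zs + length zs ≤ cnt isX F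
  crossCount can k zs u bl = subst (_≤ cnt isX F) (both-length (crossEntry k) zs) (⊆-cnt isX (crossList-Unique k u) (crossList-∈ can k zs bl))

  -- The extra fault has an end of the opposite parity in copy `k`, so it leads to the other
  -- neighbouring copy and is none of the two faults counted for each blocked vertex.
  crossCount⁺ : CanonR F → ∀ d k (zs : List (Vertex (suc m))) → Unique zs → (∀ {z} → z ∈ zs → Blocked (k , z)) → (∀ {z} → z ∈ zs → par z ≡ not d) →
    ∀ {x y} → par x ≡ d → par y ≡ not d → InL F (k , x) (up d k , y) → suc (length zs + length zs) ≤ cnt isX F
  crossCount⁺ can d k zs u bl pz {x} {y} px py f = subst (λ n → suc n ≤ cnt isX F) (both-length (crossEntry k) zs)
    (⊆-cnt isX (All-∉ _ new ∷ crossList-Unique k u) sub)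
    where
    extra = edgeR (k , x) (up d k , y)
    clash : ∀ d {x y z : Vertex (suc m)} b → par x ≡ d → par z ≡ not d → ¬ edgeR (k , x) (up d k , y) ≡ crossEntry k z b
    clash d {x} {y} {z} b px pz e with par x | par z | px | pz | e
    ... | true | .false | refl | refl | e' = up-≢ true k (cong (proj₁ ∘ proj₂) e')
    ... | false | .true | refl | refl | e' = up-≢ false k (cong (proj₁ ∘ proj₁) e')
    new : ¬ extra ∈ both (crossEntry k) zs
    new i with ∈-both (crossEntry k) zs i
    ... | z , b , j , e = clash d {x} {y} {z} b px (pz j) e
    sub : ∀ {r} → r ∈ extra ∷ both (crossEntry k) zs → r ∈ F × isX r ≡ true
    sub (here refl) = edgeR-∈ can (trans py (cong not (sym px))) f , isX-edgeR {x = x} {y = y} (λ e → up-≢ d k (sym e))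
    sub (there i) = crossList-∈ can k zs bl i

-- Numerical bounds, and faults counted by copy and by dimension.

pow-lower : ∀ m → 3 + m ≤ 4 ^ suc m
pow-lower zero = s≤s (s≤s (s≤s z≤n))
pow-lower (suc m) = ≤-trans (s≤s (pow-lower m)) (≤-trans (+-monoˡ-≤ (4 ^ suc m) (≤-trans (s≤s z≤n) (pow-lower m))) (+-monoʳ-≤ (4 ^ suc m) (m≤m+n (4 ^ suc m) _)))

-- Compares the bound on the faults of the ring with the number of vertices of a single copy: a
-- Hamiltonian path of a copy is too long to be spoiled everywhere.
4*-lower : ∀ m → 4 * (2 + m) < 4 ^ (2 + m)
4*-lower m = *-monoʳ-< 4 (pow-lower m)

pow-lower₂ : ∀ m → 2 * (2 + m) ≤ 4 ^ suc m
pow-lower₂ zero = ≤-refl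
pow-lower₂ (suc m) = ≤-trans (≤-reflexive (lem m)) (≤-trans (+-monoʳ-≤ (2 * (2 + m)) (≤-trans (s≤s (s≤s z≤n)) (≤-trans (≤-trans (s≤s (s≤s z≤n)) (pow-lower m)) (m≤m+n (4 ^ suc m) _)))) (+-monoˡ-≤ _ (pow-lower₂ m)))
  where
  lem : ∀ m → 2 * (2 + suc m) ≡ 2 * (2 + m) + 2
  lem = solve-∀

b2n-≤ : ∀ a b c → (a ≡ true → b ≡ true → ⊥) → (a ≡ true → c ≡ true → ⊥) → (b ≡ true → c ≡ true → ⊥) → b2n a + (b2n b + b2n c) ≤ 1
b2n-≤ false false false _ _ _ = z≤n
b2n-≤ false false true _ _ _ = s≤s z≤n
b2n-≤ false true false _ _ _ = s≤s z≤n
b2n-≤ true false false _ _ _ = s≤s z≤n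
b2n-≤ false true true _ _ h = ⊥-elim (h refl refl)
b2n-≤ true false true _ h _ = ⊥-elim (h refl refl)
b2n-≤ true true _ h _ _ = ⊥-elim (h refl refl)

cnt₃ : {A : Set} (p q r : A → Bool) (l : List A) → (∀ x → p x ≡ true → q x ≡ true → ⊥) → (∀ x → p x ≡ true → r x ≡ true → ⊥) → (∀ x → q x ≡ true → r x ≡ true → ⊥) →
  cnt p l + (cnt q l + cnt r l) ≤ length l
cnt₃ p q r l h₁ h₂ h₃ = ≤-trans (≤-reflexive (trans (cong (cnt p l +_) (sym (sumW-+ (b2n ∘ q) (b2n ∘ r) l))) (sym (sumW-+ (b2n ∘ p) _ l))))
  (≤-trans (sumW-mono l (λ {x} _ → b2n-≤ (p x) (q x) (r x) (h₁ x) (h₂ x) (h₃ x))) (≤-reflexive (sumW-1 l)))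

inn-true : ∀ {m} k (r : R m × R m) → inn k r ≡ true → proj₁ (proj₁ r) ≡ k × proj₁ (proj₂ r) ≡ k
inn-true k ((a , x) , (b , y)) e with a ≟ᶠ k | b ≟ᶠ k | e
... | yes p | yes q | _ = p , q

inn-isX : ∀ {m} k (r : R m × R m) → inn k r ≡ true → isX r ≡ true → ⊥
inn-isX k r@((a , x) , (b , y)) e f with inn-true k r e
... | refl , refl with k ≟ᶠ k | f
... | yes _ | ()
... | no h | _ = h refl

inn-X : ∀ {m} k (F : List (R m × R m)) → length (inner k F) + cnt isX F ≤ length F
inn-X k F = subst (λ z → z + cnt isX F ≤ length F) (sym (inner-length k F))
  (cnt₃ (λ _ → false) (inn k) isX F (λ _ ()) (λ _ ()) (inn-isX k)  |> λ h → subst (_≤ length F) (cong (_+ (cnt (inn k) F + cnt isX F)) (zeros F)) h)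
  where
  _|>_ : {A B : Set} → A → (A → B) → B
  x |> f = f x
  zeros : ∀ {A : Set} (l : List A) → cnt (λ _ → false) l ≡ 0
  zeros [] = refl
  zeros (x ∷ l) = zeros l

inn-inn-X : ∀ {m} k s (F : List (R m × R m)) → ¬ k ≡ s → length (inner k F) + (length (inner s F) + cnt isX F) ≤ length F
inn-inn-X k s F ne = subst₂ (λ y z → y + (z + cnt isX F) ≤ length F) (sym (inner-length k F)) (sym (inner-length s F))
  (cnt₃ (inn k) (inn s) isX F (λ r e f → ne (trans (sym (proj₁ (inn-true k r e))) (proj₁ (inn-true s r f)))) (inn-isX k) (inn-isX s))

nbrs-tw : ∀ {n} {x y : Vertex (suc n)} → y ∈ nbrs (tw x) → y ∈ nbrs x
nbrs-tw {x = x} i with nb-adj (nbrs-adj i)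
... | j , b , refl = subst (_∈ nbrs x) (sym (trans (cong (λ c → nb j c (tw x)) (sym (not-involutive b))) (nb-tw j (not b) x))) (adj-nbrs (adj-nb j (not b) x))

same-tail : ∀ {n} b c (x y : Vertex (suc n)) → par x ≡ par y → nb zero b x ≡ nb zero c y → y ≡ x ⊎ y ≡ tw x
same-tail b c (a ∷ τ) (a' ∷ σ) e h with cong Data.Vec.tail h
  where import Data.Vec
... | refl = go a a' e
  where
  go : ∀ a a' → pe a ≡ pe a' → a' ∷ τ ≡ a ∷ τ ⊎ a' ∷ τ ≡ tw4 a ∷ τ
  go #0 #0 _ = inj₁ refl
  go #0 #2 _ = inj₂ refl
  go #1 #1 _ = inj₁ refl
  go #1 #3 _ = inj₂ refl
  go #2 #0 _ = inj₂ refl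
  go #2 #2 _ = inj₁ refl
  go #3 #1 _ = inj₂ refl
  go #3 #3 _ = inj₁ refl
  go #0 #1 ()
  go #0 #3 ()
  go #1 #0 ()
  go #1 #2 ()
  go #2 #1 ()
  go #2 #3 ()
  go #3 #0 ()
  go #3 #2 ()

inc-inj : ∀ {x y} → inc4 x ≡ inc4 y → x ≡ y
inc-inj {x} {y} e = trans (sym (dec-inc x)) (trans (cong dec4 e) (dec-inc y))

-- Supplies, for an odd vertex, a second odd vertex whose crossing neighbours are not adjacent to
-- the first one, see `push-nonadj`.
push : ∀ {m} → Vertex (2 + m) → Vertex (2 + m)
push (a ∷ x ∷ τ) = a ∷ inc4 x ∷ τ

push-inj : ∀ {m} (x y : Vertex (2 + m)) → push x ≡ push y → x ≡ y
push-inj (a ∷ x ∷ τ) (b ∷ y ∷ σ) e with cong Data.Vec.head e | cong (Data.Vec.head ∘ Data.Vec.tail) e | cong (Data.Vec.tail ∘ Data.Vec.tail) e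
  where import Data.Vec
... | refl | e' | refl = cong (λ z → a ∷ z ∷ τ) (inc-inj e')

par-push : ∀ {m} (x : Vertex (2 + m)) → par (push x) ≡ par x
par-push (a ∷ x ∷ τ) = refl

-- An odd vertex has its neighbours at coordinate offsets 0 and -1, never at +1.
push-nonadj : ∀ {m} (x : Vertex (2 + m)) b → par x ≡ false → ¬ nb zero b (push x) ∈ nbrs x
push-nonadj {m} (a ∷ x ∷ τ) b e i with nb-adj (nbrs-adj i)
... | zero , c , h = inc-≢ x (cong (λ v → lookup v (suc zero)) h)
... | suc zero , c , h = lem a e (cong (λ v → lookup v (suc zero)) h)
  where
  inc-dec-≢ : ∀ x → ¬ inc4 x ≡ dec4 x
  inc-dec-≢ #0 ()
  inc-dec-≢ #1 ()
  inc-dec-≢ #2 ()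
  inc-dec-≢ #3 ()
  lem : ∀ a → pe a ≡ false → ¬ inc4 x ≡ shift a x
  lem #1 _ = inc-dec-≢ x
  lem #3 _ = inc-dec-≢ x
  lem #0 ()
  lem #2 ()
... | suc (suc j) , c , h = inc-≢ x (cong (λ v → lookup v (suc zero)) h)

tw-nb : ∀ {n} b (x : Vertex (suc n)) → tw (nb zero b x) ≡ nb zero (not b) x
tw-nb true (#0 ∷ τ) = refl
tw-nb true (#1 ∷ τ) = refl
tw-nb true (#2 ∷ τ) = refl
tw-nb true (#3 ∷ τ) = refl
tw-nb false (#0 ∷ τ) = refl
tw-nb false (#1 ∷ τ) = refl
tw-nb false (#2 ∷ τ) = refl
tw-nb false (#3 ∷ τ) = refl

tw-tw : ∀ {n} (x : Vertex (suc n)) → tw (tw x) ≡ x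
tw-tw (#0 ∷ τ) = refl
tw-tw (#1 ∷ τ) = refl
tw-tw (#2 ∷ τ) = refl
tw-tw (#3 ∷ τ) = refl

-- The index is one less than the dimension, so `n + n` is the bound 2(n+1)-2.
Laceable : ℕ → Set
Laceable n = (F : List (Vertex (suc n) × Vertex (suc n))) → Canon F → length F ≤ n + n → ∀ {x y} → par x ≡ true → par y ≡ false → HP F x y

-- Lace and Cond are opaque so that their statements are not unfolded in every context that assumes them.
abstract
  Lace : ℕ → Set
  Lace = Laceable

  lace-intro : ∀ {n} → Laceable n → Lace n
  lace-intro h = h

  lace-elim : ∀ {n} → Lace n → Laceable n
  lace-elim h = h

E : ℕ → Set
E n = Vertex n × Vertex n

dimX : ∀ {m} → Fin (2 + m) → E (2 + m) → Bool
dimX i r = isX (pmap (φ i) r)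

isX-false : ∀ {m} {p q : R m} → proj₁ p ≡ proj₁ q → isX (p , q) ≡ false
isX-false {p = k , x} {.k , y} refl with k ≟ᶠ k
... | yes _ = refl
... | no h = ⊥-elim (h refl)

isX-true : ∀ {m} {p q : R m} → ¬ proj₁ p ≡ proj₁ q → isX (p , q) ≡ true
isX-true {p = k , x} {l , y} h with k ≟ᶠ l
... | yes e = ⊥-elim (h e)
... | no _ = refl

dimX-nb : ∀ {m} i b (x : Vertex (2 + m)) → dimX i (x , nb i b x) ≡ true
dimX-nb i b x = isX-true {p = φ i x} {φ i (nb i b x)} (λ e → up-≢ (parR (φ i x)) (proj₁ (φ i x)) (sym (trans e (cong proj₁ (φ-nb-same i b x)))))

dimX-nb-≢ : ∀ {m} i j b (x : Vertex (2 + m)) → ¬ i ≡ j → dimX j (x , nb i b x) ≡ false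
dimX-nb-≢ i j b x h = isX-false {p = φ j x} {φ j (nb i b x)} (sym (cong proj₁ (proj₂ (φ-nb-other i j b x h))))

sumW-map : {A B : Set} (f : B → ℕ) (g : A → B) (l : List A) → sumW f (map g l) ≡ sumW (f ∘ g) l
sumW-map f g [] = refl
sumW-map f g (x ∷ l) = cong (f (g x) +_) (sumW-map f g l)

sumW-swap : {A B : Set} (f : A → B → ℕ) (l : List A) (l' : List B) → sumW (λ a → sumW (f a) l') l ≡ sumW (λ b → sumW (λ a → f a b) l) l'
sumW-swap f [] l' = sym (zeros l')
  where
  zeros : ∀ {B : Set} (l : List B) → sumW (λ _ → 0) l ≡ 0
  zeros [] = refl
  zeros (x ∷ l) = zeros l
sumW-swap f (a ∷ l) l' = trans (cong (sumW (f a) l' +_) (sumW-swap f l l')) (sym (sumW-+ (f a) (λ b → sumW (λ a → f a b) l) l'))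

sumW-∈ : {A : Set} (f : A → ℕ) {l : List A} {x : A} → x ∈ l → f x ≤ sumW f l
sumW-∈ f (here refl) = m≤m+n _ _
sumW-∈ f {y ∷ l} (there i) = ≤-trans (sumW-∈ f i) (m≤n+m _ (f y))

sumW-const : {A : Set} (c : ℕ) (f : A → ℕ) (l : List A) → (∀ {x} → x ∈ l → f x ≤ c) → sumW f l ≤ length l * c
sumW-const c f [] h = z≤n
sumW-const c f (x ∷ l) h = +-mono-≤ (h (here refl)) (sumW-const c f l (h ∘ there))

module _ {m : ℕ} (F : List (E (2 + m))) where

  dimCount : Fin (2 + m) → ℕ
  dimCount i = cnt (dimX i) F

  dimCount-X : ∀ i → cnt isX (FR i F) ≡ dimCount i
  dimCount-X i = sumW-map (b2n ∘ isX) (pmap (φ i)) F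

  dims-lower : Canon F → length F ≤ sumW dimCount (fins (2 + m))
  dims-lower c = ≤-trans (≤-reflexive (sym (sumW-1 F))) (≤-trans (sumW-mono F one) (≤-reflexive (sumW-swap (λ r i → b2n (dimX i r)) F (fins (2 + m)))))
    where
    one : ∀ {r} → r ∈ F → 1 ≤ sumW (λ i → b2n (dimX i r)) (fins (2 + m))
    one {x , y} i with nb-adj (proj₂ (c i))
    ... | j , b , refl = ≤-trans (≤-reflexive (sym (cong b2n (dimX-nb j b x)))) (sumW-∈ (λ i → b2n (dimX i (x , nb j b x))) (fins-∈ j))

  copy-dim : ∀ i k → length (inner k (FR i F)) + dimCount i ≤ length F
  copy-dim i k = subst₂ _≤_ (cong (length (inner k (FR i F)) +_) (dimCount-X i)) (length-map (pmap (φ i)) F) (inn-X k (FR i F))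

abstract
  pick : ∀ {n} {P : Fin n → Set} → (∀ i → Dec (P i)) → (∃[ i ] P i) ⊎ (∀ i → ¬ P i)
  pick {P = P} P? with anyᶠ? P?
  ... | yes p = inj₁ p
  ... | no h = inj₂ (λ i p → h (i , p))

-- Degrees, stars, and faults that are temporarily restored.

sel-length : {A : Set} {P : A → Set} (P? : ∀ x → Dec (P x)) (l : List A) → length (sel P? l) + length (sel (λ x → ¬? (P? x)) l) ≡ length l
sel-length P? [] = refl
sel-length P? (x ∷ l) with P? x
... | yes _ = cong suc (sel-length P? l)
... | no _ = trans (+-suc _ _) (cong suc (sel-length P? l))

abstract
  goodN badN : ∀ {n} → List (E n) → Vertex n → List (Vertex n)
  goodN F x = sel (λ y → ¬? (InL? F x y)) (nbrs x)
  badN F x = sel (λ y → InL? F x y) (nbrs x)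

  badN-Unique : ∀ {n} (F : List (E n)) x → Unique (badN F x)
  badN-Unique F x = sel-Unique (λ y → InL? F x y) (nbrs-Unique x)

  goodN-Unique : ∀ {n} (F : List (E n)) x → Unique (goodN F x)
  goodN-Unique F x = sel-Unique (λ y → ¬? (InL? F x y)) (nbrs-Unique x)

  badN-∈ : ∀ {n} {F : List (E n)} {x y} → y ∈ badN F x → Adj x y × InL F x y
  badN-∈ {F = F} {x} i with ∈-sel⁻ (λ y → InL? F x y) {l = nbrs x} i
  ... | j , f = nbrs-adj j , f

  goodN-∈ : ∀ {n} {F : List (E n)} {x y} → y ∈ goodN F x → AdjF F x y
  goodN-∈ {F = F} {x} i with ∈-sel⁻ (λ y → ¬? (InL? F x y)) {l = nbrs x} i
  ... | j , f = nbrs-adj j , f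

  ∈-goodN : ∀ {n} {F : List (E n)} {x y} → AdjF F x y → y ∈ goodN F x
  ∈-goodN {F = F} {x} (a , h) = ∈-sel⁺ (λ y → ¬? (InL? F x y)) (adj-nbrs a) h

  ∈-badN : ∀ {n} {F : List (E n)} {x y} → Adj x y → InL F x y → y ∈ badN F x
  ∈-badN {F = F} {x} a h = ∈-sel⁺ (λ y → InL? F x y) (adj-nbrs a) h

  good-bad : ∀ {n} (F : List (E n)) x → length (badN F x) + length (goodN F x) ≡ n + n
  good-bad F x = trans (sel-length (InL? F x) (nbrs x)) (nbrs-length x)

deg : ∀ {n} → List (E n) → Vertex n → ℕ
deg F x = length (goodN F x)

deg-bad : ∀ {n} (F : List (E n)) x → length (badN F x) + deg F x ≡ n + n
deg-bad = good-bad

deg-mono : ∀ {n} {F F' : List (E n)} x → (∀ {y} → InL F' x y → InL F x y) → deg F x ≤ deg F' x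
deg-mono {F = F} {F'} x h = ⊆-length (goodN-Unique F x) (λ i → ∈-goodN {F = F'} (proj₁ (goodN-∈ {F = F} i) , proj₂ (goodN-∈ {F = F} i) ∘ h))

without : ∀ {n} → E n → List (E n) → List (E n)
without h F = sel (λ r → ¬? (r ≟ᴱ h)) F

module _ {n : ℕ} {h : E n} {F : List (E n)} where

  without-⊆ : ∀ {r} → r ∈ without h F → r ∈ F
  without-⊆ i = proj₁ (∈-sel⁻ (λ r → ¬? (r ≟ᴱ h)) {l = F} i)

  without-∉ : ¬ h ∈ without h F
  without-∉ i = proj₂ (∈-sel⁻ (λ r → ¬? (r ≟ᴱ h)) {l = F} i) refl

  ∈-without : ∀ {r} → r ∈ F → ¬ r ∈ without h F → r ≡ h
  ∈-without {r} i ni with r ≟ᴱ h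
  ... | yes e = e
  ... | no ne = ⊥-elim (ni (∈-sel⁺ (λ r → ¬? (r ≟ᴱ h)) i ne))

  without-Unique : Unique F → Unique (without h F)
  without-Unique u = sel-Unique (λ r → ¬? (r ≟ᴱ h)) u

  without-length : Unique F → h ∈ F → length (without h F) < length F
  without-length u i = ⊆-length (All-∉ _ without-∉ ∷ without-Unique u) (λ { (here refl) → i ; (there j) → without-⊆ j })

  without-InL : ∀ {x y} → InL (without h F) x y → InL F x y
  without-InL (inj₁ i) = inj₁ (without-⊆ i)
  without-InL (inj₂ i) = inj₂ (without-⊆ i)

without-canon : ∀ {n} {h : E (suc n)} {F : List (E (suc n))} → Canon F → Canon (without h F)
without-canon c i = c (without-⊆ i)

edge-inj : ∀ {n} (x : Vertex (suc n)) {y z} → edge x y ≡ edge x z → y ≡ z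
edge-inj x e with par x
... | true = cong proj₂ e
... | false = cong proj₁ e

edge-ends : ∀ {n} (x y x' y' : Vertex (suc n)) → edge x y ≡ edge x' y' → (x ≡ x' × y ≡ y') ⊎ (x ≡ y' × y ≡ x')
edge-ends x y x' y' e with par x | par x'
... | true | true = inj₁ (cong proj₁ e , cong proj₂ e)
... | true | false = inj₂ (cong proj₁ e , cong proj₂ e)
... | false | true = inj₂ (cong proj₂ e , cong proj₁ e)
... | false | false = inj₁ (cong proj₂ e , cong proj₁ e)

star : ∀ {n} → List (E (suc n)) → Vertex (suc n) → List (E (suc n))
star F x = map (edge x) (badN F x)

star-Unique : ∀ {n} (F : List (E (suc n))) x → Unique (star F x)
star-Unique F x = Unique-map (edge x) (λ _ _ → edge-inj x) (badN-Unique F x)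

star-⊆ : ∀ {n} {F : List (E (suc n))} → Canon F → ∀ {x r} → r ∈ star F x → r ∈ F
star-⊆ {F = F} c {x} i with ∈-map⁻ (edge x) i
... | y , j , refl with badN-∈ {F = F} j
... | a , f = edge-∈ c (adj-par a) f

-- The stars of two vertices have at most the edge joining them in common.
two-stars : ∀ {n} {F : List (E (suc n))} → Canon F → ∀ x w → ¬ x ≡ w → length (badN F w) + length (badN F x) ≤ suc (length F)
two-stars {F = F} c x w ne = ≤-trans (+-monoʳ-≤ (length (badN F w)) one) (≤-trans (≤-reflexive (+-suc _ _)) (s≤s all))
  where
  B : List _
  B = sel (λ y → ¬? (y ≟ⱽ w)) (badN F x)
  one : length (badN F x) ≤ suc (length B)
  one = ⊆-length (badN-Unique F x) sub
    where
    sub : ∀ {y} → y ∈ badN F x → y ∈ w ∷ B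
    sub {y} i with y ≟ⱽ w
    ... | yes e = here e
    ... | no h = there (∈-sel⁺ (λ y → ¬? (y ≟ⱽ w)) i h)
  disj : ∀ {r} → r ∈ star F w → r ∈ map (edge x) B → ⊥
  disj i j with ∈-map⁻ (edge w) i | ∈-map⁻ (edge x) j
  ... | y , _ , e | z , k , e' with edge-ends w y x z (trans (sym e) e')
  ... | inj₁ (p , _) = ne (sym p)
  ... | inj₂ (p , _) = proj₂ (∈-sel⁻ (λ y → ¬? (y ≟ⱽ w)) {l = badN F x} k) (sym p)
  all : length (badN F w) + length B ≤ length F
  all = ≤-trans (≤-reflexive (trans (sym (cong₂ _+_ (length-map (edge w) (badN F w)) (length-map (edge x) B))) (sym (length-++ (star F w)))))
    (⊆-length (Unique-++ (star-Unique F w) (Unique-map (edge x) (λ _ _ → edge-inj x) (sel-Unique (λ y → ¬? (y ≟ⱽ w)) (badN-Unique F x))) disj) sub)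
    where
    sub : ∀ {r} → r ∈ star F w ++ map (edge x) B → r ∈ F
    sub i with ∈-++⁻ (star F w) i
    ... | inj₁ j = star-⊆ c j
    ... | inj₂ j with ∈-map⁻ (edge x) j
    ... | z , k , refl with badN-∈ {F = F} (proj₁ (∈-sel⁻ (λ y → ¬? (y ≟ⱽ w)) {l = badN F x} k))
    ... | a , f = edge-∈ c (adj-par a) f

-- In dimension n+1 the bound 4(n+1)-5 reads `length F < 4 * n`. The edge joining `u` and `v` may be
-- faulty here: a Hamiltonian path between its ends does not use it.
Conditional : ℕ → Set
Conditional n = (F : List (E (suc n))) → Canon F → Unique F → length F < 4 * n → (∀ x → 2 ≤ deg F x) →
  ∀ {u v} → par u ≡ true → par v ≡ false → Adj u v → HP F u v

abstract
  Cond : ℕ → Set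
  Cond = Conditional

  cond-intro : ∀ {n} → Conditional n → Cond n
  cond-intro h = h

  cond-elim : ∀ {n} → Cond n → Conditional n
  cond-elim h = h

module _ {n : ℕ} {F : List (E (suc n))} (can : Canon F) {h : E (suc n)} where

  is-h : ∀ {x y} → AdjF (without h F) x y → InL F x y → edge x y ≡ h
  is-h {x} {y} (a , nf) f = ∈-without (edge-∈ can (adj-par a) f) (λ i → nf (∈-edge {x = x} {y} i))

  -- `x` is an end of `h`, so a path that misses `x` cannot use `h`.
  off-path : ∀ {x y v l} → (∀ {a b} → edge a b ≡ h → a ≡ x ⊎ b ≡ x) → Path (AdjF (without h F)) y v l → ¬ x ∈ l → Path (AdjF F) y v l
  off-path hx (stop y) nx = stop y
  off-path {x} hx (_▸_ {a} {b} e p) nx = (proj₁ e , bad) ▸ off-path hx p (nx ∘ there)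
    where
    bad : ¬ InL F a b
    bad f with hx {a} {b} (is-h e f)
    ... | inj₁ refl = nx (here refl)
    ... | inj₂ refl = nx (there (first-∈ p))

  ends-of : ∀ {x y} → edge x y ≡ h → ∀ {a b} → edge a b ≡ h → a ≡ x ⊎ b ≡ x
  ends-of {x} {y} e {a} {b} e' with edge-ends a b x y (trans e' (sym e))
  ... | inj₁ (p , _) = inj₁ p
  ... | inj₂ (_ , p) = inj₂ p

  record HCut (u v : Vertex (suc n)) (l : List (Vertex (suc n))) : Set where
    field
      r t : Vertex (suc n)
      l₁ l₂ : List (Vertex (suc n))
      eq : l ≡ l₁ ++ l₂
      left : Path (AdjF F) u r l₁
      right : Path (AdjF F) t v l₂
      adj : Adj r t
      is : edge r t ≡ h

  -- A path without repetitions uses the restored fault `h` at most once, so cutting there leaves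
  -- two parts free of faults.
  useH : ∀ {u v l} → Unique l → Path (AdjF (without h F)) u v l → Path (AdjF F) u v l ⊎ HCut u v l
  useH _ (stop x) = inj₁ (stop x)
  useH (nx ∷ u) (_▸_ {x} {y} e p) with InL? F x y
  ... | yes f = inj₂ record { r = x ; t = y ; l₁ = x ∷ [] ; l₂ = _ ; eq = refl ; left = stop x
        ; right = off-path (ends-of (is-h e f)) p (∉-All nx) ; adj = proj₁ e ; is = is-h e f }
  ... | no nf with useH u p
  ... | inj₁ q = inj₁ ((proj₁ e , nf) ▸ q)
  ... | inj₂ c = inj₂ record { r = HCut.r c ; t = HCut.t c ; l₁ = x ∷ HCut.l₁ c ; l₂ = HCut.l₂ c ; eq = cong (x ∷_) (HCut.eq c)
        ; left = (proj₁ e , nf) ▸ HCut.left c ; right = HCut.right c ; adj = HCut.adj c ; is = HCut.is c }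

  -- A path between the ends of `h` that uses `h` would consist of `h` alone.
  closeH : ∀ {x y l} → edge x y ≡ h → 3 ≤ length l → Unique l → Path (AdjF (without h F)) x y l → Path (AdjF F) x y l
  closeH e (s≤s ()) _ (stop _)
  closeH {x} {y} eh len (nx ∷ u) (_▸_ {y = z} e p) = (proj₁ e , nf) ▸ off-path (ends-of eh) p (∉-All nx)
    where
    single : ∀ {l} → Path (AdjF (without h F)) y y l → Unique l → ¬ 2 ≤ length l
    single (stop _) _ (s≤s ())
    single (_ ▸ q) (n ∷ _) _ = ∉-All n (last-∈ q)
    nf : ¬ InL F x z
    nf f with edge-ends x z x y (trans (is-h e f) (sym eh))
    ... | inj₁ (_ , refl) = single p u (≤-pred len)
    ... | inj₂ (refl , refl) = single p u (≤-pred len)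

true≢false : ¬ true ≡ false
true≢false ()

up₂-≢ : ∀ d k → ¬ up d (up d k) ≡ k
up₂-≢ true #0 ()
up₂-≢ true #1 ()
up₂-≢ true #2 ()
up₂-≢ true #3 ()
up₂-≢ false #0 ()
up₂-≢ false #1 ()
up₂-≢ false #2 ()
up₂-≢ false #3 ()

up₃-≢ : ∀ d k → ¬ up₃ d k ≡ k
up₃-≢ d k e = up-≢ (not d) k (trans (down-up₃ d k) e)

-- Chains through three copies.

record RingFaults {m : ℕ} (F : List (R (suc m) × R (suc m))) : Set where
  constructor ringFaults
  field
    can : CanonR F
    small : length F < 4 * (2 + m)

module Ring {m : ℕ} (F : List (R (suc m) × R (suc m))) (H : RingFaults F) where

  open RingFaults H

  open RingBase F public

  V : Set
  V = Vertex (2 + m)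

  X≤F : cnt isX F ≤ length F
  X≤F = cnt≤length isX F

  -- Breaking a path at an edge with two vertices outside Bad; if there is none, every second vertex or its successor is in Bad.
  breakGen : ∀ {k} (Bad : V → Set) (bad? : ∀ x → Dec (Bad x)) {u v l} → Path (AdjF (inner k F)) u v l →
    (∃[ r ] ∃[ t ] (Cut {E = AdjF (inner k F)} u v l r t × ¬ Bad r × ¬ Bad t × par r ≡ par u))
    ⊎ length l ≤ 1 + (length (sel bad? l) + length (sel bad? l))
  breakGen Bad bad? (stop x) = inj₂ (s≤s z≤n)
  breakGen {k} Bad bad? (_▸_ {x} e (stop y)) with bad? x | bad? y
  ... | no h | no h' = inj₁ (x , y , cut (x ∷ []) (y ∷ []) refl (stop x) e (stop y) , h , h' , refl)
  ... | yes _ | no _ = inj₂ (s≤s (s≤s z≤n))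
  ... | no _ | yes _ = inj₂ (s≤s (s≤s z≤n))
  ... | yes _ | yes _ = inj₂ (s≤s (s≤s z≤n))
  breakGen {k} Bad bad? (_▸_ {x} e (_▸_ {y} {z} f p)) with breakGen Bad bad? p
  ... | inj₁ (r , t , c , hr , ht , e') = inj₁ (r , t , consCut e (consCut f c) , hr , ht ,
        trans e' (trans (adj-par (proj₁ f)) (trans (cong not (adj-par (proj₁ e))) (not-involutive (par x)))))
  ... | inj₂ le with bad? x | bad? y
  ... | no h | no h' = inj₁ (x , y , cut (x ∷ []) _ refl (stop x) e (f ▸ p) , h , h' , refl)
  ... | yes _ | no _ = inj₂ (s≤s (s≤s (≤-trans le (≤-reflexive (sym (+-suc _ _))))))
  ... | no _ | yes _ = inj₂ (s≤s (s≤s (≤-trans le (≤-reflexive (sym (+-suc _ _))))))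
  ... | yes _ | yes _ = inj₂ (s≤s (s≤s (≤-trans le (≤-trans (n≤1+n _) (≤-trans (s≤s (≤-reflexive (sym (+-suc _ _)))) (s≤s (+-monoʳ-≤ _ (n≤1+n _))))))))

  full-length : ∀ l → OV.Full {2 + m} l → 4 ^ (2 + m) ≤ length l
  full-length l f = subst (_≤ length l) (allV-length (2 + m)) (⊆-length (allV-Unique (2 + m)) (λ {x} _ → OV.Full-∈ l f x))

  blockedCount : ∀ k {l : List V} → Unique l → length (sel (λ x → Blocked? (k , x)) l) + length (sel (λ x → Blocked? (k , x)) l) ≤ cnt isX F
  blockedCount k {l} u = crossCount can k _ (sel-Unique _ u) (λ i → proj₂ (∈-sel⁻ (λ x → Blocked? (k , x)) {l = l} i))

  -- A blocked vertex spoils at most two edges of the path and costs two crossing faults, and the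
  -- path has more vertices than there are faults.
  breakGood : ∀ k {u v} → HP (inner k F) u v → ∃[ r ] ∃[ t ] (Broken k u r t v × ¬ Blocked (k , r) × ¬ Blocked (k , t))
  breakGood k (l , p , f) with breakGen (λ x → Blocked (k , x)) (λ x → Blocked? (k , x)) p
  ... | inj₁ (r , t , c , hr , ht , _) = r , t , cutBroken {l = l} c f , hr , ht
  ... | inj₂ le = ⊥-elim (1+n≰n (≤-trans (s≤s (≤-trans (full-length l f) (≤-trans le (s≤s (≤-trans (blockedCount k {l} (OV.Full-Unique l f)) X≤F)))))
          (≤-trans (s≤s small) (4*-lower m))))

  Clean : Fin 4 → V → Set
  Clean k x = ∀ b → ¬ InL F (k , x) (cr b (k , x))

  Dirty : Fin 4 → V → Set
  Dirty k x = InL F (k , x) (cr true (k , x)) ⊎ InL F (k , x) (cr false (k , x))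

  Dirty? : ∀ k x → Dec (Dirty k x)
  Dirty? k x = InLR? F (k , x) (cr true (k , x)) ⊎-dec InLR? F (k , x) (cr false (k , x))

  ¬Dirty : ∀ {k x} → ¬ Dirty k x → Clean k x
  ¬Dirty h true i = h (inj₁ i)
  ¬Dirty h false i = h (inj₂ i)

  odds : List V
  odds = both (λ τ b → step b #0 ∷ τ) (allV (suc m))

  odds-par : ∀ {y} → y ∈ odds → par y ≡ false
  odds-par i with ∈-both _ (allV (suc m)) i
  ... | τ , b , _ , refl = pe-step b #0

  odds-Unique : Unique odds
  odds-Unique = both-Unique _ (λ _ _ → cons-inj #0) (allV-Unique (suc m))

  odds-length : 4 * (2 + m) ≤ length odds
  odds-length = ≤-trans (≤-trans (≤-reflexive (lem m)) (+-mono-≤ (pow-lower₂ m) (pow-lower₂ m)))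
    (≤-reflexive (sym (trans (both-length _ (allV (suc m))) (cong₂ _+_ (allV-length (suc m)) (allV-length (suc m))))))
    where
    lem : ∀ m → 4 * (2 + m) ≡ 2 * (2 + m) + 2 * (2 + m)
    lem = solve-∀

  dirty-∈ : ∀ {k x} → par x ≡ false → Dirty k x → (k , x) ∈ map proj₂ F
  dirty-∈ {k} {x} e d = go d
    where
    pt : ∀ b → InL F (k , x) (cr b (k , x)) → (k , x) ∈ map proj₂ F
    pt b i = subst (_∈ map proj₂ F) (cong (λ c → proj₂ (if c then ((k , x) , cr b (k , x)) else (cr b (k , x) , (k , x)))) e)
      (∈-map⁺ proj₂ (edgeR-∈ can (parR-cr b (k , x)) i))
    go : Dirty k x → (k , x) ∈ map proj₂ F
    go (inj₁ i) = pt true i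
    go (inj₂ i) = pt false i

  -- Otherwise each odd `s` yields the odd end `(k , s)` or `(k' , push s)` of a crossing fault.
  -- These ends are distinct, every fault has one odd end, and a copy has more odd vertices than
  -- there are faults.
  cleanPair : ∀ k k' → ¬ k ≡ k' → ∃[ s ] (par s ≡ false × Clean k s × Clean k' (push s))
  cleanPair k k' ne with any? (λ s → ¬? (Dirty? k s) ×-dec ¬? (Dirty? k' (push s))) odds
  ... | yes a = go odds a odds-par
    where
    go : ∀ l → Any (λ s → ¬ Dirty k s × ¬ Dirty k' (push s)) l → (∀ {y} → y ∈ l → par y ≡ false) → ∃[ s ] (par s ≡ false × Clean k s × Clean k' (push s))
    go (x ∷ l) (here (h , h')) p = x , p (here refl) , ¬Dirty h , ¬Dirty h'
    go (x ∷ l) (there i) p = go l i (p ∘ there)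
  ... | no h = ⊥-elim (1+n≰n (≤-trans small (≤-trans odds-length (subst (_≤ length F) (length-map wit odds) (subst (length (map wit odds) ≤_) (length-map proj₂ F) (⊆-length uni sub))))))
    where
    dirtyEnd : ∀ s → Dec (Dirty k s) → R (suc m)
    dirtyEnd s (yes _) = k , s
    dirtyEnd s (no _) = k' , push s
    wit : V → R (suc m)
    wit s = dirtyEnd s (Dirty? k s)
    uni : Unique (map wit odds)
    uni = Unique-map wit (λ {x} {y} _ _ → inj x y) odds-Unique
      where
      inj : ∀ x y → wit x ≡ wit y → x ≡ y
      inj x y e with Dirty? k x | Dirty? k y
      ... | yes _ | yes _ = cong proj₂ e
      ... | yes _ | no _ = ⊥-elim (ne (cong proj₁ e))
      ... | no _ | yes _ = ⊥-elim (ne (sym (cong proj₁ e)))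
      ... | no _ | no _ = push-inj x y (cong proj₂ e)
    none : ∀ l → ¬ Any (λ s → ¬ Dirty k s × ¬ Dirty k' (push s)) l → ∀ {s} → s ∈ l → ¬ Dirty k s → Dirty k' (push s)
    none (x ∷ l) n (here refl) nd with Dirty? k' (push x)
    ... | yes d = d
    ... | no nd' = ⊥-elim (n (here (nd , nd')))
    none (x ∷ l) n (there i) nd = none l (n ∘ there) i nd
    sub : ∀ {r} → r ∈ map wit odds → r ∈ map proj₂ F
    sub i with ∈-map⁻ wit i
    ... | s , j , refl with Dirty? k s
    ... | yes d = dirty-∈ (odds-par j) d
    ... | no nd = dirty-∈ (trans (par-push s) (odds-par j)) (none odds h j nd)

  cleanOdd : ∀ k → ∃[ s ] (par s ≡ false × Clean k s)
  cleanOdd k with cleanPair k (inc4 k) (λ e → inc-≢ k (sym e))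
  ... | s , p , c , _ = s , p , c

  LevelEdge : Bool → Fin 4 → Set
  LevelEdge d k = ∃[ x ] ∃[ y ] (par x ≡ d × par y ≡ not d × G (k , x) (up d k , y))

  -- Of two consecutive copies, the odd vertices of the upper one cross to the lower one and the
  -- even vertices of the lower one to the upper one; a clean odd vertex of the appropriate copy
  -- therefore suffices.
  levelEdge : ∀ d k → LevelEdge d k
  levelEdge true k with cleanOdd (inc4 k)
  ... | y , p , c = nb zero true y , y , trans (par-nb zero true y) (cong not p) , p ,
        G-sym (subst (λ z → G (inc4 k , y) (z , nb zero true y)) (trans (cong (λ d → up d (inc4 k)) p) (dec-inc k)) (adj-cr true (inc4 k , y) , c true))
  levelEdge false k with cleanOdd k
  ... | x , p , c = x , nb zero true x , p , trans (par-nb zero true x) (cong not p) ,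
        subst (λ d → G (k , x) (up d k , nb zero true x)) p (adj-cr true (k , x) , c true)

  back : ∀ d k y → par y ≡ not d → ¬ Blocked (up d k , y) → ∃[ x ] (G (k , x) (up d k , y) × par x ≡ d)
  back d k y e h with exit (not d) (up d k) y e h
  ... | x , g , e' = x , G-sym (subst (λ z → G (up d k , y) (z , x)) (up-up d k) g) , trans e' (not-involutive d)

  LaceC : Fin 4 → Set
  LaceC k = ∀ {x y} → par x ≡ true → par y ≡ false → HP (inner k F) x y

  laceD : ∀ {k} → LaceC k → ∀ d {x y} → par x ≡ d → par y ≡ not d → HP (inner k F) x y
  laceD h true e e' = h e e'
  laceD h false e e' = HP-sym (h e' e)

  laceD' : ∀ {k} → LaceC k → ∀ d {x y} → par x ≡ not d → par y ≡ d → HP (inner k F) x y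
  laceD' h d e e' = HP-sym (laceD h d e' e)

  -- A traversal of the three other copies in direction d.
  Chain : Bool → Fin 4 → V → V → Set
  Chain d a p q = Seg (up d a , p) (up₃ d a , q) (others d a)

  -- A special copy is only known to have a Hamiltonian path between one pair of unblocked vertices.
  Pair : Fin 4 → Bool → V → V → Set
  Pair s d y x = par y ≡ not d × par x ≡ d × HP (inner s F) y x × ¬ Blocked (s , y) × ¬ Blocked (s , x)

  -- The chains differ in the position of the copy for which only one path is at hand: first here,
  -- second in `chain₂`, third in `chain₃`, nowhere in `chainL`.
  chain₁ : ∀ d a {p x q} → HP (inner (up d a) F) p x → par x ≡ d → ¬ Blocked (up d a , x) →
    LaceC (up₂ d a) → LaceC (up₃ d a) → par q ≡ d → Chain d a p q
  chain₁ d a {x = x} h ex nx L₂ L₃ eq with exit d (up d a) x ex nx | levelEdge d (up₂ d a)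
  ... | p₂ , g₁ , e₂ | q₂ , p₃ , f₂ , e₃ , g₂ =
    joinSeg (liftHP _ h) g₁ (joinSeg (liftHP _ (laceD' L₂ d e₂ f₂)) g₂ (liftHP _ (laceD' L₃ d e₃ eq)))

  chainL : ∀ d a {p q} → LaceC (up d a) → LaceC (up₂ d a) → LaceC (up₃ d a) → par p ≡ not d → par q ≡ d → Chain d a p q
  chainL d a L₁ L₂ L₃ ep eq with levelEdge d (up d a) | levelEdge d (up₂ d a)
  ... | q₁ , p₂ , f₁ , e₂ , g₁ | q₂ , p₃ , f₂ , e₃ , g₂ =
    joinSeg (liftHP _ (laceD' L₁ d ep f₁)) g₁ (joinSeg (liftHP _ (laceD' L₂ d e₂ f₂)) g₂ (liftHP _ (laceD' L₃ d e₃ eq)))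

  chain₂ : ∀ d a {p q y x} → LaceC (up d a) → Pair (up₂ d a) d y x → LaceC (up₃ d a) → par p ≡ not d → par q ≡ d → Chain d a p q
  chain₂ d a {y = y} {x} L₁ (ey , ex , h , ny , nx) L₃ ep eq with back d (up d a) y ey ny | exit d (up₂ d a) x ex nx
  ... | q₁ , g₁ , f₁ | p₃ , g₂ , e₃ =
    joinSeg (liftHP _ (laceD' L₁ d ep f₁)) g₁ (joinSeg (liftHP _ h) g₂ (liftHP _ (laceD' L₃ d e₃ eq)))

  chain₃ : ∀ d a {p y q} → LaceC (up d a) → LaceC (up₂ d a) → par y ≡ not d → HP (inner (up₃ d a) F) y q → ¬ Blocked (up₃ d a , y) →
    par p ≡ not d → Chain d a p q
  chain₃ d a {y = y} L₁ L₂ ey h ny ep with levelEdge d (up d a) | back d (up₂ d a) y ey ny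
  ... | q₁ , p₂ , f₁ , e₂ , g₁ | q₂ , g₂ , f₂ =
    joinSeg (liftHP _ (laceD' L₁ d ep f₁)) g₁ (joinSeg (liftHP _ (laceD' L₂ d e₂ f₂)) g₂ (liftHP _ h))

  up₄ : ∀ d a → up d (up₃ d a) ≡ a
  up₄ d a = trans (cong (up d) (sym (down-up₃ d a))) (trans (cong (λ c → up c (up (not d) a)) (sym (not-involutive d))) (up-up (not d) a))

  -- The parity of `r` decides in which direction the path leaves the copy. Since `t` has the other
  -- parity, it is entered from the opposite side, where the chain through the three other copies
  -- ends.
  insertChain : ∀ {a u r t v} → Broken a u r t v → ¬ Blocked (a , r) → ¬ Blocked (a , t) →
    (∀ {p q} → par p ≡ not (par r) → par q ≡ par r → Chain (par r) a p q) → HPR F (a , u) (a , v)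
  insertChain {a} {r = r} {t} b nr nt ch with exit (par r) a r refl nr | exit₃ (par r) a t (Broken.odd b) nt
  ... | p , g , ep | q , g' , eq = insert b g (ch ep eq) (G-sym g') (others-cover (par r) a)

  inCopy : ∀ {a u v} → HP (inner a F) u v → (∀ {d p q} → par p ≡ not d → par q ≡ d → Chain d a p q) → HPR F (a , u) (a , v)
  inCopy {a} h ch with breakGood a h
  ... | r , t , b , nr , nt = insertChain b nr nt (λ {p} {q} → ch {par r} {p} {q})

  -- From a vertex u of copy a to a vertex v of the next copy, the ring is traversed against the direction of the edge.
  crossing : ∀ d a {u z q v} → HP (inner a F) u z → G (up₃ d a , q) (a , z) → Chain d a v q → HPR F (a , u) (up d a , v)
  crossing d a h g c = fullSeg (joinSeg (liftHP a h) (G-sym g) (revSeg c)) (others-cover d a)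

  -- Rings with laceable copies.

  module Laced (lace : Lace (suc m)) where

    L : ℕ
    L = suc m + suc m

    blockedNbrs : Fin 4 → V → List V
    blockedNbrs k t = sel (λ y → Blocked? (k , y)) (nbrs t)

    blockedNbrs-X : ∀ k t → length (blockedNbrs k t) + length (blockedNbrs k t) ≤ cnt isX F
    blockedNbrs-X k t = crossCount can k _ (sel-Unique (λ y → Blocked? (k , y)) (nbrs-Unique t)) (λ i → proj₂ (∈-sel⁻ (λ y → Blocked? (k , y)) {l = nbrs t} i))

    canonI : ∀ k → Canon (inner k F)
    canonI k = canon-inner k can

    lacy : ∀ k → length (inner k F) ≤ L → LaceC k
    lacy k h = lace-elim lace (inner k F) (canonI k) h

    -- With the edges from `t` to its blocked neighbours declared faulty, whatever stands next to
    -- `t` on a path is unblocked.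
    Avoiding : Fin 4 → V → List (V × V)
    Avoiding k t = map (edge t) (blockedNbrs k t) ++ inner k F

    avoid-canon : ∀ k t → Canon (Avoiding k t)
    avoid-canon k t i with ∈-++⁻ (map (edge t) (blockedNbrs k t)) i
    ... | inj₂ j = canonI k j
    ... | inj₁ j with ∈-map⁻ (edge t) j
    ... | y , j' , e with par t in et | nbrs-adj (proj₁ (∈-sel⁻ (λ y → Blocked? (k , y)) {l = nbrs t} j')) | e
    ... | true | a | refl = et , a
    ... | false | a | refl = trans (adj-par a) (cong not et) , adj-sym a

    avoid : ∀ k t d {u v} → length (inner k F) + length (blockedNbrs k t) ≤ L → par u ≡ d → par v ≡ not d → HP (Avoiding k t) u v
    avoid k t d {u} {v} h eu ev = go d eu ev
      where
      le : length (Avoiding k t) ≤ suc m + suc m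
      le = ≤-trans (≤-reflexive (trans (length-++ (map (edge t) (blockedNbrs k t))) (trans (cong (_+ length (inner k F)) (length-map (edge t) (blockedNbrs k t))) (+-comm _ (length (inner k F)))))) h
      go : ∀ d → par u ≡ d → par v ≡ not d → HP (Avoiding k t) u v
      go true eu ev = lace-elim lace _ (avoid-canon k t) le eu ev
      go false eu ev = HP-sym (lace-elim lace _ (avoid-canon k t) le ev eu)

    avoid-weaken : ∀ {k t x y} → AdjF (Avoiding k t) x y → AdjF (inner k F) x y
    avoid-weaken {k} {t} (a , h) = a , λ { (inj₁ i) → h (inj₁ (∈-++⁺ʳ (map (edge t) (blockedNbrs k t)) i)) ; (inj₂ i) → h (inj₂ (∈-++⁺ʳ (map (edge t) (blockedNbrs k t)) i)) }

    avoid-free : ∀ {k t r} → AdjF (Avoiding k t) t r → ¬ Blocked (k , r)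
    avoid-free {k} {t} {r} (a , h) b = h (∈-edge {x = t} {r} (∈-++⁺ˡ (∈-map⁺ (edge t) (∈-sel⁺ (λ y → Blocked? (k , y)) (adj-nbrs a) b))))

    cutAvoid : ∀ {k t u v l r s} → Cut {E = AdjF (Avoiding k t)} u v l r s → OV.Full l → Broken k u r s v
    cutAvoid (cut l₁ l₂ refl a b c) f = broken l₁ l₂ (pathMono avoid-weaken a) (pathMono avoid-weaken c) f (proj₁ b)

    -- Either all edges from t to blocked vertices can be treated as faults, or there is at most one such edge and t or its twin has an unblocked predecessor.
    steer : ∀ d k {w s} t → par w ≡ d → par s ≡ not d → ¬ t ≡ w → ¬ tw t ≡ w →
      length (inner k F) ≤ L → length (inner k F) + cnt isX F ≤ 2 + L →
      ∃[ t' ] ∃[ r ] ((t' ≡ t ⊎ t' ≡ tw t) × Broken k w r t' s × ¬ Blocked (k , r))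
    steer d k {w} {s} t ew es tw₁ tw₂ hf hx with length (inner k F) + length (blockedNbrs k t) ≤? L
    ... | yes le with avoid k t d le ew es
    ... | l , p , f with cutBefore p (OV.Full-∈ l f t) tw₁
    ... | r , c = t , r , inj₁ refl , cutAvoid {l = l} c f , avoid-free (adjF-sym (Cut.edge c))
    steer d k {w} {s} t ew es tw₁ tw₂ hf hx | no nle with laceD (lacy k hf) d ew es
    ... | l , p , f with cutBefore p (OV.Full-∈ l f t) tw₁ | cutBefore p (OV.Full-∈ l f (tw t)) tw₂
    ... | r , c | r' , c' with Blocked? (k , r) | Blocked? (k , r')
    ... | no h | _ = t , r , inj₁ refl , cutBroken {l = l} c f , h
    ... | yes _ | no h = tw t , r' , inj₂ refl , cutBroken {l = l} c' f , h
    -- Twins have the same neighbours, so both predecessors are blocked neighbours of `t`, and they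
    -- are distinct.
    ... | yes b | yes b' = ⊥-elim (1+n≰n (≤-trans two one))
      where
      B = blockedNbrs k t
      r≢ : ¬ r ≡ r'
      r≢ refl = tw-≢ t (sym (succ-unique (OV.Full-Unique l f) c c'))
      in-B : ∀ {x} → x ∈ r ∷ r' ∷ [] → x ∈ B
      in-B (here refl) = ∈-sel⁺ (λ y → Blocked? (k , y)) (adj-nbrs (adj-sym (proj₁ (Cut.edge c)))) b
      in-B (there (here refl)) = ∈-sel⁺ (λ y → Blocked? (k , y)) (nbrs-tw {x = t} (adj-nbrs (adj-sym (proj₁ (Cut.edge c'))))) b'
      two : 2 ≤ length B
      two = ⊆-length ((r≢ ∷ []) ∷ ([] ∷ [])) in-B
      -- With I the faults of the copy and X the crossing ones: (L+1) + |B| ≤ |I| + 2|B| ≤ |I| + |X|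
      -- ≤ L + 2.
      one : length B ≤ 1
      one = +-cancelˡ-≤ (suc L) _ _ (≤-trans (+-monoˡ-≤ (length B) (≰⇒> nle)) (≤-trans (≤-reflexive (+-assoc (length (inner k F)) _ _))
              (≤-trans (+-monoʳ-≤ (length (inner k F)) (blockedNbrs-X k t)) (≤-trans hx (≤-reflexive (sym (+-comm (suc L) 1)))))))

    -- Routes that enter a copy twice need partial coverage: the count of one visit is arbitrary,
    -- and only the sum over both visits is known, see `Split`.
    record Piece (u v : R (suc m)) (f : R (suc m) → ℕ) : Set where
      constructor piece
      field
        verts : List (R (suc m))
        path : Path G u v verts
        cov : ∀ w → OR.occ w verts ≡ f w

    _⟨_⟩_ : ∀ {u v w x f g} → Piece u v f → G v w → Piece w x g → Piece u x (λ z → f z + g z)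
    piece l p c ⟨ e ⟩ piece l' p' c' = piece (l ++ l') (join p e p') (λ w → trans (sumW-++ (OR.same w) l l') (cong₂ _+_ (c w) (c' w)))

    infixr 5 _⟨_⟩_

    segPiece : ∀ {u v ks} → Seg u v ks → Piece u v (λ w → O4.occ (proj₁ w) ks)
    segPiece (seg l p c) = piece l p c

    record Split (k : Fin 4) (u r t v : V) : Set where
      constructor split
      field
        f₁ f₂ : R (suc m) → ℕ
        fst : Piece (k , u) (k , r) f₁
        snd : Piece (k , t) (k , v) f₂
        sum : ∀ w → f₁ w + f₂ w ≡ O4.same (proj₁ w) k

    splitB : ∀ {k u r t v} → Broken k u r t v → Split k u r t v
    splitB {k} (broken l₁ l₂ p₁ p₂ full _) = split _ _
      (piece (map (k ,_) l₁) (mapPath (k ,_) (liftG k) p₁) (λ w → occ-lift k w l₁))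
      (piece (map (k ,_) l₂) (mapPath (k ,_) (liftG k) p₂) (λ w → occ-lift k w l₂))
      (λ w → trans (sym (*-distribˡ-+ (O4.same (proj₁ w) k) _ _)) (trans (cong (O4.same (proj₁ w) k *_) (trans (sym (sumW-++ (OV.same (proj₂ w)) l₁ l₂)) (full (proj₂ w)))) (*-identityʳ _)))
      where open import Data.Nat.Properties using (*-distribˡ-+; *-identityʳ)

    module LaceStep (lenF : length F ≤ 2 + L) (inners : ∀ k → length (inner k F) ≤ L) where

      LC : ∀ k → LaceC k
      LC k = lacy k (inners k)

      kX : ∀ k → length (inner k F) + cnt isX F ≤ 2 + L
      kX k = ≤-trans (inn-X k F) lenF

      -- The path leaves `a` downwards at `z`, returns from above at `z₂`, and leaves downwards
      -- again at `y₂`. The field `w≢` keeps the two arrivals in the copy below apart.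
      record Opening (a : Fin 4) (x y₂ : V) : Set where
        field
          z z₂ w : V
          brk : Broken a x z z₂ y₂
          par-z₂ : par z₂ ≡ true
          free-z₂ : ¬ Blocked (a , z₂)
          out : G (a , z) (up₃ true a , w)
          par-w : par w ≡ true
          w≢ : ∀ b → ¬ nb zero b y₂ ≡ w

      opening : ∀ a {x y₂} → par x ≡ true → par y₂ ≡ false → Opening a x y₂
      opening a {x} {y₂} ex ey with LC a {x} {y₂} ex ey
      ... | l , stop .x , f = ⊥-elim (absurd (trans (sym ex) ey))
        where
        absurd : ¬ true ≡ false
        absurd ()
      -- The even first vertex is set aside, so that the removed edge begins at an odd vertex, which
      -- leaves downwards.
      ... | l , _▸_ {l = l'} e p , f with breakGen Bad bad? p
        where
        -- Only a vertex and its twin share crossing neighbours, so excluding `y₂` and its twin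
        -- yields `w≢`.
        Bad : V → Set
        Bad z = Blocked (a , z) ⊎ z ≡ y₂ ⊎ z ≡ tw y₂
        bad? : ∀ z → Dec (Bad z)
        bad? z = Blocked? (a , z) ⊎-dec ((z ≟ⱽ y₂) ⊎-dec (z ≟ⱽ tw y₂))
      ... | inj₁ (z , z₂ , c , hz , hz₂ , epar) = res (exitN false a z pz (hz ∘ inj₁))
        where
        pz : par z ≡ false
        pz = trans epar (trans (adj-par (proj₁ e)) (cong not ex))
        res : ∃[ b ] G (a , z) (up false a , nb zero b z) → Opening a x y₂
        res (b , g) = record { z = z ; z₂ = z₂ ; w = nb zero b z ; brk = cutBroken {l = x ∷ l'} (consCut e c) f
          ; par-z₂ = trans (adj-par (proj₁ (Cut.edge c))) (cong not pz)
          ; free-z₂ = hz₂ ∘ inj₁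
          ; out = subst (λ k → G (a , z) (k , nb zero b z)) (down-up₃ true a) g
          ; par-w = trans (par-nb zero b z) (cong not pz)
          ; w≢ = λ c e → no-tail (same-tail c b y₂ z (trans ey (sym pz)) e) }
          where
          no-tail : ¬ (z ≡ y₂ ⊎ z ≡ tw y₂)
          no-tail = hz ∘ inj₂
      ... | inj₂ le = ⊥-elim (1+n≰n (≤-trans (s≤s (≤-trans (full-length (x ∷ l') f) (≤-trans (s≤s le) bound))) bound₂))
        where
        Bl = sel (λ z → Blocked? (a , z)) l'
        Bad = sel (λ z → Blocked? (a , z) ⊎-dec ((z ≟ⱽ y₂) ⊎-dec (z ≟ⱽ tw y₂))) l'
        uni : Unique l'
        uni with OV.Full-Unique (x ∷ l') f
        ... | _ ∷ u = u
        sub : ∀ {z} → z ∈ Bad → z ∈ y₂ ∷ tw y₂ ∷ Bl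
        sub i with ∈-sel⁻ (λ z → Blocked? (a , z) ⊎-dec ((z ≟ⱽ y₂) ⊎-dec (z ≟ⱽ tw y₂))) {l = l'} i
        ... | j , inj₁ b = there (there (∈-sel⁺ (λ z → Blocked? (a , z)) j b))
        ... | j , inj₂ (inj₁ e) = here e
        ... | j , inj₂ (inj₂ e) = there (here e)
        few : length Bad ≤ 2 + length Bl
        few = ⊆-length (sel-Unique _ uni) sub
        bound : 1 + (1 + (length Bad + length Bad)) ≤ 6 + (2 + L)
        bound = ≤-trans (s≤s (s≤s (+-mono-≤ few few))) (≤-trans (≤-reflexive (lem (length Bl))) (+-monoʳ-≤ 6 (≤-trans (blockedCount a uni) (≤-trans X≤F lenF))))
          where
          lem : ∀ b → 1 + (1 + ((2 + b) + (2 + b))) ≡ 6 + (b + b)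
          lem = solve-∀
        bound₂ : 1 + (6 + (2 + L)) ≤ 4 ^ (2 + m)
        bound₂ = ≤-trans (≤-trans (≤-reflexive (lem₁ m)) (≤-trans (m≤m+n _ (m + m + 1)) (≤-reflexive (lem₂ m)))) (*-monoʳ-≤ 4 (pow-lower m))
          where
          lem₁ : ∀ m → 1 + (6 + (2 + (suc m + suc m))) ≡ m + m + 11
          lem₁ = solve-∀
          lem₂ : ∀ m → (m + m + 11) + (m + m + 1) ≡ 4 * (3 + m)
          lem₂ = solve-∀

      t-of : ∀ {y₂} (t' : V) → t' ≡ nb zero true y₂ ⊎ t' ≡ tw (nb zero true y₂) → ∃[ b ] t' ≡ nb zero b y₂
      t-of {y₂} t' (inj₁ e) = true , e
      t-of {y₂} t' (inj₂ e) = false , trans e (tw-nb true y₂)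

      clean-edge : ∀ k {y} → par y ≡ false → Clean k y → ∀ b → G (k , y) (up₃ true k , nb zero b y)
      clean-edge k {y} p c b = subst (λ z → G (k , y) (z , nb zero b y)) (trans (cong (λ d → up d k) p) (down-up₃ true k)) (adj-cr b (k , y) , c b)

      down₃ : ∀ a → up false (up₃ true a) ≡ up₂ true a
      down₃ a = up-up true (up₂ true a)

      down₂ : ∀ a → up false (up₂ true a) ≡ up true a
      down₂ a = up-up true (up true a)

      up₃₃ : ∀ a → up₃ true (up₃ true a) ≡ up₂ true a
      up₃₃ a = trans (sym (down-up₃ true (up₃ true a))) (down₃ a)

      -- An even-to-odd path of a copy can be left only downwards, so a route that visits every copy
      -- once ends in the copy above `a`. To end in the copy below, that copy and `a` are visited in
      -- two pieces each, with the two remaining copies in between.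
      rel₃ : ∀ a {x y} → par x ≡ true → par y ≡ false → HPR F (a , x) (up₃ true a , y)
      rel₃ a {x} {y} ex ey with cleanOdd a
      ... | y₂ , ey₂ , cy with opening a ex ey₂
      ... | o with steer true (up₃ true a) (nb zero true y₂) (Opening.par-w o) ey (Opening.w≢ o true) (λ e → Opening.w≢ o false (trans (sym (tw-nb true y₂)) e)) (inners _) (kX _)
      ... | t' , r , et , br , nr with t-of t' et
      ... | b , refl with exit false (up₃ true a) r pr nr | exit true a z₂ par-z₂ free-z₂ | levelEdge true (up true a)
        where
        open Opening o
        pr : par r ≡ false
        pr = trans (sym (not-involutive (par r))) (cong not (trans (sym (Broken.odd br)) (trans (par-nb zero b y₂) (cong not ey₂))))
      ... | c , gc , ec | g , gg , eg | f , p , ef , ep , gf with splitB (Opening.brk o) | splitB br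
      ... | split f₁ f₂ P₁ P₂ sP | split g₁ g₂ Q₁ Q₂ sQ = finish whole
        where
        open Opening o
        mid = revSeg (joinSeg (liftHP (up true a) (HP-sym (LC (up true a) ef eg))) gf (liftHP (up₂ true a) (HP-sym (LC (up₂ true a) ec ep))))
        whole = P₁ ⟨ out ⟩ Q₁ ⟨ subst (λ k → G (up₃ true a , r) (k , c)) (down₃ a) gc ⟩ segPiece mid ⟨ G-sym gg ⟩ P₂ ⟨ clean-edge a ey₂ cy b ⟩ Q₂
        finish : Piece (a , x) (up₃ true a , y) _ → HPR F (a , x) (up₃ true a , y)
        finish (piece l q cov) = l , q , λ w → trans (cov w) (trans (lem (f₁ w) (g₁ w) (f₂ w) (g₂ w) (O4.same (proj₁ w) (up true a)) (O4.same (proj₁ w) (up₂ true a)))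
          (trans (cong₂ (λ s t → s + (O4.same (proj₁ w) (up true a) + (O4.same (proj₁ w) (up₂ true a) + (t + 0)))) (sP w) (sQ w)) (others-cover true a (proj₁ w))))
          where
          lem : ∀ f₁ g₁ f₂ g₂ s₁ s₂ → f₁ + (g₁ + ((s₁ + (s₂ + 0)) + (f₂ + g₂))) ≡ (f₁ + f₂) + (s₁ + (s₂ + ((g₁ + g₂) + 0)))
          lem = solve-∀

      -- As in `rel₃`, now with three copies visited twice and only `up true a` visited once. The
      -- second visits are linked through `push s` and `s`, which must be clean in their copies.
      rel₂ : ∀ a {x y} → par x ≡ true → par y ≡ false → HPR F (a , x) (up₂ true a , y)
      rel₂ a {x} {y} ex ey with cleanPair (up₃ true a) a ne₃
        where
        ne₃ : ¬ up₃ true a ≡ a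
        ne₃ e = up-≢ false a (trans (down-up₃ true a) e)
      ... | s , es , cs , cy with opening a ex (trans (par-push s) es)
      ... | o with steer true (up₃ true a) (nb zero true (push s)) (Opening.par-w o) es (Opening.w≢ o true) (λ e → Opening.w≢ o false (trans (sym (tw-nb true (push s))) e)) (inners _) (kX _)
      ... | t' , r , et , br , nr with t-of t' et
      ... | b , refl with exitN false (up₃ true a) r pr nr
        where
        pr : par r ≡ false
        pr = trans (sym (not-involutive (par r))) (cong not (trans (sym (Broken.odd br)) (trans (par-nb zero b (push s)) (cong not (trans (par-push s) es)))))
      ... | e , gc with steer true (up₂ true a) (nb zero true s) (trans (par-nb zero e r) (cong not pr)) ey (far true) (λ h → far false (trans (sym (tw-nb true s)) h)) (inners _) (kX _)
        where
        pr : par r ≡ false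
        pr = trans (sym (not-involutive (par r))) (cong not (trans (sym (Broken.odd br)) (trans (par-nb zero b (push s)) (cong not (trans (par-push s) es)))))
        -- If the two arrivals in the opposite copy agreed, `r` would be `s` or its twin, and `s`
        -- would be adjacent to a crossing neighbour of `push s`.
        far : ∀ c → ¬ nb zero c s ≡ nb zero e r
        far c h with same-tail c e s r (trans es (sym pr)) h
        ... | inj₁ refl = push-nonadj s b es (adj-nbrs (Broken.adj br))
        ... | inj₂ refl = push-nonadj s b es (nbrs-tw {x = s} (adj-nbrs (Broken.adj br)))
      ... | c' , r₂ , ec' , br₂ , nr₂ with t-of c' ec'
      ... | b' , refl with exit false (up₂ true a) r₂ pr₂ nr₂ | exit true a z₂ par-z₂ free-z₂
        where
        open Opening o
        pr₂ : par r₂ ≡ false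
        pr₂ = trans (sym (not-involutive (par r₂))) (cong not (trans (sym (Broken.odd br₂)) (trans (par-nb zero b' s) (cong not es))))
      ... | f , gf , ef | g , gg , eg with splitB (Opening.brk o) | splitB br | splitB br₂
      ... | split f₁ f₂ P₁ P₂ sP | split g₁ g₂ Q₁ Q₂ sQ | split h₁ h₂ R₁ R₂ sR = finish whole
        where
        open Opening o
        whole = P₁ ⟨ out ⟩ Q₁ ⟨ subst (λ k → G (up₃ true a , r) (k , nb zero e r)) (down₃ a) gc ⟩ R₁ ⟨ subst (λ k → G (up₂ true a , r₂) (k , f)) (down₂ a) gf ⟩
          segPiece (liftHP (up true a) (LC (up true a) ef eg)) ⟨ G-sym gg ⟩ P₂ ⟨ clean-edge a (trans (par-push s) es) cy b ⟩ Q₂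
          ⟨ subst (λ k → G (up₃ true a , s) (k , nb zero b' s)) (up₃₃ a) (clean-edge (up₃ true a) es cs b') ⟩ R₂
        finish : Piece (a , x) (up₂ true a , y) _ → HPR F (a , x) (up₂ true a , y)
        finish (piece l q cov) = l , q , λ w → trans (cov w) (trans (lem (f₁ w) (g₁ w) (h₁ w) (f₂ w) (g₂ w) (h₂ w) (O4.same (proj₁ w) (up true a)))
          (trans (cong₂ _+_ (sP w) (cong (O4.same (proj₁ w) (up true a) +_) (cong₂ (λ s t → s + (t + 0)) (sR w) (sQ w)))) (others-cover true a (proj₁ w))))
          where
          lem : ∀ f₁ g₁ h₁ f₂ g₂ h₂ s₁ → f₁ + (g₁ + (h₁ + ((s₁ + 0) + (f₂ + (g₂ + h₂))))) ≡ (f₁ + f₂) + (s₁ + ((h₁ + h₂) + ((g₁ + g₂) + 0)))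
          lem = solve-∀

      laceRing : ∀ {u v} → parR u ≡ true → parR v ≡ false → HPR F u v
      laceRing {a , x} {c , y} ex ey with four-copies true a c
      ... | inj₁ refl = inCopy (LC a ex ey) (λ {d} → chainL d a (LC _) (LC _) (LC _))
      ... | inj₂ (inj₂ (inj₁ refl)) = rel₂ a ex ey
      ... | inj₂ (inj₂ (inj₂ refl)) = rel₃ a ex ey
      ... | inj₂ (inj₁ refl) with levelEdge true (up₃ true a)
      ... | q , z , eq , ez , g = crossing true a (LC a ex ez) (subst (λ k → G (up₃ true a , q) (k , z)) (up₄ true a) g) (chainL true a (LC _) (LC _) (LC _) ey eq)

    -- Rings with one copy that has many faults.

    module Robust (uniq : Unique F) (cond : Cond (suc m)) where

      I : Fin 4 → List (E (2 + m))
      I k = inner k F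

      U : ∀ k → Unique (I k)
      U k = inner-Unique k uniq

      -- What is used of a copy with many faults: paths that can be left and re-entered through two adjacent unblocked vertices.
      Through : Fin 4 → V → V → Set
      Through s u v = ∃[ r ] ∃[ t ] (Broken s u r t v × ¬ Blocked (s , r) × ¬ Blocked (s , t))

      Ends : Fin 4 → Set
      Ends s = ∃[ x ] ∃[ y ] (par x ≡ true × par y ≡ false × HP (I s) x y × ¬ Blocked (s , x) × ¬ Blocked (s , y))

      record Semi (s : Fin 4) : Set where
        field
          through : ∀ {u v} → par u ≡ true → par v ≡ false → Adj u v → ¬ InL (I s) u v → Through s u v
          ends : Ends s

      pairD : ∀ {s} → Ends s → ∀ d → ∃[ y ] ∃[ x ] Pair s d y x
      pairD (x , y , ex , ey , h , nx , ny) true = y , x , ey , ex , HP-sym h , ny , nx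
      pairD (x , y , ex , ey , h , nx , ny) false = x , y , ex , ey , h , nx , ny

      semi₀ : ∀ s → (∀ x → 2 ≤ deg (I s) x) → length (I s) < 4 * suc m → Semi s
      semi₀ s hd hl = record { through = λ eu ev a _ → breakGood s (cond-elim cond (I s) (canonI s) (U s) hl hd eu ev a) ; ends = ends }
        where
        ends : Ends s
        ends with breakGood s (cond-elim cond (I s) (canonI s) (U s) hl hd {#0 ∷ Data.Vec.replicate _ #0} {#1 ∷ Data.Vec.replicate _ #0} refl refl (inj₁ refl , inj₁ refl))
          where import Data.Vec
        ... | r , t , b , nr , nt = go (par r) refl
          where
          go : ∀ d → par r ≡ d → Ends s
          go true er = r , t , er , trans (Broken.odd b) (cong not er) , cond-elim cond (I s) (canonI s) (U s) hl hd er (trans (Broken.odd b) (cong not er)) (Broken.adj b) , nr , nt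
          go false er = t , r , trans (Broken.odd b) (cong not er) , er , cond-elim cond (I s) (canonI s) (U s) hl hd (trans (Broken.odd b) (cong not er)) er (adj-sym (Broken.adj b)) , nt , nr

      -- The fault between `w` and `y` is treated as good. If the path uses it, this is where the
      -- path is opened, which is possible because `w` and `y` are unblocked.
      semi₁ : ∀ s w y → Adj w y → par w ≡ true → ¬ Blocked (s , w) → ¬ Blocked (s , y) →
        (∀ x → 2 ≤ deg (without (edge w y) (I s)) x) → length (without (edge w y) (I s)) < 4 * suc m → Semi s
      semi₁ s w y a ew nw ny hd hl = record { through = through ; ends = w , y , ew , ey , ends , nw , ny }
        where
        ey : par y ≡ false
        ey = trans (adj-par a) (cong not ew)
        F' = without (edge w y) (I s)
        solve : ∀ {u v} → par u ≡ true → par v ≡ false → Adj u v → HP F' u v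
        solve = cond-elim cond F' (without-canon (canonI s)) (without-Unique (U s)) hl hd
        -- A Hamiltonian path between the ends of the restored fault cannot use it.
        ends : HP (I s) w y
        ends with solve ew ey a
        ... | l , p , f = l , closeH (canonI s) refl (≤-trans (≤-trans (s≤s (s≤s (s≤s z≤n))) (4*-lower m)) (full-length l f)) (OV.Full-Unique l f) p , f
        unbl : ∀ {r t} → edge r t ≡ edge w y → ¬ Blocked (s , r) × ¬ Blocked (s , t)
        unbl {r} {t} e with edge-ends r t w y e
        ... | inj₁ (refl , refl) = nw , ny
        ... | inj₂ (refl , refl) = ny , nw
        through : ∀ {u v} → par u ≡ true → par v ≡ false → Adj u v → ¬ InL (I s) u v → Through s u v
        through eu ev a' _ with solve eu ev a'
        ... | l , p , f with useH (canonI s) (OV.Full-Unique l f) p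
        ... | inj₁ q = breakGood s (l , q , f)
        ... | inj₂ c = HCut.r c , HCut.t c , broken (HCut.l₁ c) (HCut.l₂ c) (HCut.left c) (HCut.right c) (subst OV.Full (HCut.eq c) f) (HCut.adj c) ,
                       proj₁ (unbl (HCut.is c)) , proj₂ (unbl (HCut.is c))

      badN-length : ∀ s x → length (badN (I s) x) ≤ length (I s)
      badN-length s x = subst (_≤ length (I s)) (length-map (edge x) (badN (I s) x)) (⊆-length (star-Unique (I s) x) (star-⊆ (canonI s)))

      badN-many : ∀ s {x} → deg (I s) x ≤ 1 → 3 + (m + m) ≤ length (badN (I s) x)
      badN-many s {x} h = +-cancelʳ-≤ 1 _ _ (≤-trans (≤-reflexive (trans (lem m) (sym (deg-bad (I s) x)))) (+-monoʳ-≤ _ h))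
        where
        lem : ∀ m → 3 + (m + m) + 1 ≡ (2 + m) + (2 + m)
        lem = solve-∀

      allBlocked : ∀ k (zs : List V) → Unique zs → (∀ {z} → z ∈ zs → ¬ ¬ Blocked (k , z)) → length zs + length zs ≤ cnt isX F
      allBlocked k zs u h = crossCount can k zs u (λ {z} i → decidable-stable (Blocked? (k , z)) (h i))

      -- Restoring one fault is enough to apply `Cond`: a fault at the only vertex of degree one if
      -- there is such a vertex, or else, if the copy has exactly 4(m+1) faults, any fault with
      -- unblocked ends.
      semi : ∀ s → length (I s) ≤ 4 * suc m → (∀ x → 1 ≤ deg (I s) x) → (∀ x → Blocked (s , x) → 2 ≤ deg (I s) x) → Semi s
      semi s hl h₁ hb with search (λ x → deg (I s) x ≤? 1) (allV (2 + m))
      ... | inj₁ (w , _ , hw) with search (λ y → ¬? (Blocked? (s , y))) (badN (I s) w)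
      -- If all of the at least 2m+3 faulty neighbours of `w` were blocked, they would cost twice as
      -- many crossing faults, in addition to the faults at `w`.
      ... | inj₂ none = ⊥-elim (1+n≰n (≤-trans small (≤-trans (m≤m+n _ (1 + (m + m))) (≤-trans (≤-reflexive (lem m)) (≤-trans (+-mono-≤ big (+-mono-≤ big big)) (≤-trans (+-mono-≤ (badN-length s w) (allBlocked s _ (badN-Unique (I s) w) none)) (inn-X s F)))))))
        where
        big = badN-many s hw
        lem : ∀ m → 4 * (2 + m) + (1 + (m + m)) ≡ (3 + (m + m)) + ((3 + (m + m)) + (3 + (m + m)))
        lem = solve-∀
      ... | inj₁ (y , i , ny) = go (par w) refl
        where
        a : Adj w y
        a = proj₁ (badN-∈ {F = I s} i)
        nw : ¬ Blocked (s , w)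
        nw b = 1+n≰n (≤-trans (hb w b) hw)
        F' = without (edge w y) (I s)
        in-F : edge w y ∈ I s
        in-F = edge-∈ (canonI s) (adj-par a) (proj₂ (badN-∈ {F = I s} i))
        hl' : length F' < 4 * suc m
        hl' = ≤-trans (without-length (U s) in-F) hl
        hd : ∀ x → 2 ≤ deg F' x
        hd x with x ≟ⱽ w
        ... | yes refl = ≤-trans (s≤s (h₁ w)) (⊆-length (All-∉ _ (λ j → proj₂ (goodN-∈ {F = I s} j) (proj₂ (badN-∈ {F = I s} i))) ∷ goodN-Unique (I s) w) sub)
          where
          sub : ∀ {z} → z ∈ y ∷ goodN (I s) w → z ∈ goodN F' w
          sub (here refl) = ∈-goodN {F = F'} (a , λ f → without-∉ {h = edge w y} {I s} (edge-∈ (without-canon (canonI s)) (adj-par a) f))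
          sub (there j) = ∈-goodN {F = F'} (proj₁ (goodN-∈ {F = I s} j) , λ f → proj₂ (goodN-∈ {F = I s} j) (without-InL f))
        ... | no ne with 2 ≤? deg F' x
        ... | yes h = h
        -- Two vertices with 2m+3 faults each require 4m+5 faults, since their stars share at most
        -- one edge.
        ... | no nh = ⊥-elim (1+n≰n (≤-trans (≤-trans (≤-reflexive (lem m)) (+-mono-≤ (badN-many s hw) (badN-many s hx))) (≤-trans (two-stars (canonI s) x w ne) (s≤s hl))))
          where
          hx : deg (I s) x ≤ 1
          hx = ≤-trans (deg-mono {F = I s} {F'} x without-InL) (≤-pred (≰⇒> nh))
          lem : ∀ m → suc (suc (4 * suc m)) ≡ (3 + (m + m)) + (3 + (m + m))
          lem = solve-∀
        go : ∀ d → par w ≡ d → Semi s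
        go true ew = semi₁ s w y a ew nw ny hd hl'
        go false ew = subst (λ h → (∀ x → 2 ≤ deg (without h (I s)) x) → length (without h (I s)) < 4 * suc m → Semi s) sw
          (semi₁ s y w (adj-sym a) ey ny nw) hd hl'
          where
          ey : par y ≡ true
          ey = trans (adj-par a) (cong not ew)
          sw : edge y w ≡ edge w y
          sw = trans (cong (λ c → if c then (y , w) else (w , y)) ey) (sym (cong (λ c → if c then (w , y) else (y , w)) ew))
      semi s hl h₁ hb | inj₂ none with m≤n⇒m<n∨m≡n hl
      ... | inj₁ lt = semi₀ s (λ x → ≰⇒> (none (allV-∈ x))) lt
      ... | inj₂ eq with search (λ r → ¬? (Blocked? (s , proj₁ r)) ×-dec ¬? (Blocked? (s , proj₂ r))) (I s)
      ... | inj₁ ((w , y) , i , nw , ny) = semi₁ s w y (proj₂ (canonI s i)) ew nw ny (λ x → ≤-trans (≰⇒> (none (allV-∈ x))) (deg-mono {F = I s} {without (edge w y) (I s)} x without-InL))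
            (≤-trans (without-length (U s) (subst (_∈ I s) (sym (cong (λ c → if c then (w , y) else (y , w)) ew)) i)) hl)
        where
        ew : par w ≡ true
        ew = proj₁ (canonI s i)
      -- With at most three crossing faults there is only one blocked vertex `z`, so every fault is
      -- incident with it. As `z` keeps two good edges inside the copy, it cannot carry 4(m+1)
      -- faults.
      ... | inj₂ allb = ⊥-elim (noFault (I s) refl)
        where
        X≤3 : cnt isX F ≤ 3
        X≤3 = +-cancelˡ-≤ (4 * suc m) _ _ (≤-trans (≤-reflexive (cong (_+ cnt isX F) (sym eq))) (≤-trans (inn-X s F) (≤-pred (≤-trans small (≤-reflexive (lem m))))))
          where
          lem : ∀ m → 4 * (2 + m) ≡ suc (4 * suc m + 3)
          lem = solve-∀
        At : V → E (2 + m) → Set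
        At z r = proj₁ r ≡ z ⊎ proj₂ r ≡ z
        hit : ∀ {r} → r ∈ I s → ∃[ z ] (At z r × Blocked (s , z))
        hit {r} i with Blocked? (s , proj₁ r) | Blocked? (s , proj₂ r)
        ... | yes b | _ = proj₁ r , inj₁ refl , b
        ... | no _ | yes b = proj₂ r , inj₂ refl , b
        ... | no a | no b = ⊥-elim (allb i (a , b))
        noFault : ∀ l → I s ≡ l → ⊥
        noFault [] e with trans (sym eq) (cong length e)
        ... | ()
        noFault (r ∷ l) e with hit (subst (r ∈_) (sym e) (here refl))
        ... | z , _ , bz = 1+n≰n (≤-trans small' (≤-trans (⊆-length (U s) sub) (≤-reflexive (length-map (edge z) (badN (I s) z)))))
          where
          same-z : ∀ {r'} → r' ∈ I s → At z r'
          same-z {r'} i with hit i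
          ... | z' , at , bz' with z' ≟ⱽ z
          ... | yes refl = at
          ... | no ne = ⊥-elim (1+n≰n (≤-trans (crossCount can s (z' ∷ z ∷ []) ((ne ∷ []) ∷ ([] ∷ [])) (λ { (here refl) → bz' ; (there (here refl)) → bz })) X≤3))
          sub : ∀ {r'} → r' ∈ I s → r' ∈ star (I s) z
          sub {p , q} i with same-z i | canonI s i
          ... | inj₁ refl | ep , a = subst (_∈ star (I s) p) (cong (λ c → if c then (p , q) else (q , p)) ep) (∈-map⁺ (edge p) (∈-badN {F = I s} a (inj₁ i)))
          ... | inj₂ refl | ep , a = subst (_∈ star (I s) q) (cong (λ c → if c then (q , p) else (p , q)) (trans (adj-par a) (cong not ep))) (∈-map⁺ (edge q) (∈-badN {F = I s} (adj-sym a) (inj₂ i)))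
          small' : suc (length (badN (I s) z)) ≤ length (I s)
          small' = +-cancelʳ-≤ 2 _ _ (≤-trans (≤-trans (s≤s (+-monoʳ-≤ (length (badN (I s) z)) (hb z bz))) (s≤s (≤-reflexive (deg-bad (I s) z)))) (≤-trans (m≤m+n _ (1 + (m + m))) (≤-reflexive (trans (lem m) (cong (_+ 2) (sym eq))))))
            where
            lem : ∀ m → suc ((2 + m) + (2 + m)) + (1 + (m + m)) ≡ 4 * suc m + 2
            lem = solve-∀

      blocked-par : ∀ {a x d} → par x ≡ d → ∀ {z} → z ∈ blockedNbrs a x → par z ≡ not d
      blocked-par {a} {x} e i = trans (adj-par (nbrs-adj (proj₁ (∈-sel⁻ (λ y → Blocked? (a , y)) {l = nbrs x} i)))) (cong not e)

      few-blocked : ∀ a x → length (I a) + cnt isX F ≤ 2 + L → ¬ length (I a) + length (blockedNbrs a x) ≤ L → length (blockedNbrs a x) ≤ 1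
      few-blocked a x hx nle = +-cancelˡ-≤ (suc L) _ _ (≤-trans (+-monoˡ-≤ (length (blockedNbrs a x)) (≰⇒> nle)) (≤-trans (≤-reflexive (+-assoc (length (I a)) _ _))
        (≤-trans (+-monoʳ-≤ (length (I a)) (blockedNbrs-X a x)) (≤-trans hx (≤-reflexive (sym (+-comm (suc L) 1)))))))

      -- The path of copy `a` is opened so that one side meets the prescribed end `y` of the special
      -- path in the next copy, while the other side leaves in the opposite direction.
      record Pass (d : Bool) (a : Fin 4) (u v y : V) : Set where
        field
          x y' : V
          par-x : par x ≡ d
          par-y' : par y' ≡ not d
          out : G (a , x) (up d a , y)
          free : ¬ Blocked (a , y')
          brk : Broken a u x y' v ⊎ Broken a u y' x v

      Gr : Bool → Fin 4 → V → V → Set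
      Gr d a x y = G (a , x) (up d a , y)

      -- `x` is an inner vertex of the path. Either all its blocked neighbours can be avoided, or at
      -- most one neighbour is blocked and one of its two neighbours on the path is free.
      passA : ∀ d a {u v y} x → par u ≡ true → par v ≡ false → length (I a) ≤ L → length (I a) + cnt isX F ≤ 2 + L →
        par x ≡ d → Gr d a x y → ¬ x ≡ (if d then u else v) → Pass d a u v y
      passA d a {u} {v} {y} x eu ev hf hx ex g ne with length (I a) + length (blockedNbrs a x) ≤? L
      ... | yes le with avoid a x true le eu ev
      ... | l , p , f with cutBefore p (OV.Full-∈ l f x) (x≢u d ex ne)
        where
        x≢u : ∀ d → par x ≡ d → ¬ x ≡ (if d then u else v) → ¬ x ≡ u
        x≢u true _ h = h
        x≢u false e _ refl = true≢false (trans (sym eu) e)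
      ... | r , c = record { x = x ; y' = r ; par-x = ex ; par-y' = trans (adj-par (adj-sym (proj₁ (Cut.edge c)))) (cong not ex) ; out = g
                           ; free = avoid-free {a} {x} (adjF-sym (Cut.edge c)) ; brk = inj₂ (cutAvoid {a} {x} {l = l} c f) }
      passA d a {u} {v} {y} x eu ev hf hx ex g ne | no nle with lacy a hf eu ev
      ... | l , p , f with cutBoth (OV.Full-Unique l f) p (OV.Full-∈ l f x) (x≢u d ex ne) (x≢v d ex ne)
        where
        x≢u : ∀ d → par x ≡ d → ¬ x ≡ (if d then u else v) → ¬ x ≡ u
        x≢u true _ h = h
        x≢u false e _ refl = true≢false (trans (sym eu) e)
        x≢v : ∀ d → par x ≡ d → ¬ x ≡ (if d then u else v) → ¬ x ≡ v
        x≢v false _ h = h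
        x≢v true e _ refl = true≢false (trans (sym e) ev)
      ... | r , r' , c , c' , r≢ with Blocked? (a , r) | Blocked? (a , r')
      ... | no h | _ = record { x = x ; y' = r ; par-x = ex ; par-y' = trans (adj-par (adj-sym (proj₁ (Cut.edge c)))) (cong not ex) ; out = g
                           ; free = h ; brk = inj₂ (cutBroken {l = l} c f) }
      ... | yes _ | no h = record { x = x ; y' = r' ; par-x = ex ; par-y' = trans (adj-par (proj₁ (Cut.edge c'))) (cong not ex) ; out = g
                           ; free = h ; brk = inj₁ (cutBroken {l = l} c' f) }
      ... | yes b | yes b' = ⊥-elim (1+n≰n (≤-trans two (few-blocked a x hx nle)))
        where
        in-B : ∀ {z} → z ∈ r ∷ r' ∷ [] → z ∈ blockedNbrs a x
        in-B (here refl) = ∈-sel⁺ (λ y → Blocked? (a , y)) (adj-nbrs (adj-sym (proj₁ (Cut.edge c)))) b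
        in-B (there (here refl)) = ∈-sel⁺ (λ y → Blocked? (a , y)) (adj-nbrs (proj₁ (Cut.edge c'))) b'
        two : 2 ≤ length (blockedNbrs a x)
        two = ⊆-length ((r≢ ∷ []) ∷ ([] ∷ [])) in-B

      -- Here `y` is reached from an end of the path, which has only one neighbour on it. In return,
      -- the other crossing edge of `y` is a further crossing fault, and this leaves room to avoid
      -- all blocked neighbours of that end.
      passB : ∀ d a {u v y} x₂ → par u ≡ true → par v ≡ false → length (I a) ≤ L → length (I a) + cnt isX F ≤ 2 + L →
        Gr d a (if d then u else v) y → par x₂ ≡ d → par y ≡ not d → InL F (a , x₂) (up d a , y) → Pass d a u v y
      passB d a {u} {v} {y} x₂ eu ev hf hx g e₂ ey bad = go d (λ { refl → refl }) refl
        where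
        w = if d then u else v
        pw : ∀ d → par (if d then u else v) ≡ d
        pw true = eu
        pw false = ev
        B = blockedNbrs a w
        le : length (I a) + length B ≤ L
        le with length B in eB
        ... | zero = ≤-trans (≤-reflexive (+-identityʳ _)) hf
        -- From |I| + 1 + 2|B| ≤ L + 2 and |B| ≥ 1 follows |I| + |B| ≤ L.
        ... | suc b = +-cancelˡ-≤ 2 _ _ (≤-trans (m≤m+n _ b) (≤-trans (≤-reflexive (lem (length (I a)) b)) (≤-trans (+-monoʳ-≤ (length (I a)) (subst (λ c → suc (c + c) ≤ cnt isX F) eB
            (crossCount⁺ can d a B (sel-Unique (λ y → Blocked? (a , y)) (nbrs-Unique w)) (λ i → proj₂ (∈-sel⁻ (λ y → Blocked? (a , y)) {l = nbrs w} i)) (blocked-par (pw d)) e₂ ey bad))) hx)))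
          where
          lem : ∀ f b → 2 + (f + suc b) + b ≡ f + suc (suc b + suc b)
          lem = solve-∀
        u≢v : ¬ u ≡ v
        u≢v refl = true≢false (trans (sym eu) ev)
        go : ∀ d' → (d' ≡ d → d' ≡ d) → d' ≡ d → Pass d a u v y
        go true _ refl with avoid a u true le eu ev
        ... | l , p , f with cutAfter p (OV.Full-∈ l f u) u≢v
        ... | r , c = record { x = u ; y' = r ; par-x = eu ; par-y' = trans (adj-par (proj₁ (Cut.edge c))) (cong not eu) ; out = g
                           ; free = avoid-free {a} {u} (Cut.edge c) ; brk = inj₁ (cutAvoid {a} {u} {l = l} c f) }
        go false _ refl with avoid a v true le eu ev
        ... | l , p , f with cutBefore p (OV.Full-∈ l f v) (u≢v ∘ sym)
        ... | r , c = record { x = v ; y' = r ; par-x = ev ; par-y' = trans (adj-par (adj-sym (proj₁ (Cut.edge c)))) (cong not ev) ; out = g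
                           ; free = avoid-free {a} {v} (adjF-sym (Cut.edge c)) ; brk = inj₂ (cutAvoid {a} {v} {l = l} c f) }

      back-edge : ∀ d a y b → par y ≡ not d → ¬ InL F (up d a , y) (a , nb zero b y) → Gr d a (nb zero b y) y
      back-edge d a y b ey h = G-sym (subst (λ k → RAdj (up d a , y) (k , nb zero b y)) (trans (cong (λ c → up c (up d a)) ey) (up-up d a)) (adj-cr b (up d a , y)) , h)

      par-back : ∀ d (y : V) b → par y ≡ not d → par (nb zero b y) ≡ d
      par-back d y b ey = trans (par-nb zero b y) (trans (cong not ey) (not-involutive d))

      pass : ∀ d a {u v y} → par u ≡ true → par v ≡ false → length (I a) ≤ L → length (I a) + cnt isX F ≤ 2 + L →
        par y ≡ not d → ¬ Blocked (up d a , y) → Pass d a u v y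
      pass d a {u} {v} {y} eu ev hf hx ey ny with InLR? F (up d a , y) (a , nb zero true y) | InLR? F (up d a , y) (a , nb zero false y)
      ... | yes i | yes j = ⊥-elim (ny (subst (λ k → InL F (up d a , y) (k , nb zero true y)) back≡ i , subst (λ k → InL F (up d a , y) (k , nb zero false y)) back≡ j))
        where
        back≡ : a ≡ up (par y) (up d a)
        back≡ = sym (trans (cong (λ c → up c (up d a)) ey) (up-up d a))
      ... | no h | yes j with nb zero true y ≟ⱽ (if d then u else v)
      ... | no ne = passA d a _ eu ev hf hx (par-back d y true ey) (back-edge d a y true ey h) ne
      ... | yes e = passB d a (nb zero false y) eu ev hf hx (subst (λ x → Gr d a x y) e (back-edge d a y true ey h)) (par-back d y false ey) ey (InL-sym j)
      pass d a {u} {v} {y} eu ev hf hx ey ny | yes i | no h with nb zero false y ≟ⱽ (if d then u else v)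
      ... | no ne = passA d a _ eu ev hf hx (par-back d y false ey) (back-edge d a y false ey h) ne
      ... | yes e = passB d a (nb zero true y) eu ev hf hx (subst (λ x → Gr d a x y) e (back-edge d a y false ey h)) (par-back d y true ey) ey (InL-sym i)
      pass d a {u} {v} {y} eu ev hf hx ey ny | no h | no h' with nb zero true y ≟ⱽ (if d then u else v)
      ... | no ne = passA d a _ eu ev hf hx (par-back d y true ey) (back-edge d a y true ey h) ne
      ... | yes e = passA d a _ eu ev hf hx (par-back d y false ey) (back-edge d a y false ey h') (λ e' → twins (trans e (sym e')))
        where
        twins : ¬ nb zero true y ≡ nb zero false y
        twins e with proj₂ (nb-inj zero zero true false y e)
        ... | ()

      module Build (s : Fin 4) (hs : L < length (I s)) (small-others : ∀ k → ¬ k ≡ s → length (I k) ≤ L) where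

        LC : ∀ {k} → ¬ k ≡ s → LaceC k
        LC {k} h = lacy k (small-others k h)

        -- Of at most 4m+7 faults the special copy takes 2m+3; the rest fits the budget required by
        -- `pass`.
        outside : ∀ a → ¬ a ≡ s → length (I a) + cnt isX F ≤ 2 + L
        outside a h = +-cancelˡ-≤ (suc L) _ _ (≤-trans (+-monoˡ-≤ _ hs) (≤-trans (≤-reflexive (lem₁ (length (I s)) (length (I a)) (cnt isX F)))
          (≤-trans (inn-inn-X a s F h) (≤-pred (≤-trans small (≤-reflexive (lem₂ m)))))))
          where
          lem₁ : ∀ s a x → s + (a + x) ≡ a + (s + x)
          lem₁ = solve-∀
          lem₂ : ∀ m → 4 * (2 + m) ≡ suc (suc (suc m + suc m) + (2 + (suc m + suc m)))
          lem₂ = solve-∀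

        -- The special copy directly follows `a` and offers only one path, so that the crossing from
        -- `a` must end at a prescribed vertex; this is what `pass` provides.
        next : ∀ d a → up d a ≡ s → Ends s → ∀ {u v} → par u ≡ true → par v ≡ false → HPR F (a , u) (a , v)
        next d a refl S {u} {v} eu ev with pairD S d
        ... | y , x , ey , ex , h , ny , nx with pass d a {u} {v} eu ev (small-others a a≢) (outside a a≢) ey ny
          where
          a≢ : ¬ a ≡ up d a
          a≢ e = up-≢ d a (sym e)
        ... | P with exit₃ d a (Pass.y' P) (Pass.par-y' P) (Pass.free P)
        ... | q , g , eq with chain₁ d a h ex nx (LC (up-≢ d (up d a))) (LC (up₂-≢ d (up d a))) eq | Pass.brk P
        ... | c | inj₁ b = insert b (Pass.out P) c (G-sym g) (others-cover d a)
        ... | c | inj₂ b = insert b g (revSeg c) (G-sym (Pass.out P)) (others-cover d a)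

        buildIn : ∀ a {u v} → par u ≡ true → par v ≡ false → (a ≡ s → Through s u v) → (¬ a ≡ s → Ends s) → HPR F (a , u) (a , v)
        buildIn a {u} {v} eu ev thr ends with four-copies true a s
        ... | inj₁ refl with thr refl
        ... | r , t , b , nr , nt = insertChain b nr nt (chainL (par r) a (LC (up-≢ (par r) a)) (LC (up₂-≢ (par r) a)) (LC (up₃-≢ (par r) a)))
        buildIn a {u} {v} eu ev thr ends | inj₂ (inj₁ e) = next true a (sym e) (ends (λ e' → up-≢ true a (trans (sym e) (sym e')))) eu ev
        buildIn a {u} {v} eu ev thr ends | inj₂ (inj₂ (inj₂ e)) = next false a (trans (down-up₃ true a) (sym e)) (ends (λ e' → up₃-≢ true a (trans (sym e) (sym e')))) eu ev
        buildIn a {u} {v} eu ev thr ends | inj₂ (inj₂ (inj₁ refl)) = inCopy (LC (λ e → up₂-≢ true a (sym e)) eu ev) ch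
          where
          S : Ends (up₂ true a)
          S = ends (λ e → up₂-≢ true a (sym e))
          opp : ∀ d → up₂ d a ≡ up₂ true a
          opp true = refl
          opp false = dd a
            where
            dd : ∀ a → up₂ false a ≡ up₂ true a
            dd #0 = refl
            dd #1 = refl
            dd #2 = refl
            dd #3 = refl
          ch : ∀ {d p q} → par p ≡ not d → par q ≡ d → Chain d a p q
          ch {d} ep eq with pairD S d
          ... | y , x , P = chain₂ d a (LC (λ e → up-≢ d (up d a) (trans (opp d) (sym e)))) (subst (λ k → Pair k d y x) (sym (opp d)) P) (LC (λ e → up-≢ d (up₂ d a) (trans e (sym (opp d))))) ep eq

      allLace : (∀ k → length (I k) ≤ L) → ∀ a {u v} → par u ≡ true → par v ≡ false → HPR F (a , u) (a , v)
      allLace h a eu ev = inCopy (lacy a (h a) eu ev) (λ {d} → chainL d a (lacy _ (h _)) (lacy _ (h _)) (lacy _ (h _)))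

      allLaceCross : (∀ k → length (I k) ≤ L) → ∀ a {u v} → par u ≡ true → par v ≡ false → HPR F (a , u) (up true a , v)
      allLaceCross h a {u} {v} eu ev with levelEdge true (up₃ true a)
      ... | q , z , eq , ez , g = crossing true a (lacy a (h a) eu ez) (subst (λ k → G (up₃ true a , q) (k , z)) (up₄ true a) g)
            (chainL true a (lacy _ (h _)) (lacy _ (h _)) (lacy _ (h _)) ev eq)

      -- With the ends of the edge in consecutive copies no path is opened, so nothing would hide a
      -- restored fault: `Cond` is applied to all faults of the special copy. When an end of the
      -- edge lies in it, the path runs from there to an unblocked neighbour.
      module BuildCross (s : Fin 4) (hd : ∀ x → 2 ≤ deg (I s) x) (hl : length (I s) < 4 * suc m) (small-others : ∀ k → ¬ k ≡ s → length (I k) ≤ L) where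

        LC : ∀ {k} → ¬ k ≡ s → LaceC k
        LC {k} h = lacy k (small-others k h)

        solve : ∀ {u v} → par u ≡ true → par v ≡ false → Adj u v → HP (I s) u v
        solve = cond-elim cond (I s) (canonI s) (U s) hl hd

        freeNbr : ∀ u → ∃[ z ] (Adj u z × ¬ Blocked (s , z))
        freeNbr u with search (λ z → ¬? (Blocked? (s , z))) (nbrs u)
        ... | inj₁ (z , i , h) = z , nbrs-adj i , h
        ... | inj₂ h = ⊥-elim (1+n≰n (≤-trans small (≤-trans (≤-reflexive (lem m)) (≤-trans (≤-reflexive (sym (cong (λ k → k + k) (nbrs-length u)))) (≤-trans (allBlocked s (nbrs u) (nbrs-Unique u) h) X≤F)))))
          where
          lem : ∀ m → 4 * (2 + m) ≡ ((2 + m) + (2 + m)) + ((2 + m) + (2 + m))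
          lem = solve-∀

        cross : ∀ a {u v} → par u ≡ true → par v ≡ false → HPR F (a , u) (up true a , v)
        cross a {u} {v} eu ev with four-copies true a s
        ... | inj₁ refl with freeNbr u
        ... | z , adj , nz with exit₃ true a z (trans (adj-par adj) (cong not eu)) nz
        ... | q , g , eq = crossing true a (solve eu (trans (adj-par adj) (cong not eu)) adj) (G-sym g)
              (chainL true a (LC (up-≢ true a)) (LC (up₂-≢ true a)) (LC (up₃-≢ true a)) ev eq)
        cross a {u} {v} eu ev | inj₂ (inj₁ refl) with freeNbr v | levelEdge true (up₃ true a)
        ... | x , adj , nx | q , z , eq , ez , g = crossing true a (LC (λ e → up-≢ true a (sym e)) eu ez) (subst (λ k → G (up₃ true a , q) (k , z)) (up₄ true a) g)
              (chain₁ true a (HP-sym (solve ex ev (adj-sym adj))) ex nx (LC (up-≢ true (up true a))) (LC (up₂-≢ true (up true a))) eq)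
          where
          ex : par x ≡ true
          ex = trans (adj-par adj) (cong not ev)
        cross a {u} {v} eu ev | inj₂ (inj₂ (inj₁ refl)) with pairD (Semi.ends (semi₀ s hd hl)) true | levelEdge true (up₃ true a)
        ... | y , x , P | q , z , eq , ez , g = crossing true a (LC (λ e → up₂-≢ true a (sym e)) eu ez) (subst (λ k → G (up₃ true a , q) (k , z)) (up₄ true a) g)
              (chain₂ true a (LC (λ e → up-≢ true (up true a) (sym e))) P (LC (up-≢ true (up₂ true a))) ev eq)
        cross a {u} {v} eu ev | inj₂ (inj₂ (inj₂ refl)) with pairD (Semi.ends (semi₀ s hd hl)) true
        ... | y , x , ey , ex , h , ny , nx with exit true (up₃ true a) x ex nx
        ... | z , g , ez = crossing true a (LC (λ e → up₃-≢ true a (sym e)) eu ez) (subst (λ k → G (up₃ true a , x) (k , z)) (up₄ true a) g)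
              (chain₃ true a (LC (λ e → up₂-≢ true (up true a) (sym e))) (LC (λ e → up-≢ true (up₂ true a) (sym e))) ey h ny ev)

-- Choice of the dimension in the laceable case.

-- A dimension with two faults leaves at most 2(m+1) to each copy, which is the bound of the
-- induction hypothesis.
laceable-step : ∀ m → Lace (suc m) → Laceable (suc (suc m))
laceable-step m lace F can len {x} {y} ex ey = byDim (proj₁ good) (proj₂ good)
  where
  L = suc m + suc m
  len' : length F ≤ 2 + L
  len' = ≤-trans len (≤-reflexive (lem m))
    where
    lem : ∀ m → suc (suc m) + suc (suc m) ≡ 2 + (suc m + suc m)
    lem = solve-∀
  good : ∃[ i ] ∀ k → length (inner k (FR i F)) ≤ L
  good with pick (λ i → 2 ≤? dimCount F i)
  ... | inj₁ (i , h) = i , λ k → +-cancelʳ-≤ 2 _ _ (≤-trans (+-monoʳ-≤ _ h) (≤-trans (copy-dim F i k) (≤-trans len' (≤-reflexive (+-comm 2 L)))))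
  -- Now every dimension has at most one fault, so there are at most m+3 in all, and one crossing
  -- fault is enough.
  ... | inj₂ h with pick (λ i → 1 ≤? dimCount F i)
  ... | inj₁ (i , h') = i , λ k → +-cancelʳ-≤ 1 _ _ (≤-trans (+-monoʳ-≤ _ h') (≤-trans (copy-dim F i k) (≤-trans (dims-lower F can)
        (≤-trans (sumW-const 1 (dimCount F) (fins (3 + m)) (λ {i} _ → ≤-pred (≰⇒> (h i)))) (≤-trans (≤-reflexive (cong (_* 1) (fins-length (3 + m)))) (≤-trans (m≤m+n _ m) (≤-reflexive (lem m))))))))
    where
    lem : ∀ m → (3 + m) * 1 + m ≡ (suc m + suc m) + 1
    lem = solve-∀
  ... | inj₂ h' = zero , λ k → ≤-trans (m≤m+n _ _) (≤-trans (copy-dim F zero k) (≤-trans (dims-lower F can)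
        (≤-trans (sumW-const 0 (dimCount F) (fins (3 + m)) (λ {i} _ → ≤-pred (≰⇒> (h' i)))) (≤-trans (≤-reflexive (lem (length (fins (3 + m))))) z≤n))))
    where
    lem : ∀ k → k * 0 ≡ 0
    lem = solve-∀
  byDim : ∀ i → (∀ k → length (inner k (FR i F)) ≤ L) → HP F x y
  byDim i h = fromRing i F x y (Ring.Laced.LaceStep.laceRing (FR i F) (ringFaults (canon-φ i can) small) lace (≤-trans lenR len') h (trans (par-φ i x) ex) (trans (par-φ i y) ey))
    where
    lenR : length (FR i F) ≤ length F
    lenR = ≤-reflexive (length-map (pmap (φ i)) F)
    small : length (FR i F) < 4 * (2 + m)
    small = ≤-trans (s≤s (≤-trans lenR len')) (≤-trans (m≤m+n _ (m + m + 3)) (≤-reflexive (lem m)))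
      where
      lem : ∀ m → suc (2 + (suc m + suc m)) + (m + m + 3) ≡ 4 * (2 + m)
      lem = solve-∀

-- Coordinates of all splittings, and lines of edges.

cnt-sel : {A : Set} (p : A → Bool) (l : List A) → cnt p l ≡ length (sel (λ r → p r ≟ᵇ true) l)
cnt-sel p [] = refl
cnt-sel p (x ∷ l) with p x
... | true = cong suc (cnt-sel p l)
... | false = cnt-sel p l

abstract
  finsNot : ∀ {n} → Fin n → List (Fin n)
  finsNot {n} i = sel (λ j → ¬? (j ≟ᶠ i)) (fins n)

  finsNot-length : ∀ {n} (i : Fin (suc n)) → length (finsNot i) ≡ n
  finsNot-length {n} i = suc-injective (trans (≤-antisym (≤-trans a (≤-reflexive (fins-length (suc n)))) (≤-trans (≤-reflexive (sym (fins-length (suc n)))) b)) refl)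
    where
    a : suc (length (finsNot i)) ≤ length (fins (suc n))
    a = ⊆-length (All-∉ _ (λ j → proj₂ (∈-sel⁻ (λ j → ¬? (j ≟ᶠ i)) {l = fins (suc n)} j) refl) ∷ sel-Unique (λ j → ¬? (j ≟ᶠ i)) (fins-Unique (suc n))) (λ {x} _ → fins-∈ x)
    b : length (fins (suc n)) ≤ suc (length (finsNot i))
    b = ⊆-length (fins-Unique (suc n)) sub
      where
      sub : ∀ {x} → x ∈ fins (suc n) → x ∈ i ∷ finsNot i
      sub {x} k with x ≟ᶠ i
      ... | yes e = here e
      ... | no h = there (∈-sel⁺ (λ j → ¬? (j ≟ᶠ i)) k h)

  finsNot-≢ : ∀ {n} {i j : Fin n} → j ∈ finsNot i → ¬ j ≡ i
  finsNot-≢ {n} {i} k = proj₂ (∈-sel⁻ (λ j → ¬? (j ≟ᶠ i)) {l = fins n} k)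

  finsNot-∈ : ∀ {n} {i j : Fin n} → ¬ j ≡ i → j ∈ finsNot i
  finsNot-∈ {i = i} {j} ne = ∈-sel⁺ (λ j → ¬? (j ≟ᶠ i)) (fins-∈ j) ne

  finsNot-Unique : ∀ {n} (i : Fin n) → Unique (finsNot i)
  finsNot-Unique {n} i = sel-Unique (λ j → ¬? (j ≟ᶠ i)) (fins-Unique n)

nbrsNot : ∀ {n} → Fin n → Vertex n → List (Vertex n)
nbrsNot i x = both (λ j b → nb j b x) (finsNot i)

nbrsNot-Unique : ∀ {n} (i : Fin n) x → Unique (nbrsNot i x)
nbrsNot-Unique {n} i x = both-Unique _ (λ {j} {k} {b} {c} _ _ e → nb-inj j k b c x e) (finsNot-Unique i)

inX : ∀ {m} → Fin (2 + m) → Fin 4 → E (2 + m) → Bool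
inX i k r = inn k (pmap (φ i) r)

dimX-unique : ∀ {m} {i j b} {x : Vertex (2 + m)} → dimX i (x , nb j b x) ≡ true → j ≡ i
dimX-unique {i = i} {j} {b} {x} h with j ≟ᶠ i
... | yes e = e
... | no ne with trans (sym h) (dimX-nb-≢ j i b x ne)
... | ()

κ-other : ∀ {m} {i j} b (x : Vertex (2 + m)) → ¬ j ≡ i → κ i (nb j b x) ≡ κ i x
κ-other {i = i} {j} b x h = cong proj₁ (proj₂ (φ-nb-other j i b x h))

inX-elim : ∀ {m} {i k} {r : E (2 + m)} → inX i k r ≡ true → κ i (proj₁ r) ≡ k × κ i (proj₂ r) ≡ k
inX-elim {i = i} {k} {r} h = inn-true k (pmap (φ i) r) h

inX-dim : ∀ {m} {i k} {r : E (2 + m)} → inX i k r ≡ true → dimX i r ≡ true → ⊥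
inX-dim {i = i} {k} {r} = inn-isX k (pmap (φ i) r)

inX-≢ : ∀ {m} {i k l} {r : E (2 + m)} → ¬ k ≡ l → inX i k r ≡ true → inX i l r ≡ true → ⊥
inX-≢ {i = i} {k} {l} {r} ne h h' = ne (trans (sym (proj₁ (inX-elim {i = i} {k} {r} h))) (proj₁ (inX-elim {i = i} {l} {r} h')))

⊖-cancel : ∀ x {y y'} → y ⊖ x ≡ y' ⊖ x → y ≡ y'
⊖-cancel #0 e = e
⊖-cancel #1 {y} {y'} e = trans (sym (inc-dec y)) (trans (cong inc4 e) (inc-dec y'))
⊖-cancel #2 {y} {y'} e = trans (sym (inc-dec y)) (trans (cong inc4 (trans (sym (inc-dec (dec4 y))) (trans (cong inc4 e) (inc-dec (dec4 y'))))) (inc-dec y'))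
⊖-cancel #3 {y} {y'} e = trans (sym (dec-inc y)) (trans (cong dec4 e) (dec-inc y'))

-- The height is a signed sum of the coordinates, so it recovers the one that is missing.
hgt-determines : ∀ {n} d (τ σ : Vec (Fin 4) n) i → (∀ j → ¬ j ≡ i → lookup τ j ≡ lookup σ j) → hgt d τ ≡ hgt d σ → τ ≡ σ
hgt-determines d (x ∷ τ) (y ∷ σ) zero h e with lookups τ σ (λ j → h (suc j) (λ ()))
  where
  lookups : ∀ {n} (τ σ : Vec (Fin 4) n) → (∀ j → lookup τ j ≡ lookup σ j) → τ ≡ σ
  lookups [] [] h = refl
  lookups (x ∷ τ) (y ∷ σ) h = cong₂ _∷_ (h zero) (lookups τ σ (h ∘ suc))
... | refl = cong (_∷ τ) (trans (sym (⊖-inv (hgt d τ) x)) (trans (cong (hgt d τ ⊖_) e) (⊖-inv (hgt d τ) y)))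
hgt-determines d (x ∷ τ) (y ∷ σ) (suc i) h e with h zero (λ ())
... | refl = cong (x ∷_) (hgt-determines d τ σ i (λ j ne → h (suc j) (λ { refl → ne refl })) (⊖-cancel x e))

lookup-ext : ∀ {n} (τ σ : Vec (Fin 4) n) → (∀ j → lookup τ j ≡ lookup σ j) → τ ≡ σ
lookup-ext [] [] h = refl
lookup-ext (x ∷ τ) (y ∷ σ) h = cong₂ _∷_ (h zero) (lookup-ext τ σ (h ∘ suc))

-- All coordinates but one, together with the parity, determine a vertex up to its twin.
coords : ∀ {m} (j : Fin (2 + m)) (x y : Vertex (2 + m)) → par x ≡ par y → (∀ i → ¬ i ≡ j → κ i x ≡ κ i y) → y ≡ x ⊎ y ≡ tw x
coords {m} j (a ∷ τ) (b ∷ σ) e h = same-tail true (bit e) (a ∷ τ) (b ∷ σ) e (nbs e (tails j e h))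
  where
  κ0 : ∀ {m} (a : Fin 4) (τ : Vec (Fin 4) (suc m)) → κ zero (a ∷ τ) ≡ hgt (pe a) τ
  κ0 a (x ∷ τ) = refl
  tails : ∀ j → pe a ≡ pe b → (∀ i → ¬ i ≡ j → κ i (a ∷ τ) ≡ κ i (b ∷ σ)) → τ ≡ σ
  tails zero _ h = lookup-ext τ σ (λ i → h (suc i) (λ ()))
  tails (suc j) e h = hgt-determines (pe a) τ σ j (λ i ne → h (suc i) (λ { refl → ne refl }))
    (trans (sym (κ0 a τ)) (trans (h zero (λ ())) (trans (κ0 b σ) (cong (λ d → hgt d σ) (sym e)))))
  bit : pe a ≡ pe b → Bool
  bit _ = does (inc4 a ≟ᶠ inc4 b)
  heads : ∀ a b → pe a ≡ pe b → inc4 a ≡ step (does (inc4 a ≟ᶠ inc4 b)) b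
  heads #0 #0 _ = refl
  heads #0 #2 _ = refl
  heads #2 #0 _ = refl
  heads #2 #2 _ = refl
  heads #1 #1 _ = refl
  heads #1 #3 _ = refl
  heads #3 #1 _ = refl
  heads #3 #3 _ = refl
  heads #0 #1 ()
  heads #0 #3 ()
  heads #1 #0 ()
  heads #1 #2 ()
  heads #2 #1 ()
  heads #2 #3 ()
  heads #3 #0 ()
  heads #3 #2 ()
  nbs : (e : pe a ≡ pe b) → τ ≡ σ → nb zero true (a ∷ τ) ≡ nb zero (bit e) (b ∷ σ)
  nbs e refl = cong (_∷ τ) (heads a b e)

record Dir {m : ℕ} (j : Fin (2 + m)) (r : E (2 + m)) : Set where
  constructor dir
  field
    even : par (proj₁ r) ≡ true
    bit : Bool
    end : proj₂ r ≡ nb j bit (proj₁ r)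

-- By `coords` the even end is determined up to its twin, and each of the two has two edges of
-- dimension `j`: these are the four edges of one line.
c4 : ∀ {m} (j : Fin (2 + m)) (k : Fin (2 + m) → Fin 4) {xs : List (E (2 + m))} → Unique xs →
  (∀ {r} → r ∈ xs → Dir j r × (∀ i → ¬ i ≡ j → κ i (proj₁ r) ≡ k i)) → length xs ≤ 4
c4 j k {[]} u h = z≤n
c4 j k {(x , y) ∷ xs} u h = ⊆-length u sub
  where
  sub : ∀ {r} → r ∈ (x , y) ∷ xs → r ∈ (x , nb j true x) ∷ (x , nb j false x) ∷ (tw x , nb j true (tw x)) ∷ (tw x , nb j false (tw x)) ∷ []
  sub {x' , y'} i with h i | h (here refl)
  ... | dir e b refl , f | dir e₀ _ _ , f₀ with coords j x x' (trans e₀ (sym e)) (λ i ne → trans (f₀ i ne) (sym (f i ne))) | b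
  ... | inj₁ refl | true = here refl
  ... | inj₁ refl | false = there (here refl)
  ... | inj₂ refl | true = there (there (here refl))
  ... | inj₂ refl | false = there (there (there (here refl)))

dimX-sym : ∀ {m} i (x y : Vertex (2 + m)) → dimX i (x , y) ≡ dimX i (y , x)
dimX-sym i x y with κ i x ≟ᶠ κ i y | κ i y ≟ᶠ κ i x
... | yes _ | yes _ = refl
... | no _ | no _ = refl
... | yes e | no h = ⊥-elim (h (sym e))
... | no h | yes e = ⊥-elim (h (sym e))

dimX-edge : ∀ {m} i (x y : Vertex (2 + m)) → dimX i (edge x y) ≡ dimX i (x , y)
dimX-edge i x y with par x
... | true = refl
... | false = dimX-sym i y x

cnt-neither : {A : Set} (p q : A → Bool) {l : List A} {x : A} → (∀ x → p x ≡ true → q x ≡ true → ⊥) → x ∈ l → p x ≡ false → q x ≡ false → cnt p l + (cnt q l + 1) ≤ length l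
cnt-neither p q {l} {x} h i ep eq = ≤-trans (+-monoʳ-≤ (cnt p l) (+-monoʳ-≤ (cnt q l) (≤-trans (≤-reflexive one) (sumW-∈ (b2n ∘ r) i)))) (cnt₃ p q r l h h₁ h₂)
  where
  r : _ → Bool
  r y = not (p y) ∧ not (q y)
  one : 1 ≡ b2n (r x)
  one rewrite ep | eq = refl
  h₁ : ∀ x → p x ≡ true → r x ≡ true → ⊥
  h₁ x a b rewrite a with b
  ... | ()
  h₂ : ∀ x → q x ≡ true → r x ≡ true → ⊥
  h₂ x a b with p x
  h₂ x a () | true
  h₂ x a b | false rewrite a with b
  ... | ()

false-or-true : ∀ b → ¬ b ≡ true → b ≡ false
false-or-true true h = ⊥-elim (h refl)
false-or-true false h = refl

selNe-length : {A : Set} (_≟_ : (x y : A) → Dec (x ≡ y)) (w : A) {l : List A} → Unique l → length l ≤ suc (length (sel (λ y → ¬? (y ≟ w)) l))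
selNe-length _≟_ w {l} u = ⊆-length u sub
  where
  sub : ∀ {x} → x ∈ l → x ∈ w ∷ sel (λ y → ¬? (y ≟ w)) l
  sub {x} i with x ≟ w
  ... | yes e = here e
  ... | no h = there (∈-sel⁺ (λ y → ¬? (y ≟ w)) i h)

abstract
  fresh : ∀ {n} (l : List (Fin n)) → length l < n → ∃[ γ ] ¬ γ ∈ l
  fresh {n} l h with pick (λ γ → ¬? (any? (γ ≟ᶠ_) l))
  ... | inj₁ p = p
  ... | inj₂ no-γ = ⊥-elim (1+n≰n (≤-trans h (≤-trans (≤-reflexive (sym (fins-length n))) (⊆-length (fins-Unique n) (λ {γ} _ → decidable-stable (any? (γ ≟ᶠ_) l) (no-γ γ))))))

-- Refutes a numeric inequality between two expressions whose difference is made explicit.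
absurd≤ : ∀ {a b} c → a ≡ suc (b + c) → a ≤ b → ⊥
absurd≤ {b = b} c refl h = 1+n≰n (≤-trans (s≤s (m≤m+n b c)) h)

abstract
  pickOr : ∀ {n} {A B : Fin n → Set} → (∀ i → A i ⊎ B i) → (∃[ i ] A i) ⊎ (∀ i → B i)
  pickOr {zero} f = inj₂ (λ ())
  pickOr {suc n} f with f zero | pickOr (f ∘ suc)
  ... | inj₁ a | _ = inj₁ (zero , a)
  ... | inj₂ _ | inj₁ (i , a) = inj₁ (suc i , a)
  ... | inj₂ b | inj₂ h = inj₂ (λ { zero → b ; (suc i) → h i })

Any-∃ : {A : Set} {P : A → Set} {l : List A} → Any P l → ∃[ x ] P x
Any-∃ (here p) = _ , p
Any-∃ (there i) = Any-∃ i

∃-Any : {A : Set} {P : A → Set} {l : List A} {x : A} → x ∈ l → P x → Any P l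
∃-Any (here refl) p = here p
∃-Any (there i) p = there (∃-Any i p)

set : ∀ {n} → (Fin n → Fin 4) → Fin n → Fin 4 → Fin n → Fin 4
set kk j k γ with γ ≟ᶠ j
... | yes _ = k
... | no _ = kk γ

set-same : ∀ {n} (kk : Fin n → Fin 4) j k → set kk j k j ≡ k
set-same kk j k with j ≟ᶠ j
... | yes _ = refl
... | no h = ⊥-elim (h refl)

set-other : ∀ {n} (kk : Fin n → Fin 4) {j} k {γ} → ¬ γ ≡ j → set kk j k γ ≡ kk γ
set-other kk {j} k {γ} h with γ ≟ᶠ j
... | yes e = ⊥-elim (h e)
... | no _ = refl

arith₁ : ∀ {m} → 1 ≤ m → 4 * suc m ≤ 3 + (m + m + 2) → ⊥
arith₁ {suc m} _ = absurd≤ (m + m) (lem m)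
  where
  lem : ∀ m → 4 * (2 + m) ≡ suc (3 + (suc m + suc m + 2) + (m + m))
  lem = solve-∀

arith₂ : ∀ {m} → 1 ≤ m → 4 * suc m ≤ 4 → ⊥
arith₂ {suc m} _ = absurd≤ (3 + 4 * m) (lem m)
  where
  lem : ∀ m → 4 * (2 + m) ≡ suc (4 + (3 + 4 * m))
  lem = solve-∀

arith₃ : ∀ {m} → 1 ≤ m → suc (suc m + suc m) ≤ 4 → ⊥
arith₃ {suc m} _ = absurd≤ (m + m) (lem m)
  where
  lem : ∀ m → 1 + ((2 + m) + (2 + m)) ≡ 5 + (m + m)
  lem = solve-∀

arith₄ : ∀ {m} → 1 ≤ m → m + m + 3 ≤ 3 → ⊥
arith₄ {suc m} _ = absurd≤ (1 + m + m) (lem m)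
  where
  lem : ∀ m → suc m + suc m + 3 ≡ 4 + (1 + m + m)
  lem = solve-∀

arith₅ : ∀ m → 2 + (m + m + 3) ≡ suc (((2 + m) + (2 + m)) + 0)
arith₅ = solve-∀

arith₆ : ∀ {m} → 1 ≤ m → 4 * suc m ≤ (2 + m) * 2 → ⊥
arith₆ {suc m} _ = absurd≤ (1 + 2 * m) (lem m)
  where
  lem : ∀ m → 4 * (2 + m) ≡ suc ((3 + m) * 2 + (1 + 2 * m))
  lem = solve-∀

arith₇ : ∀ m → suc (suc m + suc m) + suc (suc m + suc m) ≡ suc ((2 + m) * 2 + (1 + m + m))
arith₇ = solve-∀

arith₈ : ∀ {m} → 1 ≤ m → 4 * suc m + 3 ≤ 4 + (2 + m) * 2 → ⊥
arith₈ {suc m} _ = absurd≤ (m + m) (lem m)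
  where
  lem : ∀ m → 4 * (2 + m) + 3 ≡ suc (4 + (3 + m) * 2 + (m + m))
  lem = solve-∀

arith₉ : ∀ {m} → 1 ≤ m → suc (4 * suc m) ≤ 4 + (m + m + 2) → ⊥
arith₉ {suc m} _ = absurd≤ (m + m) (lem m)
  where
  lem : ∀ m → 1 + 4 * (2 + m) ≡ 1 + (4 + (suc m + suc m + 2) + (m + m))
  lem = solve-∀

-- Choice of the dimension in the conditional case.

record Faults {m : ℕ} (F : List (E (3 + m))) : Set where
  constructor faultSet
  field
    can : Canon F
    uniq : Unique F
    small : length F < 4 * (2 + m)
    δ : ∀ x → 2 ≤ deg F x
    lace : Lace (suc m)
    cond : Cond (suc m)

module Sel {m : ℕ} (F : List (E (3 + m))) (H : Faults F) where

  open Faults H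

  W : Set
  W = Vertex (3 + m)

  D : Set
  D = Fin (3 + m)

  L₀ : ℕ
  L₀ = suc m + suc m

  fc : D → Fin 4 → ℕ
  fc i k = length (inner k (FR i F))

  dc : D → ℕ
  dc i = cnt (dimX i) F

  fc-cnt : ∀ i k → fc i k ≡ cnt (inX i k) F
  fc-cnt i k = trans (inner-length k (FR i F)) (sumW-map (b2n ∘ inn k) (pmap (φ i)) F)

  fc+dc : ∀ i k → fc i k + dc i ≤ length F
  fc+dc = copy-dim F

  fc+fc+dc : ∀ i {k l} → ¬ k ≡ l → fc i k + (fc i l + dc i) ≤ length F
  fc+fc+dc i {k} {l} ne = subst₂ (λ a b → a + (b + dc i) ≤ length F) (sym (fc-cnt i k)) (sym (fc-cnt i l))
    (cnt₃ (inX i k) (inX i l) (dimX i) F (λ r → inX-≢ {i = i} {k} {l} {r} ne) (λ r → inX-dim {i = i} {k} {r}) (λ r → inX-dim {i = i} {l} {r}))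

  degR : D → W → ℕ
  degR i x = deg (inner (κ i x) (FR i F)) (proj₂ (φ i x))

  pull : ∀ i {x y} → κ i y ≡ κ i x → InL (inner (κ i x) (FR i F)) (proj₂ (φ i x)) (proj₂ (φ i y)) → InL F x y
  pull i {x} {y} e h = map-InL _≟ⱽ_ _≟ᴿ_ (φ i) (ψ i) (ψφ i) (φψ i) (up' h)
    where
    up' : InL (inner (κ i x) (FR i F)) (proj₂ (φ i x)) (proj₂ (φ i y)) → InL (FR i F) (φ i x) (φ i y)
    up' h = subst (λ k → InL (FR i F) (φ i x) (k , proj₂ (φ i y))) (sym e) (lift h)
      where
      lift : InL (inner (κ i x) (FR i F)) (proj₂ (φ i x)) (proj₂ (φ i y)) → InL (FR i F) (φ i x) (κ i x , proj₂ (φ i y))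
      lift (inj₁ j) = inj₁ (∈-inner⁻ j)
      lift (inj₂ j) = inj₂ (∈-inner⁻ j)

  -- The fault-free neighbours of x outside dimension i are neighbours of its image inside the copy.
  goodNot : ∀ i x → length (sel (λ y → ¬? (InL? F x y)) (nbrsNot i x)) ≤ degR i x
  goodNot i x = subst (_≤ degR i x) (length-map (proj₂ ∘ φ i) gs) (⊆-length (Unique-map (proj₂ ∘ φ i) inj (sel-Unique (λ y → ¬? (InL? F x y)) (nbrsNot-Unique i x))) sub)
    where
    gs = sel (λ y → ¬? (InL? F x y)) (nbrsNot i x)
    κ≡ : ∀ {y} → y ∈ nbrsNot i x → κ i y ≡ κ i x
    κ≡ k with ∈-both _ (finsNot i) k
    ... | j , b , k' , refl = κ-other {i = i} b x (finsNot-≢ {i = i} k')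
    inj : ∀ {y z} → y ∈ gs → z ∈ gs → proj₂ (φ i y) ≡ proj₂ (φ i z) → y ≡ z
    inj {y} {z} k l e = trans (sym (ψφ i y)) (trans (cong (ψ i) (cong₂ _,_ (trans (κ≡ (proj₁ (∈-sel⁻ (λ y → ¬? (InL? F x y)) {l = nbrsNot i x} k))) (sym (κ≡ (proj₁ (∈-sel⁻ (λ y → ¬? (InL? F x y)) {l = nbrsNot i x} l))))) e)) (ψφ i z))
    sub : ∀ {z} → z ∈ map (proj₂ ∘ φ i) gs → z ∈ goodN (inner (κ i x) (FR i F)) (proj₂ (φ i x))
    sub k with ∈-map⁻ (proj₂ ∘ φ i) k
    ... | y , l , refl with ∈-sel⁻ (λ y → ¬? (InL? F x y)) {l = nbrsNot i x} l
    ... | l' , good with ∈-both (λ j b → nb j b x) (finsNot i) l'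
    ... | j , b , j∈ , refl with φ-nb-other j i b x (finsNot-≢ {i = i} j∈)
    ... | i' , e = ∈-goodN {F = inner (κ i x) (FR i F)} (subst (Adj (proj₂ (φ i x))) (sym (cong proj₂ e)) (adj-nb i' b _) , λ h → good (pull i (cong proj₁ e) h))

  badNot : D → W → List W
  badNot i x = sel (λ y → InL? F x y) (nbrsNot i x)

  badNot-many : ∀ i x → (2 + m) + (2 + m) ≤ length (badNot i x) + degR i x
  badNot-many i x = ≤-trans (≤-reflexive (trans (sym (trans (both-length _ (finsNot i)) (cong₂ _+_ (finsNot-length i) (finsNot-length i)))) (sym (sel-length (InL? F x) (nbrsNot i x))))) (+-monoʳ-≤ (length (badNot i x)) (goodNot i x))

  -- The vertex is isolated inside its copy, so by the degree condition both its crossing edges are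
  -- good.
  Pinched : D → W → Set
  Pinched i x = degR i x ≤ 0

  pinched-all : ∀ {i x} → Pinched i x → ∀ {j} → ¬ j ≡ i → ∀ b → InL F x (nb j b x)
  pinched-all {i} {x} p {j} ne b = decidable-stable (InL? F x (nb j b x)) no-good
    where
    no-good : ¬ ¬ InL F x (nb j b x)
    no-good h = 1+n≰n (≤-trans (pos (∈-sel⁺ (λ y → ¬? (InL? F x y)) (both-∈ (λ j b → nb j b x) b (finsNot-∈ ne)) h)) (≤-trans (goodNot i x) p))
      where
      pos : ∀ {A : Set} {l : List A} {x} → x ∈ l → 1 ≤ length l
      pos (here _) = s≤s z≤n
      pos (there _) = s≤s z≤n

  canR : ∀ i → CanonR (FR i F)
  canR i = canon-φ i can

  φ-inj : ∀ i {x y : W} → φ i x ≡ φ i y → x ≡ y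
  φ-inj i {x} {y} e = trans (sym (ψφ i x)) (trans (cong (ψ i) e) (ψφ i y))

  uniqR : ∀ i → Unique (FR i F)
  uniqR i = Unique-map (pmap (φ i)) (λ _ _ e → cong₂ _,_ (φ-inj i (cong proj₁ e)) (φ-inj i (cong proj₂ e))) uniq

  smallR : ∀ i → length (FR i F) < 4 * (2 + m)
  smallR i = subst (_< 4 * (2 + m)) (sym (length-map (pmap (φ i)) F)) small

  -- The good edges of a blocked vertex all lie inside its copy.
  unbl : ∀ i s x → RingBase.Blocked (FR i F) (s , x) → 2 ≤ deg (inner s (FR i F)) x
  unbl i s x b = ≤-trans (δ w) (≤-trans (⊆-length (goodN-Unique F w) sub) (≤-trans (goodNot i w) (≤-reflexive (cong (λ p → deg (inner (proj₁ p) (FR i F)) (proj₂ p)) (φψ i (s , x))))))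
    where
    w = ψ i (s , x)
    both-bad : ∀ b → InL F w (nb i b w)
    both-bad c = map-InL _≟ⱽ_ _≟ᴿ_ (φ i) (ψ i) (ψφ i) (φψ i) (subst₂ (InL (FR i F)) (sym (φψ i (s , x))) (sym (trans (φ-nb-same i c w) (cong (cr c) (φψ i (s , x))))) (sel-b c b))
      where
      sel-b : ∀ c → RingBase.Blocked (FR i F) (s , x) → InL (FR i F) (s , x) (cr c (s , x))
      sel-b true = proj₁
      sel-b false = proj₂
    sub : ∀ {y} → y ∈ goodN F w → y ∈ sel (λ y → ¬? (InL? F w y)) (nbrsNot i w)
    sub k with goodN-∈ {F = F} k
    ... | a , h with nb-adj a
    ... | j , c , refl = ∈-sel⁺ (λ y → ¬? (InL? F w y)) (both-∈ (λ j b → nb j b w) c (finsNot-∈ (λ { refl → h (both-bad c) }))) h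

  degR-ψ : ∀ i s x → degR i (ψ i (s , x)) ≡ deg (inner s (FR i F)) x
  degR-ψ i s x = cong (λ p → deg (inner (proj₁ p) (FR i F)) (proj₂ p)) (φψ i (s , x))

  goal : ∀ i {u v k} → κ i u ≡ k → κ i v ≡ k → HPR (FR i F) (k , proj₂ (φ i u)) (k , proj₂ (φ i v)) → HP F u v
  goal i {u} {v} refl e h = fromRing i F u v (subst (λ k → HPR (FR i F) (φ i u) (k , proj₂ (φ i v))) (sym e) h)

  -- What is needed when both ends lie in one copy of the splitting `i`. The bound 4(m+1) is one
  -- above that of `Cond`, which accounts for the fault restored in `semi`.
  record C (i : D) : Set where
    field
      c₁ : ∀ k → fc i k ≤ 4 * suc m
      c₂ : ∀ {k l} → ¬ k ≡ l → L₀ < fc i k → L₀ < fc i l → ⊥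
      c₃ : ∀ x → ¬ Pinched i x

  data NotC (i : D) : Set where
    n₁ : ∀ k → 4 * suc m < fc i k → NotC i
    n₂ : ∀ k l → ¬ k ≡ l → L₀ < fc i k → L₀ < fc i l → NotC i
    n₃ : ∀ x → Pinched i x → NotC i

  two? : ∀ i → (∃[ k ] ∃[ l ] (¬ k ≡ l × L₀ < fc i k × L₀ < fc i l)) ⊎ (∀ {k l} → ¬ k ≡ l → L₀ < fc i k → L₀ < fc i l → ⊥)
  two? i with pick (λ k → anyᶠ? (λ l → ¬? (k ≟ᶠ l) ×-dec ((L₀ <? fc i k) ×-dec (L₀ <? fc i l))))
  ... | inj₁ (k , l , h) = inj₁ (k , l , h)
  ... | inj₂ h = inj₂ (λ {k} {l} ne a b → h k (l , ne , a , b))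

  decC : ∀ i → C i ⊎ NotC i
  decC i with pick (λ k → 4 * suc m <? fc i k) | two? i | search (λ x → degR i x ≤? 0) (allV (3 + m))
  ... | inj₁ (k , h) | _ | _ = inj₂ (n₁ k h)
  ... | inj₂ _ | inj₁ (k , l , ne , a , b) | _ = inj₂ (n₂ k l ne a b)
  ... | inj₂ _ | inj₂ _ | inj₁ (x , _ , h) = inj₂ (n₃ x h)
  ... | inj₂ h₁ | inj₂ h₂ | inj₂ h₃ = inj₁ record { c₁ = λ k → ≮⇒≥ (h₁ k) ; c₂ = h₂ ; c₃ = λ x → h₃ (allV-∈ x) }

  -- The counterpart for the dimension of the given edge, where no fault can be restored: the
  -- hypotheses of `Cond` must hold in the special copy as they stand.
  record P (j : D) : Set where
    field
      p₁ : ∀ k → fc j k < 4 * suc m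
      p₂ : ∀ {k l} → ¬ k ≡ l → L₀ < fc j k → L₀ < fc j l → ⊥
      p₃ : ∀ x → 2 ≤ degR j x

  data NotP (j : D) : Set where
    n₁ : ∀ k → 4 * suc m ≤ fc j k → NotP j
    n₂ : ∀ k l → ¬ k ≡ l → L₀ < fc j k → L₀ < fc j l → NotP j
    n₃ : ∀ x → degR j x ≤ 1 → NotP j

  decP : ∀ j → P j ⊎ NotP j
  decP j with pick (λ k → 4 * suc m ≤? fc j k) | two? j | search (λ x → degR j x ≤? 1) (allV (3 + m))
  ... | inj₁ (k , h) | _ | _ = inj₂ (n₁ k h)
  ... | inj₂ _ | inj₁ (k , l , ne , a , b) | _ = inj₂ (n₂ k l ne a b)
  ... | inj₂ _ | inj₂ _ | inj₁ (x , _ , h) = inj₂ (n₃ x h)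
  ... | inj₂ h₁ | inj₂ h₂ | inj₂ h₃ = inj₁ record { p₁ = λ k → ≰⇒> (h₁ k) ; p₂ = h₂ ; p₃ = λ x → ≰⇒> (h₃ (allV-∈ x)) }

  resolveC : ∀ {i} → C i → ∀ {u v} → par u ≡ true → par v ≡ false → Adj u v → ¬ InL F u v → κ i v ≡ κ i u → HP F u v
  resolveC {i} c {u} {v} eu ev adj good e with pick (λ k → L₀ <? fc i k)
  ... | inj₂ h = goal i refl e (Ring.Laced.Robust.allLace (FR i F) (ringFaults (canR i) (smallR i)) lace (uniqR i) cond (λ k → ≮⇒≥ (h k)) (κ i u) (trans (par-φ i u) eu) (trans (par-φ i v) ev))
  ... | inj₁ (s , h) = goal i refl e (Ring.Laced.Robust.Build.buildIn (FR i F) (ringFaults (canR i) (smallR i)) lace (uniqR i) cond s h rest (κ i u) (trans (par-φ i u) eu) (trans (par-φ i v) ev)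
          (λ { refl → Ring.Laced.Robust.Semi.through S (trans (par-φ i u) eu) (trans (par-φ i v) ev) adj' (λ g → good (pull i e g)) }) (λ _ → Ring.Laced.Robust.Semi.ends S))
    where
    rest : ∀ k → ¬ k ≡ s → fc i k ≤ L₀
    rest k ne = ≮⇒≥ (λ h' → C.c₂ c (ne ∘ sym) h h')
    S : Ring.Laced.Robust.Semi (FR i F) (ringFaults (canR i) (smallR i)) lace (uniqR i) cond s
    S = Ring.Laced.Robust.semi (FR i F) (ringFaults (canR i) (smallR i)) lace (uniqR i) cond s (C.c₁ c s) (λ x → ≤-trans (≰⇒> (C.c₃ c (ψ i (s , x)))) (≤-reflexive (degR-ψ i s x))) (unbl i s)
    adj' : Adj (proj₂ (φ i u)) (proj₂ (φ i v))
    adj' with φ-adj i adj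
    ... | inj₁ (_ , a) = a
    ... | inj₂ (b , e' , _) = ⊥-elim (up-≢ (parR (φ i u)) (κ i u) (trans (sym e') e))

  resolveP : ∀ {j} → P j → ∀ {u v} → par u ≡ true → par v ≡ false → κ j v ≡ up true (κ j u) → HP F u v
  resolveP {j} p {u} {v} eu ev e with pick (λ k → L₀ <? fc j k)
  ... | inj₂ h = fromRing j F u v (subst (λ k → HPR (FR j F) (φ j u) (k , proj₂ (φ j v))) (sym e) (Ring.Laced.Robust.allLaceCross (FR j F) (ringFaults (canR j) (smallR j)) lace (uniqR j) cond (λ k → ≮⇒≥ (h k)) (κ j u) (trans (par-φ j u) eu) (trans (par-φ j v) ev)))
  ... | inj₁ (s , h) = fromRing j F u v (subst (λ k → HPR (FR j F) (φ j u) (k , proj₂ (φ j v))) (sym e)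
          (Ring.Laced.Robust.BuildCross.cross (FR j F) (ringFaults (canR j) (smallR j)) lace (uniqR j) cond s (λ x → ≤-trans (P.p₃ p (ψ j (s , x))) (≤-reflexive (degR-ψ j s x))) (P.p₁ p s) rest (κ j u) (trans (par-φ j u) eu) (trans (par-φ j v) ev)))
    where
    rest : ∀ k → ¬ k ≡ s → fc j k ≤ L₀
    rest k ne = ≮⇒≥ (λ h' → P.p₂ p (ne ∘ sym) h h')

  small' : length F ≤ 4 * suc m + 3
  small' = ≤-pred (≤-trans small (≤-reflexive (lem m)))
    where
    lem : ∀ m → 4 * (2 + m) ≡ suc (4 * suc m + 3)
    lem = solve-∀

  dirOf : ∀ {r} → r ∈ F → ∃[ j ] Dir j r
  dirOf i with can i
  ... | e , a with nb-adj a
  ... | j , b , eq = j , dir e b eq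

  dir-dim : ∀ {j r} → Dir {suc m} j r → dimX j r ≡ true
  dir-dim {j} {x , _} (dir e b refl) = dimX-nb j b x

  dir-unique : ∀ {i j r} → Dir {suc m} j r → dimX i r ≡ true → j ≡ i
  dir-unique {i} {j} {x , _} (dir e b refl) h = dimX-unique {i = i} {j} {b} {x} h

  dimDir : ∀ {j r} → r ∈ F → dimX j r ≡ true → Dir j r
  dimDir {j} i h with dirOf i
  ... | j' , d with dir-unique {j} d h
  ... | refl = d

  edge-F : ∀ {x y} → Adj x y → InL F x y → edge x y ∈ F
  edge-F a f = edge-∈ can (adj-par a) f

  full-dim : ∀ {i k} → 4 * suc m < fc i k → dc i ≤ 2
  full-dim {i} {k} h = +-cancelˡ-≤ (suc (4 * suc m)) _ _ (≤-trans (+-monoˡ-≤ (dc i) h) (≤-trans (fc+dc i k) (≤-trans small' (≤-reflexive (+-suc (4 * suc m) 2)))))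

  two-dim : ∀ {i k l} → ¬ k ≡ l → L₀ < fc i k → L₀ < fc i l → dc i ≤ 1
  two-dim {i} {k} {l} ne h h' = +-cancelˡ-≤ (suc L₀ + suc L₀) _ _ (≤-trans (≤-reflexive (+-assoc (suc L₀) (suc L₀) (dc i))) (≤-trans (+-mono-≤ h (+-monoˡ-≤ (dc i) h'))
    (≤-trans (fc+fc+dc i ne) (≤-trans small' (≤-reflexive (lem m))))))
    where
    lem : ∀ m → 4 * suc m + 3 ≡ (suc (suc m + suc m) + suc (suc m + suc m)) + 1
    lem = solve-∀

  -- The copy and the two crossing faults already exhaust the total of 4m+7, so every fault of
  -- another dimension lies in this copy.
  tight : ∀ {i k} → 4 * suc m < fc i k → 2 ≤ dc i → ∀ {r} → r ∈ F → ∀ {j} → Dir j r → ¬ j ≡ i → κ i (proj₁ r) ≡ k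
  tight {i} {k} h h' {r} r∈ {j} d ne with κ i (proj₁ r) ≟ᶠ k
  ... | yes e = e
  ... | no ne' = ⊥-elim (1+n≰n (≤-trans (≤-trans (≤-reflexive (lem m)) (+-mono-≤ h (+-monoˡ-≤ 1 h')))
      (≤-trans (≤-trans (≤-reflexive (cong (_+ (dc i + 1)) (fc-cnt i k))) (cnt-neither (inX i k) (dimX i) (λ r → inX-dim {i = i} {k} {r}) r∈ not-in not-dim)) small')))
    where
    not-in : inX i k r ≡ false
    not-in = false-or-true _ (λ e → ne' (proj₁ (inX-elim {i = i} {k} {r} e)))
    not-dim : dimX i r ≡ false
    not-dim = false-or-true _ (λ e → ne (dir-unique {i} d e))
    lem : ∀ m → suc (4 * suc m + 3) ≡ suc (4 * suc m) + (2 + 1)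
    lem = solve-∀

  tight-length : ∀ {i k} → 4 * suc m < fc i k → 2 ≤ dc i → 4 * suc m + 3 ≤ length F
  tight-length {i} {k} h h' = ≤-trans (≤-trans (≤-reflexive (lem m)) (+-mono-≤ h h')) (fc+dc i k)
    where
    lem : ∀ m → 4 * suc m + 3 ≡ suc (4 * suc m) + 2
    lem = solve-∀

  spoke : W → D → Bool → E (3 + m)
  spoke w γ b = edge w (nb γ b w)

  spoke-∈ : ∀ {w γ b} → InL F w (nb γ b w) → spoke w γ b ∈ F
  spoke-∈ {w} {γ} {b} f = edge-F (adj-nb γ b w) f

  spoke-dim : ∀ w γ b → dimX γ (spoke w γ b) ≡ true
  spoke-dim w γ b = trans (dimX-edge γ w (nb γ b w)) (dimX-nb γ b w)

  spoke-≢ : ∀ {w γ} → ¬ spoke w γ true ≡ spoke w γ false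
  spoke-≢ {w} {γ} e with proj₂ (nb-inj γ γ true false w (edge-inj w e))
  ... | ()

  Full : D → W → Set
  Full γ w = ∀ b → InL F w (nb γ b w)

  full-two : ∀ {γ w} → Full γ w → 2 ≤ dc γ
  full-two {γ} {w} f = ⊆-cnt (dimX γ) {spoke w γ true ∷ spoke w γ false ∷ []} ((spoke-≢ {w} {γ} ∷ []) ∷ ([] ∷ []))
    (λ { (here refl) → spoke-∈ (f true) , spoke-dim w γ true ; (there (here refl)) → spoke-∈ (f false) , spoke-dim w γ false })

  pinched-full : ∀ {i w} → Pinched i w → ∀ {γ} → ¬ γ ≡ i → Full γ w
  pinched-full p ne b = pinched-all p ne b

  -- The good edges of a pinched vertex all have its pinching dimension; two such dimensions would
  -- leave no good edge.
  pinched-once : ∀ {i γ w} → Pinched i w → Pinched γ w → ¬ γ ≡ i → ⊥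
  pinched-once {i} {γ} {w} p q ne with goodN F w in eg | δ w
  ... | y ∷ _ | _ with goodN-∈ {F = F} {x = w} (subst (y ∈_) (sym eg) (here refl))
  ... | a , h with nb-adj a
  ... | j , b , refl with j ≟ᶠ i
  ... | yes refl = h (pinched-all q (ne ∘ sym) b)
  ... | no ne' = h (pinched-all p ne' b)

  full-only : ∀ {γ w} → Full γ w → dc γ ≤ 2 → ∀ {r} → r ∈ F → dimX γ r ≡ true → r ≡ spoke w γ true ⊎ r ≡ spoke w γ false
  full-only {γ} {w} f le {r} i d with r ≟ᴱ spoke w γ true | r ≟ᴱ spoke w γ false
  ... | yes e | _ = inj₁ e
  ... | no _ | yes e = inj₂ e
  ... | no h | no h' = ⊥-elim (1+n≰n (≤-trans (⊆-cnt (dimX γ) {r ∷ spoke w γ true ∷ spoke w γ false ∷ []} ((h ∷ h' ∷ []) ∷ ((spoke-≢ {w} {γ} ∷ []) ∷ ([] ∷ [])))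
      (λ { (here refl) → i , d ; (there (here refl)) → spoke-∈ (f true) , spoke-dim w γ true ; (there (there (here refl))) → spoke-∈ (f false) , spoke-dim w γ false })) le))

  dims-sum : ∀ j → length F ≤ dc j + sumW dc (finsNot j)
  dims-sum j = ≤-trans (dims-lower F can) (sumW-⊆ dc {fins (3 + m)} {j ∷ finsNot j} (fins-Unique (3 + m)) (λ {x} _ → cov x))
    where
    cov : ∀ x → x ∈ j ∷ finsNot j
    cov x with x ≟ᶠ j
    ... | yes e = here e
    ... | no h = there (finsNot-∈ h)

  fc≤sum : ∀ j k → fc j k ≤ sumW dc (finsNot j)
  fc≤sum j k = +-cancelʳ-≤ (dc j) _ _ (≤-trans (fc+dc j k) (≤-trans (dims-sum j) (≤-reflexive (+-comm (dc j) _))))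

  sum≤ : ∀ j c → (∀ i → ¬ i ≡ j → dc i ≤ c) → sumW dc (finsNot j) ≤ (2 + m) * c
  sum≤ j c h = subst (λ k → sumW dc (finsNot j) ≤ k * c) (finsNot-length j) (sumW-const c dc (finsNot j) (λ {i} k → h i (finsNot-≢ {i = j} k)))

  nbrsNot-length : ∀ i (w : W) → length (nbrsNot i w) ≡ (2 + m) + (2 + m)
  nbrsNot-length i w = trans (both-length _ (finsNot i)) (cong₂ _+_ (finsNot-length i) (finsNot-length i))

  ∈-nbrsNot : ∀ {i j} b (w : W) → ¬ j ≡ i → nb j b w ∈ nbrsNot i w
  ∈-nbrsNot {i} {j} b w h = both-∈ (λ j b → nb j b w) b (finsNot-∈ h)

  nbrsNot-∈ : ∀ {i} {w y : W} → y ∈ nbrsNot i w → ∃[ j ] ∃[ b ] (¬ j ≡ i × y ≡ nb j b w)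
  nbrsNot-∈ {i} {w} k with ∈-both (λ j b → nb j b w) (finsNot i) k
  ... | j , b , k' , e = j , b , finsNot-≢ {i = i} k' , e

  badNot-∈ : ∀ {i} {w y : W} → y ∈ badNot i w → ∃[ j ] ∃[ b ] (¬ j ≡ i × y ≡ nb j b w × InL F w y)
  badNot-∈ {i} {w} k with ∈-sel⁻ (λ y → InL? F w y) {l = nbrsNot i w} k
  ... | k' , f with nbrsNot-∈ {i} k'
  ... | j , b , ne , e = j , b , ne , e , f

  badNot-Unique : ∀ i w → Unique (badNot i w)
  badNot-Unique i w = sel-Unique (λ y → InL? F w y) (nbrsNot-Unique i w)

  spoke-dir : ∀ w γ b → Dir γ (spoke w γ b)
  spoke-dir w γ b with par w in e
  ... | true = dir e b refl
  ... | false = dir (trans (par-nb γ b w) (cong not e)) (not b) (sym (nb-nb γ b w))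

  spoke-κ : ∀ w {γ j} b → ¬ j ≡ γ → κ γ (proj₁ (spoke w j b)) ≡ κ γ w
  spoke-κ w b ne with par w
  ... | true = refl
  ... | false = κ-other b w ne

  pinched-good : ∀ {i w} → Pinched i w → ∀ b → ¬ InL F w (nb i b w)
  pinched-good {i} {w} p b f = 1+n≰n (≤-trans (δ w) (⊆-length (goodN-Unique F w) sub))
    where
    sub : ∀ {y} → y ∈ goodN F w → y ∈ nb i (not b) w ∷ []
    sub k with goodN-∈ {F = F} {x = w} k
    ... | a , h with nb-adj a
    ... | j , c , refl with j ≟ᶠ i
    ... | no ne = ⊥-elim (h (pinched-all p ne c))
    ... | yes refl with c ≟ᵇ b
    ... | yes refl = ⊥-elim (h f)
    ... | no ne = here (cong (λ d → nb i d w) (≢-not ne))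

  -- Two pinched vertices overlap in at most one edge.
  third : ∀ {i γ w x} → Pinched i w → Pinched γ x → ¬ w ≡ x → ∀ {γ'} → ¬ γ' ≡ i → ¬ γ' ≡ γ → 3 ≤ dc γ'
  third {i} {γ} {w} {x} p q ne {γ'} h h' = ⊆-cnt (dimX γ') ((spoke-≢ {w} {γ'} ∷ (new true ∘ sym) ∷ []) ∷ (((new false ∘ sym) ∷ []) ∷ ([] ∷ []))) sub
    where
    c : Bool
    c = does (nb γ' false x ≟ⱽ w)
    c-ok : ¬ nb γ' c x ≡ w
    c-ok e with nb γ' false x ≟ⱽ w
    ... | no h = h e
    ... | yes e' with proj₂ (nb-inj γ' γ' true false x (trans e (sym e')))
    ... | ()
    new : ∀ b → ¬ spoke x γ' c ≡ spoke w γ' b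
    new b e with edge-ends x (nb γ' c x) w (nb γ' b w) e
    ... | inj₁ (e₁ , _) = ne (sym e₁)
    ... | inj₂ (_ , e₂) = c-ok e₂
    sub : ∀ {r} → r ∈ spoke w γ' true ∷ spoke w γ' false ∷ spoke x γ' c ∷ [] → r ∈ F × dimX γ' r ≡ true
    sub (here refl) = spoke-∈ (pinched-full p h true) , spoke-dim w γ' true
    sub (there (here refl)) = spoke-∈ (pinched-full p h false) , spoke-dim w γ' false
    sub (there (there (here refl))) = spoke-∈ (pinched-full q h' c) , spoke-dim x γ' c

  pinched-in : ∀ {i w} → Pinched i w → ∀ {y} → y ∈ nbrsNot i w → edge w y ∈ F
  pinched-in {i} {w} p k with nbrsNot-∈ {i} {w} k
  ... | j , b , ne , refl = spoke-∈ (pinched-all p ne b)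

  -- Three sets of 2m+4 faults that pairwise share at most one edge amount to 6m+9, more than 4m+7.
  no-three : ∀ {i γ γ' w x y} → Pinched i w → Pinched γ x → Pinched γ' y → ¬ w ≡ x → ¬ w ≡ y → ¬ x ≡ y → ⊥
  no-three {i} {γ} {γ'} {w} {x} {y} p q r wx wy xy = 1+n≰n (≤-trans (≤-trans (s≤s small') (≤-trans (m≤m+n _ (m + m + 1)) (≤-reflexive (lem m)))) (≤-trans (+-mono-≤ lw (+-mono-≤ lx ly)) total))
    where
    Lw = nbrsNot i w
    Lx = sel (λ z → ¬? (z ≟ⱽ w)) (nbrsNot γ x)
    Ly' = sel (λ z → ¬? (z ≟ⱽ w)) (nbrsNot γ' y)
    Ly = sel (λ z → ¬? (z ≟ⱽ x)) Ly'
    uLx : Unique Lx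
    uLx = sel-Unique (λ z → ¬? (z ≟ⱽ w)) (nbrsNot-Unique γ x)
    uLy' : Unique Ly'
    uLy' = sel-Unique (λ z → ¬? (z ≟ⱽ w)) (nbrsNot-Unique γ' y)
    uLy : Unique Ly
    uLy = sel-Unique (λ z → ¬? (z ≟ⱽ x)) uLy'
    lem : ∀ m → suc (4 * suc m + 3) + (m + m + 1) ≡ ((2 + m) + (2 + m)) + ((3 + (m + m)) + (2 + (m + m)))
    lem = solve-∀
    lw : (2 + m) + (2 + m) ≤ length Lw
    lw = ≤-reflexive (sym (nbrsNot-length i w))
    half : ∀ m → (2 + m) + (2 + m) ≡ suc (3 + (m + m))
    half = solve-∀
    lx : 3 + (m + m) ≤ length Lx
    lx = ≤-pred (≤-trans (≤-reflexive (trans (sym (half m)) (sym (nbrsNot-length γ x)))) (selNe-length _≟ⱽ_ w (nbrsNot-Unique γ x)))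
    ly : 2 + (m + m) ≤ length Ly
    ly = ≤-pred (≤-trans (≤-pred (≤-trans (≤-reflexive (trans (sym (half m)) (sym (nbrsNot-length γ' y)))) (selNe-length _≟ⱽ_ w (nbrsNot-Unique γ' y)))) (selNe-length _≟ⱽ_ x uLy'))
    big : List (E (3 + m))
    big = map (edge w) Lw ++ (map (edge x) Lx ++ map (edge y) Ly)
    eu : ∀ (z : W) {l} → Unique l → Unique (map (edge z) l)
    eu z u = Unique-map (edge z) (λ _ _ → edge-inj z) u
    d₁ : ∀ {s} → s ∈ map (edge w) Lw → s ∈ map (edge x) Lx ++ map (edge y) Ly → ⊥
    d₁ k k' with ∈-map⁻ (edge w) k | ∈-++⁻ (map (edge x) Lx) k'
    ... | z , _ , e | inj₁ l with ∈-map⁻ (edge x) l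
    ... | z' , l' , e' with edge-ends w z x z' (trans (sym e) e')
    ... | inj₁ (h , _) = wx h
    ... | inj₂ (h , _) = proj₂ (∈-sel⁻ (λ z → ¬? (z ≟ⱽ w)) {l = nbrsNot γ x} l') (sym h)
    d₁ k k' | z , _ , e | inj₂ l with ∈-map⁻ (edge y) l
    ... | z' , l' , e' with edge-ends w z y z' (trans (sym e) e')
    ... | inj₁ (h , _) = wy h
    ... | inj₂ (h , _) = proj₂ (∈-sel⁻ (λ z → ¬? (z ≟ⱽ w)) {l = nbrsNot γ' y} (proj₁ (∈-sel⁻ (λ z → ¬? (z ≟ⱽ x)) {l = Ly'} l'))) (sym h)
    d₂ : ∀ {s} → s ∈ map (edge x) Lx → s ∈ map (edge y) Ly → ⊥
    d₂ k k' with ∈-map⁻ (edge x) k | ∈-map⁻ (edge y) k'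
    ... | z , _ , e | z' , l' , e' with edge-ends x z y z' (trans (sym e) e')
    ... | inj₁ (h , _) = xy h
    ... | inj₂ (h , _) = proj₂ (∈-sel⁻ (λ z → ¬? (z ≟ⱽ x)) {l = Ly'} l') (sym h)
    total : length Lw + (length Lx + length Ly) ≤ length F
    total = ≤-trans (≤-reflexive (sym (trans (length-++ (map (edge w) Lw)) (cong₂ _+_ (length-map (edge w) Lw) (trans (length-++ (map (edge x) Lx)) (cong₂ _+_ (length-map (edge x) Lx) (length-map (edge y) Ly)))))))
      (⊆-length (Unique-++ (eu w (nbrsNot-Unique i w)) (Unique-++ (eu x uLx) (eu y uLy) d₂) d₁) sub)
      where
      sub : ∀ {s} → s ∈ big → s ∈ F
      sub k with ∈-++⁻ (map (edge w) Lw) k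
      ... | inj₁ k' with ∈-map⁻ (edge w) k'
      ... | z , l , refl = pinched-in p l
      sub k | inj₂ k' with ∈-++⁻ (map (edge x) Lx) k'
      ... | inj₁ k'' with ∈-map⁻ (edge x) k''
      ... | z , l , refl = pinched-in q (proj₁ (∈-sel⁻ (λ z → ¬? (z ≟ⱽ w)) {l = nbrsNot γ x} l))
      sub k | inj₂ k' | inj₂ k'' with ∈-map⁻ (edge y) k''
      ... | z , l , refl = pinched-in r (proj₁ (∈-sel⁻ (λ z → ¬? (z ≟ⱽ w)) {l = nbrsNot γ' y} (proj₁ (∈-sel⁻ (λ z → ¬? (z ≟ⱽ x)) {l = Ly'} l))))

  -- Counting the faults of a copy of the j-splitting by whether they have dimension i.
  split-fc : ∀ i j k → fc j k ≤ length (sel (λ r → (inX j k r ≟ᵇ true) ×-dec (dimX i r ≟ᵇ true)) F) + length (sel (λ r → (inX j k r ≟ᵇ true) ×-dec (dimX i r ≟ᵇ false)) F)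
  split-fc i j k = ≤-trans (≤-reflexive (fc-cnt j k)) (go F)
    where
    go : ∀ l → cnt (inX j k) l ≤ length (sel (λ r → (inX j k r ≟ᵇ true) ×-dec (dimX i r ≟ᵇ true)) l) + length (sel (λ r → (inX j k r ≟ᵇ true) ×-dec (dimX i r ≟ᵇ false)) l)
    go [] = z≤n
    go (r ∷ l) with inX j k r | dimX i r
    ... | true | true = s≤s (go l)
    ... | true | false = ≤-trans (s≤s (go l)) (≤-reflexive (sym (+-suc _ _)))
    ... | false | true = go l
    ... | false | false = go l

  Sub : D → Fin 4 → D → Bool → List (E (3 + m))
  Sub j k i b = sel (λ r → (inX j k r ≟ᵇ true) ×-dec (dimX i r ≟ᵇ b)) F

  Sub-Unique : ∀ j k i b → Unique (Sub j k i b)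
  Sub-Unique j k i b = sel-Unique (λ r → (inX j k r ≟ᵇ true) ×-dec (dimX i r ≟ᵇ b)) uniq

  Sub-∈ : ∀ j k i b {r} → r ∈ Sub j k i b → r ∈ F × inX j k r ≡ true × dimX i r ≡ b
  Sub-∈ j k i b h with ∈-sel⁻ (λ r → (inX j k r ≟ᵇ true) ×-dec (dimX i r ≟ᵇ b)) {l = F} h
  ... | r∈ , e , d = r∈ , e , d

  -- All faults whose dimension is neither i nor j are spokes of w, and the faults of dimension i agree in all coordinates but i and j.
  module Concentrated {i j : D} (i≢j : ¬ i ≡ j) (w : W) (kk : D → Fin 4)
      (full : ∀ γ → ¬ γ ≡ i → ¬ γ ≡ j → Full γ w × dc γ ≤ 2)
      (aligned : ∀ γ → ¬ γ ≡ i → ¬ γ ≡ j → ∀ {r} → r ∈ F → Dir i r → κ γ (proj₁ r) ≡ kk γ) where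

    along across : Fin 4 → ℕ
    along k = length (Sub j k i true)
    across k = length (Sub j k i false)

    along-fixed : ∀ k {r} → r ∈ Sub j k i true → Dir i r × (∀ γ → ¬ γ ≡ i → κ γ (proj₁ r) ≡ set kk j k γ)
    along-fixed k {r} h with Sub-∈ j k i true h
    ... | r∈ , e , d = dimDir r∈ d , fixed
      where
      fixed : ∀ γ → ¬ γ ≡ i → κ γ (proj₁ r) ≡ set kk j k γ
      fixed γ ne with γ ≟ᶠ j
      ... | yes refl = proj₁ (inX-elim {i = j} {k} {r} e)
      ... | no ne' = aligned γ ne ne' r∈ (dimDir r∈ d)

    along≤4 : ∀ k → along k ≤ 4
    along≤4 k = c4 i (set kk j k) (Sub-Unique j k i true) (along-fixed k)

    across-spoke : ∀ k {r} → r ∈ Sub j k i false → κ j w ≡ k × ∃[ γ ] ∃[ b ] (¬ γ ≡ i × ¬ γ ≡ j × r ≡ spoke w γ b)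
    across-spoke k {r} h with Sub-∈ j k i false h
    ... | r∈ , e , d with dirOf r∈
    ... | γ , dr = go
      where
      ni : ¬ γ ≡ i
      ni refl with trans (sym (dir-dim dr)) d
      ... | ()
      nj : ¬ γ ≡ j
      nj refl = inX-dim {i = j} {k} {r} e (dir-dim dr)
      fo : r ≡ spoke w γ true ⊎ r ≡ spoke w γ false
      fo = full-only (proj₁ (full γ ni nj)) (proj₂ (full γ ni nj)) r∈ (dir-dim dr)
      at : ∀ b → r ≡ spoke w γ b → κ j w ≡ k
      at b eq = trans (sym (spoke-κ w b nj)) (trans (cong (κ j ∘ proj₁) (sym eq)) (proj₁ (inX-elim {i = j} {k} {r} e)))
      go : κ j w ≡ k × ∃[ γ ] ∃[ b ] (¬ γ ≡ i × ¬ γ ≡ j × r ≡ spoke w γ b)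
      go with fo
      ... | inj₁ eq = at true eq , γ , true , ni , nj , eq
      ... | inj₂ eq = at false eq , γ , false , ni , nj , eq

    across-away : ∀ k → ¬ κ j w ≡ k → across k ≤ 0
    across-away k ne = ⊆-length {xs = Sub j k i false} {F = []} (Sub-Unique j k i false) (λ h → ⊥-elim (ne (proj₁ (across-spoke k h))))

    spoke-new : ∀ {b γ c} → ¬ γ ≡ j → ¬ spoke w j b ≡ spoke w γ c
    spoke-new {b} {γ} {c} ne e = ne (sym (proj₁ (nb-inj j γ b c w (edge-inj w e))))

    -- Of the 2m+4 spokes of `w` outside dimension `i`, two have dimension `j` and thus lie in no
    -- copy of the splitting `j`.
    across≤ : ∀ k → across k ≤ m + m + 2
    across≤ k = +-cancelˡ-≤ 2 _ _ (≤-trans (⊆-length uni sub) (≤-reflexive (trans (length-map (edge w) (nbrsNot i w)) (trans (nbrsNot-length i w) (lem m)))))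
      where
      lem : ∀ m → (2 + m) + (2 + m) ≡ 2 + (m + m + 2)
      lem = solve-∀
      new : ∀ b → ¬ spoke w j b ∈ Sub j k i false
      new b h with across-spoke k h
      ... | _ , γ , c , _ , nj , e = spoke-new nj e
      uni : Unique (spoke w j true ∷ spoke w j false ∷ Sub j k i false)
      uni = (spoke-≢ {w} {j} ∷ All-∉ _ (new true)) ∷ (All-∉ _ (new false) ∷ Sub-Unique j k i false)
      sub : ∀ {r} → r ∈ spoke w j true ∷ spoke w j false ∷ Sub j k i false → r ∈ map (edge w) (nbrsNot i w)
      sub (here refl) = ∈-map⁺ (edge w) (∈-nbrsNot true w (i≢j ∘ sym))
      sub (there (here refl)) = ∈-map⁺ (edge w) (∈-nbrsNot false w (i≢j ∘ sym))
      sub (there (there h)) with across-spoke k h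
      ... | _ , γ , c , ni , _ , refl = ∈-map⁺ (edge w) (∈-nbrsNot c w ni)

    fc-bound : ∀ k → fc j k ≤ along k + across k
    fc-bound = split-fc i j

    fc-away : ∀ k → ¬ κ j w ≡ k → fc j k ≤ 4
    fc-away k ne = ≤-trans (fc-bound k) (≤-trans (+-mono-≤ (along≤4 k) (across-away k ne)) ≤-refl)

    -- The good spoke of `w` is one of the four edges of the line.
    along≤3 : ¬ InL F w (nb i true w) → (∀ γ → ¬ γ ≡ i → ¬ γ ≡ j → kk γ ≡ κ γ w) → along (κ j w) ≤ 3
    along≤3 good kk≡ = ≤-pred (c4 i (set kk j (κ j w)) {spoke w i true ∷ Sub j (κ j w) i true}
        (All-∉ _ (λ h → good (∈-edge {x = w} {nb i true w} (proj₁ (Sub-∈ j (κ j w) i true h)))) ∷ Sub-Unique j (κ j w) i true) fixed)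
      where
      fixed : ∀ {r} → r ∈ spoke w i true ∷ Sub j (κ j w) i true → Dir i r × (∀ γ → ¬ γ ≡ i → κ γ (proj₁ r) ≡ set kk j (κ j w) γ)
      fixed (there h) = along-fixed (κ j w) h
      fixed (here refl) = spoke-dir w i true , λ γ ne → trans (spoke-κ w true (ne ∘ sym)) (eq γ ne)
        where
        eq : ∀ γ → ¬ γ ≡ i → κ γ w ≡ set kk j (κ j w) γ
        eq γ ne with γ ≟ᶠ j
        ... | yes refl = refl
        ... | no ne' = sym (kk≡ γ ne ne')

  badNot-low : ∀ {j w} → degR j w ≤ 1 → m + m + 3 ≤ length (badNot j w)
  badNot-low {j} {w} h = +-cancelʳ-≤ 1 _ _ (≤-trans (≤-reflexive (lem m)) (≤-trans (badNot-many j w) (+-monoʳ-≤ (length (badNot j w)) h)))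
    where
    lem : ∀ m → (m + m + 3) + 1 ≡ (2 + m) + (2 + m)
    lem = solve-∀

  badNot-nb : ∀ {j w γ b} → ¬ InL F w (nb γ b w) → ¬ nb γ b w ∈ badNot j w
  badNot-nb {j} {w} good h with badNot-∈ {j} h
  ... | _ , _ , _ , _ , f = good f

  only-one-good : ∀ {j w γ γ' b c} → degR j w ≤ 1 → ¬ γ ≡ j → ¬ γ' ≡ j → ¬ γ ≡ γ' → ¬ InL F w (nb γ b w) → ¬ InL F w (nb γ' c w) → ⊥
  only-one-good {j} {w} {γ} {γ'} {b} {c} h n n' ne g g' = absurd≤ 0 (lem m) (≤-trans (≤-trans (s≤s (s≤s (badNot-low h))) (⊆-length uni sub)) (≤-reflexive (nbrsNot-length j w)))
    where
    lem : ∀ m → 2 + (m + m + 3) ≡ suc (((2 + m) + (2 + m)) + 0)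
    lem = solve-∀
    uni : Unique (nb γ b w ∷ nb γ' c w ∷ badNot j w)
    uni = ((λ e → ne (proj₁ (nb-inj γ γ' b c w e))) ∷ All-∉ _ (badNot-nb {j} g)) ∷ (All-∉ _ (badNot-nb {j} g') ∷ badNot-Unique j w)
    sub : ∀ {y} → y ∈ nb γ b w ∷ nb γ' c w ∷ badNot j w → y ∈ nbrsNot j w
    sub (here refl) = ∈-nbrsNot b w n
    sub (there (here refl)) = ∈-nbrsNot c w n'
    sub (there (there k)) = proj₁ (∈-sel⁻ (λ y → InL? F w y) {l = nbrsNot j w} k)

  notC-dc : ∀ {i} → NotC i → (∀ x → ¬ Pinched i x) → dc i ≤ 2
  notC-dc (n₁ k h) _ = full-dim h
  notC-dc (n₂ k l ne h h') _ = ≤-trans (two-dim ne h h') (s≤s z≤n)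
  notC-dc (n₃ x p) np = ⊥-elim (np x p)

  notC-big : ∀ {i} → NotC i → (∀ x → ¬ Pinched i x) → 2 ≤ dc i → ∃[ k ] 4 * suc m < fc i k
  notC-big (n₁ k h) _ _ = k , h
  notC-big (n₂ k l ne h h') _ d = ⊥-elim (1+n≰n (≤-trans d (two-dim ne h h')))
  notC-big (n₃ x p) np _ = ⊥-elim (np x p)

  -- The three dimensions i, j, γ leave a fourth one, which is what fails when n = 3.
  pinched-case : 1 ≤ m → ∀ {i j w} → ¬ i ≡ j → Pinched i w → (∀ γ → ¬ γ ≡ j → NotC γ) → NotP j → ⊥
  pinched-case m≥1 {i} {j} {w} i≢j pw nc np = finish np
    where
    full : ∀ γ → ¬ γ ≡ i → Full γ w
    full γ ne = pinched-full pw ne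
    distinct : ∀ {γ x} → ¬ γ ≡ i → Pinched γ x → ¬ w ≡ x
    distinct ne px refl = pinched-once pw px ne
    big : ∀ γ → ¬ γ ≡ i → ¬ γ ≡ j → ∃[ k ] 4 * suc m < fc γ k
    big γ ni nj = notC-big (nc γ nj) unpinched (full-two (full γ ni))
      where
      -- A vertex pinched in `γ` would force three faults of a fourth dimension `γ'`. This rules out
      -- two of the reasons for `NotC γ'`, and the third one would be a third pinched vertex.
      unpinched : ∀ x → ¬ Pinched γ x
      unpinched x px = many (nc γ' (λ e → out (there (there (here e)))))
        where
        fr : ∃[ γ' ] ¬ γ' ∈ i ∷ γ ∷ j ∷ []
        fr = fresh (i ∷ γ ∷ j ∷ []) (+-monoʳ-≤ 3 m≥1)
        γ' : D
        γ' = proj₁ fr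
        out : ¬ γ' ∈ i ∷ γ ∷ j ∷ []
        out = proj₂ fr
        ni' : ¬ γ' ≡ i
        ni' e = out (here e)
        nγ' : ¬ γ' ≡ γ
        nγ' e = out (there (here e))
        three : 3 ≤ dc γ'
        three = third pw px (distinct ni px) ni' nγ'
        many : NotC γ' → ⊥
        many (n₁ k h) = 1+n≰n (≤-trans three (full-dim h))
        many (n₂ k l ne h h') = 1+n≰n (≤-trans (≤-trans (n≤1+n 2) three) (two-dim ne h h'))
        many (n₃ y py) = no-three pw px py (distinct ni px) (distinct ni' py) (λ { refl → pinched-once px py nγ' })
    aligned : ∀ γ → ¬ γ ≡ i → ¬ γ ≡ j → ∀ {r γ'} → r ∈ F → Dir γ' r → ¬ γ' ≡ γ → κ γ (proj₁ r) ≡ κ γ w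
    aligned γ ni nj r∈ d ne with big γ ni nj
    ... | k , h = trans (tight h (full-two (full γ ni)) r∈ d ne)
          (trans (sym (tight h (full-two (full γ ni)) (spoke-∈ (full j (i≢j ∘ sym) true)) (spoke-dir w j true) (nj ∘ sym))) (spoke-κ w true (nj ∘ sym)))
    star-full : ∀ γ → ¬ γ ≡ i → ¬ γ ≡ j → Full γ w × dc γ ≤ 2
    star-full γ ni nj = full γ ni , full-dim (proj₂ (big γ ni nj))
    aligned-i : ∀ γ → ¬ γ ≡ i → ¬ γ ≡ j → ∀ {r} → r ∈ F → Dir i r → κ γ (proj₁ r) ≡ κ γ w
    aligned-i γ ni nj r∈ d = aligned γ ni nj r∈ d (ni ∘ sym)
    kw : D → Fin 4
    kw γ = κ γ w
    open Concentrated i≢j w kw star-full aligned-i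
    three : ∀ {x} → ¬ x ≡ w → length (badNot j x) ≤ 3
    three {x} x≢w = ⊆-length {F = nb i true x ∷ nb i false x ∷ w ∷ []} (badNot-Unique j x) sub
      where
      sub : ∀ {y} → y ∈ badNot j x → y ∈ nb i true x ∷ nb i false x ∷ w ∷ []
      sub h with badNot-∈ {j} h
      ... | γ , b , nj , refl , f with γ ≟ᶠ i
      ... | no ni with full-only (full γ ni) (full-dim (proj₂ (big γ ni nj))) (spoke-∈ {x} f) (spoke-dim x γ b)
      ... | inj₁ e with edge-ends x (nb γ b x) w (nb γ true w) e
      ... | inj₁ (h , _) = ⊥-elim (x≢w h)
      ... | inj₂ (_ , h) = there (there (here h))
      sub h | γ , b , nj , refl , f | no ni | inj₂ e with edge-ends x (nb γ b x) w (nb γ false w) e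
      ... | inj₁ (h , _) = ⊥-elim (x≢w h)
      ... | inj₂ (_ , h) = there (there (here h))
      sub h | γ , true , nj , refl , f | yes refl = here refl
      sub h | γ , false , nj , refl , f | yes refl = there (here refl)
    finish : NotP j → ⊥
    finish (n₁ k h) with κ j w ≟ᶠ k
    -- The copy of `w` holds at most 3 + (2m+2) faults, fewer than 4(m+1) as m ≥ 1.
    ... | yes refl = arith₁ m≥1 (≤-trans h (≤-trans (fc-bound k) (+-mono-≤ (along≤3 (pinched-good pw true) (λ _ _ _ → refl)) (across≤ k))))
    ... | no ne = arith₂ m≥1 (≤-trans h (fc-away k ne))
    finish (n₂ k l ne h h') with κ j w ≟ᶠ k
    ... | yes refl = arith₃ m≥1 (≤-trans h' (fc-away l ne))
    ... | no ne' = arith₃ m≥1 (≤-trans h (fc-away k ne'))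
    finish (n₃ x h) with x ≟ⱽ w
    ... | no ne = arith₄ m≥1 (≤-trans (badNot-low h) (three ne))
    -- At least 2m+3 neighbours of `w` outside dimension `j` are reached by faults, none of them
    -- along `i`, where the edges of `w` are good. Together with the two neighbours along `j` they
    -- exceed the 2m+4 neighbours outside dimension `i`.
    ... | yes refl = absurd≤ 0 (arith₅ m) (≤-trans (≤-trans (s≤s (s≤s (badNot-low h))) (⊆-length uni sub)) (≤-reflexive (nbrsNot-length i w)))
      where
      new : ∀ b → ¬ nb j b w ∈ badNot j w
      new b k with badNot-∈ {j} k
      ... | γ , c , nj , e , _ = nj (sym (proj₁ (nb-inj j γ b c w e)))
      uni : Unique (nb j true w ∷ nb j false w ∷ badNot j w)
      uni = ((λ e → spoke-≢ {w} {j} (cong (edge w) e)) ∷ All-∉ _ (new true)) ∷ (All-∉ _ (new false) ∷ badNot-Unique j w)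
      sub : ∀ {y} → y ∈ nb j true w ∷ nb j false w ∷ badNot j w → y ∈ nbrsNot i w
      sub (here refl) = ∈-nbrsNot true w (i≢j ∘ sym)
      sub (there (here refl)) = ∈-nbrsNot false w (i≢j ∘ sym)
      sub (there (there k)) with badNot-∈ {j} k
      ... | γ , b , nj , refl , f = ∈-nbrsNot b w (λ { refl → pinched-good pw b f })

  -- Every dimension except `j` has at most two faults, too few to overfill a copy of the splitting
  -- `j`. There remains a vertex `w` of low degree in its copy, which forces the faults onto one
  -- line or concentrates them at `w`.
  unpinched-case : 1 ≤ m → ∀ {j} → (∀ i → ¬ i ≡ j → ∀ x → ¬ Pinched i x) → (∀ γ → ¬ γ ≡ j → NotC γ) → NotP j → ⊥
  unpinched-case m≥1 {j} np nc = finish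
    where
    dc≤2 : ∀ i → ¬ i ≡ j → dc i ≤ 2
    dc≤2 i ne = notC-dc (nc i ne) (np i ne)
    total : sumW dc (finsNot j) ≤ (2 + m) * 2
    total = sum≤ j 2 dc≤2
    big : ∀ i → ¬ i ≡ j → 2 ≤ dc i → ∃[ k ] 4 * suc m < fc i k
    big i ne = notC-big (nc i ne) (np i ne)
    finish : NotP j → ⊥
    finish (n₁ k h) = arith₆ m≥1 (≤-trans h (≤-trans (fc≤sum j k) total))
    finish (n₂ k l ne h h') = absurd≤ (1 + m + m) (arith₇ m) (≤-trans (+-mono-≤ h h') (+-cancelʳ-≤ (dc j) _ _
        (≤-trans (≤-reflexive (+-assoc (fc j k) (fc j l) (dc j))) (≤-trans (fc+fc+dc j ne) (≤-trans (dims-sum j) (≤-trans (+-monoʳ-≤ (dc j) total) (≤-reflexive (+-comm (dc j) _))))))))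
    finish (n₃ w h) with pick (λ i → ¬? (i ≟ᶠ j) ×-dec (dc i ≤? 1))
    -- Each dimension other than `j` has two faults, and one of its copies holds all faults of the
    -- other dimensions. So the faults of dimension `j` lie on one line and are at most four, and
    -- the total stays below the required 4m+7.
    ... | inj₂ none = arith₈ m≥1 (≤-trans (tight-length (proj₂ (kk i₀ i₀≢)) (two i₀ i₀≢)) (≤-trans (dims-sum j) (+-mono-≤ four total)))
      where
      two : ∀ i → ¬ i ≡ j → 2 ≤ dc i
      two i ne = ≰⇒> (λ h → none i (ne , h))
      kk : ∀ i → ¬ i ≡ j → ∃[ k ] 4 * suc m < fc i k
      kk i ne = big i ne (two i ne)
      other : ∃[ i ] ¬ i ∈ j ∷ []
      other = fresh (j ∷ []) (s≤s (s≤s z≤n))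
      i₀ : D
      i₀ = proj₁ other
      i₀≢ : ¬ i₀ ≡ j
      i₀≢ = proj₂ other ∘ here
      k₀ : D → Fin 4
      k₀ i with i ≟ᶠ j
      ... | yes _ = #0
      ... | no ne = proj₁ (kk i ne)
      four : dc j ≤ 4
      four = subst (_≤ 4) (sym (cnt-sel (dimX j) F)) (c4 j k₀ (sel-Unique (λ r → dimX j r ≟ᵇ true) uniq) fixed)
        where
        fixed : ∀ {r} → r ∈ sel (λ r → dimX j r ≟ᵇ true) F → Dir j r × (∀ i → ¬ i ≡ j → κ i (proj₁ r) ≡ k₀ i)
        fixed {r} k with ∈-sel⁻ (λ r → dimX j r ≟ᵇ true) {l = F} k
        ... | r∈ , d = dimDir r∈ d , at
          where
          at : ∀ i → ¬ i ≡ j → κ i (proj₁ r) ≡ k₀ i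
          at i ne with i ≟ᶠ j
          ... | yes e = ⊥-elim (ne e)
          ... | no ne' = tight (proj₂ (kk i ne')) (two i ne') r∈ (dimDir r∈ d) (ne ∘ sym)
    -- `w` has a good edge of dimension `i`, so its edges of all dimensions besides `i` and `j` are
    -- faulty. This concentrates the faults at `w` and excludes `NotC i`.
    ... | inj₁ (i , ni , one) = last (nc i ni)
      where
      good : ∃[ c ] ¬ InL F w (nb i c w)
      good with InL? F w (nb i true w) | InL? F w (nb i false w)
      ... | no g | _ = true , g
      ... | yes _ | no g = false , g
      ... | yes f | yes f' = ⊥-elim (1+n≰n (≤-trans (full-two {i} {w} (λ { true → f ; false → f' })) one))
      full : ∀ γ → ¬ γ ≡ j → ¬ γ ≡ i → Full γ w
      full γ nj ni' b = decidable-stable (InL? F w (nb γ b w)) (λ g → only-one-good h nj ni ni' g (proj₂ good))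
      kk : ∀ γ → ¬ γ ≡ j → ¬ γ ≡ i → ∃[ k ] 4 * suc m < fc γ k
      kk γ nj ni' = big γ nj (full-two (full γ nj ni'))
      k₀ : D → Fin 4
      k₀ γ with γ ≟ᶠ j | γ ≟ᶠ i
      ... | no nj | no ni' = proj₁ (kk γ nj ni')
      ... | yes _ | _ = #0
      ... | no _ | yes _ = #0
      al : ∀ γ → ¬ γ ≡ j → ¬ γ ≡ i → ∀ {r} → r ∈ F → Dir j r → κ γ (proj₁ r) ≡ k₀ γ
      al γ nj ni' r∈ d with γ ≟ᶠ j | γ ≟ᶠ i
      ... | no nj' | no ni'' = tight (proj₂ (kk γ nj' ni'')) (full-two (full γ nj' ni'')) r∈ d (nj ∘ sym)
      ... | yes e | _ = ⊥-elim (nj e)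
      ... | no _ | yes e = ⊥-elim (ni' e)
      i≢ : ¬ j ≡ i
      i≢ = ni ∘ sym
      star-full : ∀ γ → ¬ γ ≡ j → ¬ γ ≡ i → Full γ w × dc γ ≤ 2
      star-full γ nj ni' = full γ nj ni' , dc≤2 γ nj
      open Concentrated i≢ w k₀ star-full al
      last : NotC i → ⊥
      last (n₁ k h) = arith₉ m≥1 (≤-trans h (≤-trans (fc-bound k) (+-mono-≤ (along≤4 k) (across≤ k))))
      last (n₂ k l ne h h') with κ i w ≟ᶠ k
      ... | yes refl = arith₃ m≥1 (≤-trans h' (fc-away l ne))
      ... | no ne' = arith₃ m≥1 (≤-trans h (fc-away k ne'))
      last (n₃ x p) = np i ni x p

  select : 1 ≤ m → ∀ j → P j ⊎ ∃[ i ] (¬ i ≡ j × C i)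
  select m≥1 j with decP j | pickOr (λ i → decC' i)
    where
    decC' : ∀ i → (¬ i ≡ j × C i) ⊎ (¬ i ≡ j → NotC i)
    decC' i with i ≟ᶠ j | decC i
    ... | yes e | _ = inj₂ (λ ne → ⊥-elim (ne e))
    ... | no ne | inj₁ c = inj₁ (ne , c)
    ... | no _ | inj₂ nc = inj₂ (λ _ → nc)
  ... | inj₁ p | _ = inj₁ p
  ... | inj₂ np | inj₁ c = inj₂ c
  ... | inj₂ np | inj₂ nc with pick (λ i → ¬? (i ≟ᶠ j) ×-dec any? (λ x → degR i x ≤? 0) (allV (3 + m)))
  ... | inj₁ (i , ni , h) = ⊥-elim (pinched-case m≥1 ni (proj₂ (Any-∃ h)) nc np)
  ... | inj₂ none = ⊥-elim (unpinched-case m≥1 (λ i ni x p → none i (ni , ∃-Any (allV-∈ x) p)) nc np)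

-- A verified finite search in BH_2.

Code : Set
Code = ℕ × ℕ

_==_ : Code → Code → Bool
(a , b) == (c , d) = (a ≡ᵇ c) ∧ (b ≡ᵇ d)

mem : Code → List Code → Bool
mem e [] = false
mem e (f ∷ l) = (e == f) ∨ mem e l

touches : ℕ → Code → Bool
touches z (a , b) = (z ≡ᵇ a) ∨ (z ≡ᵇ b)

hits : ℕ → List Code → ℕ
hits z [] = 0
hits z (e ∷ l) = if touches z e then suc (hits z l) else hits z l

is : Maybe ℕ → ℕ → Bool
is nothing x = false
is (just z) x = z ≡ᵇ x

∧-true : ∀ {a b} → a ∧ b ≡ true → a ≡ true × b ≡ true
∧-true {true} e = refl , e

∨-true : ∀ {a b} → a ∨ b ≡ true → a ≡ true ⊎ b ≡ true
∨-true {true} e = inj₁ refl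
∨-true {false} e = inj₂ e

≡ᵇ-true : ∀ {a b} → (a ≡ᵇ b) ≡ true → a ≡ b
≡ᵇ-true {a} {b} e = ≡ᵇ⇒≡ a b (subst T (sym e) tt)

≤ᵇ-true : ∀ {a b} → (a ≤ᵇ b) ≡ true → a ≤ b
≤ᵇ-true {a} {b} e = ≤ᵇ⇒≤ a b (subst T (sym e) tt)

≡ᵇ-refl : ∀ a → (a ≡ᵇ a) ≡ true
≡ᵇ-refl zero = refl
≡ᵇ-refl (suc a) = ≡ᵇ-refl a

==-true : ∀ {e f} → (e == f) ≡ true → e ≡ f
==-true h with ∧-true h
... | p , q = cong₂ _,_ (≡ᵇ-true p) (≡ᵇ-true q)

mem-∈ : ∀ e l → mem e l ≡ true → e ∈ l
mem-∈ e (f ∷ l) h with ∨-true {e == f} h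
... | inj₁ p = here (==-true p)
... | inj₂ q = there (mem-∈ e l q)

∈-mem : ∀ {e l} → e ∈ l → mem e l ≡ true
∈-mem {a , b} (here refl) rewrite ≡ᵇ-refl a | ≡ᵇ-refl b = refl
∈-mem {e} {f ∷ l} (there i) with e == f
... | true = refl
... | false = ∈-mem i

hits-sel : ∀ z l → hits z l ≡ length (sel (λ e → touches z e ≟ᵇ true) l)
hits-sel z [] = refl
hits-sel z (e ∷ l) with touches z e
... | true = cong suc (hits-sel z l)
... | false = hits-sel z l

-- An adversary argument: the faults are revealed one at a time, K those known to be faulty, G those known to be good, Z the blocked vertex if known,
-- and b bounds the number of unrevealed faults.  A candidate i settles the goal as soon as the edges es i are good and the vertices pts i unblocked;
-- otherwise one of them fails, which is new information.
module Adversary {Ix : Set} (es : Ix → List Code) (pts : Ix → List ℕ) (pick : List Code → Maybe ℕ → Maybe Ix) (lim : ℕ) where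

  -- `lim` faults at one vertex, or three at the blocked one, contradict the degree bounds, so such
  -- a state needs no candidate.
  deadAt : List Code → Maybe ℕ → ℕ → Bool
  deadAt K Z x = (lim ≤ᵇ hits x K) ∨ (is Z x ∧ (3 ≤ᵇ hits x K))

  dead : List Code → Maybe ℕ → List Code → Bool
  dead K Z [] = false
  dead K Z ((a , b) ∷ l) = deadAt K Z a ∨ (deadAt K Z b ∨ dead K Z l)

  explore : ℕ → ℕ → List Code → List Code → Maybe ℕ → Bool
  tryPick : ℕ → ℕ → List Code → List Code → Maybe ℕ → Maybe Ix → Bool
  edges : ℕ → ℕ → List Code → List Code → Maybe ℕ → List Code → List ℕ → Bool
  points : ℕ → ℕ → List Code → List Code → Maybe ℕ → List ℕ → Bool
  explore zero b K G Z = false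
  explore (suc n) b K G Z = dead K Z K ∨ tryPick n b K G Z (pick K Z)
  tryPick n b K G Z nothing = false
  tryPick n b K G Z (just i) = edges n b K G Z (es i) (pts i)
  edges n b K G Z [] ps = points n b K G Z ps
  -- All faults have been revealed, so every edge outside `K` is good.
  edges n zero K G Z (e ∷ l) ps = not (mem e K) ∧ edges n zero K G Z l ps
  -- Either `e` is faulty and a new candidate is sought, or `e` joins the known good edges and the
  -- present candidate is pursued.
  edges n (suc b) K G Z (e ∷ l) ps =
    not (mem e K) ∧ (if mem e G then edges n (suc b) K G Z l ps else (explore n b (e ∷ K) G Z ∧ edges n (suc b) K (e ∷ G) Z l ps))
  points n b K G Z [] = true
  -- At most one vertex is blocked, so once `z` is known all others are free.
  points n b K G (just z) (x ∷ ps) = not (z ≡ᵇ x) ∧ points n b K G (just z) ps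
  points n b K G nothing (x ∷ ps) = explore n b K G (just x) ∧ points n b K G nothing ps

  -- Nothing is assumed about `pick`: each candidate is checked edge by edge and vertex by vertex,
  -- so the choice affects only the success of the search.
  module Sound {Bad : Code → Set} (Bad? : ∀ e → Dec (Bad e)) {Blk : ℕ → Set} (Blk? : ∀ x → Dec (Blk x)) {N : ℕ} {Goal : Set}
    (count : ∀ {xs} → Unique xs → (∀ {e} → e ∈ xs → Bad e) → length xs ≤ N)
    (limit : ∀ x {xs} → Unique xs → (∀ {e} → e ∈ xs → Bad e × touches x e ≡ true) → length xs < lim)
    (limitZ : ∀ x {xs} → Blk x → Unique xs → (∀ {e} → e ∈ xs → Bad e × touches x e ≡ true) → length xs < 3)
    (one : ∀ {x y} → Blk x → Blk y → x ≡ y)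
    (use : ∀ i → (∀ {e} → e ∈ es i → ¬ Bad e) → (∀ {x} → x ∈ pts i → ¬ Blk x) → Goal) where

    record State (b : ℕ) (K G : List Code) (Z : Maybe ℕ) : Set where
      field
        bad : ∀ {e} → e ∈ K → Bad e
        uni : Unique K
        bound : N ≤ length K + b
        good : ∀ {e} → e ∈ G → ¬ Bad e
        blk : ∀ {z} → Z ≡ just z → Blk z

    deadAt-⊥ : ∀ {b K G Z} → State b K G Z → ∀ x → deadAt K Z x ≡ true → ⊥
    deadAt-⊥ {K = K} {Z = Z} st x h with ∨-true {lim ≤ᵇ hits x K} h
    ... | inj₁ p = 1+n≰n (≤-trans (limit x (sel-Unique (λ e → touches x e ≟ᵇ true) (State.uni st)) mm) (subst (lim ≤_) (hits-sel x K) (≤ᵇ-true {lim} p)))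
      where
      mm : ∀ {e} → e ∈ sel (λ e → touches x e ≟ᵇ true) K → Bad e × touches x e ≡ true
      mm k with ∈-sel⁻ (λ e → touches x e ≟ᵇ true) {l = K} k
      ... | k' , a = State.bad st k' , a
    deadAt-⊥ {K = K} {Z = just z} st x h | inj₂ q with ∧-true {z ≡ᵇ x} q
    ... | p , q' with ≡ᵇ-true {z} p
    ... | refl = 1+n≰n (≤-trans (limitZ x (State.blk st refl) (sel-Unique (λ e → touches x e ≟ᵇ true) (State.uni st)) mm) (subst (3 ≤_) (hits-sel x K) (≤ᵇ-true {3} q')))
      where
      mm : ∀ {e} → e ∈ sel (λ e → touches x e ≟ᵇ true) K → Bad e × touches x e ≡ true
      mm k with ∈-sel⁻ (λ e → touches x e ≟ᵇ true) {l = K} k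
      ... | k' , a = State.bad st k' , a

    dead-⊥ : ∀ {b K G Z} → State b K G Z → ∀ l → dead K Z l ≡ true → ⊥
    dead-⊥ {K = K} {Z = Z} st ((x , y) ∷ l) h with ∨-true {deadAt K Z x} h
    ... | inj₁ p = deadAt-⊥ st x p
    ... | inj₂ q with ∨-true {deadAt K Z y} q
    ... | inj₁ p = deadAt-⊥ st y p
    ... | inj₂ r = dead-⊥ st l r

    Claim : List Code → List ℕ → Set
    Claim l ps = (∀ {e} → e ∈ l → ¬ Bad e) → (∀ {x} → x ∈ ps → ¬ Blk x) → Goal

    cons-good : ∀ {e : Code} {l} → ¬ Bad e → (∀ {f} → f ∈ l → ¬ Bad f) → ∀ {f} → f ∈ e ∷ l → ¬ Bad f
    cons-good h g (here refl) = h
    cons-good h g (there i) = g i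

    cons-free : ∀ {x : ℕ} {l} → ¬ Blk x → (∀ {y} → y ∈ l → ¬ Blk y) → ∀ {y} → y ∈ x ∷ l → ¬ Blk y
    cons-free h g (here refl) = h
    cons-free h g (there i) = g i

    explore-sound : ∀ n {b K G Z} → State b K G Z → explore n b K G Z ≡ true → Goal
    tryPick-sound : ∀ n {b K G Z} → State b K G Z → ∀ p → tryPick n b K G Z p ≡ true → Goal
    edges-sound : ∀ n {b K G Z} → State b K G Z → ∀ l ps → Claim l ps → edges n b K G Z l ps ≡ true → Goal
    points-sound : ∀ n {b K G Z} → State b K G Z → ∀ ps → Claim [] ps → points n b K G Z ps ≡ true → Goal
    explore-sound (suc n) {K = K} {Z = Z} st h with ∨-true {dead K Z K} h
    ... | inj₁ p = ⊥-elim (dead-⊥ st K p)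
    ... | inj₂ q = tryPick-sound n st (pick K Z) q
    tryPick-sound n st (just i) h = edges-sound n st (es i) (pts i) (use i) h
    edges-sound n st [] ps c h = points-sound n st ps c h
    edges-sound n {zero} {K} st (e ∷ l) ps c h with ∧-true {not (mem e K)} h
    ... | p , q = edges-sound n st l ps (λ g → c (cons-good good g)) q
      where
      good : ¬ Bad e
      good bad = 1+n≰n (≤-trans (count (All-∉ _ e∉ ∷ State.uni st) (λ { (here refl) → bad ; (there k) → State.bad st k })) (≤-trans (State.bound st) (≤-reflexive (+-identityʳ _))))
        where
        e∉ : ¬ e ∈ K
        e∉ k with trans (sym p) (cong not (∈-mem k))
        ... | ()
    edges-sound n {suc b} {K} {G} st (e ∷ l) ps c h with ∧-true {not (mem e K)} h
    ... | p , q with mem e G in eg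
    ... | true = edges-sound n st l ps (λ g → c (cons-good (State.good st (mem-∈ e G eg)) g)) q
    ... | false with ∧-true {explore n b (e ∷ K) G _} q | Bad? e
    ... | q₁ , q₂ | yes bad = explore-sound n record { bad = λ { (here refl) → bad ; (there k) → State.bad st k }
            ; uni = All-∉ _ e∉ ∷ State.uni st ; bound = ≤-trans (State.bound st) (≤-reflexive (+-suc _ b)) ; good = State.good st ; blk = State.blk st } q₁
      where
      e∉ : ¬ e ∈ K
      e∉ k with trans (sym p) (cong not (∈-mem k))
      ... | ()
    ... | q₁ , q₂ | no g' = edges-sound n record { bad = State.bad st ; uni = State.uni st ; bound = State.bound st
            ; good = cons-good g' (State.good st) ; blk = State.blk st } l ps (λ g → c (cons-good g' g)) q₂
    points-sound n st [] c h = c (λ ()) (λ ())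
    points-sound n {Z = just z} st (x ∷ ps) c h with ∧-true {not (z ≡ᵇ x)} h
    ... | p , q = points-sound n st ps (λ g f → c g (cons-free free f)) q
      where
      free : ¬ Blk x
      free bx with one (State.blk st refl) bx
      ... | refl with trans (sym p) (cong not (≡ᵇ-refl z))
      ... | ()
    points-sound n {Z = nothing} st (x ∷ ps) c h with ∧-true {explore n _ _ _ (just x)} h | Blk? x
    ... | q₁ , q₂ | yes bx = explore-sound n record { bad = State.bad st ; uni = State.uni st ; bound = State.bound st ; good = State.good st ; blk = λ { refl → bx } } q₁
    ... | q₁ , q₂ | no free = points-sound n st ps (λ g f → c g (cons-free free f)) q₂

fin4 : ℕ → Fin 4
fin4 0 = #0
fin4 1 = #1
fin4 2 = #2
fin4 _ = #3

-- A vertex (a, x) of BH_2 is coded by 4a + x, an edge by the codes of its even and its odd end.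
vtx : ℕ → Vertex 2
vtx c = fin4 (c / 4) ∷ fin4 (c % 4) ∷ []

cd : Vertex 2 → ℕ
cd (a ∷ x ∷ []) = 4 * toℕ a + toℕ x

OK : ℕ → Set
OK c = cd (vtx c) ≡ c

ok-inj : ∀ {c d} → OK c → OK d → vtx c ≡ vtx d → c ≡ d
ok-inj p q e = trans (sym p) (trans (cong cd e) q)

all₂? : {P : Vertex 2 → Set} → (∀ v → Dec (P v)) → Dec (∀ v → P v)
all₂? {P} P? with allᶠ? (λ a → allᶠ? (λ x → P? (a ∷ x ∷ [])))
... | yes h = yes (λ { (a ∷ x ∷ []) → h a x })
... | no h = no (λ k → h (λ a x → k (a ∷ x ∷ [])))

vtx-cd : ∀ v → vtx (cd v) ≡ v
vtx-cd = toWitness {a? = all₂? (λ v → vtx (cd v) ≟ⱽ v)} tt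

ok-cd : ∀ v → OK (cd v)
ok-cd v = cong cd (vtx-cd v)

Adj? : ∀ {n} (x y : Vertex n) → Dec (Adj x y)
Adj? {n} x y with any? (λ i → (y ≟ⱽ nb i true x) ⊎-dec (y ≟ⱽ nb i false x)) (fins n)
... | yes h = yes (go h)
  where
  go : ∀ {l} → Any (λ i → (y ≡ nb i true x) ⊎ (y ≡ nb i false x)) l → Adj x y
  go (here {i} (inj₁ refl)) = adj-nb i true x
  go (here {i} (inj₂ refl)) = adj-nb i false x
  go (there k) = go k
... | no h = no (λ a → h (go (nb-adj a)))
  where
  mk : ∀ {l} i b → i ∈ l → y ≡ nb i b x → Any (λ i → (y ≡ nb i true x) ⊎ (y ≡ nb i false x)) l
  mk i true (here refl) e = here (inj₁ e)
  mk i false (here refl) e = here (inj₂ e)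
  mk i b (there k) e = there (mk i b k e)
  go : ∃[ i ] ∃[ b ] y ≡ nb i b x → Any (λ i → (y ≡ nb i true x) ⊎ (y ≡ nb i false x)) (fins n)
  go (i , b , e) = mk i b (fins-∈ i) e

ek : ℕ → ℕ → Code
ek c d = if par (vtx c) then c , d else d , c

esOf : List ℕ → List Code
esOf (c ∷ d ∷ l) = ek c d ∷ esOf (d ∷ l)
esOf _ = []

data CPath : ℕ → ℕ → List ℕ → Set where
  end : ∀ {c} → OK c → CPath c c (c ∷ [])
  _∷⟨_⟩_ : ∀ {c d e l} → OK c → Adj (vtx c) (vtx d) → CPath d e (d ∷ l) → CPath c e (c ∷ d ∷ l)

toCPath : ∀ c l → Maybe (∃[ e ] CPath c e (c ∷ l))
toCPath c l with cd (vtx c) ≟ⁿ c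
... | no _ = nothing
toCPath c [] | yes o = just (c , end o)
toCPath c (d ∷ l) | yes o with Adj? (vtx c) (vtx d) | toCPath d l
... | yes a | just (e , p) = just (e , o ∷⟨ a ⟩ p)
... | yes _ | nothing = nothing
... | no _ | _ = nothing

head-OK : ∀ {c e l} → CPath c e l → OK c
head-OK (end o) = o
head-OK (o ∷⟨ _ ⟩ _) = o

last-OK : ∀ {c e l} → CPath c e l → OK e
last-OK (end o) = o
last-OK (_ ∷⟨ _ ⟩ p) = last-OK p

record HamPath (s t : ℕ) : Set where
  constructor hamPath
  field
    codes : List ℕ
    path : CPath s t codes
    full : OV.Full (map vtx codes)

Full? : (l : List (Vertex 2)) → Dec (OV.Full l)
Full? l = all₂? (λ w → OV.occ w l ≟ⁿ 1)

-- Tables of paths carry no proofs; an entry counts only after this check of adjacency and coverage.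
toHam : List ℕ → Maybe (∃[ s ] ∃[ t ] HamPath s t)
toHam [] = nothing
toHam (c ∷ l) with toCPath c l | Full? (map vtx (c ∷ l))
... | just (e , p) | yes f = just (c , e , hamPath (c ∷ l) p f)
... | just _ | no _ = nothing
... | nothing | _ = nothing

between : ∀ s t → List (List ℕ) → List (HamPath s t)
between s t [] = []
between s t (l ∷ ls) with toHam l
... | nothing = between s t ls
... | just (s' , t' , h) with s' ≟ⁿ s | t' ≟ⁿ t
... | yes refl | yes refl = h ∷ between s t ls
... | yes _ | no _ = between s t ls
... | no _ | _ = between s t ls

record Aut : Set where
  field
    f g : Vertex 2 → Vertex 2
    gf : ∀ x → g (f x) ≡ x
    fg : ∀ x → f (g x) ≡ x
    adj : ∀ {x y} → Adj x y → Adj (f x) (f y)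
    par-f : ∀ x → par (f x) ≡ par x

  f-inj : ∀ {x y} → f x ≡ f y → x ≡ y
  f-inj {x} {y} e = trans (sym (gf x)) (trans (cong g e) (gf y))

-- The search in BH_2, relative to an automorphism σ that moves the tabulated paths to the required place.
module Frame (F : List (E 2)) (can : Canon F) (uniq : Unique F) (σ : Aut) {B : Vertex 2 → Set} (B? : ∀ x → Dec (B x)) where

  open Aut σ

  -- Validity of the codes, orientation and adjacency are included, so that distinct bad codes
  -- always stand for distinct faults.
  Bad : Code → Set
  Bad (a , b) = OK a × OK b × par (vtx a) ≡ true × Adj (vtx a) (vtx b) × InL F (f (vtx a)) (f (vtx b))

  Bad? : ∀ e → Dec (Bad e)
  Bad? (a , b) = (cd (vtx a) ≟ⁿ a) ×-dec ((cd (vtx b) ≟ⁿ b) ×-dec ((par (vtx a) ≟ᵇ true) ×-dec (Adj? (vtx a) (vtx b) ×-dec InL? F (f (vtx a)) (f (vtx b)))))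

  Blk : ℕ → Set
  Blk x = OK x × B (f (vtx x))

  Blk? : ∀ x → Dec (Blk x)
  Blk? x = (cd (vtx x) ≟ⁿ x) ×-dec B? (f (vtx x))

  real : Code → E 2
  real (a , b) = f (vtx a) , f (vtx b)

  real-∈ : ∀ {e} → Bad e → real e ∈ F
  real-∈ {a , b} (_ , _ , p , adj-ab , i) = subst (_∈ F) eq (edge-∈ can (adj-par (adj adj-ab)) i)
    where
    eq : edge (f (vtx a)) (f (vtx b)) ≡ (f (vtx a) , f (vtx b))
    eq rewrite par-f (vtx a) | p = refl

  real-inj : ∀ {e e'} → Bad e → Bad e' → real e ≡ real e' → e ≡ e'
  real-inj (o , o' , _) (q , q' , _) h = cong₂ _,_ (ok-inj o q (f-inj (cong proj₁ h))) (ok-inj o' q' (f-inj (cong proj₂ h)))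

  module _ {xs : List Code} (u : Unique xs) (h : ∀ {e} → e ∈ xs → Bad e) where
    reals-Unique : Unique (map real xs)
    reals-Unique = Unique-map real (λ i j → real-inj (h i) (h j)) u

    count : length xs ≤ length F
    count = subst (_≤ length F) (length-map real xs) (⊆-length reals-Unique sub)
      where
      sub : ∀ {r} → r ∈ map real xs → r ∈ F
      sub i with ∈-map⁻ real i
      ... | e , j , refl = real-∈ (h j)

  limit : ∀ x {xs} → Unique xs → (∀ {e} → e ∈ xs → Bad e × touches x e ≡ true) → length xs ≤ length (badN F (f (vtx x)))
  limit x {xs} u h = subst₂ _≤_ (length-map real xs) (length-map (edge (f (vtx x))) (badN F (f (vtx x)))) (⊆-length (reals-Unique u (proj₁ ∘ h)) sub)
    where
    sub : ∀ {r} → r ∈ map real xs → r ∈ star F (f (vtx x))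
    sub i with ∈-map⁻ real i
    ... | (a , b) , j , refl with h j
    ... | (oa , ob , p , ab , inF) , z with ∨-true {x ≡ᵇ a} z
    ... | inj₁ xa with ≡ᵇ-true {x} xa
    ... | refl = subst (_∈ star F (f (vtx x))) eq (∈-map⁺ (edge (f (vtx x))) (∈-badN {F = F} (adj ab) inF))
      where
      eq : edge (f (vtx x)) (f (vtx b)) ≡ (f (vtx x) , f (vtx b))
      eq rewrite par-f (vtx x) | p = refl
    sub i | (a , b) , j , refl | (oa , ob , p , ab , inF) , z | inj₂ xb with ≡ᵇ-true {x} xb
    ... | refl = subst (_∈ star F (f (vtx x))) eq (∈-map⁺ (edge (f (vtx x))) (∈-badN {F = F} (adj (adj-sym ab)) (InL-sym inF)))
      where
      eq : edge (f (vtx x)) (f (vtx a)) ≡ (f (vtx a) , f (vtx x))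
      eq rewrite par-f (vtx x) | adj-par ab | p = refl

  bad-ek : ∀ {c d} → OK c → OK d → Adj (vtx c) (vtx d) → InL F (f (vtx c)) (f (vtx d)) → Bad (ek c d)
  bad-ek {c} {d} oc od a i with par (vtx c) in e
  ... | true = oc , od , e , a , i
  ... | false = od , oc , trans (adj-par a) (cong not e) , adj-sym a , InL-sym i

  real-ek : ∀ {c d} → Adj (vtx c) (vtx d) → real (ek c d) ≡ edge (f (vtx c)) (f (vtx d))
  real-ek {c} {d} a rewrite par-f (vtx c) with par (vtx c)
  ... | true = refl
  ... | false = refl

  toPath : ∀ {E : Vertex 2 → Vertex 2 → Set} {s t l} → CPath s t l → (∀ {c d} → OK c → OK d → Adj (vtx c) (vtx d) → ek c d ∈ esOf l → E (vtx c) (vtx d)) → Path E (vtx s) (vtx t) (map vtx l)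
  toPath (end _) h = stop _
  toPath (o ∷⟨ a ⟩ p) h = h o (head-OK p) a (here refl) ▸ toPath p (λ o o' a i → h o o' a (there i))

  ham : ∀ {E : Vertex 2 → Vertex 2 → Set} {s t} (p : HamPath s t) → (∀ {c d} → OK c → OK d → Adj (vtx c) (vtx d) → ek c d ∈ esOf (HamPath.codes p) → E (f (vtx c)) (f (vtx d))) →
    ∃[ l ] (Path E (f (vtx s)) (f (vtx t)) l × OV.Full l)
  ham {E} p h = transport _≟ⱽ_ _≟ⱽ_ f g gf fg {E = λ x y → E (f x) (f y)} id (map vtx (HamPath.codes p) , toPath (HamPath.path p) h , HamPath.full p)

  useHP : ∀ {s t} (p : HamPath s t) → (∀ {e} → e ∈ esOf (HamPath.codes p) → ¬ Bad e) → HP F (f (vtx s)) (f (vtx t))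
  useHP p good = ham p (λ o o' a i → adj a , λ k → good i (bad-ek o o' a k))

  without-h : Code → List Code → List Code
  without-h h = sel (λ e → (e == h) ≟ᵇ false)

  useIn : ∀ {s t} (p : HamPath s t) h → (∀ {e} → e ∈ without-h h (esOf (HamPath.codes p)) → ¬ Bad e) →
    HP (without (real h) F) (f (vtx s)) (f (vtx t))
  useIn p h good = ham p step'
    where
    step' : ∀ {c d} → OK c → OK d → Adj (vtx c) (vtx d) → ek c d ∈ esOf (HamPath.codes p) → AdjF (without (real h) F) (f (vtx c)) (f (vtx d))
    step' {c} {d} o o' a i = adj a , no-fault
      where
      no-fault : ¬ InL (without (real h) F) (f (vtx c)) (f (vtx d))
      no-fault k with ek c d == h in e
      ... | false = good (∈-sel⁺ (λ e → (e == h) ≟ᵇ false) i e) (bad-ek o o' a (without-InL {h = real h} {F} k))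
      ... | true = without-∉ {h = real h} {F} (subst (_∈ without (real h) F) (trans (sym (real-ek {c} {d} a)) (cong real (==-true {ek c d} {h} e))) (edge-∈ (without-canon can) (adj-par (adj a)) k))

digits : ℕ → ℕ → List ℕ
digits zero k = []
digits (suc n) k = (k % 16) ∷ digits n (k / 16)

meet : List Code → List Code → List Code
meet K [] = []
meet K (e ∷ es) = if mem e K then e ∷ meet K es else meet K es

Ready : ℕ → ℕ → Set
Ready s t = HamPath s t × List Code

-- The tables list Hamiltonian paths with given ends, in base 16, together with their edges.
ready : ∀ s t → List ℕ → List (Ready s t)
ready s t ns = map (λ p → p , esOf (HamPath.codes p)) (between s t (map (digits 16) ns))

record Hit : Set where
  constructor hit
  field
    a b : ℕ
    oka : OK a
    okb : OK b

toHit : Code → Maybe Hit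
toHit (a , b) with cd (vtx a) ≟ⁿ a | cd (vtx b) ≟ⁿ b
... | yes p | yes q = just (hit a b p q)
... | _ | _ = nothing

pickHP : ∀ {s t} → List (Ready s t) → List Code → Maybe ℕ → Maybe (HamPath s t)
pickHP [] K Z = nothing
pickHP ((p , es) ∷ ps) K Z with meet K es
... | [] = just p
... | _ ∷ _ = pickHP ps K Z

InIx : ℕ → ℕ → Set
InIx s t = HamPath s t × Maybe Hit

pickIn : ∀ {s t} → List (Ready s t) → List Code → Maybe ℕ → Maybe (InIx s t)
pickIn [] K Z = nothing
pickIn ((p , es) ∷ ps) K Z with meet K es
... | [] = just (p , nothing)
... | _ ∷ _ ∷ _ = pickIn ps K Z
... | (a , b) ∷ [] with is Z a ∨ is Z b | toHit (a , b)
... | false | just h = just (p , just h)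
... | _ | _ = pickIn ps K Z

record OutIx : Set where
  constructor opened
  field
    s t : ℕ
    p : HamPath s t
    even-s : par (vtx s) ≡ true
    odd-t : par (vtx t) ≡ false

toOut : List ℕ → Maybe OutIx
toOut l with toHam l
... | nothing = nothing
... | just (s , t , p) with par (vtx s) ≟ᵇ true | par (vtx t) ≟ᵇ false
... | yes e | yes o = just (opened s t p e o)
... | _ | _ = nothing

-- The sixteen Hamiltonian paths obtained by opening a Hamiltonian cycle, each with the removed edge.
openings : ℕ → List ℕ → List (Code × Maybe OutIx)
openings (suc n) (a ∷ b ∷ l) = ((a , b) , toOut (a ∷ reverse (b ∷ l))) ∷ ((a , last l) , toOut (a ∷ b ∷ l)) ∷ openings n (l ++ a ∷ b ∷ [])
  where
  last : List ℕ → ℕ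
  last [] = b
  last (x ∷ []) = x
  last (_ ∷ l) = last l
openings _ _ = []

Cycle : Set
Cycle = List Code × List (Code × Maybe OutIx)

cycles : List ℕ → List Cycle
cycles = map (λ n → cyc (digits 16 n))
  where
  cyc : List ℕ → Cycle
  cyc l = map (λ { ((a , b) , _) → ek a b }) (openings 8 l) , openings 8 l

-- A cycle with one known fault must be opened at this fault; a cycle without one may be opened at
-- any edge whose ends are not known to be blocked.
pickOut : List Cycle → List Code → Maybe ℕ → Maybe OutIx
pickOut [] K Z = nothing
pickOut ((es , os) ∷ cs) K Z with meet K es
... | _ ∷ _ ∷ _ = pickOut cs K Z
... | hs = try os
  where
  allowed : List Code → ℕ → ℕ → Bool
  allowed [] a b = true
  allowed (h ∷ _) a b = h == ek a b
  try : List (Code × Maybe OutIx) → Maybe OutIx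
  try [] = pickOut cs K Z
  try (((a , b) , o) ∷ os) with allowed hs a b ∧ not (is Z a ∨ is Z b) | o
  ... | true | just i = just i
  ... | _ | _ = try os

esIn : ∀ {s t} → InIx s t → List Code
esIn (p , nothing) = esOf (HamPath.codes p)
esIn (p , just h) = sel (λ e → (e == (Hit.a h , Hit.b h)) ≟ᵇ false) (esOf (HamPath.codes p))

ptsIn : ∀ {s t} → InIx s t → List ℕ
ptsIn (p , nothing) = []
ptsIn (p , just h) = Hit.a h ∷ Hit.b h ∷ []

module AdvHP {s t : ℕ} (tab : List (Ready s t)) (lim : ℕ) = Adversary (λ (p : HamPath s t) → esOf (HamPath.codes p)) (λ _ → []) (pickHP tab) lim
module AdvIn {s t : ℕ} (tab : List (Ready s t)) = Adversary (esIn {s} {t}) ptsIn (pickIn tab) 4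
module AdvOut (tab : List Cycle) = Adversary (λ i → esOf (HamPath.codes (OutIx.p i))) (λ i → OutIx.s i ∷ OutIx.t i ∷ []) (pickOut tab) 4

-- The versions of `Through` and `Ends` delivered by the search; in the second alternative the fault
-- between `r` and `t` is restored.
Thr : ∀ {n} → List (E n) → (Vertex n → Set) → Vertex n → Vertex n → Set
Thr F B u v = HP F u v ⊎ ∃[ r ] ∃[ t ] (¬ B r × ¬ B t × HP (without (r , t) F) u v)

End : ∀ {n} → List (E (suc n)) → (Vertex (suc n) → Set) → Set
End F B = ∃[ x ] ∃[ y ] (par x ≡ true × par y ≡ false × HP F x y × ¬ B x × ¬ B y)

module Results (F : List (E 2)) (can : Canon F) (uniq : Unique F) (σ : Aut) where

  open Aut σ

  -- Candidates have no vertices to test here, so each recursive call of `explore` reveals a fault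
  -- and the fuel cannot run out before the faults do.
  hpResult : ∀ {s t} (tab : List (Ready s t)) lim → (∀ x → length (badN F x) < lim) →
    AdvHP.explore tab lim (2 + length F) (length F) [] [] nothing ≡ true → HP F (f (vtx s)) (f (vtx t))
  hpResult tab lim low h = explore-sound (2 + length F) record { bad = λ () ; uni = [] ; bound = ≤-refl ; good = λ () ; blk = λ () } h
    where
    open Frame F can uniq σ {λ _ → ⊥} (λ _ → no id)
    open AdvHP tab lim
    open Sound Bad? Blk? (λ u h → count u h) (λ x u h → ≤-trans (s≤s (limit x u h)) (low _)) (λ x b → ⊥-elim (proj₂ b)) (λ b → ⊥-elim (proj₂ b)) (λ p g _ → useHP p g)

  module Blocking {B : Vertex 2 → Set} (B? : ∀ x → Dec (B x)) (one : ∀ {x y} → B x → B y → x ≡ y)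
    (low : ∀ x → length (badN F x) < 4) (lowB : ∀ x → B x → length (badN F x) < 3) where

    open Frame F can uniq σ B? public

    one' : ∀ {x y} → Blk x → Blk y → x ≡ y
    one' (ox , bx) (oy , by) = ok-inj ox oy (f-inj (one bx by))

    Known : List Code → Set
    Known K = Unique K × (∀ {e} → e ∈ K → Bad e)

    inResult : ∀ {s t} (tab : List (Ready s t)) {b K G Z} → Known K → length F ≤ length K + b → (∀ {e} → e ∈ G → ¬ Bad e) → (∀ {z} → Z ≡ just z → Blk z) →
      AdvIn.explore tab (3 + b) b K G Z ≡ true → Thr F B (f (vtx s)) (f (vtx t))
    inResult {s} {t} tab {b} (u , bad) le good blk h = explore-sound (3 + b) record { bad = bad ; uni = u ; bound = le ; good = good ; blk = blk } h
      where
      use : ∀ (i : InIx s t) → (∀ {e} → e ∈ esIn i → ¬ Bad e) → (∀ {x} → x ∈ ptsIn i → ¬ Blk x) → Thr F B (f (vtx s)) (f (vtx t))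
      use (p , nothing) g _ = inj₁ (useHP p g)
      use (p , just (hit a b oa ob)) g n = inj₂ (f (vtx a) , f (vtx b) , (λ k → n (here refl) (oa , k)) , (λ k → n (there (here refl)) (ob , k)) , useIn p (a , b) g)
      open AdvIn tab
      open Sound Bad? Blk? (λ u h → count u h) (λ x u h → ≤-trans (s≤s (limit x u h)) (low _)) (λ x k u h → ≤-trans (s≤s (limit x u h)) (lowB _ (proj₂ k))) one' use

    outResult : (tab : List Cycle) → ∀ {b K G Z} → Known K → length F ≤ length K + b → (∀ {e} → e ∈ G → ¬ Bad e) → (∀ {z} → Z ≡ just z → Blk z) →
      AdvOut.explore tab (3 + b) b K G Z ≡ true → End F B
    outResult tab {b} (u , bad) le good blk h = explore-sound (3 + b) record { bad = bad ; uni = u ; bound = le ; good = good ; blk = blk } h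
      where
      use : ∀ (i : OutIx) → (∀ {e} → e ∈ esOf (HamPath.codes (OutIx.p i)) → ¬ Bad e) → (∀ {x} → x ∈ OutIx.s i ∷ OutIx.t i ∷ [] → ¬ Blk x) → End F B
      use (opened s t p es ot) g n = f (vtx s) , f (vtx t) , trans (par-f (vtx s)) es , trans (par-f (vtx t)) ot , useHP p g ,
        (λ k → n (here refl) (head-OK (HamPath.path p) , k)) , (λ k → n (there (here refl)) (last-OK (HamPath.path p) , k))
      open AdvOut tab
      open Sound Bad? Blk? (λ u h → count u h) (λ x u h → ≤-trans (s≤s (limit x u h)) (low _)) (λ x k u h → ≤-trans (s≤s (limit x u h)) (lowB _ (proj₂ k))) one' use

-- Automorphisms of BH_2 and the base cases.

allᵇ? : {P : Bool → Set} → (∀ b → Dec (P b)) → Dec (∀ b → P b)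
allᵇ? P? with P? true | P? false
... | yes p | yes q = yes (λ { true → p ; false → q })
... | no h | _ = no (λ k → h (k true))
... | yes _ | no h = no (λ k → h (k false))

add : Fin 4 → Fin 4 → Fin 4
add #0 x = x
add #1 x = inc4 x
add #2 x = tw4 x
add #3 x = dec4 x

neg : Fin 4 → Fin 4
neg #0 = #0
neg #1 = #3
neg #2 = #2
neg #3 = #1

-- Automorphisms of BH_2: w exchanges the two dimensions, e and o exchange the twins among the even and the odd vertices, t translates.
act : Bool → Bool → Bool → Fin 4 → Vertex 2 → Vertex 2
act w e o t (a ∷ x ∷ []) = (if (if pe a then e else o) then tw4 a else a) ∷ add t (if w then hgt (pe a) (x ∷ []) else x) ∷ []

actInv : Bool → Bool → Bool → Fin 4 → Vertex 2 → Vertex 2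
actInv w e o t = act w e o (if w then t else neg t)

swapDim : Bool → Fin 2 → Fin 2
swapDim false d = d
swapDim true zero = suc zero
swapDim true (suc zero) = zero

forAll? : {P : Bool → Bool → Bool → Fin 4 → Set} → (∀ w e o t → Dec (P w e o t)) → Dec (∀ w e o t → P w e o t)
forAll? P? = allᵇ? (λ w → allᵇ? (λ e → allᵇ? (λ o → allᶠ? (λ t → P? w e o t))))

abstract
  act-gf : ∀ w e o t x → actInv w e o t (act w e o t x) ≡ x
  act-gf = toWitness {a? = forAll? (λ w e o t → all₂? (λ x → actInv w e o t (act w e o t x) ≟ⱽ x))} tt

  act-fg : ∀ w e o t x → act w e o t (actInv w e o t x) ≡ x
  act-fg = toWitness {a? = forAll? (λ w e o t → all₂? (λ x → act w e o t (actInv w e o t x) ≟ⱽ x))} tt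

  act-par : ∀ w e o t x → par (act w e o t x) ≡ par x
  act-par = toWitness {a? = forAll? (λ w e o t → all₂? (λ x → par (act w e o t x) ≟ᵇ par x))} tt

  act-tw : ∀ w e o t x → act w e o t (tw x) ≡ tw (act w e o t x)
  act-tw = toWitness {a? = forAll? (λ w e o t → all₂? (λ x → act w e o t (tw x) ≟ⱽ tw (act w e o t x)))} tt

  act-nb' : ∀ w e o t x d b → act w e o t (nb d b x) ≡ nb (swapDim w d) true (act w e o t x) ⊎ act w e o t (nb d b x) ≡ nb (swapDim w d) false (act w e o t x)
  act-nb' = toWitness {a? = forAll? (λ w e o t → all₂? (λ x → allᶠ? (λ d → allᵇ? (λ b →
    (act w e o t (nb d b x) ≟ⱽ nb (swapDim w d) true (act w e o t x)) ⊎-dec (act w e o t (nb d b x) ≟ⱽ nb (swapDim w d) false (act w e o t x))))))} tt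

act-nb : ∀ w e o t x d b → ∃[ b' ] act w e o t (nb d b x) ≡ nb (swapDim w d) b' (act w e o t x)
act-nb w e o t x d b with act-nb' w e o t x d b
... | inj₁ h = true , h
... | inj₂ h = false , h

auto : Bool → Bool → Bool → Fin 4 → Aut
auto w e o t = record
  { f = act w e o t ; g = actInv w e o t ; gf = act-gf w e o t ; fg = act-fg w e o t ; par-f = act-par w e o t
  ; adj = λ {x} a → act-adj (nb-adj a) }
  where
  act-adj : ∀ {x y} → ∃[ d ] ∃[ b ] y ≡ nb d b x → Adj (act w e o t x) (act w e o t y)
  act-adj {x} (d , b , refl) with act-nb w e o t x d b
  ... | b' , h = subst (Adj (act w e o t x)) (sym h) (adj-nb (swapDim w d) b' _)

-- The automorphism carrying vertex 0 to the even vertex u and one of the vertices 4, 6 to the odd vertex v.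
frameAut : Bool → Vertex 2 → Vertex 2 → Aut
frameAut w (a ∷ x ∷ []) (c ∷ y ∷ []) = auto w (does (a ≟ᶠ #2)) (does (c ≟ᶠ #3)) x

frame : Bool → Vertex 2 → Vertex 2 → Vertex 2 → Vertex 2
frame w u v = Aut.f (frameAut w u v)

abstract
  -- Up to automorphism there are two kinds of pairs of opposite parity: adjacent ones, like 0 and
  -- 4, and non-adjacent ones, like 0 and 6.
  frame-pair' : ∀ u → par u ≡ true → ∀ v → par v ≡ false →
    (frame true u v (vtx 0) ≡ u × (frame true u v (vtx 4) ≡ v ⊎ frame true u v (vtx 6) ≡ v)) ⊎ (frame false u v (vtx 0) ≡ u × (frame false u v (vtx 4) ≡ v ⊎ frame false u v (vtx 6) ≡ v))
  frame-pair' = toWitness {a? = all₂? (λ u → (par u ≟ᵇ true) →-dec all₂? (λ v → (par v ≟ᵇ false) →-dec (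
      ((frame true u v (vtx 0) ≟ⱽ u) ×-dec ((frame true u v (vtx 4) ≟ⱽ v) ⊎-dec (frame true u v (vtx 6) ≟ⱽ v))) ⊎-dec
      ((frame false u v (vtx 0) ≟ⱽ u) ×-dec ((frame false u v (vtx 4) ≟ⱽ v) ⊎-dec (frame false u v (vtx 6) ≟ⱽ v))))))} tt

  frame-edge' : ∀ u → par u ≡ true → ∀ d b → frame (does (d ≟ᶠ suc zero)) u (nb d b u) (vtx 0) ≡ u × frame (does (d ≟ᶠ suc zero)) u (nb d b u) (vtx 4) ≡ nb d b u
  frame-edge' = toWitness {a? = all₂? (λ u → (par u ≟ᵇ true) →-dec allᶠ? (λ d → allᵇ? (λ b →
    (frame (does (d ≟ᶠ suc zero)) u (nb d b u) (vtx 0) ≟ⱽ u) ×-dec (frame (does (d ≟ᶠ suc zero)) u (nb d b u) (vtx 4) ≟ⱽ nb d b u))))} tt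

paths₄ : List ℕ
paths₄ =
  4885124640523507920 ∷ 4885273592128460880 ∷ 5438766538690906320 ∷ 5459482542479104080 ∷ 4898484080472738000 ∷ 4862446519420386240 ∷
  5474795330886363600 ∷ 5247232823927138640 ∷ 5436909978948102480 ∷ 5213428266437407680 ∷ 4862315097877104720 ∷ 5247073356472351680 ∷
  4860064577524722000 ∷ 5438909036677914960 ∷ 4898484112298500560 ∷ 4884393364788240720 ∷ 5211063323645372880 ∷ 4860203593586201040 ∷
  5472553542723168720 ∷ 5438927541696096720 ∷ 5459333595152341200 ∷ 5472938775958677840 ∷ 4884384600915339600 ∷ 5474945412309873600 ∷
  5247073904072848320 ∷ 5460704065840409040 ∷ 4862746763546155200 ∷ 5245553863748604240 ∷ 4885133404529612880 ∷ 5436655549662386640 ∷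
  5247092636186241360 ∷ 5438775330202645440 ∷ 4896083326754520000 ∷ 5245553897974092240 ∷ 5438907274031778000 ∷ 5211204576655600080 ∷
  5472563801547760080 ∷ 4896232388457714000 ∷ 5459473780745820240 ∷ 5243310896392034640 ∷ 4860205315013566800 ∷ 4898729273713125840 ∷
  5249335639907426640 ∷ 4898643584801691840 ∷ 5213447030629360080 ∷ 5211185810324552640 ∷ 5438916111209386320 ∷ 5436964477894514880 ∷
  5245413712380156240 ∷ 5243170706520365520 ∷ 4860054609760672080 ∷ 4860205315005178320 ∷ 5472563803561027920 ∷ 4862475587633178960 ∷
  4862700511062286800 ∷ 4862756073021462720 ∷ 4860203515566029760 ∷ 5474804097434765520 ∷ 5243310862166514000 ∷ 5460854116957446480 ∷
  4884252627299885520 ∷ 5459333595286034640 ∷ 5460712861933429200 ∷ 4885264830528870480 ∷ 4896111845337358800 ∷ 4885133402256791760 ∷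
  4860054536464353360 ∷ 5472563801405188560 ∷ 4862747311288178880 ∷ 5472843775566502080 ∷ 5472684821118699600 ∷ []

paths₆ : List ℕ
paths₆ =
  7706478997730982720 ∷ 7125215060745157440 ∷ 7708976022881989440 ∷ 7632038944171413840 ∷ 7014595988517243840 ∷ 7096485832149817680 ∷
  7050599947606616400 ∷ 7132514627021787600 ∷ 7050764288095091520 ∷ 7132149038556768720 ∷ 7591047976814103360 ∷ 7629795938311655760 ∷
  7625133423686010960 ∷ 7708970085349185600 ∷ 7096541517859800000 ∷ 7701535623302247360 ∷ 7706629733787159360 ∷ 7130125626204838080 ∷
  7096231938880699200 ∷ 7589104626524997840 ∷ 7053475375879870800 ∷ 7672946584319513040 ∷ []

hamCycles : List ℕ
hamCycles =
  15589739434570662720 ∷ 15621653893579106640 ∷ 6402396158369712960 ∷ 14072467882632140880 ∷ 15587356208891904960 ∷ 15585765834040664400 ∷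
  6398474747439117120 ∷ 6402255970637693760 ∷ 14646825782448609360 ∷ 6440987234092046400 ∷ 15126037850932537680 ∷ 14083577349720858960 ∷
  15619595016558246720 ∷ 14695924911871521600 ∷ 14696170109684834640 ∷ 15700238555163589440 ∷ 15700379306224080960 ∷ 15089849806052608080 ∷
  15666461023796287680 ∷ 6476696109726200640 ∷ 15125717870206188480 ∷ 15583523377927809360 ∷ 5866637747839091520 ∷ 15700378957911739200 ∷
  6402396192595233600 ∷ 15087757802076828480 ∷ 15619410889850087760 ∷ 6443229268725168960 ∷ 15126179136020834640 ∷ 14085847074732140880 ∷
  15589599246837599040 ∷ 15085031228256187200 ∷ 15621654475404601680 ∷ 15589739400345142080 ∷ 15664330225309350720 ∷ 6474148742728676160 ∷
  15090130068903754560 ∷ 14072467882498447440 ∷ 5866458325732457280 ∷ 6443088531236846400 ∷ 15661483184332372800 ∷ 15125738413049497680 ∷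
  15664217985850104000 ∷ 14083426573319096400 ∷ 14119483334449588560 ∷ 14662288104537387840 ∷ 14085827395886567760 ∷ 14121847394665027920 ∷
  14071727290995370320 ∷ 15619411437458940240 ∷ 6402255970637171520 ∷ 14662139125301463120 ∷ 15084889941012050880 ∷ 15699938056205977680 ∷
  14085932325824784720 ∷ 15123918205742533440 ∷ 14660141310660501840 ∷ 15621705494910661440 ∷ 15702488813199422400 ∷ 6440986922286891840 ∷
  14659897330176221520 ∷ 15619454244844403520 ∷ 15699927372585433920 ∷ 15583566219539282880 ∷ 15666461740761631680 ∷ 6400012969056125760 ∷
  14083577349720336720 ∷ 15126037830237247680 ∷ 15702489807277154640 ∷ 14695935290785849680 ∷ 14119596101089262400 ∷ 15123918540248869200 ∷
  15621654475412957520 ∷ 15126168832743537600 ∷ 15702630723365653440 ∷ 6477014512267656000 ∷ 15587496396623924160 ∷ []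

few-faults : ∀ {n} {F : List (E (suc n))} → Canon F → ∀ x → length (badN F x) ≤ length F
few-faults {F = F} c x = subst (_≤ length F) (length-map (edge x) (badN F x)) (⊆-length (star-Unique F x) (star-⊆ c))

abstract
  lace₄ : ∀ k → k ≤ 2 → AdvHP.explore (ready 0 4 paths₄) 3 (2 + k) k [] [] nothing ≡ true
  lace₄ 0 _ = refl
  lace₄ 1 _ = refl
  lace₄ 2 _ = refl
  lace₄ (suc (suc (suc k))) (s≤s (s≤s ()))

  lace₆ : ∀ k → k ≤ 2 → AdvHP.explore (ready 0 6 paths₆) 3 (2 + k) k [] [] nothing ≡ true
  lace₆ 0 _ = refl
  lace₆ 1 _ = refl
  lace₆ 2 _ = refl
  lace₆ (suc (suc (suc k))) (s≤s (s≤s ()))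

  -- With three faults the limit 3 is the degree condition: BH_2 is 4-regular, so at most two edges
  -- at a vertex are faulty.
  cond₄ : ∀ k → k ≤ 3 → AdvHP.explore (ready 0 4 paths₄) 3 (2 + k) k [] [] nothing ≡ true
  cond₄ 0 _ = refl
  cond₄ 1 _ = refl
  cond₄ 2 _ = refl
  cond₄ 3 _ = refl
  cond₄ (suc (suc (suc (suc k)))) (s≤s (s≤s (s≤s ())))

dedup : ∀ {n} (F : List (E n)) → ∃[ F' ] (Unique F' × length F' ≤ length F × (∀ {r} → r ∈ F → r ∈ F') × (∀ {r} → r ∈ F' → r ∈ F))
dedup [] = [] , [] , z≤n , id , id
dedup (r ∷ F) with dedup F
... | F' , u , le , to , from with any? (r ≟ᴱ_) F'
... | yes i = F' , u , ≤-trans le (n≤1+n _) , (λ { (here refl) → i ; (there j) → to j }) , there ∘ from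
... | no h = r ∷ F' , All-∉ _ h ∷ u , s≤s le , (λ { (here refl) → here refl ; (there j) → there (to j) }) , (λ { (here refl) → here refl ; (there j) → there (from j) })

HP-mono : ∀ {n} {F F' : List (E n)} → (∀ {r} → r ∈ F → r ∈ F') → ∀ {u v} → HP F' u v → HP F u v
HP-mono sub (l , p , f) = l , pathMono (λ { (a , h) → a , λ { (inj₁ i) → h (inj₁ (sub i)) ; (inj₂ i) → h (inj₂ (sub i)) } }) p , f

HP-ends : ∀ {n} {F : List (E n)} {u u' v v'} → u ≡ u' → v ≡ v' → HP F u v → HP F u' v'
HP-ends refl refl h = h

lace-unique : ∀ (F : List (E 2)) → Canon F → Unique F → length F ≤ 2 → ∀ {u v} → par u ≡ true → par v ≡ false → HP F u v
lace-unique F can uniq le {u} {v} eu ev = go (frame-pair' u eu v ev)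
  where
  low : ∀ x → length (badN F x) < 3
  low x = s≤s (≤-trans (few-faults can x) le)
  by : ∀ w → (frame w u v (vtx 0) ≡ u × (frame w u v (vtx 4) ≡ v ⊎ frame w u v (vtx 6) ≡ v)) → HP F u v
  by w (e , inj₁ e') = HP-ends e e' (Results.hpResult F can uniq (frameAut w u v) (ready 0 4 paths₄) 3 low (lace₄ (length F) le))
  by w (e , inj₂ e') = HP-ends e e' (Results.hpResult F can uniq (frameAut w u v) (ready 0 6 paths₆) 3 low (lace₆ (length F) le))
  go : _ → HP F u v
  go (inj₁ h) = by true h
  go (inj₂ h) = by false h

lace₁ : Laceable 1
lace₁ F can le eu ev with dedup F
... | F' , u , le' , to , from = HP-mono to (lace-unique F' (can ∘ from) u (≤-trans le' le) eu ev)

cond₁ : Conditional 1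
cond₁ F can uniq le δ {u} eu ev a with nb-adj a
... | d , b , refl with frame-edge' u eu d b
... | e , e' = HP-ends e e' (Results.hpResult F can uniq (frameAut (does (d ≟ᶠ suc zero)) u (nb d b u)) (ready 0 4 paths₄) 3 low (cond₄ (length F) (≤-pred le)))
  where
  low : ∀ x → length (badN F x) < 3
  low x = s≤s (+-cancelʳ-≤ 2 _ _ (≤-trans (+-monoʳ-≤ (length (badN F x)) (δ x)) (≤-reflexive (deg-bad F x))))

-- Configurations of five faults in BH_2.

-- For some parameters the edges listed in a configuration coincide, and only distinct ones may be
-- charged to the budget of five.
distinct : List Code → List Code
distinct [] = []
distinct (e ∷ K) = if mem e (distinct K) then distinct K else e ∷ distinct K

distinct-∈ : ∀ {e} K → e ∈ distinct K → e ∈ K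
distinct-∈ (f ∷ K) i with mem f (distinct K)
... | true = there (distinct-∈ K i)
distinct-∈ (f ∷ K) (here refl) | false = here refl
distinct-∈ (f ∷ K) (there i) | false = there (distinct-∈ K i)

distinct-Unique : ∀ K → Unique (distinct K)
distinct-Unique [] = []
distinct-Unique (f ∷ K) with mem f (distinct K) in eq
... | true = distinct-Unique K
... | false = All-∉ _ (λ i → false≢true (trans (sym eq) (∈-mem i))) ∷ distinct-Unique K
  where
  false≢true : ¬ false ≡ true
  false≢true ()

ec : Vertex 2 → Fin 2 → Bool → Code
ec z d b = ek (cd z) (cd (nb d b z))

-- Three of the four edges of dimension 0 between a pair of even twins and their common neighbours.
three : Vertex 2 → Bool → List Code
three y b = ec y zero b ∷ ec (tw y) zero true ∷ ec (tw y) zero false ∷ []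

-- The codes 0 and 4 stand for the ends of the given edge. This edge is good, so configurations that
-- contain it do not occur.
runIn : List (Ready 0 4) → List Code → List Code → Maybe ℕ → Bool
runIn tab K G Z = mem (0 , 4) K ∨ AdvIn.explore tab (3 + (5 ∸ length (distinct K))) (5 ∸ length (distinct K)) (distinct K) G Z

runOut : List Cycle → List Code → List Code → Maybe ℕ → Bool
runOut tab K G Z = AdvOut.explore tab (3 + (5 ∸ length (distinct K))) (5 ∸ length (distinct K)) (distinct K) G Z

Runs : Set
Runs = List Code → List Code → Maybe ℕ → Bool

-- In `KC`, taken at vertex 0, the given edge is the only good one of its line. `KX` is the trace,
-- in a copy of another splitting, of a pinched vertex `z` and the faults at its twin.
KC KX : Vertex 2 → List Code
KC y = ec y zero false ∷ ec (tw y) zero true ∷ ec (tw y) zero false ∷ []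
KX z = ec z zero true ∷ ec z zero false ∷ ec (tw z) (suc zero) true ∷ ec (tw z) (suc zero) false ∷ []

evenV : List (Vertex 2)
evenV = map vtx (0 ∷ 1 ∷ 2 ∷ 3 ∷ 8 ∷ 9 ∷ 10 ∷ 11 ∷ [])

otherOnes : Code → List Code
otherOnes r = sel (λ e → (e == r) ≟ᵇ false) (both (λ v d → ec v (suc zero) d) evenV)

maybeTw : ∀ {n} → Bool → Vertex (suc n) → Vertex (suc n)
maybeTw true z = tw z
maybeTw false z = z

-- These are the configurations that remain when n = 3: X comes from a pinched vertex, the variants
-- of A from a blocked vertex `z` with a fault next to three faults on a line, B from faults on two
-- lines.
record CfgX (run : Runs) : Set where
  field
    get : ∀ z → run (KX z) [] (just (cd z)) ≡ true

record CfgA₀ (run : Runs) : Set where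
  field
    get : ∀ z c s b → run (ec z (suc zero) c ∷ three (maybeTw s z) b) [] (just (cd z)) ≡ true

-- The fault at `z` is the only one of its dimension, so the search is told that all other edges of
-- this dimension are good.
record CfgA₁ (run : Runs) : Set where
  field
    get : ∀ z c s b → run (ec z (suc zero) c ∷ three (maybeTw s z) b) (otherOnes (ec z (suc zero) c)) (just (cd z)) ≡ true

record CfgA₂ (run : Runs) : Set where
  field
    get : ∀ y → par y ≡ true → ∀ z c b s d → (mem (ec (maybeTw s z) zero d) (three y b) ∨
      run (ec z (suc zero) c ∷ ec (maybeTw s z) zero d ∷ three y b) [] (just (cd z))) ≡ true

record CfgB (run : Runs) : Set where
  field
    get : ∀ y → par y ≡ true → ∀ b x → par x ≡ true → ∀ c s c' → ((ec x (suc zero) c == ec (maybeTw s x) (suc zero) c') ∨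
      run (ec x (suc zero) c ∷ ec (maybeTw s x) (suc zero) c' ∷ three y b) [] nothing) ≡ true

abstract
  for4 : (Fin 4 → Bool) → Bool
  for4 f = f #0 ∧ (f #1 ∧ (f #2 ∧ f #3))

  forB : (Bool → Bool) → Bool
  forB f = f true ∧ f false

  forV : (Vertex 2 → Bool) → Bool
  forV f = for4 (λ a → for4 (λ x → f (a ∷ x ∷ [])))

  for4-sound : ∀ f → for4 f ≡ true → ∀ i → f i ≡ true
  for4-sound f h i with ∧-true {f #0} h
  ... | h₀ , r with ∧-true {f #1} r
  ... | h₁ , r' with ∧-true {f #2} r'
  for4-sound f h #0 | h₀ , r | h₁ , r' | h₂ , h₃ = h₀
  for4-sound f h #1 | h₀ , r | h₁ , r' | h₂ , h₃ = h₁
  for4-sound f h #2 | h₀ , r | h₁ , r' | h₂ , h₃ = h₂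
  for4-sound f h #3 | h₀ , r | h₁ , r' | h₂ , h₃ = h₃

  forB-sound : ∀ f → forB f ≡ true → ∀ b → f b ≡ true
  forB-sound f h true = proj₁ (∧-true {f true} h)
  forB-sound f h false = proj₂ (∧-true {f true} h)

  forV-sound : ∀ f → forV f ≡ true → ∀ v → f v ≡ true
  forV-sound f h (a ∷ x ∷ []) = for4-sound (λ x → f (a ∷ x ∷ [])) (for4-sound (λ a → for4 (λ x → f (a ∷ x ∷ []))) h a) x

evenly : Vertex 2 → Bool → Bool
evenly y b = not (par y) ∨ b

evenly-sound : ∀ {y b} → evenly y b ≡ true → par y ≡ true → b ≡ true
evenly-sound h e rewrite e = h

testX testA₀ testA₁ testA₂ testB : Runs → Bool
testX run = forV (λ z → run (KX z) [] (just (cd z)))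
testA₀ run = forV (λ z → forB (λ c → forB (λ s → forB (λ b → run (ec z (suc zero) c ∷ three (maybeTw s z) b) [] (just (cd z))))))
testA₁ run = forV (λ z → forB (λ c → forB (λ s → forB (λ b → run (ec z (suc zero) c ∷ three (maybeTw s z) b) (otherOnes (ec z (suc zero) c)) (just (cd z))))))
testA₂ run = forV (λ y → evenly y (forV (λ z → forB (λ c → forB (λ b → forB (λ s → forB (λ d → mem (ec (maybeTw s z) zero d) (three y b) ∨
  run (ec z (suc zero) c ∷ ec (maybeTw s z) zero d ∷ three y b) [] (just (cd z)))))))))
testB run = forV (λ y → evenly y (forB (λ b → forV (λ x → evenly x (forB (λ c → forB (λ s → forB (λ c' → (ec x (suc zero) c == ec (maybeTw s x) (suc zero) c') ∨
  run (ec x (suc zero) c ∷ ec (maybeTw s x) (suc zero) c' ∷ three y b) [] nothing))))))))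

testIn : List (Ready 0 4) → Bool
testIn tab = (runIn tab (KC (vtx 0)) [] nothing ∧ testX (runIn tab)) ∧ (testA₁ (runIn tab) ∧ testA₂ (runIn tab))

testOut : List Cycle → Bool
testOut tab = (testX (runOut tab) ∧ testB (runOut tab)) ∧ (testA₀ (runOut tab) ∧ testA₂ (runOut tab))

soundX : ∀ run → testX run ≡ true → CfgX run
soundX run h = record { get = forV-sound _ h }

soundA₀ : ∀ run → testA₀ run ≡ true → CfgA₀ run
soundA₀ run h = record { get = λ z c s b → forB-sound _ (forB-sound _ (forB-sound _ (forV-sound _ h z) c) s) b }

soundA₁ : ∀ run → testA₁ run ≡ true → CfgA₁ run
soundA₁ run h = record { get = λ z c s b → forB-sound _ (forB-sound _ (forB-sound _ (forV-sound _ h z) c) s) b }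

soundA₂ : ∀ run → testA₂ run ≡ true → CfgA₂ run
soundA₂ run h = record { get = λ y e z c b s d → forB-sound _ (forB-sound _ (forB-sound _ (forB-sound _ (forV-sound _ (evenly-sound {y} (forV-sound _ h y) e) z) c) b) s) d }

soundB : ∀ run → testB run ≡ true → CfgB run
soundB run h = record { get = λ y e b x e' c s c' → forB-sound _ (forB-sound _ (forB-sound _ (evenly-sound {x} (forV-sound _ (forB-sound _ (evenly-sound {y} (forV-sound _ h y) e) b) x) e') c) s) c' }

abstract
  tabIn : List (Ready 0 4)
  tabIn = ready 0 4 paths₄

  tabOut : List Cycle
  tabOut = cycles hamCycles

  test-in : testIn tabIn ≡ true
  test-in = refl

  test-out : testOut tabOut ≡ true
  test-out = refl

split₄ : ∀ a b c d → (a ∧ b) ∧ (c ∧ d) ≡ true → (a ≡ true × b ≡ true) × (c ≡ true × d ≡ true)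
split₄ true true true true refl = (refl , refl) , (refl , refl)

resultsIn : ∀ tab → testIn tab ≡ true → (runIn tab (KC (vtx 0)) [] nothing ≡ true × CfgX (runIn tab)) × (CfgA₁ (runIn tab) × CfgA₂ (runIn tab))
resultsIn tab h = (proj₁ (proj₁ q) , soundX (runIn tab) (proj₂ (proj₁ q))) , (soundA₁ (runIn tab) (proj₁ (proj₂ q)) , soundA₂ (runIn tab) (proj₂ (proj₂ q)))
  where
  q : (runIn tab (KC (vtx 0)) [] nothing ≡ true × testX (runIn tab) ≡ true) × (testA₁ (runIn tab) ≡ true × testA₂ (runIn tab) ≡ true)
  q = split₄ (runIn tab (KC (vtx 0)) [] nothing) (testX (runIn tab)) (testA₁ (runIn tab)) (testA₂ (runIn tab)) h

resultsOut : ∀ tab → testOut tab ≡ true → (CfgX (runOut tab) × CfgB (runOut tab)) × (CfgA₀ (runOut tab) × CfgA₂ (runOut tab))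
resultsOut tab h = (soundX (runOut tab) (proj₁ (proj₁ q)) , soundB (runOut tab) (proj₂ (proj₁ q))) , (soundA₀ (runOut tab) (proj₁ (proj₂ q)) , soundA₂ (runOut tab) (proj₂ (proj₂ q)))
  where
  q : (testX (runOut tab) ≡ true × testB (runOut tab) ≡ true) × (testA₀ (runOut tab) ≡ true × testA₂ (runOut tab) ≡ true)
  q = split₄ (testX (runOut tab)) (testB (runOut tab)) (testA₀ (runOut tab)) (testA₂ (runOut tab)) h

inAll : (runIn tabIn (KC (vtx 0)) [] nothing ≡ true × CfgX (runIn tabIn)) × (CfgA₁ (runIn tabIn) × CfgA₂ (runIn tabIn))
inAll = resultsIn tabIn test-in

outAll : (CfgX (runOut tabOut) × CfgB (runOut tabOut)) × (CfgA₀ (runOut tabOut) × CfgA₂ (runOut tabOut))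
outAll = resultsOut tabOut test-out

maybeTw-act : ∀ w e o t s z → act w e o t (maybeTw s z) ≡ maybeTw s (act w e o t z)
maybeTw-act w e o t true z = act-tw w e o t z
maybeTw-act w e o t false z = refl

record FiveFaults (F : List (E 2)) (B : Vertex 2 → Set) : Set where
  constructor fiveFaults
  field
    can : Canon F
    uniq : Unique F
    small : length F ≤ 5
    B? : ∀ x → Dec (B x)
    one : ∀ {x y} → B x → B y → x ≡ y
    low : ∀ x → length (badN F x) < 4
    lowB : ∀ x → B x → length (badN F x) < 3

-- Five faults in BH_2, seen through an automorphism; j and p are the images of the dimensions 0 and 1.
module Five (F : List (E 2)) {B : Vertex 2 → Set} (H : FiveFaults F B) (w e o : Bool) (t : Fin 4) where

  open FiveFaults H

  σ : Aut
  σ = auto w e o t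

  open Results F can uniq σ
  open Blocking B? one low lowB
  open Aut σ

  j p : Fin 2
  j = swapDim w zero
  p = swapDim w (suc zero)

  V₂ : Set
  V₂ = Vertex 2

  AllBad : List Code → Set
  AllBad K = ∀ {e} → e ∈ K → Bad e

  -- The automorphism maps the two edges of a dimension at `z` bijectively to those of the image
  -- dimension, possibly exchanging the bits.
  act-nb⁻ : ∀ z d b → ∃[ b' ] f (nb d b' z) ≡ nb (swapDim w d) b (f z)
  act-nb⁻ z d b with act-nb w e o t z d true | act-nb w e o t z d false
  ... | c , h | c' , h' with c ≟ᵇ b | c' ≟ᵇ b
  ... | yes refl | _ = true , h
  ... | no _ | yes refl = false , h'
  ... | no ne | no ne' with nb-inj d d true false z (f-inj (trans h (trans (cong (λ c → nb (swapDim w d) c (f z)) (trans (≢-not ne) (sym (≢-not ne')))) (sym h'))))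
  ... | _ , ()

  bad-ec : ∀ z d b → InL F (f z) (f (nb d b z)) → Bad (ec z d b)
  bad-ec z d b i = bad-ek (ok-cd z) (ok-cd (nb d b z)) (subst₂ Adj (sym (vtx-cd z)) (sym (vtx-cd (nb d b z))) (adj-nb d b z))
    (subst₂ (λ x y → InL F (f x) (f y)) (sym (vtx-cd z)) (sym (vtx-cd (nb d b z))) i)

  real-ec : ∀ z d b → real (ec z d b) ≡ edge (f z) (f (nb d b z))
  real-ec z d b = trans (real-ek {cd z} {cd (nb d b z)} (subst₂ Adj (sym (vtx-cd z)) (sym (vtx-cd (nb d b z))) (adj-nb d b z)))
    (cong₂ (λ x y → edge (f x) (f y)) (vtx-cd z) (vtx-cd (nb d b z)))

  faultAt : ∀ z d {b} → InL F (f z) (nb (swapDim w d) b (f z)) → ∃[ b' ] (f (nb d b' z) ≡ nb (swapDim w d) b (f z) × Bad (ec z d b'))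
  faultAt z d {b} i with act-nb⁻ z d b
  ... | b' , h = b' , h , bad-ec z d b' (subst (InL F (f z)) (sym h) i)

  faultsAt : ∀ z d → (∀ b → InL F (f z) (nb (swapDim w d) b (f z))) → ∀ b' → Bad (ec z d b')
  faultsAt z d i b' with act-nb w e o t z d b'
  ... | b , h = bad-ec z d b' (subst (InL F (f z)) (sym h) (i b))

  Three : V₂ → Bool → Set
  Three y b = InL F y (nb j b y) × ∀ c → InL F (tw y) (nb j c (tw y))

  faultsTw : ∀ z d → (∀ b → InL F (tw (f z)) (nb (swapDim w d) b (tw (f z)))) → ∀ b' → Bad (ec (tw z) d b')
  faultsTw z d i = faultsAt (tw z) d (subst (λ y → ∀ b → InL F y (nb (swapDim w d) b y)) (sym (act-tw w e o t z)) i)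

  threeBad : ∀ y {b} → Three (f y) b → ∃[ b' ] (f (nb zero b' y) ≡ nb j b (f y) × AllBad (three y b'))
  threeBad y {b} (i , h) with faultAt y zero i
  ... | b' , e , bad = b' , e , λ { (here refl) → bad ; (there (here refl)) → faultsTw y zero h true ; (there (there (here refl))) → faultsTw y zero h false }

  blk : ∀ {z} → B (f z) → ∀ {c} → just (cd z) ≡ just c → Blk c
  blk {z} b refl = ok-cd z , subst (B ∘ f) (sym (vtx-cd z)) b

  cons-bad : ∀ {e K} → Bad e → AllBad K → AllBad (e ∷ K)
  cons-bad b h (here refl) = b
  cons-bad b h (there i) = h i

  codes≢ : ∀ x d b x' d' b' → Bad (ec x d b) → (ec x d b == ec x' d' b') ≡ true → edge (f x) (f (nb d b x)) ≡ edge (f x') (f (nb d' b' x'))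
  codes≢ x d b x' d' b' _ h = trans (sym (real-ec x d b)) (trans (cong real (==-true {ec x d b} {ec x' d' b'} h)) (real-ec x' d' b'))

  record Resolver (run : Runs) (Res : Set) : Set where
    constructor resolver
    field
      res : ∀ K G Z → AllBad K → (∀ {e} → e ∈ G → ¬ Bad e) → (∀ {z} → Z ≡ just z → Blk z) → run K G Z ≡ true → Res

  module With (run : Runs) {Res : Set} (Q : Resolver run Res) where

    open Resolver Q

    factX : CfgX run → ∀ x → B x → (∀ b → InL F x (nb j b x)) → (∀ b → InL F (tw x) (nb p b (tw x))) → Res
    factX cfg x = subst (λ x → B x → (∀ b → InL F x (nb j b x)) → (∀ b → InL F (tw x) (nb p b (tw x))) → Res) (fg x) (go (g x))
      where
      go : ∀ z → B (f z) → (∀ b → InL F (f z) (nb j b (f z))) → (∀ b → InL F (tw (f z)) (nb p b (tw (f z)))) → Res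
      go z bz h h' = res (KX z) [] (just (cd z)) (cons-bad (k true) (cons-bad (k false) (cons-bad (k' true) (cons-bad (k' false) (λ ()))))) (λ ()) (blk bz) (CfgX.get cfg z)
        where
        k : ∀ b → Bad (ec z zero b)
        k = faultsAt z zero h
        k' : ∀ b → Bad (ec (tw z) (suc zero) b)
        k' = faultsTw z (suc zero) h'

    factA₀ : CfgA₀ run → ∀ x → B x → ∀ c → InL F x (nb p c x) → ∀ s b → Three (maybeTw s x) b → Res
    factA₀ cfg x = subst (λ x → B x → ∀ c → InL F x (nb p c x) → ∀ s b → Three (maybeTw s x) b → Res) (fg x) (go (g x))
      where
      go : ∀ z → B (f z) → ∀ c → InL F (f z) (nb p c (f z)) → ∀ s b → Three (maybeTw s (f z)) b → Res
      go z bz c i s b th with faultAt z (suc zero) i | threeBad (maybeTw s z) {b} (subst (λ y → Three y b) (sym (maybeTw-act w e o t s z)) th)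
      ... | c' , _ , bad | b' , _ , bads = res _ [] (just (cd z)) (cons-bad bad bads) (λ ()) (blk bz) (CfgA₀.get cfg z c' s b')

    factA₁ : CfgA₁ run → ∀ x → B x → ∀ c → InL F x (nb p c x) → (∀ v d → InL F v (nb p d v) → edge v (nb p d v) ≡ edge x (nb p c x)) →
      ∀ s b → Three (maybeTw s x) b → Res
    factA₁ cfg x = subst (λ x → B x → ∀ c → InL F x (nb p c x) → (∀ v d → InL F v (nb p d v) → edge v (nb p d v) ≡ edge x (nb p c x)) →
      ∀ s b → Three (maybeTw s x) b → Res) (fg x) (go (g x))
      where
      go : ∀ z → B (f z) → ∀ c → InL F (f z) (nb p c (f z)) → (∀ v d → InL F v (nb p d v) → edge v (nb p d v) ≡ edge (f z) (nb p c (f z))) →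
        ∀ s b → Three (maybeTw s (f z)) b → Res
      go z bz c i only s b th with faultAt z (suc zero) i | threeBad (maybeTw s z) {b} (subst (λ y → Three y b) (sym (maybeTw-act w e o t s z)) th)
      ... | c' , e₁ , bad | b' , _ , bads = res _ _ (just (cd z)) (cons-bad bad bads) good (blk bz) (CfgA₁.get cfg z c' s b')
        where
        good : ∀ {r} → r ∈ otherOnes (ec z (suc zero) c') → ¬ Bad r
        good {r} k bad' with ∈-sel⁻ (λ e → (e == ec z (suc zero) c') ≟ᵇ false) {l = both (λ v d → ec v (suc zero) d) evenV} k
        ... | k' , ne with ∈-both (λ v d → ec v (suc zero) d) evenV k'
        ... | v , d , _ , refl with act-nb w e o t v (suc zero) d
        ... | d' , e₂ with trans (sym ne) (trans (cong (_== ec z (suc zero) c') same-code) (==-refl (ec z (suc zero) c')))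
          where
          fault : InL F (f v) (nb p d' (f v))
          fault = subst (InL F (f v)) e₂ (∈-edge {x = f v} {f (nb (suc zero) d v)} (subst (_∈ F) (real-ec v (suc zero) d) (real-∈ bad')))
          same-code : ec v (suc zero) d ≡ ec z (suc zero) c'
          same-code = real-inj bad' bad (trans (real-ec v (suc zero) d) (trans (cong (edge (f v)) e₂) (trans (only (f v) d' fault) (trans (cong (edge (f z)) (sym e₁)) (sym (real-ec z (suc zero) c'))))))
          ==-refl : ∀ e → (e == e) ≡ true
          ==-refl (a , b) rewrite ≡ᵇ-refl a | ≡ᵇ-refl b = refl
        ... | ()

    factA₂ : CfgA₂ run → ∀ y → par y ≡ true → ∀ b → Three y b → ∀ x → B x → ∀ c → InL F x (nb p c x) → ∀ s d → InL F (maybeTw s x) (nb j d (maybeTw s x)) →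
      ¬ edge (maybeTw s x) (nb j d (maybeTw s x)) ≡ edge y (nb j b y) → (∀ b' → ¬ edge (maybeTw s x) (nb j d (maybeTw s x)) ≡ edge (tw y) (nb j b' (tw y))) → Res
    factA₂ cfg y₀ ey₀ b th x₀ = subst (λ x → B x → ∀ c → InL F x (nb p c x) → ∀ s d → InL F (maybeTw s x) (nb j d (maybeTw s x)) →
      ¬ edge (maybeTw s x) (nb j d (maybeTw s x)) ≡ edge y₀ (nb j b y₀) → (∀ b' → ¬ edge (maybeTw s x) (nb j d (maybeTw s x)) ≡ edge (tw y₀) (nb j b' (tw y₀))) → Res) (fg x₀)
      (λ bz c i s d i' n n' → go (g y₀) (trans (sym (par-f (g y₀))) (trans (cong par (fg y₀)) ey₀)) b (subst (λ y → Three y b) (sym (fg y₀)) th) (g x₀) bz c i s d i'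
        (subst (λ y → ¬ _ ≡ edge y (nb j b y)) (sym (fg y₀)) n) (subst (λ y → ∀ b' → ¬ _ ≡ edge (tw y) (nb j b' (tw y))) (sym (fg y₀)) n'))
      where
      go : ∀ y → par y ≡ true → ∀ b → Three (f y) b → ∀ z → B (f z) → ∀ c → InL F (f z) (nb p c (f z)) → ∀ s d → InL F (maybeTw s (f z)) (nb j d (maybeTw s (f z))) →
        ¬ edge (maybeTw s (f z)) (nb j d (maybeTw s (f z))) ≡ edge (f y) (nb j b (f y)) → (∀ b' → ¬ edge (maybeTw s (f z)) (nb j d (maybeTw s (f z))) ≡ edge (tw (f y)) (nb j b' (tw (f y)))) → Res
      go y ey b th z bz c i s d i' n n' with faultAt z (suc zero) i | threeBad y {b} th | faultAt (maybeTw s z) zero {d} (subst (λ y → InL F y (nb j d y)) (sym (maybeTw-act w e o t s z)) i')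
      ... | c' , _ , bad | b' , e₁ , bads | d' , e₂ , bad' with ∨-true {mem (ec (maybeTw s z) zero d') (three y b')} (CfgA₂.get cfg y ey z c' b' s d')
      ... | inj₂ r = res _ [] (just (cd z)) (cons-bad bad (cons-bad bad' bads)) (λ ()) (blk bz) r
      ... | inj₁ m = ⊥-elim (clash (mem-∈ _ (three y b') m))
        where
        lhs : real (ec (maybeTw s z) zero d') ≡ edge (maybeTw s (f z)) (nb j d (maybeTw s (f z)))
        lhs = trans (real-ec (maybeTw s z) zero d') (trans (cong (edge (f (maybeTw s z))) e₂) (cong (λ v → edge v (nb j d v)) (maybeTw-act w e o t s z)))
        tws : ∀ b'' → real (ec (tw y) zero b'') ≡ edge (tw (f y)) (nb j (proj₁ (act-nb w e o t (tw y) zero b'')) (tw (f y)))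
        tws b'' = trans (real-ec (tw y) zero b'') (trans (cong (edge (f (tw y))) (proj₂ (act-nb w e o t (tw y) zero b''))) (cong (λ v → edge v (nb j (proj₁ (act-nb w e o t (tw y) zero b'')) v)) (act-tw w e o t y)))
        clash : ec (maybeTw s z) zero d' ∈ three y b' → ⊥
        clash (here h) = n (trans (sym lhs) (trans (cong real h) (trans (real-ec y zero b') (cong (edge (f y)) e₁))))
        clash (there (here h)) = n' _ (trans (sym lhs) (trans (cong real h) (tws true)))
        clash (there (there (here h))) = n' _ (trans (sym lhs) (trans (cong real h) (tws false)))

    factB : CfgB run → ∀ y → par y ≡ true → ∀ b → Three y b → ∀ x → par x ≡ true → ∀ c → InL F x (nb p c x) → ∀ s c' → InL F (maybeTw s x) (nb p c' (maybeTw s x)) →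
      ¬ edge x (nb p c x) ≡ edge (maybeTw s x) (nb p c' (maybeTw s x)) → Res
    factB cfg y₀ ey₀ b th x₀ ex₀ = subst (λ x → ∀ c → InL F x (nb p c x) → ∀ s c' → InL F (maybeTw s x) (nb p c' (maybeTw s x)) →
      ¬ edge x (nb p c x) ≡ edge (maybeTw s x) (nb p c' (maybeTw s x)) → Res) (fg x₀)
      (go (g y₀) (pg y₀ ey₀) b (subst (λ y → Three y b) (sym (fg y₀)) th) (g x₀) (pg x₀ ex₀))
      where
      pg : ∀ y → par y ≡ true → par (g y) ≡ true
      pg y e = trans (sym (par-f (g y))) (trans (cong par (fg y)) e)
      go : ∀ y → par y ≡ true → ∀ b → Three (f y) b → ∀ z → par z ≡ true → ∀ c → InL F (f z) (nb p c (f z)) → ∀ s c' → InL F (maybeTw s (f z)) (nb p c' (maybeTw s (f z))) →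
        ¬ edge (f z) (nb p c (f z)) ≡ edge (maybeTw s (f z)) (nb p c' (maybeTw s (f z))) → Res
      go y ey b th z ez c i s c' i' n with faultAt z (suc zero) i | threeBad y {b} th | faultAt (maybeTw s z) (suc zero) {c'} (subst (λ y → InL F y (nb p c' y)) (sym (maybeTw-act w e o t s z)) i')
      ... | d , e₁ , bad | b' , _ , bads | d' , e₂ , bad' with ∨-true {ec z (suc zero) d == ec (maybeTw s z) (suc zero) d'} (CfgB.get cfg y ey b' z ez d s d')
      ... | inj₂ r = res _ [] nothing (cons-bad bad (cons-bad bad' bads)) (λ ()) (λ ()) r
      ... | inj₁ m = ⊥-elim (n (trans (cong (edge (f z)) (sym e₁)) (trans (codes≢ z (suc zero) d (maybeTw s z) (suc zero) d' bad m)
            (trans (cong (edge (f (maybeTw s z))) e₂) (cong (λ v → edge v (nb p c' v)) (maybeTw-act w e o t s z))))))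

  known : ∀ {K} → AllBad K → Known (distinct K)
  known {K} h = distinct-Unique K , λ i → h (distinct-∈ K i)

  enough : ∀ K → length F ≤ length (distinct K) + (5 ∸ length (distinct K))
  enough K = ≤-trans small (Data.Nat.Properties.m≤n+m∸n 5 (length (distinct K)))
    where import Data.Nat.Properties

  resOut : ∀ K G Z → AllBad K → (∀ {e} → e ∈ G → ¬ Bad e) → (∀ {z} → Z ≡ just z → Blk z) → runOut tabOut K G Z ≡ true → End F B
  resOut K G Z h good z r = outResult tabOut (known h) (enough K) good z r

  resIn : ¬ InL F (f (vtx 0)) (f (vtx 4)) → ∀ K G Z → AllBad K → (∀ {e} → e ∈ G → ¬ Bad e) → (∀ {z} → Z ≡ just z → Blk z) → runIn tabIn K G Z ≡ true →
    Thr F B (f (vtx 0)) (f (vtx 4))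
  resIn ne K G Z h good z r with ∨-true {mem (0 , 4) K} r
  ... | inj₁ m = ⊥-elim (ne (proj₂ (proj₂ (proj₂ (proj₂ (h (mem-∈ (0 , 4) K m)))))))
  ... | inj₂ r' = inResult tabIn (known h) (enough K) good z r'

  factC : ¬ InL F (f (vtx 0)) (f (vtx 4)) → (∀ b → ¬ nb j b (f (vtx 0)) ≡ f (vtx 4) → InL F (f (vtx 0)) (nb j b (f (vtx 0)))) →
    (∀ b → InL F (tw (f (vtx 0))) (nb j b (tw (f (vtx 0))))) → Thr F B (f (vtx 0)) (f (vtx 4))
  factC ne h h' = resIn ne (KC (vtx 0)) [] nothing (cons-bad k₀ (cons-bad (faultsTw (vtx 0) zero h' true) (cons-bad (faultsTw (vtx 0) zero h' false) (λ ())))) (λ ()) (λ ()) (proj₁ (proj₁ inAll))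
    where
    k₀ : Bad (ec (vtx 0) zero false)
    k₀ with act-nb w e o t (vtx 0) zero false
    ... | b , h₀ = bad-ec (vtx 0) zero false (subst (InL F (f (vtx 0))) (sym h₀) (h b (λ e → different (f-inj (trans h₀ e)))))
      where
      different : ¬ nb zero false (vtx 0) ≡ vtx 4
      different ()

-- The case n = 3.

φ-tw : ∀ {m} i (x : Vertex (2 + m)) → φ i (tw x) ≡ (κ i x , tw (proj₂ (φ i x)))
φ-tw zero (a ∷ x ∷ τ) = cong (λ d → hgt d (x ∷ τ) , tw4 a ∷ τ) (pe-tw a)
φ-tw (suc i) (a ∷ τ) = refl

κ-tw : ∀ {m} i (x : Vertex (2 + m)) → κ i (tw x) ≡ κ i x
κ-tw i x = cong proj₁ (φ-tw i x)

edge-map : ∀ {n m} (h : Vertex (suc n) → Vertex (suc m)) → (∀ x → par (h x) ≡ par x) → ∀ x y → pmap h (edge x y) ≡ edge (h x) (h y)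
edge-map h ph x y rewrite ph x with par x
... | true = refl
... | false = refl

-- The dimension `j` of BH_3 seen inside a copy of the splitting `i`: the explicit value of the
-- witness in `φ-nb-other`.
down : Fin 3 → Fin 3 → Fin 2
down i zero = zero
down zero (suc zero) = zero
down zero (suc (suc zero)) = suc zero
down (suc i) (suc j) = suc zero

φ-nb-down : ∀ i j b (x : Vertex 3) → ¬ j ≡ i → φ i (nb j b x) ≡ (κ i x , nb (down i j) b (proj₂ (φ i x)))
φ-nb-down zero zero b x h = ⊥-elim (h refl)
φ-nb-down zero (suc zero) b (a ∷ x ∷ y ∷ []) h = proj₂ (φ-nb-other (suc zero) zero b (a ∷ x ∷ y ∷ []) h)
φ-nb-down zero (suc (suc zero)) b (a ∷ x ∷ y ∷ []) h = proj₂ (φ-nb-other (suc (suc zero)) zero b (a ∷ x ∷ y ∷ []) h)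
φ-nb-down (suc zero) zero b (a ∷ x ∷ y ∷ []) h = proj₂ (φ-nb-other zero (suc zero) b (a ∷ x ∷ y ∷ []) h)
φ-nb-down (suc (suc zero)) zero b (a ∷ x ∷ y ∷ []) h = proj₂ (φ-nb-other zero (suc (suc zero)) b (a ∷ x ∷ y ∷ []) h)
φ-nb-down (suc zero) (suc zero) b x h = ⊥-elim (h refl)
φ-nb-down (suc (suc zero)) (suc (suc zero)) b x h = ⊥-elim (h refl)
φ-nb-down (suc zero) (suc (suc zero)) b (a ∷ x ∷ y ∷ []) h = proj₂ (φ-nb-other (suc (suc zero)) (suc zero) b (a ∷ x ∷ y ∷ []) h)
φ-nb-down (suc (suc zero)) (suc zero) b (a ∷ x ∷ y ∷ []) h = proj₂ (φ-nb-other (suc zero) (suc (suc zero)) b (a ∷ x ∷ y ∷ []) h)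

down-inj : ∀ {i j p} → ¬ j ≡ i → ¬ p ≡ i → ¬ p ≡ j → ¬ down i p ≡ down i j
down-inj {zero} {zero} h _ _ _ = h refl
down-inj {suc _} {zero} {zero} _ _ n _ = n refl
down-inj {suc _} {zero} {suc _} _ _ n ()
down-inj {zero} {suc _} {zero} _ h _ _ = h refl
down-inj {suc _} {suc _} {zero} _ _ _ ()
down-inj {zero} {suc zero} {suc zero} _ _ n _ = n refl
down-inj {zero} {suc zero} {suc (suc zero)} _ _ n ()
down-inj {zero} {suc (suc zero)} {suc zero} _ _ n ()
down-inj {zero} {suc (suc zero)} {suc (suc zero)} _ _ n _ = n refl
down-inj {suc zero} {suc zero} h _ _ _ = h refl
down-inj {suc zero} {suc (suc zero)} {suc zero} _ h _ _ = h refl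
down-inj {suc zero} {suc (suc zero)} {suc (suc zero)} _ _ n _ = n refl
down-inj {suc (suc zero)} {suc (suc zero)} h _ _ _ = h refl
down-inj {suc (suc zero)} {suc zero} {suc (suc zero)} _ h _ _ = h refl
down-inj {suc (suc zero)} {suc zero} {suc zero} _ _ n _ = n refl

swap-zero : ∀ d → swapDim (does (d ≟ᶠ suc zero)) zero ≡ d
swap-zero zero = refl
swap-zero (suc zero) = refl

swap-one : ∀ d d' → ¬ d' ≡ d → swapDim (does (d ≟ᶠ suc zero)) (suc zero) ≡ d'
swap-one zero zero h = ⊥-elim (h refl)
swap-one zero (suc zero) h = refl
swap-one (suc zero) zero h = refl
swap-one (suc zero) (suc zero) h = ⊥-elim (h refl)

-- The edges of dimension j between the twins of w and their common neighbours.
four : ∀ {n} → Fin (suc n) → Vertex (suc n) → List (E (suc n))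
four j w = edge w (nb j true w) ∷ edge w (nb j false w) ∷ edge (tw w) (nb j true (tw w)) ∷ edge (tw w) (nb j false (tw w)) ∷ []

lineEnd : ∀ {m} {j : Fin (2 + m)} (w : Vertex (2 + m)) {r} → Dir j r → (∀ γ → ¬ γ ≡ j → κ γ (proj₁ r) ≡ κ γ w) → r ∈ four j w
lineEnd {j = j} w {x , _} (dir e b refl) al with par w in ew
... | true = go b (coords j w x (trans ew (sym e)) (λ i ne → sym (al i ne)))
  where
  go : ∀ b → x ≡ w ⊎ x ≡ tw w → (x , nb j b x) ∈ (w , nb j true w) ∷ (w , nb j false w) ∷ edge (tw w) (nb j true (tw w)) ∷ edge (tw w) (nb j false (tw w)) ∷ []
  go true (inj₁ refl) = here refl
  go false (inj₁ refl) = there (here refl)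
  go true (inj₂ refl) rewrite e = there (there (here refl))
  go false (inj₂ refl) rewrite e = there (there (there (here refl)))
... | false = go b (coords j w (nb j b x) (trans ew (sym (trans (par-nb j b x) (cong not e)))) (λ i ne → trans (sym (al i ne)) (sym (κ-other b x (ne ∘ sym)))))
  where
  back : ∀ b {y} → nb j b x ≡ y → (x , nb j b x) ≡ (nb j (not b) y , y)
  back b refl = cong (_, nb j b x) (sym (nb-nb j b x))
  odd-edge : ∀ b {y} → nb j b x ≡ y → (x , nb j b x) ≡ edge y (nb j (not b) y)
  odd-edge b refl rewrite par-nb j b x | e = back b refl
  go : ∀ b → nb j b x ≡ w ⊎ nb j b x ≡ tw w → (x , nb j b x) ∈ (nb j true w , w) ∷ (nb j false w , w) ∷ edge (tw w) (nb j true (tw w)) ∷ edge (tw w) (nb j false (tw w)) ∷ []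
  go true (inj₁ h) = there (here (back true h))
  go false (inj₁ h) = here (back false h)
  go true (inj₂ h) = there (there (there (here (odd-edge true h))))
  go false (inj₂ h) = there (there (here (odd-edge false h)))

module _ {A : Set} (_≟_ : (x y : A) → Dec (x ≡ y)) {xs : List A} (u : Unique xs) where

  two-of-two : ∀ {p q} → 2 ≤ length xs → (∀ {x} → x ∈ xs → x ∈ p ∷ q ∷ []) → p ∈ xs × q ∈ xs
  two-of-two {p} {q} le sub = decidable-stable (any? (p ≟_) xs) (λ np → 1+n≰n (≤-trans le (⊆-length {F = q ∷ []} u (λ i → drop₁ np i (sub i))))) ,
                              decidable-stable (any? (q ≟_) xs) (λ nq → 1+n≰n (≤-trans le (⊆-length {F = p ∷ []} u (λ i → drop₂ nq i (sub i)))))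
    where
    drop₁ : ¬ p ∈ xs → ∀ {x} → x ∈ xs → x ∈ p ∷ q ∷ [] → x ∈ q ∷ []
    drop₁ np i (here refl) = ⊥-elim (np i)
    drop₁ np i (there k) = k
    drop₂ : ¬ q ∈ xs → ∀ {x} → x ∈ xs → x ∈ p ∷ q ∷ [] → x ∈ p ∷ []
    drop₂ nq i (here e) = here e
    drop₂ nq i (there (here refl)) = ⊥-elim (nq i)

  three-of-four : ∀ {p q r s} → 3 ≤ length xs → (∀ {x} → x ∈ xs → x ∈ p ∷ q ∷ r ∷ s ∷ []) →
    ((p ∈ xs ⊎ q ∈ xs) × (r ∈ xs × s ∈ xs)) ⊎ ((r ∈ xs ⊎ s ∈ xs) × (p ∈ xs × q ∈ xs))
  three-of-four {p} {q} {r} {s} le sub with any? (p ≟_) xs | any? (q ≟_) xs | any? (r ≟_) xs | any? (s ≟_) xs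
  ... | yes a | yes b | yes c | _ = inj₂ (inj₁ c , a , b)
  ... | yes a | yes b | no _ | yes d = inj₂ (inj₂ d , a , b)
  ... | yes a | no _ | yes c | yes d = inj₁ (inj₁ a , c , d)
  ... | no _ | yes b | yes c | yes d = inj₁ (inj₂ b , c , d)
  ... | yes a | yes b | no nc | no nd = ⊥-elim (1+n≰n (≤-trans le (⊆-length {F = p ∷ q ∷ []} u (λ i → f i (sub i)))))
    where
    f : ∀ {x} → x ∈ xs → x ∈ p ∷ q ∷ r ∷ s ∷ [] → x ∈ p ∷ q ∷ []
    f i (here e) = here e
    f i (there (here e)) = there (here e)
    f i (there (there (here refl))) = ⊥-elim (nc i)
    f i (there (there (there (here refl)))) = ⊥-elim (nd i)
  ... | no na | no nb' | _ | _ = ⊥-elim (1+n≰n (≤-trans le (⊆-length {F = r ∷ s ∷ []} u (λ i → f i (sub i)))))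
    where
    f : ∀ {x} → x ∈ xs → x ∈ p ∷ q ∷ r ∷ s ∷ [] → x ∈ r ∷ s ∷ []
    f i (here refl) = ⊥-elim (na i)
    f i (there (here refl)) = ⊥-elim (nb' i)
    f i (there (there k)) = k
  ... | no na | yes _ | no nc | _ = ⊥-elim (1+n≰n (≤-trans le (⊆-length {F = q ∷ s ∷ []} u (λ i → f i (sub i)))))
    where
    f : ∀ {x} → x ∈ xs → x ∈ p ∷ q ∷ r ∷ s ∷ [] → x ∈ q ∷ s ∷ []
    f i (here refl) = ⊥-elim (na i)
    f i (there (here e)) = here e
    f i (there (there (here refl))) = ⊥-elim (nc i)
    f i (there (there (there (here e)))) = there (here e)
  ... | no na | yes _ | yes _ | no nd = ⊥-elim (1+n≰n (≤-trans le (⊆-length {F = q ∷ r ∷ []} u (λ i → f i (sub i)))))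
    where
    f : ∀ {x} → x ∈ xs → x ∈ p ∷ q ∷ r ∷ s ∷ [] → x ∈ q ∷ r ∷ []
    f i (here refl) = ⊥-elim (na i)
    f i (there (here e)) = here e
    f i (there (there (here e))) = there (here e)
    f i (there (there (there (here refl)))) = ⊥-elim (nd i)
  ... | yes _ | no nb' | no nc | _ = ⊥-elim (1+n≰n (≤-trans le (⊆-length {F = p ∷ s ∷ []} u (λ i → f i (sub i)))))
    where
    f : ∀ {x} → x ∈ xs → x ∈ p ∷ q ∷ r ∷ s ∷ [] → x ∈ p ∷ s ∷ []
    f i (here e) = here e
    f i (there (here refl)) = ⊥-elim (nb' i)
    f i (there (there (here refl))) = ⊥-elim (nc i)
    f i (there (there (there (here e)))) = there (here e)
  ... | yes _ | no nb' | yes _ | no nd = ⊥-elim (1+n≰n (≤-trans le (⊆-length {F = p ∷ r ∷ []} u (λ i → f i (sub i)))))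
    where
    f : ∀ {x} → x ∈ xs → x ∈ p ∷ q ∷ r ∷ s ∷ [] → x ∈ p ∷ r ∷ []
    f i (here e) = here e
    f i (there (here refl)) = ⊥-elim (nb' i)
    f i (there (there (here e))) = there (here e)
    f i (there (there (there (here refl)))) = ⊥-elim (nd i)

Three₃ : ∀ {n} → List (E (suc n)) → Fin (suc n) → Vertex (suc n) → Bool → Set
Three₃ F j y b = InL F y (nb j b y) × ∀ c → InL F (tw y) (nb j c (tw y))

-- Three of the four edges of a line include both edges at one of the twins and one edge at the
-- other.
three-on-line : ∀ {m} {F : List (E (2 + m))} {j : Fin (2 + m)} (w : Vertex (2 + m)) {xs} → Unique xs → 3 ≤ length xs →
  (∀ {r} → r ∈ xs → r ∈ F × Dir j r × ∀ γ → ¬ γ ≡ j → κ γ (proj₁ r) ≡ κ γ w) → ∃[ s ] ∃[ b ] Three₃ F j (maybeTw s w) b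
three-on-line {F = F} {j} w {xs} u le h with three-of-four _≟ᴱ_ u le (λ i → lineEnd w (proj₁ (proj₂ (h i))) (proj₂ (proj₂ (h i))))
... | inj₁ (inj₁ a , c , d) = false , true , fault (proj₁ (h a)) , λ { true → fault (proj₁ (h c)) ; false → fault (proj₁ (h d)) }
  where
  fault : ∀ {x y} → edge x y ∈ F → InL F x y
  fault {x} {y} i = ∈-edge {x = x} {y} i
... | inj₁ (inj₂ a , c , d) = false , false , fault (proj₁ (h a)) , λ { true → fault (proj₁ (h c)) ; false → fault (proj₁ (h d)) }
  where
  fault : ∀ {x y} → edge x y ∈ F → InL F x y
  fault {x} {y} i = ∈-edge {x = x} {y} i
... | inj₂ (q , c , d) = true , go q , go-fault q , subst (λ y → ∀ b → InL F y (nb j b y)) (sym (tw-tw w)) (λ { true → fault (proj₁ (h c)) ; false → fault (proj₁ (h d)) })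
  where
  fault : ∀ {x y} → edge x y ∈ F → InL F x y
  fault {x} {y} i = ∈-edge {x = x} {y} i
  go : _ → Bool
  go (inj₁ _) = true
  go (inj₂ _) = false
  go-fault : ∀ q → InL F (tw w) (nb j (go q) (tw w))
  go-fault (inj₁ a) = fault (proj₁ (h a))
  go-fault (inj₂ a) = fault (proj₁ (h a))

two-on-line : ∀ {m} {F : List (E (2 + m))} → Canon F → {j : Fin (2 + m)} → ∀ {xs} → Unique xs → 2 ≤ length xs → (k : Fin (2 + m) → Fin 4) →
  (∀ {r} → r ∈ xs → r ∈ F × Dir j r × ∀ γ → ¬ γ ≡ j → κ γ (proj₁ r) ≡ k γ) →
  ∃[ x ] (par x ≡ true × (∀ γ → ¬ γ ≡ j → κ γ x ≡ k γ) × ∃[ c ] ∃[ s ] ∃[ c' ] (InL F x (nb j c x) × InL F (maybeTw s x) (nb j c' (maybeTw s x)) ×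
    ¬ edge x (nb j c x) ≡ edge (maybeTw s x) (nb j c' (maybeTw s x))))
two-on-line {F = F} can {j} {r₁ ∷ r₂ ∷ _} ((ne ∷ _) ∷ _) _ k h with h (here refl) | h (there (here refl))
... | i₁ , dir e b refl , al | i₂ , d₂ , al₂ = proj₁ r₁ , e , al , b , go (lineEnd (proj₁ r₁) d₂ (λ γ n → trans (al₂ γ n) (sym (al γ n))))
  where
  x = proj₁ r₁
  same : r₁ ≡ edge x (nb j b x)
  same rewrite e = refl
  Goal : Set
  Goal = ∃[ s ] ∃[ c' ] (InL F x (nb j b x) × InL F (maybeTw s x) (nb j c' (maybeTw s x)) × ¬ edge x (nb j b x) ≡ edge (maybeTw s x) (nb j c' (maybeTw s x)))
  mk : ∀ s c' → r₂ ≡ edge (maybeTw s x) (nb j c' (maybeTw s x)) → Goal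
  mk s c' eq = s , c' , inj₁ i₁ , ∈-edge {x = maybeTw s x} {nb j c' (maybeTw s x)} (subst (_∈ F) eq i₂) , λ q → ne (trans same (trans q (sym eq)))
  go : r₂ ∈ four j x → Goal
  go (here eq) = mk false true eq
  go (there (here eq)) = mk false false eq
  go (there (there (here eq))) = mk true true eq
  go (there (there (there (here eq)))) = mk true false eq
two-on-line can {xs = _ ∷ []} _ (s≤s ()) _ _

frame-params : ∀ w u v → frame w u v (vtx 0) ≡ u → frame w u v (vtx 4) ≡ v →
  ∃[ e ] ∃[ o ] ∃[ t ] (act w e o t (vtx 0) ≡ u × act w e o t (vtx 4) ≡ v)
frame-params w (a ∷ x ∷ []) (c ∷ y ∷ []) h h' = does (a ≟ᶠ #2) , does (c ≟ᶠ #3) , x , h , h'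

edge-pair : ∀ {n} (x y : Vertex (suc n)) {p q} → edge x y ≡ (p , q) → (x ≡ p × y ≡ q) ⊎ (x ≡ q × y ≡ p)
edge-pair x y e with par x
... | true = inj₁ (cong proj₁ e , cong proj₂ e)
... | false = inj₂ (cong proj₂ e , cong proj₁ e)

module Small (F : List (E 3)) (H : Faults F) where

  open Faults H
  open Sel F H public

  -- Five faults in a copy are one more than `C` admits. With two crossing faults they exhaust the
  -- total of seven, so all other copies are free of faults.
  module Special (i : D) (k : Fin 4) (h : 4 < fc i k) (d : 2 ≤ dc i) (np : ∀ x → ¬ Pinched i x) where

    F' : List (E 2)
    F' = inner k (FR i F)

    π : W → Vertex 2
    π x = proj₂ (φ i x)

    B : Vertex 2 → Set
    B x = RingBase.Blocked (FR i F) (k , x)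

    small5 : length F' ≤ 5
    small5 = +-cancelʳ-≤ 2 _ _ (≤-trans (+-monoʳ-≤ (fc i k) d) (≤-trans (fc+dc i k) small'))

    -- Two blocked vertices would require four crossing faults, and there are only two.
    one : ∀ {x y} → B x → B y → x ≡ y
    one {x} {y} bx by with x ≟ⱽ y
    ... | yes e = e
    ... | no ne = ⊥-elim (absurd≤ 1 refl (≤-trans (Ring.Laced.Robust.allBlocked (FR i F) (ringFaults (canR i) (smallR i)) lace (uniqR i) cond k (x ∷ y ∷ []) ((ne ∷ []) ∷ ([] ∷ [])) (λ { (here refl) n → n bx ; (there (here refl)) n → n by }))
        (≤-trans (≤-reflexive (dimCount-X F i)) (full-dim h))))

    low : ∀ x → length (badN F' x) < 4
    low x = ≤-trans (≤-reflexive (+-comm 1 _)) (≤-trans (+-monoʳ-≤ (length (badN F' x)) (≤-trans (≰⇒> (np (ψ i (k , x)))) (≤-reflexive (degR-ψ i k x)))) (≤-reflexive (deg-bad F' x)))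

    lowB : ∀ x → B x → length (badN F' x) < 3
    lowB x b = +-cancelʳ-≤ 1 _ _ (≤-trans (≤-reflexive (lem (length (badN F' x)))) (≤-trans (+-monoʳ-≤ (length (badN F' x)) (unbl i k x b)) (≤-reflexive (deg-bad F' x))))
      where
      lem : ∀ n → suc n + 1 ≡ n + 2
      lem = solve-∀

    rest-small : ∀ k' → ¬ k' ≡ k → fc i k' ≤ L₀
    rest-small k' ne = ≤-trans (+-cancelʳ-≤ 2 _ 0 (+-cancelˡ-≤ 5 _ _ (≤-trans (+-mono-≤ h (+-monoʳ-≤ (fc i k') d)) (≤-trans (fc+fc+dc i (ne ∘ sym)) small')))) z≤n

    through : ∀ {u v} → Thr F' B u v → Ring.Laced.Robust.Through (FR i F) (ringFaults (canR i) (smallR i)) lace (uniqR i) cond k u v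
    through (inj₁ hp) = Ring.breakGood (FR i F) (ringFaults (canR i) (smallR i)) k hp
    through (inj₂ (r , t , nr , nt , l , p , f)) with useH (canon-inner k (canR i)) (OV.Full-Unique l f) p
    ... | inj₁ q = Ring.breakGood (FR i F) (ringFaults (canR i) (smallR i)) k (l , q , f)
    ... | inj₂ c = HCut.r c , HCut.t c , RingBase.broken (HCut.l₁ c) (HCut.l₂ c) (HCut.left c) (HCut.right c) (subst OV.Full (HCut.eq c) f) (HCut.adj c) , proj₁ ends , proj₂ ends
      where
      ends : ¬ B (HCut.r c) × ¬ B (HCut.t c)
      ends with edge-pair (HCut.r c) (HCut.t c) (HCut.is c)
      ... | inj₁ (e , e') = subst (¬_ ∘ B) (sym e) nr , subst (¬_ ∘ B) (sym e') nt
      ... | inj₂ (e , e') = subst (¬_ ∘ B) (sym e) nt , subst (¬_ ∘ B) (sym e') nr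

    finish : ∀ {u v} → par u ≡ true → par v ≡ false → κ i v ≡ κ i u → (κ i u ≡ k → Thr F' B (π u) (π v)) → (¬ κ i u ≡ k → End F' B) → HP F u v
    finish {u} {v} eu ev e thr fin = goal i refl e (Ring.Laced.Robust.Build.buildIn (FR i F) (ringFaults (canR i) (smallR i)) lace (uniqR i) cond k (≤-trans (s≤s (s≤s (s≤s z≤n))) h) rest-small (κ i u) (trans (par-φ i u) eu) (trans (par-φ i v) ev) (through ∘ thr) fin)

    into : ∀ {x y} → κ i x ≡ k → κ i y ≡ k → InL F x y → InL F' (π x) (π y)
    into {x} {y} refl e' f with InL-map _≟ⱽ_ _≟ᴿ_ (φ i) (ψ i) (ψφ i) (φψ i) f
    ... | inj₁ j = inj₁ (∈-inner⁺ (subst (λ c → (φ i x , (c , π y)) ∈ FR i F) e' j))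
    ... | inj₂ j = inj₂ (∈-inner⁺ (subst (λ c → ((c , π y) , φ i x) ∈ FR i F) e' j))

    intoN : ∀ {x q b} → κ i x ≡ k → ¬ q ≡ i → InL F x (nb q b x) → InL F' (π x) (nb (down i q) b (π x))
    intoN {x} {q} {b} e ne f = subst (InL F' (π x)) (cong proj₂ (φ-nb-down i q b x ne)) (into e (trans (cong proj₁ (φ-nb-down i q b x ne)) e) f)

    intoFull : ∀ {x} → κ i x ≡ k → Full i x → B (π x)
    intoFull {x} refl f = go true , go false
      where
      go : ∀ b → InL (FR i F) (φ i x) (cr b (φ i x))
      go b = subst (InL (FR i F) (φ i x)) (φ-nb-same i b x) (InL-map _≟ⱽ_ _≟ᴿ_ (φ i) (ψ i) (ψφ i) (φψ i) (f b))

    π-maybeTw : ∀ s x → π (maybeTw s x) ≡ maybeTw s (π x)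
    π-maybeTw true x = cong proj₂ (φ-tw i x)
    π-maybeTw false x = refl

    κ-maybeTw : ∀ s x → κ i (maybeTw s x) ≡ κ i x
    κ-maybeTw true x = κ-tw i x
    κ-maybeTw false x = refl

    pull-edge : ∀ {a b c e} → κ i a ≡ k → κ i b ≡ k → κ i c ≡ k → κ i e ≡ k → ¬ edge a b ≡ edge c e → ¬ edge (π a) (π b) ≡ edge (π c) (π e)
    pull-edge {a} {b} {c} {e} ka kb kc ke n eq = n (trans (sym (up' a b ka kb)) (trans (cong (pmap g) eq) (up' c e kc ke)))
      where
      g : Vertex 2 → W
      g x = ψ i (k , x)
      gπ : ∀ x → κ i x ≡ k → g (π x) ≡ x
      gπ x refl = ψφ i x
      up' : ∀ x y → κ i x ≡ k → κ i y ≡ k → pmap g (edge (π x) (π y)) ≡ edge x y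
      up' x y kx ky = trans (edge-map g (λ z → par-ψ i (k , z)) (π x) (π y)) (cong₂ edge (gπ x kx) (gπ y ky))

    module Facts {j p : D} (j≢i : ¬ j ≡ i) (p≢i : ¬ p ≡ i) (w e o : Bool) (t : Fin 4) (Hj : swapDim w zero ≡ down i j) (Hp : swapDim w (suc zero) ≡ down i p) where

      module V = Five F' (fiveFaults (canon-inner k (canR i)) (inner-Unique k (uniqR i)) small5 (λ x → RingBase.Blocked? (FR i F) (k , x)) one low lowB) w e o t

      faultJ : ∀ {x b} → κ i x ≡ k → InL F x (nb j b x) → InL F' (π x) (nb V.j b (π x))
      faultJ {x} {b} e f = subst (λ d → InL F' (π x) (nb d b (π x))) (sym Hj) (intoN e j≢i f)

      faultP : ∀ {x b} → κ i x ≡ k → InL F x (nb p b x) → InL F' (π x) (nb V.p b (π x))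
      faultP {x} {b} e f = subst (λ d → InL F' (π x) (nb d b (π x))) (sym Hp) (intoN e p≢i f)

      atTw : ∀ s {x} {P : Vertex 2 → Set} → P (π (maybeTw s x)) → P (maybeTw s (π x))
      atTw s {x} {P} = subst P (π-maybeTw s x)

      edgeJ : ∀ s x b → edge (π (maybeTw s x)) (π (nb j b (maybeTw s x))) ≡ edge (maybeTw s (π x)) (nb V.j b (maybeTw s (π x)))
      edgeJ s x b = trans (cong (edge (π (maybeTw s x))) (cong proj₂ (φ-nb-down i j b (maybeTw s x) j≢i))) (cong₂ (λ y d → edge y (nb d b y)) (π-maybeTw s x) (sym Hj))

      edgeP : ∀ s x b → edge (π (maybeTw s x)) (π (nb p b (maybeTw s x))) ≡ edge (maybeTw s (π x)) (nb V.p b (maybeTw s (π x)))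
      edgeP s x b = trans (cong (edge (π (maybeTw s x))) (cong proj₂ (φ-nb-down i p b (maybeTw s x) p≢i))) (cong₂ (λ y d → edge y (nb d b y)) (π-maybeTw s x) (sym Hp))

      threeJ : ∀ s {x b} → κ i x ≡ k → Three₃ F j (maybeTw s x) b → V.Three (maybeTw s (π x)) b
      threeJ s {x} {b} e (f , g) = atTw s {x} {λ y → V.Three y b} (faultJ e' f ,
          λ c → atTw true {maybeTw s x} {λ y → InL F' y (nb V.j c y)} (faultJ (trans (κ-tw i (maybeTw s x)) e') (g c)))
        where
        e' : κ i (maybeTw s x) ≡ k
        e' = trans (κ-maybeTw s x) e

      κ-nb : ∀ {x q b} → κ i x ≡ k → ¬ q ≡ i → κ i (nb q b x) ≡ k
      κ-nb {x} {q} {b} e ne = trans (κ-other b x ne) e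

      module Use (run : Runs) {Res : Set} (Q : V.Resolver run Res) where

        open V.With run Q

        X : CfgX run → ∀ {x} → κ i x ≡ k → Full i x → Full j x → Full p (tw x) → Res
        X cfg {x} e fi fj fp = factX cfg (π x) (intoFull e fi) (λ b → faultJ e (fj b)) (λ b → atTw true {x} {λ y → InL F' y (nb V.p b y)} (faultP (trans (κ-tw i x) e) (fp b)))

        A₀ : CfgA₀ run → ∀ {x c} → κ i x ≡ k → Full i x → InL F x (nb p c x) → ∀ s b → Three₃ F j (maybeTw s x) b → Res
        A₀ cfg {x} {c} e fi fp s b th = factA₀ cfg (π x) (intoFull e fi) c (faultP e fp) s b (threeJ s e th)

        A₁ : CfgA₁ run → dc p ≤ 1 → ∀ {x c} → κ i x ≡ k → Full i x → InL F x (nb p c x) → ∀ s b → Three₃ F j (maybeTw s x) b → Res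
        A₁ cfg dp {x} {c} e fi fp s b th = factA₁ cfg (π x) (intoFull e fi) c (faultP e fp) only s b (threeJ s e th)
          where
          only : ∀ v d → InL F' v (nb V.p d v) → edge v (nb V.p d v) ≡ edge (π x) (nb V.p c (π x))
          only v d f = trans (sym (trans (edgeP false v' d) (cong (λ y → edge y (nb V.p d y)) πv))) (trans (trans (sym (edge-map π (par-φ i) v' (nb p d v')))
              (trans (cong (pmap π) same) (edge-map π (par-φ i) x (nb p c x)))) (edgeP false x c))
            where
            v' : W
            v' = ψ i (k , v)
            πv : π v' ≡ v
            πv = cong proj₂ (φψ i (k , v))
            kv : κ i v' ≡ k
            kv = cong proj₁ (φψ i (k , v))
            f' : InL F v' (nb p d v')
            f' = pull i (κ-other d v' p≢i) (subst₂ (λ c' y → InL (inner c' (FR i F)) (π v') y) (sym kv) (sym (cong proj₂ (φ-nb-down i p d v' p≢i)))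
                   (subst₂ (λ y q → InL F' y (nb q d y)) (sym πv) Hp f))
            same : edge v' (nb p d v') ≡ edge x (nb p c x)
            same with spoke v' p d ≟ᴱ spoke x p c
            ... | yes eq = eq
            ... | no ne = ⊥-elim (1+n≰n (≤-trans (⊆-cnt (dimX p) {spoke v' p d ∷ spoke x p c ∷ []} ((ne ∷ []) ∷ ([] ∷ []))
                    (λ { (here refl) → spoke-∈ {v'} f' , spoke-dim v' p d ; (there (here refl)) → spoke-∈ {x} fp , spoke-dim x p c })) dp))

        A₂ : CfgA₂ run → ∀ {y b} → par y ≡ true → κ i y ≡ k → Three₃ F j y b → ∀ {x c} → κ i x ≡ k → Full i x → InL F x (nb p c x) → ∀ s d → InL F (maybeTw s x) (nb j d (maybeTw s x)) →
          (∀ s' b' → ¬ edge (maybeTw s x) (nb j d (maybeTw s x)) ≡ edge (maybeTw s' y) (nb j b' (maybeTw s' y))) → Res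
        A₂ cfg {y} {b} ey ky th {x} {c} kx fi fp s d fj ne = factA₂ cfg (π y) (trans (par-φ i y) ey) b (threeJ false ky th) (π x) (intoFull kx fi) c (faultP kx fp) s d
          (atTw s {x} {λ z → InL F' z (nb V.j d z)} (faultJ kx' fj)) (differ false b) (λ b' → differ true b')
          where
          kx' : κ i (maybeTw s x) ≡ k
          kx' = trans (κ-maybeTw s x) kx
          differ : ∀ s' b' → ¬ edge (maybeTw s (π x)) (nb V.j d (maybeTw s (π x))) ≡ edge (maybeTw s' (π y)) (nb V.j b' (maybeTw s' (π y)))
          differ s' b' eq = pull-edge kx' (κ-nb kx' j≢i) (trans (κ-maybeTw s' y) ky) (κ-nb (trans (κ-maybeTw s' y) ky) j≢i) (ne s' b') (trans (edgeJ s x d) (trans eq (sym (edgeJ s' y b'))))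

        Bs : CfgB run → ∀ {y b} → par y ≡ true → κ i y ≡ k → Three₃ F j y b → ∀ {x} → par x ≡ true → κ i x ≡ k → ∀ c s c' → InL F x (nb p c x) → InL F (maybeTw s x) (nb p c' (maybeTw s x)) →
          ¬ edge x (nb p c x) ≡ edge (maybeTw s x) (nb p c' (maybeTw s x)) → Res
        Bs cfg {y} {b} ey ky th {x} ex kx c s c' f f' ne = factB cfg (π y) (trans (par-φ i y) ey) b (threeJ false ky th) (π x) (trans (par-φ i x) ex) c (faultP kx f) s c'
          (atTw s {x} {λ z → InL F' z (nb V.p c' z)} (faultP kx' f'))
          (λ eq → pull-edge kx (κ-nb kx p≢i) kx' (κ-nb kx' p≢i) ne (trans (edgeP false x c) (trans eq (sym (edgeP s x c')))))
          where
          kx' : κ i (maybeTw s x) ≡ k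
          kx' = trans (κ-maybeTw s x) kx

    module Solve {j p : D} (j≢i : ¬ j ≡ i) (p≢i : ¬ p ≡ i) (p≢j : ¬ p ≡ j) {u : W} (eu : par u ≡ true) (b₀ : Bool) (good : ¬ InL F u (nb j b₀ u)) where

      v : W
      v = nb j b₀ u

      w₀ : Bool
      w₀ = does (down i j ≟ᶠ suc zero)

      Hj : swapDim w₀ zero ≡ down i j
      Hj = swap-zero (down i j)

      Hp : swapDim w₀ (suc zero) ≡ down i p
      Hp = swap-one (down i j) (down i p) (down-inj j≢i p≢i p≢j)

      -- `End` leaves the ends open, so the automorphism only has to match the dimensions; in `In`
      -- it must also carry 0 and 4 to the ends of the given edge.
      module Out = Facts j≢i p≢i w₀ false false #0 Hj Hp
      module OutUse = Out.Use (runOut tabOut) (Out.V.resolver Out.V.resOut)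

      πv : π v ≡ nb (down i j) b₀ (π u)
      πv = cong proj₂ (φ-nb-down i j b₀ u j≢i)

      params : ∃[ e ] ∃[ o ] ∃[ t ] (act w₀ e o t (vtx 0) ≡ π u × act w₀ e o t (vtx 4) ≡ π v)
      params = frame-params w₀ (π u) (π v) (subst (λ y → frame w₀ (π u) y (vtx 0) ≡ π u) (sym πv) (proj₁ fe)) (subst (λ y → frame w₀ (π u) y (vtx 4) ≡ y) (sym πv) (proj₂ fe))
        where
        fe = frame-edge' (π u) (trans (par-φ i u) eu) (down i j) b₀

      module In = Facts j≢i p≢i w₀ (proj₁ params) (proj₁ (proj₂ params)) (proj₁ (proj₂ (proj₂ params))) Hj Hp

      f₀ : In.V.σ .Aut.f (vtx 0) ≡ π u
      f₀ = proj₁ (proj₂ (proj₂ (proj₂ params)))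

      f₄ : In.V.σ .Aut.f (vtx 4) ≡ π v
      f₄ = proj₂ (proj₂ (proj₂ (proj₂ params)))

      good' : κ i u ≡ k → ¬ InL F' (In.V.σ .Aut.f (vtx 0)) (In.V.σ .Aut.f (vtx 4))
      good' refl f = good (pull i (κ-other b₀ u j≢i) (subst₂ (InL F') f₀ f₄ f))

      toThr : Thr F' B (In.V.σ .Aut.f (vtx 0)) (In.V.σ .Aut.f (vtx 4)) → Thr F' B (π u) (π v)
      toThr = subst₂ (Thr F' B) f₀ f₄

      module InUse (e : κ i u ≡ k) = In.Use (runIn tabIn) (In.V.resolver (In.V.resIn (good' e)))

      ok : (κ i u ≡ k → Thr F' B (π u) (π v)) → (¬ κ i u ≡ k → End F' B) → HP F u v
      ok = finish eu (trans (par-nb j b₀ u) (cong not eu)) (κ-other b₀ u j≢i)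

      solveX : ∀ {x} → κ i x ≡ k → Full i x → Full j x → Full p (tw x) → HP F u v
      solveX e fi fj fp = ok (λ eu → toThr (InUse.X eu (proj₂ (proj₁ inAll)) e fi fj fp)) (λ _ → OutUse.X (proj₁ (proj₁ outAll)) e fi fj fp)

      solveA₁ : dc p ≤ 1 → ∀ {x c} → κ i x ≡ k → Full i x → InL F x (nb p c x) → ∀ s b → Three₃ F j (maybeTw s x) b → HP F u v
      solveA₁ dp e fi fp s b th = ok (λ eu → toThr (InUse.A₁ eu (proj₁ (proj₂ inAll)) dp e fi fp s b th)) (λ _ → OutUse.A₀ (proj₁ (proj₂ outAll)) e fi fp s b th)

      solveA₂ : ∀ {y b} → par y ≡ true → κ i y ≡ k → Three₃ F j y b → ∀ {x c} → κ i x ≡ k → Full i x → InL F x (nb p c x) → ∀ s d → InL F (maybeTw s x) (nb j d (maybeTw s x)) →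
        (∀ s' b' → ¬ edge (maybeTw s x) (nb j d (maybeTw s x)) ≡ edge (maybeTw s' y) (nb j b' (maybeTw s' y))) → HP F u v
      solveA₂ ey ky th kx fi fp s d fj ne = ok (λ eu → toThr (InUse.A₂ eu (proj₂ (proj₂ inAll)) ey ky th kx fi fp s d fj ne)) (λ _ → OutUse.A₂ (proj₂ (proj₂ outAll)) ey ky th kx fi fp s d fj ne)

      outA₀ : ¬ κ i u ≡ k → ∀ {x c} → κ i x ≡ k → Full i x → InL F x (nb p c x) → ∀ s b → Three₃ F j (maybeTw s x) b → HP F u v
      outA₀ ne e fi fp s b th = ok (λ e → ⊥-elim (ne e)) (λ _ → OutUse.A₀ (proj₁ (proj₂ outAll)) e fi fp s b th)

      outB : ¬ κ i u ≡ k → ∀ {y b} → par y ≡ true → κ i y ≡ k → Three₃ F j y b → ∀ {x} → par x ≡ true → κ i x ≡ k → ∀ c s c' → InL F x (nb p c x) → InL F (maybeTw s x) (nb p c' (maybeTw s x)) →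
        ¬ edge x (nb p c x) ≡ edge (maybeTw s x) (nb p c' (maybeTw s x)) → HP F u v
      outB ne ey ky th ex kx c s c' f f' n = ok (λ e → ⊥-elim (ne e)) (λ _ → OutUse.Bs (proj₂ (proj₁ outAll)) ey ky th ex kx c s c' f f' n)

      inC : κ i u ≡ k → (∀ b → ¬ nb j b u ≡ v → InL F u (nb j b u)) → Full j (tw u) → HP F u v
      inC e h h' = ok (λ _ → toThr (In.V.factC (good' e) others' tws)) (λ ne → ⊥-elim (ne e))
        where
        others' : ∀ b → ¬ nb In.V.j b (In.V.σ .Aut.f (vtx 0)) ≡ In.V.σ .Aut.f (vtx 4) → InL F' (In.V.σ .Aut.f (vtx 0)) (nb In.V.j b (In.V.σ .Aut.f (vtx 0)))
        others' b ne = subst (λ y → InL F' y (nb In.V.j b y)) (sym f₀) (In.faultJ e (h b (λ eq → ne (trans (cong₂ (λ y d → nb d b y) f₀ Hj)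
            (trans (sym (cong proj₂ (φ-nb-down i j b u j≢i))) (trans (cong π eq) (sym f₄)))))))
        tws : ∀ b → InL F' (tw (In.V.σ .Aut.f (vtx 0))) (nb In.V.j b (tw (In.V.σ .Aut.f (vtx 0))))
        tws b = subst (λ y → InL F' (tw y) (nb In.V.j b (tw y))) (sym f₀) (In.atTw true {u} {λ y → InL F' y (nb In.V.j b y)} (In.faultJ (trans (κ-tw i u) e) (h' b)))

  abstract
    faults : D → List (E 3)
    faults j = sel (λ r → dimX j r ≟ᵇ true) F

    faults-Unique : ∀ j → Unique (faults j)
    faults-Unique j = sel-Unique (λ r → dimX j r ≟ᵇ true) uniq

    faults-∈ : ∀ {j r} → r ∈ faults j → r ∈ F × Dir j r
    faults-∈ {j} i with ∈-sel⁻ (λ r → dimX j r ≟ᵇ true) {l = F} i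
    ... | r∈ , d = r∈ , dimDir r∈ d

    faults-length : ∀ j → dc j ≡ length (faults j)
    faults-length j = cnt-sel (dimX j) F

  exhaust : ∀ {a b c : D} → ¬ a ≡ b → ¬ a ≡ c → ¬ b ≡ c → ∀ γ → γ ≡ a ⊎ γ ≡ b ⊎ γ ≡ c
  exhaust {a} {b} {c} ab ac bc γ with γ ≟ᶠ a | γ ≟ᶠ b | γ ≟ᶠ c
  ... | yes e | _ | _ = inj₁ e
  ... | no _ | yes e | _ = inj₂ (inj₁ e)
  ... | no _ | no _ | yes e = inj₂ (inj₂ e)
  ... | no na | no nb' | no nc' = ⊥-elim (absurd≤ 0 refl (⊆-length {xs = γ ∷ a ∷ b ∷ c ∷ []} {F = fins 3} ((na ∷ nb' ∷ nc' ∷ []) ∷ ((ab ∷ ac ∷ []) ∷ ((bc ∷ []) ∷ ([] ∷ [])))) (λ {x} _ → fins-∈ x)))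

  dims≤ : ∀ {a b c : D} → ¬ a ≡ b → ¬ a ≡ c → ¬ b ≡ c → dc a + (dc b + dc c) ≤ 7
  dims≤ {a} {b} {c} ab ac bc = ≤-trans (≤-reflexive (trans (cong₂ _+_ (faults-length a) (trans (cong₂ _+_ (faults-length b) (faults-length c)) (sym (length-++ (faults b))))) (sym (length-++ (faults a)))))
    (≤-trans (⊆-length (Unique-++ (faults-Unique a) (Unique-++ (faults-Unique b) (faults-Unique c) (λ i k → bc (same i k))) disj) sub) small')
    where
    same : ∀ {a b r} → r ∈ faults a → r ∈ faults b → a ≡ b
    same {a} {b} i k = dir-unique {b} (proj₂ (faults-∈ {a} i)) (dir-dim (proj₂ (faults-∈ {b} k)))
    disj : ∀ {r} → r ∈ faults a → r ∈ faults b ++ faults c → ⊥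
    disj i k with ∈-++⁻ (faults b) k
    ... | inj₁ k' = ab (same i k')
    ... | inj₂ k' = ac (same i k')
    sub : ∀ {r} → r ∈ faults a ++ (faults b ++ faults c) → r ∈ F
    sub k with ∈-++⁻ (faults a) k
    ... | inj₁ k' = proj₁ (faults-∈ k')
    ... | inj₂ k' with ∈-++⁻ (faults b) k'
    ... | inj₁ k'' = proj₁ (faults-∈ k'')
    ... | inj₂ k'' = proj₁ (faults-∈ k'')

  κ-nb-≢ : ∀ j b (x : W) → ¬ κ j (nb j b x) ≡ κ j x
  κ-nb-≢ j b x e = up-≢ (parR (φ j x)) (κ j x) (trans (sym (cong proj₁ (φ-nb-same j b x))) e)

  fullOr : ∀ γ y → Full γ y ⊎ ∃[ c ] ¬ InL F y (nb γ c y)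
  fullOr γ y with InL? F y (nb γ true y) | InL? F y (nb γ false y)
  ... | yes f | yes f' = inj₁ (λ { true → f ; false → f' })
  ... | no g | _ = inj₂ (true , g)
  ... | yes _ | no g = inj₂ (false , g)

  some-bad : ∀ {j γ γ' y} → degR j y ≤ 1 → ¬ γ ≡ j → ¬ γ' ≡ j → ¬ γ ≡ γ' → ∃[ c ] InL F y (nb γ' c y)
  some-bad {j} {γ} {γ'} {y} h n n' ne with InL? F y (nb γ' true y) | InL? F y (nb γ' false y)
  ... | yes f | _ = true , f
  ... | no _ | yes f = false , f
  ... | no g | no g' = ⊥-elim (1+n≰n (≤-trans (badNot-low h) (⊆-length {F = nb γ true y ∷ nb γ false y ∷ []} (badNot-Unique j y) sub)))
    where
    sub : ∀ {z} → z ∈ badNot j y → z ∈ nb γ true y ∷ nb γ false y ∷ []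
    sub k with badNot-∈ {j} k
    ... | γ'' , b , nj , refl , f with exhaust ne n n' γ'' | b
    ... | inj₁ refl | true = here refl
    ... | inj₁ refl | false = there (here refl)
    ... | inj₂ (inj₁ refl) | true = ⊥-elim (g f)
    ... | inj₂ (inj₁ refl) | false = ⊥-elim (g' f)
    ... | inj₂ (inj₂ e) | _ = ⊥-elim (nj e)

  -- Of the four edges of `y` inside its copy at least three are faulty: both edges of one dimension
  -- and one of the other.
  low-cases : ∀ {j a b y} → degR j y ≤ 1 → ¬ a ≡ j → ¬ b ≡ j → ¬ a ≡ b → (Full a y × ∃[ c ] InL F y (nb b c y)) ⊎ (Full b y × ∃[ c ] InL F y (nb a c y))
  low-cases {j} {a} {b} {y} h na nb' ne with fullOr a y
  ... | inj₁ f = inj₁ (f , some-bad h na nb' ne)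
  ... | inj₂ (c , g) = inj₂ ((λ b' → decidable-stable (InL? F y (nb b b' y)) (λ g' → only-one-good h na nb' ne g g')) , some-bad h nb' na (ne ∘ sym))

  -- If the faults of dimension γ are the two spokes of w, then a faulty edge of dimension γ at y shows that y is w or a neighbour of w.
  center-one : ∀ {γ w y c} → Full γ w → dc γ ≤ 2 → InL F y (nb γ c y) → y ≡ w ⊎ (nb γ c y ≡ w × ∃[ c' ] y ≡ nb γ c' w)
  center-one {γ} {w} {y} {c} f le i with full-only f le (spoke-∈ {y} i) (spoke-dim y γ c)
  ... | inj₁ e with edge-ends y (nb γ c y) w (nb γ true w) e
  ... | inj₁ (h , _) = inj₁ h
  ... | inj₂ (h , h') = inj₂ (h' , true , h)
  center-one {γ} {w} {y} {c} f le i | inj₂ e with edge-ends y (nb γ c y) w (nb γ false w) e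
  ... | inj₁ (h , _) = inj₁ h
  ... | inj₂ (h , h') = inj₂ (h' , false , h)

  center : ∀ {γ w y} → Full γ w → dc γ ≤ 2 → Full γ y → y ≡ w
  center {γ} {w} {y} f le i with center-one f le (i true) | center-one f le (i false)
  ... | inj₁ e | _ = e
  ... | inj₂ _ | inj₁ e = e
  ... | inj₂ (h , _) | inj₂ (h' , _) with proj₂ (nb-inj γ γ true false y (trans h (sym h')))
  ... | ()

  outside-copy : ∀ j l {r γ} → r ∈ F → Dir γ r → ¬ γ ≡ j → ¬ κ j (proj₁ r) ≡ l → fc j l + (dc j + 1) ≤ length F
  outside-copy j l {r} r∈ d ne out = ≤-trans (≤-reflexive (cong (_+ (dc j + 1)) (fc-cnt j l))) (cnt-neither (inX j l) (dimX j) (λ r → inX-dim {i = j} {l} {r}) r∈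
    (false-or-true _ (λ e → out (proj₁ (inX-elim {i = j} {l} {r} e)))) (false-or-true _ (λ e → ne (dir-unique {j} d e))))

  -- The seven faults are used up: the two spokes of `w` of dimension `i'`, the two of `x` of
  -- dimension `i`, and three of dimension `j`. No reason for `NotP j` is left.
  two-pinched : ∀ {i i' j w x} → ¬ i ≡ j → ¬ i' ≡ j → ¬ i ≡ i' → Pinched i w → Pinched i' x → NotP j → ⊥
  two-pinched {i} {i'} {j} {w} {x} ij i'j ii' pw px = go
    where
    wx : ¬ w ≡ x
    wx refl = pinched-once pw px (ii' ∘ sym)
    d3 : 3 ≤ dc j
    d3 = third pw px wx (ij ∘ sym) (i'j ∘ sym)
    fw : Full i' w
    fw = pinched-full pw (ii' ∘ sym)
    fx : Full i x
    fx = pinched-full px ii'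
    di≤ : dc i ≤ 2
    di≤ = +-cancelʳ-≤ 5 _ 2 (≤-trans (+-monoʳ-≤ (dc i) (+-mono-≤ (full-two fw) d3)) (dims≤ ii' ij i'j))
    di'≤ : dc i' ≤ 2
    di'≤ = +-cancelʳ-≤ 5 _ 2 (≤-trans (+-monoʳ-≤ (dc i') (+-mono-≤ (full-two fx) d3)) (dims≤ (ii' ∘ sym) i'j ij))
    go : NotP j → ⊥
    go (n₂ k l ne h h') = absurd≤ 1 refl (≤-trans (+-mono-≤ h (+-mono-≤ h' d3)) (≤-trans (fc+fc+dc j ne) small'))
    go (n₃ y h) with low-cases h ij i'j ii'
    ... | inj₁ (f , c , g) with center fx di≤ f
    ... | refl = pinched-good px c g
    go (n₃ y h) | inj₂ (f , c , g) with center fw di'≤ f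
    ... | refl = pinched-good pw c g
    -- Copy `l` would contain all faults outside dimension `j`, hence `w` and `x`. Then no edge of
    -- dimension `j` joins them, and their four spokes of this dimension are distinct.
    go (n₁ l h) = absurd≤ 0 refl (≤-trans (+-mono-≤ h four-j) (≤-trans (fc+dc j l) small'))
      where
      inside : ∀ {r γ} → r ∈ F → Dir γ r → ¬ γ ≡ j → κ j (proj₁ r) ≡ l
      inside r∈ d ne = decidable-stable (_ ≟ᶠ _) (λ out → absurd≤ 0 refl (≤-trans (+-mono-≤ h (+-monoˡ-≤ 1 d3)) (≤-trans (outside-copy j l r∈ d ne out) small')))
      kw : κ j w ≡ l
      kw = trans (sym (spoke-κ w true i'j)) (inside (spoke-∈ {w} (fw true)) (spoke-dir w i' true) i'j)
      kx : κ j x ≡ l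
      kx = trans (sym (spoke-κ x true ij)) (inside (spoke-∈ {x} (fx true)) (spoke-dir x i true) ij)
      ne : ∀ b c → ¬ spoke w j b ≡ spoke x j c
      ne b c e with edge-ends w (nb j b w) x (nb j c x) e
      ... | inj₁ (e' , _) = wx e'
      ... | inj₂ (e' , _) = κ-nb-≢ j c x (trans (cong (κ j) (sym e')) (trans kw (sym kx)))
      fjw : Full j w
      fjw = pinched-full pw (ij ∘ sym)
      fjx : Full j x
      fjx = pinched-full px (i'j ∘ sym)
      four-j : 4 ≤ dc j
      four-j = ⊆-cnt (dimX j) {spoke w j true ∷ spoke w j false ∷ spoke x j true ∷ spoke x j false ∷ []}
        ((spoke-≢ {w} {j} ∷ ne true true ∷ ne true false ∷ []) ∷ ((ne false true ∷ ne false false ∷ []) ∷ ((spoke-≢ {x} {j} ∷ []) ∷ ([] ∷ []))))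
        (λ { (here refl) → spoke-∈ {w} (fjw true) , spoke-dim w j true ; (there (here refl)) → spoke-∈ {w} (fjw false) , spoke-dim w j false
           ; (there (there (here refl))) → spoke-∈ {x} (fjx true) , spoke-dim x j true ; (there (there (there (here refl)))) → spoke-∈ {x} (fjx false) , spoke-dim x j false })

  -- The only reason for `NotP j` that survives is a copy with four faults. Two of them have
  -- dimension `i` and lie on the line of `w`; since `w` has good edges there, they belong to its
  -- twin.
  twin-full : ∀ {i i' j w k} → ¬ i ≡ j → ¬ i' ≡ j → ¬ i ≡ i' → Pinched i w → 4 < fc i' k → κ i' w ≡ k → NotP j → Full i (tw w)
  twin-full {i} {i'} {j} {w} {k} ij i'j ii' pw h kw = go
    where
    fw : Full i' w
    fw = pinched-full pw (ii' ∘ sym)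
    fj : Full j w
    fj = pinched-full pw (ij ∘ sym)
    at-k : ∀ {r γ} → r ∈ F → Dir γ r → ¬ γ ≡ i' → κ i' (proj₁ r) ≡ k
    at-k r∈ d ne = tight h (full-two fw) r∈ d ne
    κw : D → Fin 4
    κw γ = κ γ w
    star-full : ∀ γ → ¬ γ ≡ i → ¬ γ ≡ j → Full γ w × dc γ ≤ 2
    star-full γ ni nj with exhaust ii' ij i'j γ
    ... | inj₁ e = ⊥-elim (ni e)
    ... | inj₂ (inj₁ refl) = fw , full-dim h
    ... | inj₂ (inj₂ e) = ⊥-elim (nj e)
    aligned : ∀ γ → ¬ γ ≡ i → ¬ γ ≡ j → ∀ {r} → r ∈ F → Dir i r → κ γ (proj₁ r) ≡ κ γ w
    aligned γ ni nj r∈ d with exhaust ii' ij i'j γ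
    ... | inj₁ e = ⊥-elim (ni e)
    ... | inj₂ (inj₁ refl) = trans (at-k r∈ d ii') (sym kw)
    ... | inj₂ (inj₂ e) = ⊥-elim (nj e)
    open Concentrated ij w κw star-full aligned
    go : NotP j → Full i (tw w)
    go (n₂ k l ne h h') = ⊥-elim (absurd≤ 0 refl (≤-trans (+-mono-≤ h (+-mono-≤ h' (full-two fj))) (≤-trans (fc+fc+dc j ne) small')))
    go (n₃ y hy) with low-cases hy ij i'j ii'
    ... | inj₂ (f , c , g) with center fw (full-dim h) f
    ... | refl = ⊥-elim (pinched-good pw c g)
    go (n₃ y hy) | inj₁ (f , c , g) with center-one fw (full-dim h) g
    ... | inj₁ refl = ⊥-elim (pinched-good pw true (f true))
    ... | inj₂ (_ , c' , e) = ⊥-elim (κ-nb-≢ i' c' w (trans (cong (κ i') (sym e)) (trans (trans (sym (spoke-κ y true ii')) (at-k (spoke-∈ {y} (f true)) (spoke-dir y i true) ii')) (sym kw))))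
    go (n₁ l hl) with κ j w ≟ᶠ l
    ... | no ne = ⊥-elim (1+n≰n (≤-trans hl (≤-trans (fc-bound l) (+-mono-≤ along≤3' (across-away l ne)))))
      where
      along≤3' : along l ≤ 3
      along≤3' = ≤-trans (⊆-cnt (dimX i) (Sub-Unique j l i true) (λ r → proj₁ (Sub-∈ j l i true r) , proj₂ (proj₂ (Sub-∈ j l i true r))))
        (+-cancelʳ-≤ 4 _ 3 (≤-trans (+-monoʳ-≤ (dc i) (+-mono-≤ (full-two fw) (full-two fj))) (dims≤ ii' ij i'j)))
    ... | yes refl = λ { true → fault (proj₁ both∈) ; false → fault (proj₂ both∈) }
      where
      S = Sub j (κ j w) i true
      two : 2 ≤ length S
      two = +-cancelʳ-≤ 2 2 _ (≤-trans hl (≤-trans (fc-bound (κ j w)) (+-monoʳ-≤ (along (κ j w)) (across≤ (κ j w)))))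
      sub : ∀ {r} → r ∈ S → r ∈ edge (tw w) (nb i true (tw w)) ∷ edge (tw w) (nb i false (tw w)) ∷ []
      sub {r} k with along-fixed (κ j w) k
      ... | d , al with lineEnd w d (λ γ ne → trans (al γ ne) (fix γ))
        where
        fix : ∀ γ → set κw j (κ j w) γ ≡ κ γ w
        fix γ with γ ≟ᶠ j
        ... | yes refl = refl
        ... | no _ = refl
      ... | here e = ⊥-elim (pinched-good pw true (∈-edge {x = w} (subst (_∈ F) e (proj₁ (Sub-∈ j (κ j w) i true k)))))
      ... | there (here e) = ⊥-elim (pinched-good pw false (∈-edge {x = w} (subst (_∈ F) e (proj₁ (Sub-∈ j (κ j w) i true k)))))
      ... | there (there m) = m
      both∈ = two-of-two _≟ᴱ_ (Sub-Unique j (κ j w) i true) two sub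
      fault : ∀ {y} → edge (tw w) y ∈ S → InL F (tw w) y
      fault k = ∈-edge {x = tw w} (proj₁ (Sub-∈ j (κ j w) i true k))

  module Edge {j : D} {u : W} (eu : par u ≡ true) (b₀ : Bool) (good : ¬ InL F u (nb j b₀ u)) (nc : ∀ γ → ¬ γ ≡ j → NotC γ) (npj : NotP j) where

    Goal : Set
    Goal = HP F u (nb j b₀ u)

    -- In the splitting along the third dimension `i'` the pinched vertex is blocked, and with
    -- `twin-full` the faults of its copy form the configuration `KX`.
    pinched : ∀ {i w} → ¬ i ≡ j → Pinched i w → Goal
    pinched {i} {w} ij pw = go (nc i' i'j)
      where
      fr : ∃[ γ ] ¬ γ ∈ i ∷ j ∷ []
      fr = fresh (i ∷ j ∷ []) (s≤s (s≤s (s≤s z≤n)))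
      i' : D
      i' = proj₁ fr
      ii' : ¬ i ≡ i'
      ii' e = proj₂ fr (here (sym e))
      i'j : ¬ i' ≡ j
      i'j e = proj₂ fr (there (here e))
      fw : Full i' w
      fw = pinched-full pw (ii' ∘ sym)
      fj : Full j w
      fj = pinched-full pw (ij ∘ sym)
      go : NotC i' → Goal
      go (n₂ k l ne h h') = ⊥-elim (1+n≰n (≤-trans (full-two fw) (two-dim ne h h')))
      go (n₃ x px) = ⊥-elim (two-pinched ij i'j ii' pw px npj)
      go (n₁ k h) = Special.Solve.solveX i' k h (full-two fw) (λ x px → two-pinched ij i'j ii' pw px npj) (i'j ∘ sym) ii' ij eu b₀ good {x = w} kw fw fj
          (twin-full ij i'j ii' pw h kw npj)
        where
        kw : κ i' w ≡ k
        kw = trans (sym (spoke-κ w true (i'j ∘ sym))) (tight h (full-two fw) (spoke-∈ {w} (fj true)) (spoke-dir w j true) (i'j ∘ sym))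

    nonempty : ∀ {A : Set} {l : List A} → 1 ≤ length l → ∃[ x ] x ∈ l
    nonempty {l = x ∷ l} _ = x , here refl

    module Unpinched (np : ∀ i → ¬ i ≡ j → ∀ x → ¬ Pinched i x) where

      dc≤2 : ∀ i → ¬ i ≡ j → dc i ≤ 2
      dc≤2 i ne = notC-dc (nc i ne) (np i ne)

      big : ∀ i → ¬ i ≡ j → 2 ≤ dc i → ∃[ k ] 4 < fc i k
      big i ne = notC-big (nc i ne) (np i ne)

      nonj≤ : ∀ {a b} → ¬ a ≡ j → ¬ b ≡ j → ¬ a ≡ b → sumW dc (finsNot j) ≤ dc a + dc b
      nonj≤ {a} {b} aj bj ab = ≤-trans (sumW-⊆ dc {finsNot j} {a ∷ b ∷ []} (finsNot-Unique j) cov) (≤-reflexive (cong (dc a +_) (+-identityʳ (dc b))))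
        where
        cov : ∀ {γ} → γ ∈ finsNot j → γ ∈ a ∷ b ∷ []
        cov {γ} k with exhaust ab aj bj γ
        ... | inj₁ e = here e
        ... | inj₂ (inj₁ e) = there (here e)
        ... | inj₂ (inj₂ e) = ⊥-elim (finsNot-≢ {i = j} k e)

      total : ∀ {a b} → ¬ a ≡ j → ¬ b ≡ j → ¬ a ≡ b → length F ≤ dc j + (dc a + dc b)
      total aj bj ab = ≤-trans (dims-sum j) (+-monoʳ-≤ (dc j) (nonj≤ aj bj ab))

      -- Two dimensions with two faults each, both with a copy containing all other faults, put the faults of dimension j on one line.
      module Line {a b : D} (aj : ¬ a ≡ j) (bj : ¬ b ≡ j) (ab : ¬ a ≡ b) {ka kb : Fin 4} (ha : 4 < fc a ka) (hb : 4 < fc b kb) (da : 2 ≤ dc a) (db : 2 ≤ dc b) where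

        three-j : 3 ≤ dc j
        three-j = +-cancelʳ-≤ 4 3 _ (≤-trans (tight-length ha da) (≤-trans (total aj bj ab) (+-monoʳ-≤ (dc j) (+-mono-≤ (dc≤2 a aj) (dc≤2 b bj)))))

        onA : ∀ {r} → r ∈ faults j → κ a (proj₁ r) ≡ ka
        onA i = tight ha da (proj₁ (faults-∈ i)) (proj₂ (faults-∈ i)) (aj ∘ sym)

        onB : ∀ {r} → r ∈ faults j → κ b (proj₁ r) ≡ kb
        onB i = tight hb db (proj₁ (faults-∈ i)) (proj₂ (faults-∈ i)) (bj ∘ sym)

        onLine : ∀ {w} → κ a w ≡ ka → κ b w ≡ kb → ∀ {r} → r ∈ faults j → r ∈ F × Dir j r × ∀ γ → ¬ γ ≡ j → κ γ (proj₁ r) ≡ κ γ w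
        onLine {w} ea eb {r} i = proj₁ (faults-∈ i) , proj₂ (faults-∈ i) , at
          where
          at : ∀ γ → ¬ γ ≡ j → κ γ (proj₁ r) ≡ κ γ w
          at γ ne with exhaust ab aj bj γ
          ... | inj₁ refl = trans (onA i) (sym ea)
          ... | inj₂ (inj₁ refl) = trans (onB i) (sym eb)
          ... | inj₂ (inj₂ e) = ⊥-elim (ne e)

        three-at : ∀ {w} → κ a w ≡ ka → κ b w ≡ kb → ∃[ s ] ∃[ c ] Three₃ F j (maybeTw s w) c
        three-at {w} ea eb = three-on-line w (faults-Unique j) (≤-trans three-j (≤-reflexive (faults-length j))) (onLine ea eb)

        three-even : ∃[ y ] ∃[ c ] (par y ≡ true × κ a y ≡ ka × κ b y ≡ kb × Three₃ F j y c)
        three-even with nonempty (≤-trans (≤-trans (s≤s z≤n) three-j) (≤-reflexive (faults-length j)))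
        ... | r , i with three-at (onA i) (onB i)
        ... | false , c , th = proj₁ r , c , Dir.even (proj₂ (faults-∈ i)) , onA i , onB i , th
        ... | true , c , th = tw (proj₁ r) , c , trans (par-tw (proj₁ r)) (Dir.even (proj₂ (faults-∈ i))) , trans (κ-tw a (proj₁ r)) (onA i) , trans (κ-tw b (proj₁ r)) (onB i) , th

        -- The line of the given edge carries at least three faults, so the given edge is its only
        -- good one.
        closing : κ a u ≡ ka → κ b u ≡ kb → Goal
        closing ea eb = Special.Solve.inC a ka ha da (np a aj) (aj ∘ sym) (ab ∘ sym) bj eu b₀ good ea
            (λ c ne → ∈-edge {x = u} (rest (at-u c) (λ e → ne (edge-inj u e))))
            (λ c → ∈-edge {x = tw u} (rest (at-tw c) (away c)))
          where
          at-u : ∀ c → edge u (nb j c u) ∈ four j u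
          at-u true = here refl
          at-u false = there (here refl)
          at-tw : ∀ c → edge (tw u) (nb j c (tw u)) ∈ four j u
          at-tw true = there (there (here refl))
          at-tw false = there (there (there (here refl)))
          away : ∀ c → ¬ edge (tw u) (nb j c (tw u)) ≡ edge u (nb j b₀ u)
          away c e with edge-ends (tw u) (nb j c (tw u)) u (nb j b₀ u) e
          ... | inj₁ (h , _) = tw-≢ u h
          ... | inj₂ (h , _) with trans (sym (trans (par-tw u) eu)) (trans (cong par h) (trans (par-nb j b₀ u) (cong not eu)))
          ... | ()
          uv∉ : ¬ edge u (nb j b₀ u) ∈ F
          uv∉ i = good (∈-edge {x = u} i)
          rest : ∀ {e} → e ∈ four j u → ¬ e ≡ edge u (nb j b₀ u) → e ∈ F
          rest {e} k ne = decidable-stable (any? (e ≟ᴱ_) F) (λ out → absurd≤ 0 refl (≤-trans (s≤s (s≤s (≤-trans three-j (≤-reflexive (faults-length j)))))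
              (⊆-length {xs = e ∷ edge u (nb j b₀ u) ∷ faults j} {F = four j u}
                ((ne ∷ All-∉ _ (λ i → out (proj₁ (faults-∈ i)))) ∷ (All-∉ _ (λ i → uv∉ (proj₁ (faults-∈ i))) ∷ faults-Unique j)) sub)))
            where
            sub : ∀ {x} → x ∈ e ∷ edge u (nb j b₀ u) ∷ faults j → x ∈ four j u
            sub (here refl) = k
            sub (there (here refl)) = at-u b₀
            sub (there (there i)) = lineEnd u (proj₁ (proj₂ (onLine ea eb i))) (proj₂ (proj₂ (onLine ea eb i)))

        -- The given edge lies outside the special copy, where therefore any pair of unblocked ends
        -- will do.
        viaA : ¬ κ a u ≡ ka → (∀ {r r'} → r ∈ faults b → r' ∈ faults b → ∀ γ → ¬ γ ≡ b → κ γ (proj₁ r) ≡ κ γ (proj₁ r')) → Goal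
        viaA ne al with nonempty (≤-trans (≤-trans (s≤s z≤n) db) (≤-reflexive (faults-length b))) | three-even
        ... | r₀ , i₀ | y , c , ey , ya , yb , th with two-on-line can (faults-Unique b) (≤-trans db (≤-reflexive (faults-length b))) (λ γ → κ γ (proj₁ r₀))
              (λ i → proj₁ (faults-∈ i) , proj₂ (faults-∈ i) , al i i₀)
        ... | x , ex , kx , d , s , d' , f , f' , n = Special.Solve.outB a ka ha da (np a aj) (aj ∘ sym) (ab ∘ sym) bj eu b₀ good ne ey ya th ex
              (trans (kx a ab) (tight ha da (proj₁ (faults-∈ i₀)) (proj₂ (faults-∈ i₀)) (ab ∘ sym))) d s d' f f' n

      -- `w` is blocked in the splitting `a`. If dimension `b` has one fault, `NotC b` determines
      -- how the faults of dimension `j` are distributed; if it has two, `Line` applies to both `a`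
      -- and `b`.
      corner : ∀ {a b w c} → ¬ a ≡ j → ¬ b ≡ j → ¬ a ≡ b → Full a w → InL F w (nb b c w) → Goal
      corner {a} {b} {w} {c} aj bj ab fa fb with big a aj (full-two fa)
      ... | ka , ha = byB (2 ≤? dc b)
        where
        da : 2 ≤ dc a
        da = full-two fa
        atA : ∀ {r γ} → r ∈ F → Dir γ r → ¬ γ ≡ a → κ a (proj₁ r) ≡ ka
        atA r∈ d ne = tight ha da r∈ d ne
        kaw : κ a w ≡ ka
        kaw = trans (sym (spoke-κ w c (ab ∘ sym))) (atA (spoke-∈ {w} fb) (spoke-dir w b c) (ab ∘ sym))
        np' : ∀ x → ¬ Pinched a x
        np' = np a aj
        module few (db : dc b ≤ 1) where
          κw : D → Fin 4
          κw γ = κ γ w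
          star-full : ∀ γ → ¬ γ ≡ j → ¬ γ ≡ b → Full γ w × dc γ ≤ 2
          star-full γ nj nb' with exhaust ab aj bj γ
          ... | inj₁ refl = fa , dc≤2 a aj
          ... | inj₂ (inj₁ e) = ⊥-elim (nb' e)
          ... | inj₂ (inj₂ e) = ⊥-elim (nj e)
          aligned : ∀ γ → ¬ γ ≡ j → ¬ γ ≡ b → ∀ {r} → r ∈ F → Dir j r → κ γ (proj₁ r) ≡ κ γ w
          aligned γ nj nb' r∈ d with exhaust ab aj bj γ
          ... | inj₁ refl = trans (atA r∈ d (aj ∘ sym)) (sym kaw)
          ... | inj₂ (inj₁ e) = ⊥-elim (nb' e)
          ... | inj₂ (inj₂ e) = ⊥-elim (nj e)
          open Concentrated (bj ∘ sym) w κw star-full aligned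
          S : Fin 4 → List (E 3)
          S k = Sub b k j true
          S∈ : ∀ k {r} → r ∈ S k → r ∈ F
          S∈ k i = proj₁ (Sub-∈ b k j true i)
          onW : ∀ {r} → r ∈ S (κ b w) → r ∈ F × Dir j r × ∀ γ → ¬ γ ≡ j → κ γ (proj₁ r) ≡ κ γ w
          onW i = S∈ (κ b w) i , proj₁ (along-fixed (κ b w) i) , λ γ ne → trans (proj₂ (along-fixed (κ b w) i) γ ne) (fix γ)
            where
            fix : ∀ γ → set κw b (κ b w) γ ≡ κ γ w
            fix γ with γ ≟ᶠ b
            ... | yes refl = refl
            ... | no _ = refl
          -- Three faults of dimension `j` on a line in another copy of the splitting `b`, and one
          -- on the line of `w`: this is the configuration A₂.
          near-far : ∀ far → ¬ κ b w ≡ far → 3 ≤ along far → 1 ≤ along (κ b w) → Goal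
          near-far far ne three one' with nonempty {l = S far} (≤-trans (s≤s z≤n) three) | nonempty {l = S (κ b w)} one'
          ... | r₀ , i₀ | r , i = meet' (lineEnd w (proj₁ (proj₂ (onW i))) (proj₂ (proj₂ (onW i)))) th
            where
            y₀ : W
            y₀ = proj₁ r₀
            al₀ : ∀ γ → ¬ γ ≡ j → κ γ y₀ ≡ set κw b far γ
            al₀ = proj₂ (along-fixed far i₀)
            th : ∃[ s ] ∃[ d ] Three₃ F j (maybeTw s y₀) d
            th = three-on-line y₀ (Sub-Unique b far j true) three (λ i' → S∈ far i' , proj₁ (along-fixed far i') ,
                   λ γ n → trans (proj₂ (along-fixed far i') γ n) (sym (al₀ γ n)))
            yb : κ b y₀ ≡ far
            yb = trans (al₀ b bj) (set-same κw b far)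
            ya : κ a y₀ ≡ ka
            ya = trans (al₀ a aj) (trans (set-other κw far ab) kaw)
            par-maybe : ∀ s → par (maybeTw s y₀) ≡ true
            par-maybe true = trans (par-tw y₀) (Dir.even (proj₁ (along-fixed far i₀)))
            par-maybe false = Dir.even (proj₁ (along-fixed far i₀))
            κ-maybe : ∀ γ s (x : W) → κ γ (maybeTw s x) ≡ κ γ x
            κ-maybe γ true x = κ-tw γ x
            κ-maybe γ false x = refl
            apply : ∀ s d → r ≡ edge (maybeTw s w) (nb j d (maybeTw s w)) → ∃[ s' ] ∃[ d' ] Three₃ F j (maybeTw s' y₀) d' → Goal
            apply s d eq (s' , d' , th) = Special.Solve.solveA₂ a ka ha da np' (aj ∘ sym) (ab ∘ sym) bj eu b₀ good {y = maybeTw s' y₀} {b = d'} (par-maybe s') (trans (κ-maybe a s' y₀) ya) th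
                kaw fa fb s d (∈-edge {x = maybeTw s w} (subst (_∈ F) eq (S∈ (κ b w) i)))
                (λ s'' d'' e → ne (trans (sym (κ-maybe b s w)) (trans (sym (spoke-κ (maybeTw s w) d (bj ∘ sym))) (trans (cong (κ b ∘ proj₁) e)
                  (trans (spoke-κ (maybeTw s'' (maybeTw s' y₀)) d'' (bj ∘ sym)) (trans (κ-maybe b s'' (maybeTw s' y₀)) (trans (κ-maybe b s' y₀) yb)))))))
            meet' : r ∈ four j w → ∃[ s' ] ∃[ d' ] Three₃ F j (maybeTw s' y₀) d' → Goal
            meet' (here e) = apply false true e
            meet' (there (here e)) = apply false false e
            meet' (there (there (here e))) = apply true true e
            meet' (there (there (there (here e)))) = apply true false e
          three-of : ∀ k → ¬ κ b w ≡ k → 2 < fc b k → 3 ≤ along k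
          three-of k ne h = ≤-trans h (≤-trans (fc-bound k) (≤-trans (+-monoʳ-≤ (along k) (across-away k ne)) (≤-reflexive (+-identityʳ _))))
          one-of : 2 < fc b (κ b w) → 1 ≤ along (κ b w)
          one-of h = +-cancelʳ-≤ 2 1 _ (≤-trans h (≤-trans (fc-bound (κ b w)) (+-monoʳ-≤ (along (κ b w)) (across≤ (κ b w)))))
          go : NotC b → Goal
          go (n₃ x px) = ⊥-elim (np b bj x px)
          go (n₁ k h) with κ b w ≟ᶠ k
          ... | no ne = ⊥-elim (1+n≰n (≤-trans h (fc-away k ne)))
          ... | yes refl with three-on-line w (Sub-Unique b (κ b w) j true) (+-cancelʳ-≤ 2 3 _ (≤-trans h (≤-trans (fc-bound k) (+-monoʳ-≤ (along k) (across≤ k))))) onW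
          ... | s , d , th = Special.Solve.solveA₁ a ka ha da np' (aj ∘ sym) (ab ∘ sym) bj eu b₀ good db kaw fa fb s d th
          go (n₂ k l ne h h') with κ b w ≟ᶠ k | κ b w ≟ᶠ l
          ... | yes refl | yes e = ⊥-elim (ne e)
          ... | yes refl | no nl = near-far l nl (three-of l nl h') (one-of h)
          ... | no nk | yes refl = near-far k nk (three-of k nk h) (one-of h')
          -- Two copies away from `w` would contain three faults of dimension `j` each; with the two
          -- of dimension `a` there would be eight.
          ... | no nk | no nl = ⊥-elim (absurd≤ 0 refl (≤-trans (+-mono-≤ da (≤-trans (+-mono-≤ (three-of k nk h) (three-of l nl h')) both-j)) (≤-trans (m≤m+n _ (dc b)) (≤-trans (≤-reflexive (lem (dc a) (dc j) (dc b))) (dims≤ ab aj bj)))))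
            where
            lem : ∀ x y z → x + y + z ≡ x + (z + y)
            lem = solve-∀
            both-j : along k + along l ≤ dc j
            both-j = ≤-trans (≤-reflexive (sym (length-++ (S k)))) (⊆-cnt (dimX j) (Unique-++ (Sub-Unique b k j true) (Sub-Unique b l j true) disj) sub)
              where
              disj : ∀ {r} → r ∈ S k → r ∈ S l → ⊥
              disj {r} i i' = inX-≢ {i = b} {k} {l} {r} ne (proj₁ (proj₂ (Sub-∈ b k j true i))) (proj₁ (proj₂ (Sub-∈ b l j true i')))
              sub : ∀ {r} → r ∈ S k ++ S l → r ∈ F × dimX j r ≡ true
              sub i with ∈-++⁻ (S k) i
              ... | inj₁ i' = S∈ k i' , proj₂ (proj₂ (Sub-∈ b k j true i'))
              ... | inj₂ i' = S∈ l i' , proj₂ (proj₂ (Sub-∈ b l j true i'))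
        byB : Dec (2 ≤ dc b) → Goal
        byB (no lt) = few.go (≤-pred (≰⇒> lt)) (nc b bj)
        byB (yes db) with big b bj db
        ... | kb , hb = choose (κ a u ≟ᶠ ka) (κ b u ≟ᶠ kb)
          where
          module L = Line aj bj ab ha hb da db
          module L' = Line bj aj (ab ∘ sym) hb ha db da
          kbw : κ b w ≡ kb
          kbw = trans (sym (spoke-κ w true ab)) (tight hb db (spoke-∈ {w} (fa true)) (spoke-dir w a true) ab)
          al : ∀ {r r'} → r ∈ faults a → r' ∈ faults a → ∀ γ → ¬ γ ≡ a → κ γ (proj₁ r) ≡ κ γ (proj₁ r')
          al i i' γ ne = trans (at i) (sym (at i'))
            where
            at : ∀ {r} → r ∈ faults a → κ γ (proj₁ r) ≡ κ γ w
            at i with full-only fa (dc≤2 a aj) (proj₁ (faults-∈ i)) (dir-dim (proj₂ (faults-∈ i)))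
            ... | inj₁ refl = spoke-κ w true (ne ∘ sym)
            ... | inj₂ refl = spoke-κ w false (ne ∘ sym)
          choose : Dec (κ a u ≡ ka) → Dec (κ b u ≡ kb) → Goal
          choose (yes ea) (yes eb) = L.closing ea eb
          choose _ (no nb') = L'.viaA nb' al
          choose (no na) (yes _) with L.three-at kaw kbw
          ... | s , d , th = Special.Solve.outA₀ a ka ha da np' (aj ∘ sym) (ab ∘ sym) bj eu b₀ good na kaw fa fb s d th

      i₁ i₂ : D
      i₁ = proj₁ (fresh (j ∷ []) (s≤s (s≤s z≤n)))
      i₂ = proj₁ (fresh (i₁ ∷ j ∷ []) (s≤s (s≤s (s≤s z≤n))))

      i₁j : ¬ i₁ ≡ j
      i₁j e = proj₂ (fresh (j ∷ []) (s≤s (s≤s z≤n))) (here e)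

      i₂j : ¬ i₂ ≡ j
      i₂j e = proj₂ (fresh (i₁ ∷ j ∷ []) (s≤s (s≤s (s≤s z≤n)))) (there (here e))

      i₁i₂ : ¬ i₁ ≡ i₂
      i₁i₂ e = proj₂ (fresh (i₁ ∷ j ∷ []) (s≤s (s≤s (s≤s z≤n)))) (here (sym e))

      at-most-4 : dc i₁ + dc i₂ ≤ 4
      at-most-4 = +-mono-≤ (dc≤2 i₁ i₁j) (dc≤2 i₂ i₂j)

      total₄ : length F ≤ dc j + 4
      total₄ = ≤-trans (total i₁j i₂j i₁i₂) (+-monoʳ-≤ (dc j) at-most-4)

      -- The dimensions other than `j` have at most two faults each, so both have exactly two and
      -- copy `l` contains all four. This puts the faults of each of them on a line.
      square : ∀ l → 4 ≤ fc j l → Goal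
      square l h = go (big i₁ i₁j d₁) (big i₂ i₂j d₂)
        where
        sum4 : 4 ≤ dc i₁ + dc i₂
        sum4 = ≤-trans h (≤-trans (fc≤sum j l) (nonj≤ i₁j i₂j i₁i₂))
        d₁ : 2 ≤ dc i₁
        d₁ = +-cancelʳ-≤ 2 2 _ (≤-trans sum4 (+-monoʳ-≤ (dc i₁) (dc≤2 i₂ i₂j)))
        d₂ : 2 ≤ dc i₂
        d₂ = +-cancelˡ-≤ 2 2 _ (≤-trans sum4 (+-monoˡ-≤ (dc i₂) (dc≤2 i₁ i₁j)))
        inside : ∀ {r γ} → r ∈ F → Dir γ r → ¬ γ ≡ j → κ j (proj₁ r) ≡ l
        inside r∈ d ne = decidable-stable (_ ≟ᶠ _) (λ out → 1+n≰n (+-cancelʳ-≤ (dc j) 5 4 (≤-trans (≤-reflexive (lem (dc j))) (≤-trans (+-monoˡ-≤ (dc j + 1) h)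
          (≤-trans (outside-copy j l r∈ d ne out) (≤-trans total₄ (≤-reflexive (+-comm (dc j) 4))))))))
          where
          lem : ∀ x → 5 + x ≡ 4 + (x + 1)
          lem = solve-∀
        aligned : ∀ {a b ka} → ¬ a ≡ j → ¬ b ≡ j → ¬ a ≡ b → 4 < fc a ka → 2 ≤ dc a →
          ∀ {r r'} → r ∈ faults b → r' ∈ faults b → ∀ γ → ¬ γ ≡ b → κ γ (proj₁ r) ≡ κ γ (proj₁ r')
        aligned {a} {b} aj bj ab ha da i i' γ ne with exhaust ab aj bj γ
        ... | inj₁ refl = trans (tight ha da (proj₁ (faults-∈ i)) (proj₂ (faults-∈ i)) (ne ∘ sym)) (sym (tight ha da (proj₁ (faults-∈ i')) (proj₂ (faults-∈ i')) (ne ∘ sym)))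
        ... | inj₂ (inj₁ e) = ⊥-elim (ne e)
        ... | inj₂ (inj₂ refl) = trans (inside (proj₁ (faults-∈ i)) (proj₂ (faults-∈ i)) bj) (sym (inside (proj₁ (faults-∈ i')) (proj₂ (faults-∈ i')) bj))
        go : ∃[ k ] 4 < fc i₁ k → ∃[ k ] 4 < fc i₂ k → Goal
        go (k₁ , h₁) (k₂ , h₂) = choose (κ i₁ u ≟ᶠ k₁) (κ i₂ u ≟ᶠ k₂)
          where
          module L = Line i₁j i₂j i₁i₂ h₁ h₂ d₁ d₂
          module L' = Line i₂j i₁j (i₁i₂ ∘ sym) h₂ h₁ d₂ d₁
          choose : Dec (κ i₁ u ≡ k₁) → Dec (κ i₂ u ≡ k₂) → Goal
          choose (yes e₁) (yes e₂) = L.closing e₁ e₂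
          choose (no n) _ = L.viaA n (aligned i₁j i₂j i₁i₂ h₁ d₁)
          choose (yes _) (no n) = L'.viaA n (aligned i₂j i₁j (i₁i₂ ∘ sym) h₂ d₂)

      unpinched : Goal
      unpinched = go npj
        where
        go : NotP j → Goal
        go (n₁ l h) = square l h
        go (n₂ k l ne h h') = ⊥-elim (absurd≤ 1 refl (+-cancelʳ-≤ (dc j) 6 4 (≤-trans (+-monoˡ-≤ (dc j) (+-mono-≤ h h')) (≤-trans (≤-reflexive (+-assoc (fc j k) (fc j l) (dc j)))
          (≤-trans (fc+fc+dc j ne) (≤-trans total₄ (≤-reflexive (+-comm (dc j) 4))))))))
        go (n₃ w h) with low-cases h i₁j i₂j i₁i₂
        ... | inj₁ (fa , c , fb) = corner i₁j i₂j i₁i₂ fa fb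
        ... | inj₂ (fa , c , fb) = corner i₂j i₁j (i₁i₂ ∘ sym) fa fb

  solve₃ : ∀ {u} j b → par u ≡ true → ¬ InL F u (nb j b u) → HP F u (nb j b u)
  solve₃ {u} j b eu good with decP j | pickOr decC'
    where
    decC' : ∀ i → (¬ i ≡ j × C i) ⊎ (¬ i ≡ j → NotC i)
    decC' i with i ≟ᶠ j | decC i
    ... | yes e | _ = inj₂ (λ ne → ⊥-elim (ne e))
    ... | no ne | inj₁ c = inj₁ (ne , c)
    ... | no _ | inj₂ nc = inj₂ (λ _ → nc)
  ... | inj₁ p | _ = resolveP p eu (trans (par-nb j b u) (cong not eu)) (trans (cong proj₁ (φ-nb-same j b u)) (cong (λ d → up d (κ j u)) (trans (par-φ j u) eu)))
  ... | inj₂ _ | inj₁ (i , ne , c) = resolveC c eu (trans (par-nb j b u) (cong not eu)) (adj-nb j b u) good (κ-other b u (ne ∘ sym))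
  ... | inj₂ np | inj₂ nc with pick (λ i → ¬? (i ≟ᶠ j) ×-dec any? (λ x → degR i x ≤? 0) (allV 3))
  ... | inj₁ (i , ne , h) = Edge.pinched eu b good nc np ne (proj₂ (Any-∃ h))
  ... | inj₂ none = Edge.Unpinched.unpinched eu b good nc np (λ i ne x px → none i (ne , ∃-Any (allV-∈ x) px))

-- The induction.

laceAll : ∀ n → Lace (suc n)
laceAll zero = lace-intro lace₁
laceAll (suc n) = lace-intro (laceable-step n (laceAll n))

Good : ℕ → Set
Good n = (F : List (E (suc n))) → Canon F → Unique F → length F < 4 * n → (∀ x → 2 ≤ deg F x) →
  ∀ {u} j b → par u ≡ true → ¬ InL F u (nb j b u) → HP F u (nb j b u)

full-3 : ∀ n l → OV.Full {2 + n} l → 3 ≤ length l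
full-3 n l f = ≤-trans (≤-trans (s≤s (s≤s (s≤s z≤n))) (4*-lower n)) (subst (_≤ length l) (allV-length (2 + n)) (⊆-length (allV-Unique (2 + n)) (λ {x} _ → OV.Full-∈ l f x)))

-- A Hamiltonian path between the ends of an edge never uses that edge, so the edge may be dropped from the faults.
good⇒cond : ∀ n → Good (suc n) → Conditional (suc n)
good⇒cond n good F can uniq lt δ {u} eu ev a with nb-adj a
... | j , b , refl with InL? F u (nb j b u)
... | no g = good F can uniq lt δ j b eu g
... | yes f with good (without (edge u (nb j b u)) F) (without-canon can) (without-Unique uniq)
        (≤-trans (without-length uniq (edge-∈ can (adj-par a) f)) (≤-trans (n≤1+n _) lt)) (λ x → ≤-trans (δ x) (deg-mono {F = F} x (without-InL {h = edge u (nb j b u)} {F}))) j b eu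
        (λ k → without-∉ {h = edge u (nb j b u)} {F} (edge-∈ (without-canon {h = edge u (nb j b u)} can) (adj-par a) k))
... | l , p , full = l , closeH can refl (full-3 n l full) (OV.Full-Unique l full) p , full

good-step : ∀ n → Cond (suc n) → Good (2 + n)
good-step zero cond F can uniq lt δ j b eu g = Small.solve₃ F (faultSet can uniq lt δ (laceAll 0) cond) j b eu g
good-step (suc n) cond F can uniq lt δ {u} j b eu g = go (Sel.select F (faultSet can uniq lt δ (laceAll (suc n)) cond) (s≤s z≤n) j)
  where
  odd : par (nb j b u) ≡ false
  odd = trans (par-nb j b u) (cong not eu)
  go : Sel.P F (faultSet can uniq lt δ (laceAll (suc n)) cond) j ⊎ ∃[ i ] (¬ i ≡ j × Sel.C F (faultSet can uniq lt δ (laceAll (suc n)) cond) i) → HP F u (nb j b u)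
  go (inj₁ p) = Sel.resolveP F (faultSet can uniq lt δ (laceAll (suc n)) cond) {j} p {u} {nb j b u} eu odd (trans (cong proj₁ (φ-nb-same j b u)) (cong (λ d → up d (κ j u)) (trans (par-φ j u) eu)))
  go (inj₂ (i , ne , c)) = Sel.resolveC F (faultSet can uniq lt δ (laceAll (suc n)) cond) {i} c {u} {nb j b u} eu odd (adj-nb j b u) g (κ-other b u (ne ∘ sym))

condAll : ∀ n → Cond (suc n)
condAll zero = cond-intro cond₁
condAll (suc n) = cond-intro (good⇒cond (suc n) (good-step n (condAll n)))

-- Hamiltonian paths closed to cycles.

module _ {A : Set} {E : A → A → Set} where

  path-edges : ∀ {x v w y l} → Path E x v (y ∷ l) → E v w → All (uncurry E) (zip (y ∷ l) (l ++ [ w ]))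
  path-edges (stop _) e = e ∷ []
  path-edges (e' ▸ p@(stop _)) e = e' ∷ path-edges p e
  path-edges (e' ▸ p@(_ ▸ _)) e = e' ∷ path-edges p e

  closing-edge : ∀ {x v w y l} → Path E x v (y ∷ l) → (v , w) ∈ zip (y ∷ l) (l ++ [ w ])
  closing-edge (stop _) = here refl
  closing-edge (_ ▸ p@(stop _)) = there (closing-edge p)
  closing-edge (_ ▸ p@(_ ▸ _)) = there (closing-edge p)

  closed : ∀ {x v l} → Path E x v l → E v x → All (uncurry E) (cycleEdges l) × (v , x) ∈ cycleEdges l
  closed p@(stop _) e = path-edges p e , closing-edge p
  closed p@(_ ▸ _) e = path-edges p e , closing-edge p

theorem1 : (n : ℕ) → 2 ≤ n →
  (F : List (Vertex n × Vertex n)) → All (uncurry Adj) F →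
  length F ≤ 4 * n ∸ 5 → MinDeg≥2 F →
  (u v : Vertex n) → AdjF F u v →
  ∃[ c ] (IsHamCycle (AdjF F) c × EdgeOnCycle u v c)
theorem1 (suc (suc m)) (s≤s (s≤s z≤n)) F adjs len δ u v (a , good) = go (par u) refl
  where
  -- Orienting the faults from their even ends and dropping repetitions makes the length of the list
  -- the number of faulty edges.
  d : ∃[ F' ] (Unique F' × length F' ≤ length (map (uncurry edge) F) × (∀ {r} → r ∈ map (uncurry edge) F → r ∈ F') × (∀ {r} → r ∈ F' → r ∈ map (uncurry edge) F))
  d = dedup (map (uncurry edge) F)
  F' : List (E (2 + m))
  F' = proj₁ d
  canonical : ∀ x y → Adj x y → ∀ {p q} → edge x y ≡ (p , q) → par p ≡ true × Adj p q
  canonical x y xy e with par x in ex | e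
  ... | true | refl = ex , xy
  ... | false | refl = trans (adj-par xy) (cong not ex) , adj-sym xy
  can : Canon F'
  can i with ∈-map⁻ (uncurry edge) (proj₂ (proj₂ (proj₂ (proj₂ d))) i)
  ... | (x , y) , j , e = canonical x y (All.lookup adjs j) (sym e)
  to : ∀ {x y} → InL F x y → InL F' x y
  to {x} {y} (inj₁ i) = ∈-edge {x = x} (proj₁ (proj₂ (proj₂ (proj₂ d))) (∈-map⁺ (uncurry edge) i))
  to {x} {y} (inj₂ i) = InL-sym (∈-edge {x = y} (proj₁ (proj₂ (proj₂ (proj₂ d))) (∈-map⁺ (uncurry edge) i)))
  ends : ∀ {x y} → (x , y) ∈ F' → InL F x y
  ends i with ∈-map⁻ (uncurry edge) (proj₂ (proj₂ (proj₂ (proj₂ d))) i)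
  ... | (x' , y') , j , e with edge-pair x' y' (sym e)
  ... | inj₁ (refl , refl) = inj₁ j
  ... | inj₂ (refl , refl) = inj₂ j
  from : ∀ {x y} → InL F' x y → InL F x y
  from (inj₁ i) = ends i
  from (inj₂ i) = InL-sym (ends i)
  small : length F' < 4 * suc m
  small = s≤s (≤-trans (≤-trans (proj₁ (proj₂ (proj₂ d))) (≤-reflexive (length-map (uncurry edge) F))) (≤-trans len (≤-reflexive (cong (_∸ 5) (lem m)))))
    where
    lem : ∀ m → 4 * (2 + m) ≡ 5 + (m + (suc m + (suc m + (suc m + 0))))
    lem = solve-∀
  deg≥2 : ∀ x → 2 ≤ deg F' x
  deg≥2 x with δ x
  ... | y , z , ne , (ay , gy) , (az , gz) = ⊆-length ((ne ∷ []) ∷ ([] ∷ [])) sub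
    where
    sub : ∀ {t} → t ∈ y ∷ z ∷ [] → t ∈ goodN F' x
    sub (here refl) = ∈-goodN {F = F'} (ay , gy ∘ from)
    sub (there (here refl)) = ∈-goodN {F = F'} (az , gz ∘ from)
  path : ∀ {x y} → par x ≡ true → Adj x y → HP F' x y
  path ex xy = cond-elim (condAll m) F' can (proj₁ (proj₂ d)) small deg≥2 ex (trans (adj-par xy) (cong not ex)) xy
  -- The given edge itself closes the Hamiltonian path between its ends, so it lies on the cycle.
  cycle : ∀ {x y} → AdjF F y x → HP F' x y → ∃[ c ] (IsHamCycle (AdjF F) c × (y , x) ∈ cycleEdges c)
  cycle yx (l , p , full) = l , (OV.Full-Unique l full , OV.Full-∈ l full , full-3 m l full , proj₁ cl) , proj₂ cl
    where
    cl = closed (pathMono (λ { (b , g) → b , g ∘ to }) p) yx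
  backward : ∃[ c ] (IsHamCycle (AdjF F) c × (v , u) ∈ cycleEdges c) → ∃[ c ] (IsHamCycle (AdjF F) c × EdgeOnCycle u v c)
  backward (c , h , i) = c , h , inj₂ i
  forward : ∃[ c ] (IsHamCycle (AdjF F) c × (u , v) ∈ cycleEdges c) → ∃[ c ] (IsHamCycle (AdjF F) c × EdgeOnCycle u v c)
  forward (c , h , i) = c , h , inj₁ i
  go : ∀ b → par u ≡ b → ∃[ c ] (IsHamCycle (AdjF F) c × EdgeOnCycle u v c)
  go true eu = backward (cycle (adj-sym a , good ∘ InL-sym) (path eu a))
  go false eu = forward (cycle (a , good) (path (trans (adj-par a) (cong not eu)) (adj-sym a)))
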